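{- Let $S(16)$ denote the set of all values of integer circulant determinants of order $16$. Then \begin{align*} S(16) = \mathbb{Z}_{\rm odd} &\cup 128\mathbb{Z} \\ &\cup \{ 64 p m \mid p \text{ prime},\ p = a^2+b^2 \equiv 1 \pmod 8 \text{ with } a,b\in\mathbb{Z},\ a+b \equiv 3 \text{ or } 5 \pmod 8,\ m\in\mathbb{Z}\} \\ &\cup \{ 64 p m \mid p \text{ prime},\ p\equiv 5 \pmod 8,\ m \in \mathbb{Z}\} \\ &\cup \{ 64 p^2 m \mid p \text{ prime},\ p \equiv 3 \pmod 8,\ m\in\mathbb{Z}\}. \end{align*}
   Context: For integers $a_0,\dots,a_{15}$, the circulant determinant $D(a_0,\dots,a_{15})$ is the determinant of the $16\times 16$ matrix whose $(i,j)$ entry ($0\le i,j\le 15$) is $a_{(i-j)\bmod 16}$; i.e. the first row is $a_0, a_{15}, \dots, a_1$, the second row is $a_1, a_0, \dots, a_2$, and so on. $S(16) := \{D(a_0,\dots,a_{15}) \mid a_i\in\mathbb{Z}\}$. $\mathbb{Z}_{\rm odd}$ denotes the set of all odd integers. -}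

module Defs where

open import Data.Nat using (ℕ; zero; suc)
open import Data.Fin using (Fin; zero; suc; toℕ; punchIn; fromℕ<)
import Data.Nat as N
open import Data.Nat.DivMod using (m%n<n)
open import Data.Integer using (ℤ; +_; _+_; _-_; _*_; 0ℤ; 1ℤ)
open import Data.Integer.DivMod using (_%ℕ_)
open import Data.Product using (∃; ∃-syntax; _×_; _,_)
open import Data.Sum using (_⊎_)
open import Data.Nat.Primality using (Prime)
open import Data.Nat.DivMod using (_%_)
open import Data.Integer.Divisibility using (_∣_)
open import Relation.Binary.PropositionalEquality using (_≡_)

Matrix : ℕ → Set
Matrix n = Fin n → Fin n → ℤ

sgn : ℕ → ℤ
sgn zero = 1ℤ
sgn (suc zero) = Data.Integer.-_ 1ℤ
sgn (suc (suc k)) = sgn k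

minor : ∀ {n} → Matrix (suc n) → Fin (suc n) → Matrix n
minor M j r c = M (suc r) (punchIn j c)

sumFin : ∀ n → (Fin n → ℤ) → ℤ
sumFin zero f = 0ℤ
sumFin (suc n) f = f zero + sumFin n (λ i → f (suc i))

det : ∀ n → Matrix n → ℤ
det zero M = 1ℤ
det (suc n) M = sumFin (suc n) (λ j → sgn (toℕ j) * (M zero j * det n (minor M j)))

subMod16 : Fin 16 → Fin 16 → Fin 16
subMod16 i j = fromℕ< (m%n<n ((toℕ i N.+ 16) N.∸ toℕ j) 16)

circulant16 : (Fin 16 → ℤ) → Matrix 16
circulant16 a i j = a (subMod16 i j)

D : (Fin 16 → ℤ) → ℤ
D a = det 16 (circulant16 a)

S16 : ℤ → Set
S16 z = ∃[ a ] D a ≡ z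

Odd : ℤ → Set
Odd z = z %ℕ 2 ≡ 1

RHS16 : ℤ → Set
RHS16 z =
    Odd z
  ⊎ (+ 128 ∣ z)
  ⊎ (∃[ p ] Prime p × p % 8 ≡ 1
       × (∃[ a ] ∃[ b ] + p ≡ a * a + b * b × ((a + b) %ℕ 8 ≡ 3 ⊎ (a + b) %ℕ 8 ≡ 5))
       × (∃[ m ] z ≡ + 64 * + p * m))
  ⊎ (∃[ p ] Prime p × p % 8 ≡ 5 × (∃[ m ] z ≡ + 64 * + p * m))
  ⊎ (∃[ p ] Prime p × p % 8 ≡ 3 × (∃[ m ] z ≡ + 64 * (+ p * + p) * m))

{-# OPTIONS --safe #-}
module Submission where

-- D(a) is the product of f = Σ aₘxᵐ over the 16th roots of unity, hence of the integer
-- norms of f at 1, -1, i, ζ₈ and ζ₁₆.  These are congruent to each other modulo powers of 2, and an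
-- even value outside 128ℤ is 64nw, where 2n = x² + y² with x ≡ ±3 (mod 8).  The Gaussian integers
-- whose real and imaginary parts have sum and difference ±1 mod 8 are closed under products,
-- so some Gaussian prime factor of n is not among them, and its norm is a multiple of one of
-- the listed p or p².  Conversely, for p ≡ 5 (mod 8) write 2p = x² + y² and prescribe x + yi as the
-- value of f at i.  In the other two cases i is a square modulo the Gaussian prime α above p, so
-- that the Euclidean algorithm in ℤ[ζ₈] finds an element of relative norm α up to units; its
-- product with 1 - ζ₈ is prescribed as the value of f at ζ₈.  The values at the other roots are
-- chosen to contribute 32 times an arbitrary odd number.

open import Algebra.Bundles using (CommutativeMonoid; CommutativeRing; CommutativeSemiring)
open import Algebra.Structures using (IsCommutativeRing)
open import Data.Bool.Base using (Bool; true; false; if_then_else_)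
open import Data.Empty using (⊥; ⊥-elim)
open import Data.Fin using (#_)
open import Data.Fin.Base as Fin using (Fin; zero; suc; toℕ; punchIn)
open import Data.Fin.Permutation using (permutation)
import Data.Fin.Properties as Fin
open import Data.Fin.Properties using (_≟_; all?; any?)
open import Data.Integer using (ℤ; +_; -[1+_])
import Data.Integer as ℤ
import Data.Integer.DivMod as ℤ
import Data.Integer.Properties as ℤ
import Data.Integer.Tactic.RingSolver as ℤ
open import Data.List.Base using ([]; _∷_)
open import Data.List.Relation.Unary.All using (_∷_)
open import Data.Maybe.Base using (nothing)
open import Data.Nat.Base as ℕ using (ℕ; zero; suc)
import Data.Nat.DivMod as ℕ
import Data.Nat.Divisibility as ℕ
import Data.Nat.ListAction as ℕ
open import Data.Nat.Primality using (Prime; prime?; euclidsLemma; prime⇒irreducible; prime⇒nonZero; prime⇒nonTrivial)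
open import Data.Nat.Primality.Factorisation using (factorise)
import Data.Nat.Properties as ℕ
import Data.Nat.Tactic.RingSolver as ℕ
open import Data.Product using (∃; ∃-syntax; _×_; _,_; proj₁; proj₂)
open import Data.Sum using (_⊎_; inj₁; inj₂; [_,_]′)
open import Data.Unit using (⊤; tt)
open import Data.Vec.Base as Vec using (Vec; []; _∷_)
import Data.Vec.Properties as Vec
open import Defs
open import Function.Base using (_∘_; id)
open import Function.Bundles using (_⇔_; mk⇔)
open import Level using (0ℓ)
open import Relation.Binary.PropositionalEquality
open import Relation.Nullary using (¬_; Dec; yes; no; ¬?; _→-dec_; _⊎-dec_)
open import Relation.Nullary.Decidable using (decidable-stable; from-yes; toWitness)
open import Relation.Nullary.Negation using (contradiction)
open import Tactic.RingSolver.Core.AlmostCommutativeRing using (AlmostCommutativeRing; fromCommutativeRing)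

-- A cofactor expansion of size 16 is out of reach of computation, so `det` is characterised as an
-- alternating form and the circulant is diagonalised by a Fourier matrix over ℤ[ζ₁₆], a tower of
-- three quadratic extensions. The number 64 is 8 · 2 · 2 · 2. In the critical parity pattern
-- f(1)f(-1) is a difference of two odd squares, and the norms at i, ζ₈ and ζ₁₆ are even. Modulo 8
-- the real parts at ζ₈ and ζ₁₆ are 1 + 4M and 1 + 4K, where the parity of M + K is determined by
-- the values at 1. Hence one of the three norms has a coordinate ±3 mod 8, unless 16 divides
-- f(1)f(-1). The set closed under products consists of the Gaussian integers congruent to a unit
-- modulo 4(1 + i). Rational primes p ≡ ±1 (mod 8) belong to it. A prime p ≡ 3 (mod 8) does not, and
-- being inert it can enter a norm only through p²; primes p ≡ 7 (mod 8) never obstruct.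

-- The canonical map ι makes the ring solver available in abstract rings, with
-- integer coefficients.
record Ring≡ : Set₁ where
  no-eta-equality
  infixl 6 _+_ _-_
  infixl 7 _*_
  infix 8 -_
  field
    Carrier : Set
    _+_ _*_ : Carrier → Carrier → Carrier
    -_ : Carrier → Carrier
    ι : ℤ → Carrier
    isCommutativeRing : IsCommutativeRing _≡_ _+_ _*_ -_ (ι ℤ.0ℤ) (ι ℤ.1ℤ)
    ι-+ : ∀ m n → ι (m ℤ.+ n) ≡ ι m + ι n
    ι-* : ∀ m n → ι (m ℤ.* n) ≡ ι m * ι n
    ι-neg : ∀ n → ι (ℤ.- n) ≡ - ι n

  open IsCommutativeRing isCommutativeRing public
    using ( +-assoc; +-comm; +-identityˡ; +-identityʳ; -‿inverseˡ; -‿inverseʳ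
          ; *-assoc; *-comm; *-identityˡ; *-identityʳ; zeroˡ; zeroʳ; distribˡ; distribʳ)

  0# 1# : Carrier
  0# = ι ℤ.0ℤ
  1# = ι ℤ.1ℤ

  _-_ : Carrier → Carrier → Carrier
  x - y = x + - y

  bundle : CommutativeRing 0ℓ 0ℓ
  bundle = record { isCommutativeRing = isCommutativeRing }

module Solver (R : Ring≡) where
  open Ring≡ R using (Carrier; bundle; ι; ι-+; ι-*; ι-neg)
  open import Tactic.RingSolver.Core.Expression public
  open import Tactic.RingSolver.Core.Polynomial.Parameters using (Homomorphism)

  private
    zero? : ℤ → Bool
    zero? (+ zero) = true
    zero? _ = false

    homo : Homomorphism 0ℓ 0ℓ 0ℓ 0ℓ
    homo = record
      { from = record { rawRing = CommutativeRing.rawRing ℤ.+-*-commutativeRing ; isZero = zero? }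
      ; to = fromCommutativeRing bundle (λ _ → nothing)
      ; morphism = record
        { ⟦_⟧ = ι ; +-homo = ι-+ ; *-homo = ι-* ; -‿homo = ι-neg ; 0-homo = refl ; 1-homo = refl }
      ; Zero-C⟶Zero-R = λ where (+ zero) _ → refl
      }

    open Eval (AlmostCommutativeRing.rawRing (Homomorphism.to homo)) ι
    open import Tactic.RingSolver.Core.Polynomial.Base (Homomorphism.from homo) renaming (ι to ιₚ)
    import Tactic.RingSolver.Core.Polynomial.Semantics homo as Sem
    open import Tactic.RingSolver.Core.Polynomial.Homomorphism homo
    import Algebra.Properties.Semiring.Exp.TCOptimised (AlmostCommutativeRing.semiring (Homomorphism.to homo)) as Exp

    norm : ∀ {n} → Expr ℤ n → Poly n
    norm (Κ x) = κ x
    norm (Ι x) = ιₚ x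
    norm (x ⊕ y) = norm x ⊞ norm y
    norm (x ⊗ y) = norm x ⊠ norm y
    norm (⊝ x) = ⊟ norm x
    norm (x ⊛ i) = norm x ⊡ i

    ⟦_⇓⟧ : ∀ {n} → Expr ℤ n → Vec Carrier n → Carrier
    ⟦ e ⇓⟧ = Sem.⟦ norm e ⟧

    correct : ∀ {n} (e : Expr ℤ n) ρ → ⟦ e ⇓⟧ ρ ≡ ⟦ e ⟧ ρ
    correct (Κ x) ρ = κ-hom x ρ
    correct (Ι x) ρ = ι-hom x ρ
    correct (x ⊕ y) ρ = trans (⊞-hom (norm x) (norm y) ρ) (cong₂ (Ring≡._+_ R) (correct x ρ) (correct y ρ))
    correct (x ⊗ y) ρ = trans (⊠-hom (norm x) (norm y) ρ) (cong₂ (Ring≡._*_ R) (correct x ρ) (correct y ρ))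
    correct (⊝ x) ρ = trans (⊟-hom (norm x) ρ) (cong (Ring≡.-_ R) (correct x ρ))
    correct (x ⊛ i) ρ = trans (⊡-hom (norm x) i ρ) (Exp.^-congˡ i (correct x ρ))

  open import Relation.Binary.Reflection (setoid Carrier) Ι ⟦_⟧ ⟦_⇓⟧ correct public using (solve; _⊜_)

  infixl 6 _⊖_
  _⊖_ : ∀ {n} → Expr ℤ n → Expr ℤ n → Expr ℤ n
  x ⊖ y = x ⊕ (⊝ y)

-- Determinants

module Determinants (R : Ring≡) where
  open Ring≡ R
  open Solver R

  infixl 6 _⊹_
  infixl 7 _·_

  Row : ℕ → Set
  Row = Vec Carrier

  _⊹_ : ∀ {m} → Row m → Row m → Row m
  _⊹_ = Vec.zipWith _+_

  _·_ : ∀ {m} → Carrier → Row m → Row m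
  c · x = Vec.map (c *_) x

  0ᵣ : ∀ {m} → Row m
  0ᵣ = Vec.replicate _ 0#

  0·x≡0 : ∀ {m} (x : Row m) → 0# · x ≡ 0ᵣ
  0·x≡0 [] = refl
  0·x≡0 (a ∷ x) = cong₂ _∷_ (zeroˡ a) (0·x≡0 x)

  ⊹-identityˡ : ∀ {m} (x : Row m) → 0ᵣ ⊹ x ≡ x
  ⊹-identityˡ [] = refl
  ⊹-identityˡ (a ∷ x) = cong₂ _∷_ (+-identityˡ a) (⊹-identityˡ x)

  ⊹-identityʳ : ∀ {m} (x : Row m) → x ⊹ 0ᵣ ≡ x
  ⊹-identityʳ [] = refl
  ⊹-identityʳ (a ∷ x) = cong₂ _∷_ (+-identityʳ a) (⊹-identityʳ x)

  ⊹-interchange : ∀ {m} (x y z w : Row m) → (x ⊹ y) ⊹ (z ⊹ w) ≡ (x ⊹ z) ⊹ (y ⊹ w)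
  ⊹-interchange [] [] [] [] = refl
  ⊹-interchange (a ∷ x) (b ∷ y) (c ∷ z) (d ∷ w) =
    cong₂ _∷_ (solve 4 (λ a b c d → (a ⊕ b) ⊕ (c ⊕ d) ⊜ (a ⊕ c) ⊕ (b ⊕ d)) refl a b c d)
      (⊹-interchange x y z w)

  ·-distribˡ : ∀ {m} c (x y : Row m) → c · (x ⊹ y) ≡ c · x ⊹ c · y
  ·-distribˡ c [] [] = refl
  ·-distribˡ c (a ∷ x) (b ∷ y) = cong₂ _∷_ (distribˡ c a b) (·-distribˡ c x y)

  ·-distribʳ : ∀ {m} (x : Row m) c d → (c + d) · x ≡ c · x ⊹ d · x
  ·-distribʳ [] c d = refl
  ·-distribʳ (a ∷ x) c d = cong₂ _∷_ (distribʳ a c d) (·-distribʳ x c d)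

  ·-assoc : ∀ {m} c d (x : Row m) → (c * d) · x ≡ c · (d · x)
  ·-assoc c d [] = refl
  ·-assoc c d (a ∷ x) = cong₂ _∷_ (*-assoc c d a) (·-assoc c d x)

  1·x≡x : ∀ {m} (x : Row m) → 1# · x ≡ x
  1·x≡x [] = refl
  1·x≡x (a ∷ x) = cong₂ _∷_ (*-identityˡ a) (1·x≡x x)

  c·0≡0 : ∀ {m} c → c · 0ᵣ {m} ≡ 0ᵣ
  c·0≡0 {zero} c = refl
  c·0≡0 {suc m} c = cong₂ _∷_ (zeroʳ c) (c·0≡0 c)

  record LinearForm {m} (L : Row m → Carrier) : Set where
    field
      additive : ∀ x y → L (x ⊹ y) ≡ L x + L y
      homogeneous : ∀ c x → L (c · x) ≡ c * L x
  open LinearForm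

  record LinearMap {m n} (f : Row m → Row n) : Set where
    field
      additive : ∀ x y → f (x ⊹ y) ≡ f x ⊹ f y
      homogeneous : ∀ c x → f (c · x) ≡ c · f x

  Rows : ℕ → ℕ → Set
  Rows n m = Vec (Row m) n

  VanishesOnRepeat : ∀ {m} n → (Rows (suc n) m → Carrier) → Set
  VanishesOnRepeat zero Δ = ⊤
  VanishesOnRepeat (suc n) Δ = ∀ x M → Δ (x ∷ x ∷ M) ≡ 0#

  -- Repetition is tested in the first two rows only. The middle component fixes leading rows one at
  -- a time, so every pair of adjacent rows is covered.
  Alternating : ∀ {m} n → (Rows n m → Carrier) → Set
  Alternating zero Δ = ⊤
  Alternating (suc n) Δ =
    (∀ M → LinearForm (λ x → Δ (x ∷ M))) × (∀ x → Alternating n (λ M → Δ (x ∷ M))) × VanishesOnRepeat n Δ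

  alternating-combination : ∀ {m} n {Δ Δ′ : Rows n m → Carrier} c →
    Alternating n Δ → Alternating n Δ′ → Alternating n (λ M → c * Δ M - Δ′ M)
  alternating-combination zero c _ _ = tt
  alternating-combination (suc n) {Δ} {Δ′} c (lin , alt , rep) (lin′ , alt′ , rep′) =
    (λ M → record
      { additive = λ x y → trans (cong₂ (λ u v → c * u - v) (additive (lin M) x y) (additive (lin′ M) x y))
          (solve 5 (λ c a b a′ b′ → c ⊗ (a ⊕ b) ⊖ (a′ ⊕ b′) ⊜ (c ⊗ a ⊖ a′) ⊕ (c ⊗ b ⊖ b′)) refl c _ _ _ _)
      ; homogeneous = λ d x → trans (cong₂ (λ u v → c * u - v) (homogeneous (lin M) d x) (homogeneous (lin′ M) d x))
          (solve 4 (λ c d a a′ → c ⊗ (d ⊗ a) ⊖ d ⊗ a′ ⊜ d ⊗ (c ⊗ a ⊖ a′)) refl c d _ _) })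
    , (λ x → alternating-combination n c (alt x) (alt′ x))
    , repeat n rep rep′
    where
    repeat : ∀ n {Δ Δ′ : Rows (suc n) _ → Carrier} → VanishesOnRepeat n Δ → VanishesOnRepeat n Δ′ →
      VanishesOnRepeat n (λ M → c * Δ M - Δ′ M)
    repeat zero _ _ = tt
    repeat (suc n) r r′ x M = trans (cong₂ (λ u v → c * u - v) (r x M) (r′ x M))
      (solve 1 (λ c → c ⊗ Κ (+ 0) ⊖ Κ (+ 0) ⊜ Κ (+ 0)) refl c)

  alternating-map : ∀ {m m′} n {Δ : Rows n m → Carrier} {f : Row m′ → Row m} → LinearMap f →
    Alternating n Δ → Alternating n (λ M → Δ (Vec.map f M))
  alternating-map zero f-lin _ = tt
  alternating-map (suc n) {Δ} {f} f-lin (lin , alt , rep) =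
    (λ M → record
      { additive = λ x y → trans (cong (λ z → Δ (z ∷ Vec.map f M)) (LinearMap.additive f-lin x y)) (additive (lin _) _ _)
      ; homogeneous = λ c x → trans (cong (λ z → Δ (z ∷ Vec.map f M)) (LinearMap.homogeneous f-lin c x)) (homogeneous (lin _) _ _) })
    , (λ x → alternating-map n f-lin (alt (f x)))
    , repeat n rep
    where
    repeat : ∀ n {Δ : Rows (suc n) _ → Carrier} → VanishesOnRepeat n Δ → VanishesOnRepeat n (λ M → Δ (Vec.map f M))
    repeat zero _ = tt
    repeat (suc n) r x M = r (f x) (Vec.map f M)

  linear-zero : ∀ {m} {L : Row m → Carrier} → LinearForm L → L 0ᵣ ≡ 0#
  linear-zero {L = L} lin = trans (cong L (sym (0·x≡0 0ᵣ))) (trans (homogeneous lin 0# 0ᵣ) (zeroˡ _))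

  -- Polarisation: the repeated row x + y gives 0, and expanding it by linearity leaves the two
  -- mixed terms.
  swap-neg : ∀ {m n} (Δ : Rows (suc (suc n)) m → Carrier) → Alternating (suc (suc n)) Δ →
    ∀ x y M → Δ (x ∷ y ∷ M) ≡ - Δ (y ∷ x ∷ M)
  swap-neg Δ (lin , alt , rep) x y M = begin
    Δ (x ∷ y ∷ M)
      ≡⟨ solve 4 (λ a b c d → a ⊜ ((c ⊕ a) ⊕ (b ⊕ d)) ⊖ c ⊖ d ⊖ b) refl xy yx xx yy ⟩
    ((xx + xy) + (yx + yy)) - xx - yy - yx
      ≡⟨ cong₂ (λ u v → u - xx - yy - v) total refl ⟩
    0# - xx - yy - yx
      ≡⟨ cong₂ (λ u v → 0# - u - v - yx) (rep x M) (rep y M) ⟩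
    0# - 0# - 0# - yx
      ≡⟨ solve 1 (λ b → Κ (+ 0) ⊖ Κ (+ 0) ⊖ Κ (+ 0) ⊖ b ⊜ ⊝ b) refl yx ⟩
    - yx ∎
    where
    open ≡-Reasoning
    xx = Δ (x ∷ x ∷ M)
    xy = Δ (x ∷ y ∷ M)
    yx = Δ (y ∷ x ∷ M)
    yy = Δ (y ∷ y ∷ M)
    second : ∀ z → Δ (z ∷ (x ⊹ y) ∷ M) ≡ Δ (z ∷ x ∷ M) + Δ (z ∷ y ∷ M)
    second z = additive (proj₁ (alt z) M) x y
    total : (xx + xy) + (yx + yy) ≡ 0#
    total = trans (sym (trans (additive (lin _) x y) (cong₂ _+_ (second x) (second y)))) (rep (x ⊹ y) M)

  -- Expansion along the first column.
  wedge : ∀ {m n} → (Rows n m → Carrier) → Rows (suc n) (suc m) → Carrier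
  wedge {n = zero} Δ ((h ∷ t) ∷ []) = h * Δ []
  wedge {n = suc n} Δ ((h ∷ t) ∷ M) = h * Δ (Vec.map Vec.tail M) - wedge (λ N → Δ (t ∷ N)) M

  wedge-cong : ∀ {m} n {Δ Δ′ : Rows n m → Carrier} → (∀ M → Δ M ≡ Δ′ M) → ∀ M → wedge Δ M ≡ wedge Δ′ M
  wedge-cong zero eq ((h ∷ t) ∷ []) = cong (h *_) (eq [])
  wedge-cong (suc n) eq ((h ∷ t) ∷ M) = cong₂ (λ u v → h * u - v) (eq _) (wedge-cong n (λ N → eq (t ∷ N)) M)

  wedge-+ : ∀ {m} n (Δ Δ′ : Rows n m → Carrier) M → wedge (λ N → Δ N + Δ′ N) M ≡ wedge Δ M + wedge Δ′ M
  wedge-+ zero Δ Δ′ ((h ∷ t) ∷ []) = distribˡ h _ _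
  wedge-+ (suc n) Δ Δ′ ((h ∷ t) ∷ M) = trans (cong (λ v → h * _ - v) (wedge-+ n _ _ M))
    (solve 5 (λ h a b c d → h ⊗ (a ⊕ b) ⊖ (c ⊕ d) ⊜ (h ⊗ a ⊖ c) ⊕ (h ⊗ b ⊖ d)) refl h _ _ _ _)

  wedge-* : ∀ {m} n c (Δ : Rows n m → Carrier) M → wedge (λ N → c * Δ N) M ≡ c * wedge Δ M
  wedge-* zero c Δ ((h ∷ t) ∷ []) = solve 3 (λ h c a → h ⊗ (c ⊗ a) ⊜ c ⊗ (h ⊗ a)) refl h c _
  wedge-* (suc n) c Δ ((h ∷ t) ∷ M) = trans (cong (λ v → h * _ - v) (wedge-* n c _ M))
    (solve 4 (λ h c a b → h ⊗ (c ⊗ a) ⊖ c ⊗ b ⊜ c ⊗ (h ⊗ a ⊖ b)) refl h c _ _)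

  wedge-zero : ∀ {m} n {Δ : Rows n m → Carrier} → (∀ M → Δ M ≡ 0#) → ∀ M → wedge Δ M ≡ 0#
  wedge-zero n {Δ} eq M = trans (wedge-cong n (λ N → trans (eq N) (sym (zeroˡ (Δ N)))) M)
    (trans (wedge-* n 0# Δ M) (zeroˡ _))

  tail-linear : ∀ {m} → LinearMap (Vec.tail {A = Carrier} {n = m})
  tail-linear = record
    { additive = λ where (_ ∷ _) (_ ∷ _) → refl
    ; homogeneous = λ where _ (_ ∷ _) → refl }

  -- With the first row h ∷ t fixed, `wedge Δ` is h times Δ on the tails minus `wedge` of Δ (t ∷ _),
  -- a combination of alternating forms by induction. If that row is repeated, the two terms with
  -- factor h cancel and what remains is the wedge of Δ (t ∷ t ∷ _), which is 0.
  wedge-alternating : ∀ {m} n {Δ : Rows n m → Carrier} → Alternating n Δ → Alternating (suc n) (wedge Δ)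
  wedge-alternating zero {Δ} _ =
    (λ where
      [] → record
        { additive = λ where (_ ∷ _) (_ ∷ _) → distribʳ _ _ _
        ; homogeneous = λ where _ (_ ∷ _) → *-assoc _ _ _ })
    , (λ _ → tt) , tt
  wedge-alternating (suc n) {Δ} (lin , alt , rep) =
    (λ M → record
      { additive = λ where
          (h ∷ t) (h′ ∷ t′) →
            trans (cong (λ v → (h + h′) * Δ (tails M) - v)
                    (trans (wedge-cong n (λ N → additive (lin N) t t′) M) (wedge-+ n _ _ M)))
              (solve 5 (λ h h′ a b c → (h ⊕ h′) ⊗ a ⊖ (b ⊕ c) ⊜ (h ⊗ a ⊖ b) ⊕ (h′ ⊗ a ⊖ c)) refl h h′ _ _ _)
      ; homogeneous = λ where
          c (h ∷ t) →
            trans (cong (λ v → (c * h) * Δ (tails M) - v)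
                    (trans (wedge-cong n (λ N → homogeneous (lin N) c t) M) (wedge-* n c _ M)))
              (solve 4 (λ c h a b → (c ⊗ h) ⊗ a ⊖ c ⊗ b ⊜ c ⊗ (h ⊗ a ⊖ b)) refl c h _ _) })
    , (λ where (h ∷ t) → alternating-combination (suc n) h (alternating-map (suc n) tail-linear (lin , alt , rep))
                           (wedge-alternating n (alt t)))
    , repeat n Δ rep
    where
    tails : ∀ {n m} → Rows n (suc m) → Rows n m
    tails = Vec.map Vec.tail
    repeat : ∀ n (Δ : Rows (suc n) _ → Carrier) → VanishesOnRepeat n Δ → VanishesOnRepeat (suc n) (wedge Δ)
    repeat zero Δ _ (h ∷ t) [] = solve 2 (λ h a → h ⊗ a ⊖ h ⊗ a ⊜ Κ (+ 0)) refl h (Δ (t ∷ []))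
    repeat (suc n) Δ rep (h ∷ t) M = trans
      (cong (λ v → h * Δ (t ∷ tails M) - (h * Δ (t ∷ tails M) - v)) (wedge-zero n (rep t) M))
      (solve 2 (λ h a → h ⊗ a ⊖ (h ⊗ a ⊖ Κ (+ 0)) ⊜ Κ (+ 0)) refl h (Δ (t ∷ tails M)))

  -- Expansion along columns is alternating in the rows by a direct induction, whereas `det` expands
  -- along rows. The two are identified below through the uniqueness of alternating forms.
  colDet : ∀ n → Rows n n → Carrier
  colDet zero _ = 1#
  colDet (suc n) = wedge (colDet n)

  colDet-alternating : ∀ n → Alternating n (colDet n)
  colDet-alternating zero = tt
  colDet-alternating (suc n) = wedge-alternating n (colDet-alternating n)

  sumᶠ : ∀ n → (Fin n → Carrier) → Carrier
  sumᶠ zero f = 0#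
  sumᶠ (suc n) f = f zero + sumᶠ n (f ∘ suc)

  sumᶠ-cong : ∀ n {f g : Fin n → Carrier} → (∀ i → f i ≡ g i) → sumᶠ n f ≡ sumᶠ n g
  sumᶠ-cong zero eq = refl
  sumᶠ-cong (suc n) eq = cong₂ _+_ (eq zero) (sumᶠ-cong n (eq ∘ suc))

  sumᶠ-*ʳ : ∀ n f c → sumᶠ n (λ i → f i * c) ≡ sumᶠ n f * c
  sumᶠ-*ʳ zero f c = sym (zeroˡ c)
  sumᶠ-*ʳ (suc n) f c = trans (cong₂ _+_ refl (sumᶠ-*ʳ n (f ∘ suc) c)) (sym (distribʳ c _ _))

  rowDet : ∀ n → (Fin n → Fin n → Carrier) → Carrier
  rowDet zero M = 1#
  rowDet (suc n) M =
    sumᶠ (suc n) λ j → ι (sgn (toℕ j)) * (M zero j * rowDet n (λ r c → M (suc r) (punchIn j c)))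

  toRows : ∀ {n m} → (Fin n → Fin m → Carrier) → Rows n m
  toRows M = Vec.tabulate λ i → Vec.tabulate (M i)

  basis : ∀ {m} → Fin m → Row m
  basis zero = 1# ∷ 0ᵣ
  basis (suc j) = 0# ∷ basis j

  identity : ∀ n → Rows n n
  identity zero = []
  identity (suc n) = basis zero ∷ Vec.map (0# ∷_) (identity n)

  insertZero : ∀ {m} → Fin (suc m) → Row m → Row (suc m)
  insertZero zero x = 0# ∷ x
  insertZero (suc j) (a ∷ x) = a ∷ insertZero j x

  insertZero-linear : ∀ {m} (j : Fin (suc m)) → LinearMap (insertZero j)
  insertZero-linear j = record { additive = add j ; homogeneous = hom j }
    where
    add : ∀ {m} (j : Fin (suc m)) x y → insertZero j (x ⊹ y) ≡ insertZero j x ⊹ insertZero j y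
    add zero x y = cong₂ _∷_ (sym (+-identityˡ 0#)) refl
    add (suc j) (a ∷ x) (b ∷ y) = cong (_ ∷_) (add j x y)
    hom : ∀ {m} (j : Fin (suc m)) c x → insertZero j (c · x) ≡ c · insertZero j x
    hom zero c x = cong₂ _∷_ (sym (zeroʳ c)) refl
    hom (suc j) c (a ∷ x) = cong (_ ∷_) (hom j c x)

  linear-expand : ∀ {m} {L : Row m → Carrier} → LinearForm L → ∀ f →
    L (Vec.tabulate f) ≡ sumᶠ m λ j → f j * L (basis j)
  linear-expand {zero} lin f = linear-zero lin
  linear-expand {suc m} {L} lin f = begin
    L (f zero ∷ t)                                  ≡⟨ cong L split ⟩
    L (f zero · basis zero ⊹ (0# ∷ t))              ≡⟨ additive lin _ _ ⟩
    L (f zero · basis zero) + L (0# ∷ t)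
      ≡⟨ cong₂ _+_ (homogeneous lin _ _) (linear-expand tail-lin (f ∘ suc)) ⟩
    f zero * L (basis zero) + sumᶠ m (λ j → f (suc j) * L (basis (suc j))) ∎
    where
    open ≡-Reasoning
    t = Vec.tabulate (f ∘ suc)
    split : f zero ∷ t ≡ f zero · basis zero ⊹ (0# ∷ t)
    split = cong₂ _∷_ (sym (trans (+-identityʳ _) (*-identityʳ _)))
      (sym (trans (cong (_⊹ t) (c·0≡0 (f zero))) (⊹-identityˡ t)))
    tail-lin : LinearForm (λ x → L (0# ∷ x))
    tail-lin = record
      { additive = λ x y → trans (cong (λ z → L (z ∷ (x ⊹ y))) (sym (+-identityˡ 0#))) (additive lin _ _)
      ; homogeneous = λ c x → trans (cong (λ z → L (z ∷ c · x)) (sym (zeroʳ c))) (homogeneous lin _ _) }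

  tabulate-punchIn : ∀ {m} (j : Fin (suc m)) (f : Fin (suc m) → Carrier) →
    Vec.tabulate f ≡ f j · basis j ⊹ insertZero j (Vec.tabulate (f ∘ punchIn j))
  tabulate-punchIn zero f = cong₂ _∷_ (sym (trans (+-identityʳ _) (*-identityʳ _)))
    (sym (trans (cong (_⊹ Vec.tabulate (f ∘ suc)) (c·0≡0 (f zero))) (⊹-identityˡ _)))
  tabulate-punchIn {suc m} (suc j) f =
    cong₂ _∷_ (sym (trans (cong (_+ _) (zeroʳ _)) (+-identityˡ _))) (tabulate-punchIn j (f ∘ suc))

  VanishesAt : ∀ {m} n → Row m → (Rows n m → Carrier) → Set
  VanishesAt zero v Δ = ⊤
  VanishesAt (suc n) v Δ = ∀ N → Δ (v ∷ N) ≡ 0#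

  -- Each row is its entry in column j times `basis j` plus a row with a zero there. The first
  -- summand contributes nothing to a form that vanishes on `basis j`, so column j may be zeroed.
  clear-column : ∀ {m} n (j : Fin (suc m)) {Δ : Rows n (suc m) → Carrier} →
    Alternating n Δ → VanishesAt n (basis j) Δ → ∀ (M : Fin n → Fin (suc m) → Carrier) →
    Δ (toRows M) ≡ Δ (Vec.map (insertZero j) (toRows (λ r c → M r (punchIn j c))))
  clear-column zero j alt van M = refl
  clear-column (suc n) j {Δ} alt@(lin , alt′ , rep) van M = begin
    Δ (Vec.tabulate (M zero) ∷ N)                      ≡⟨ cong (λ y → Δ (y ∷ N)) (tabulate-punchIn j (M zero)) ⟩
    Δ ((M zero j · basis j ⊹ z) ∷ N)                   ≡⟨ additive (lin N) _ _ ⟩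
    Δ (M zero j · basis j ∷ N) + Δ (z ∷ N)             ≡⟨ cong (_+ Δ (z ∷ N)) (homogeneous (lin N) _ _) ⟩
    M zero j * Δ (basis j ∷ N) + Δ (z ∷ N)             ≡⟨ cong (λ u → M zero j * u + Δ (z ∷ N)) (van N) ⟩
    M zero j * 0# + Δ (z ∷ N)                          ≡⟨ trans (cong (_+ Δ (z ∷ N)) (zeroʳ _)) (+-identityˡ _) ⟩
    Δ (z ∷ N)                                          ≡⟨ clear-column n j (alt′ z) (van′ n Δ alt van) (M ∘ suc) ⟩
    Δ (z ∷ Vec.map (insertZero j) (toRows (λ r c → M (suc r) (punchIn j c)))) ∎
    where
    open ≡-Reasoning
    N = toRows (M ∘ suc)
    z = insertZero j (Vec.tabulate (M zero ∘ punchIn j))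
    van′ : ∀ n (Δ : Rows (suc n) _ → Carrier) → Alternating (suc n) Δ → VanishesAt (suc n) (basis j) Δ →
      VanishesAt n (basis j) (λ N → Δ (z ∷ N))
    van′ zero Δ alt van = tt
    van′ (suc n) Δ alt van N = trans (swap-neg Δ alt _ _ N)
      (trans (cong -_ (van (z ∷ N))) (solve 0 (⊝ Κ (+ 0) ⊜ Κ (+ 0)) refl))

  -- Moving `basis j` down to its place in the identity takes j transpositions of adjacent rows.
  insertZero-identity : ∀ n (j : Fin (suc n)) {Δ : Rows (suc n) (suc n) → Carrier} → Alternating (suc n) Δ →
    Δ (basis j ∷ Vec.map (insertZero j) (identity n)) ≡ ι (sgn (toℕ j)) * Δ (identity (suc n))
  insertZero-identity n zero {Δ} alt = sym (*-identityˡ _)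
  insertZero-identity (suc n) (suc j) {Δ} alt@(lin , alt′ , rep) = begin
    Δ (basis (suc j) ∷ (1# ∷ insertZero j 0ᵣ) ∷ Vec.map (insertZero (suc j)) (Vec.map (0# ∷_) (identity n)))
      ≡⟨ cong₂ (λ u v → Δ (basis (suc j) ∷ (1# ∷ u) ∷ v)) (insertZero-0 j) (shift (identity n)) ⟩
    Δ (basis (suc j) ∷ basis zero ∷ Vec.map (0# ∷_) (Vec.map (insertZero j) (identity n)))
      ≡⟨ swap-neg Δ alt _ _ _ ⟩
    - Δ (basis zero ∷ Vec.map (0# ∷_) (basis j ∷ Vec.map (insertZero j) (identity n)))
      ≡⟨ cong -_ (insertZero-identity n j (alternating-map (suc n) (insertZero-linear zero) (alt′ (basis zero)))) ⟩
    - (ι (sgn (toℕ j)) * Δ (identity (suc (suc n))))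
      ≡⟨ solve 2 (λ s d → ⊝ (s ⊗ d) ⊜ (⊝ s) ⊗ d) refl _ _ ⟩
    (- ι (sgn (toℕ j))) * Δ (identity (suc (suc n)))
      ≡⟨ cong (_* Δ (identity (suc (suc n)))) (trans (sym (ι-neg _)) (cong ι (sgn-suc (toℕ j)))) ⟩
    ι (sgn (toℕ (suc j))) * Δ (identity (suc (suc n))) ∎
    where
    open ≡-Reasoning
    sgn-suc : ∀ k → ℤ.- sgn k ≡ sgn (suc k)
    sgn-suc zero = refl
    sgn-suc (suc zero) = refl
    sgn-suc (suc (suc k)) = sgn-suc k
    insertZero-0 : ∀ {m} (j : Fin (suc m)) → insertZero j 0ᵣ ≡ 0ᵣ
    insertZero-0 zero = refl
    insertZero-0 {suc m} (suc j) = cong (0# ∷_) (insertZero-0 j)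
    shift : ∀ {k} (M : Rows k n) →
      Vec.map (insertZero (suc j)) (Vec.map (0# ∷_) M) ≡ Vec.map (0# ∷_) (Vec.map (insertZero j) M)
    shift [] = refl
    shift (x ∷ M) = cong (_ ∷_) (shift M)

  -- Expanding the first row linearly puts some `basis j` on top. Clearing column j then leaves an
  -- alternating form of the minor, to which induction applies; the coefficients that accumulate are
  -- those of the row expansion.
  alternating-unique : ∀ n {Δ : Rows n n → Carrier} → Alternating n Δ → ∀ M →
    Δ (toRows M) ≡ rowDet n M * Δ (identity n)
  alternating-unique zero alt M = sym (*-identityˡ _)
  alternating-unique (suc n) {Δ} alt@(lin , alt′ , rep) M = begin
    Δ (Vec.tabulate (M zero) ∷ N)                      ≡⟨ linear-expand (lin N) (M zero) ⟩
    sumᶠ (suc n) (λ j → M zero j * Δ (basis j ∷ N))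
      ≡⟨ sumᶠ-cong (suc n) (λ j → trans (cong (M zero j *_) (cofactor j))
           (solve 4 (λ m d s e → m ⊗ (d ⊗ (s ⊗ e)) ⊜ (s ⊗ (m ⊗ d)) ⊗ e) refl
             (M zero j) (rowDet n (minorAt j)) (ι (sgn (toℕ j))) (Δ (identity (suc n))))) ⟩
    sumᶠ (suc n) (λ j → (ι (sgn (toℕ j)) * (M zero j * rowDet n (minorAt j))) * Δ (identity (suc n)))
      ≡⟨ sumᶠ-*ʳ (suc n) (λ j → ι (sgn (toℕ j)) * (M zero j * rowDet n (minorAt j))) _ ⟩
    rowDet (suc n) M * Δ (identity (suc n)) ∎
    where
    open ≡-Reasoning
    N = toRows (M ∘ suc)
    minorAt : Fin (suc n) → Fin n → Fin n → Carrier
    minorAt j r c = M (suc r) (punchIn j c)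
    repeat : ∀ {m} n (Δ : Rows (suc n) m → Carrier) → VanishesOnRepeat n Δ → ∀ v → VanishesAt n v (λ N → Δ (v ∷ N))
    repeat zero Δ _ v = tt
    repeat (suc n) Δ rep v N = rep v N
    cofactor : ∀ j → Δ (basis j ∷ N) ≡ rowDet n (minorAt j) * (ι (sgn (toℕ j)) * Δ (identity (suc n)))
    cofactor j = trans (clear-column n j (alt′ (basis j)) (repeat n Δ rep (basis j)) (M ∘ suc))
      (trans (alternating-unique n (alternating-map n (insertZero-linear j) (alt′ (basis j))) (minorAt j))
        (cong (rowDet n (minorAt j) *_) (insertZero-identity n j alt)))

  colDet-identity : ∀ n → colDet n (identity n) ≡ 1#
  colDet-identity zero = refl
  colDet-identity (suc zero) = *-identityʳ 1#
  colDet-identity (suc (suc n)) = trans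
    (cong₂ (λ u v → 1# * u - v) (trans (cong (colDet (suc n)) (tails (identity (suc n)))) (colDet-identity (suc n)))
      (zeroColumn n _ (identity (suc n))))
    (solve 0 (Κ (+ 1) ⊗ Κ (+ 1) ⊖ Κ (+ 0) ⊜ Κ (+ 1)) refl)
    where
    tails : ∀ {k m} (M : Rows k m) → Vec.map Vec.tail (Vec.map (0# ∷_) M) ≡ M
    tails [] = refl
    tails (x ∷ M) = cong (x ∷_) (tails M)
    zeroColumn : ∀ {m} n (Δ : Rows n m → Carrier) (M : Rows (suc n) m) → wedge Δ (Vec.map (0# ∷_) M) ≡ 0#
    zeroColumn zero Δ (x ∷ []) = zeroˡ _
    zeroColumn (suc n) Δ (x ∷ M) = trans (cong (λ v → 0# * Δ _ - v) (zeroColumn n _ M))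
      (solve 1 (λ a → Κ (+ 0) ⊗ a ⊖ Κ (+ 0) ⊜ Κ (+ 0)) refl (Δ _))

  colDet≡rowDet : ∀ n M → colDet n (toRows M) ≡ rowDet n M
  colDet≡rowDet n M = trans (alternating-unique n (colDet-alternating n) M)
    (trans (cong (rowDet n M *_) (colDet-identity n)) (*-identityʳ _))

  rowDet-ι : ∀ n (M : Fin n → Fin n → ℤ) → rowDet n (λ i j → ι (M i j)) ≡ ι (det n M)
  rowDet-ι zero M = refl
  rowDet-ι (suc n) M = trans
    (sumᶠ-cong (suc n) {g = λ j → ι (cofactor j)} λ j →
      trans (cong (λ d → ι (sgn (toℕ j)) * (ι (M zero j) * d)) (rowDet-ι n (minor M j)))
        (trans (cong (ι (sgn (toℕ j)) *_) (sym (ι-* _ _))) (sym (ι-* (sgn (toℕ j)) _))))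
    (sum-ι (suc n) cofactor)
    where
    cofactor : Fin (suc n) → ℤ
    cofactor j = sgn (toℕ j) ℤ.* (M zero j ℤ.* det n (minor M j))
    sum-ι : ∀ n (f : Fin n → ℤ) → sumᶠ n (ι ∘ f) ≡ ι (sumFin n f)
    sum-ι zero f = refl
    sum-ι (suc n) f = trans (cong (λ u → ι (f zero) + u) (sum-ι n (f ∘ suc))) (sym (ι-+ _ _))

  infixl 7 _⋆_
  _⋆_ : ∀ {n m} → Row n → Rows n m → Row m
  [] ⋆ [] = 0ᵣ
  (a ∷ x) ⋆ (y ∷ N) = a · y ⊹ x ⋆ N

  ⋆-linear : ∀ {n m} (N : Rows n m) → LinearMap (_⋆ N)
  ⋆-linear N = record { additive = λ x y → add x y N ; homogeneous = λ c x → hom c x N }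
    where
    add : ∀ {n m} x y (N : Rows n m) → (x ⊹ y) ⋆ N ≡ x ⋆ N ⊹ y ⋆ N
    add [] [] [] = sym (⊹-identityˡ _)
    add (a ∷ x) (b ∷ y) (z ∷ N) = trans (cong₂ _⊹_ (·-distribʳ z a b) (add x y N)) (⊹-interchange _ _ _ _)
    hom : ∀ {n m} c x (N : Rows n m) → (c · x) ⋆ N ≡ c · (x ⋆ N)
    hom c [] [] = sym (c·0≡0 c)
    hom c (a ∷ x) (z ∷ N) = trans (cong₂ _⊹_ (·-assoc c a z) (hom c x N)) (sym (·-distribˡ c _ _))

  identity-⋆ : ∀ {n m} (N : Rows n m) → Vec.map (_⋆ N) (identity n) ≡ N
  identity-⋆ [] = refl
  identity-⋆ {suc n} (z ∷ N) = cong₂ _∷_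
    (trans (cong₂ _⊹_ (1·x≡x z) (zero⋆ N)) (⊹-identityʳ z))
    (trans (shift (identity n)) (identity-⋆ N))
    where
    zero⋆ : ∀ {n m} (N : Rows n m) → 0ᵣ ⋆ N ≡ 0ᵣ
    zero⋆ [] = refl
    zero⋆ (z ∷ N) = trans (cong₂ _⊹_ (0·x≡0 z) (zero⋆ N)) (⊹-identityˡ _)
    shift : ∀ {k} (I : Rows k n) → Vec.map (_⋆ (z ∷ N)) (Vec.map (0# ∷_) I) ≡ Vec.map (_⋆ N) I
    shift [] = refl
    shift (x ∷ I) = cong₂ _∷_ (trans (cong (_⊹ x ⋆ N) (0·x≡0 z)) (⊹-identityˡ _)) (shift I)

  -- Multiplicativity of determinants: M ↦ det (M N) is alternating in the rows of M, hence a
  -- multiple of det M, and the identity matrix determines the factor.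
  colDet-⋆ : ∀ n (M : Fin n → Fin n → Carrier) (N : Rows n n) →
    colDet n (Vec.map (_⋆ N) (toRows M)) ≡ rowDet n M * colDet n N
  colDet-⋆ n M N = trans (alternating-unique n (alternating-map n (⋆-linear N) (colDet-alternating n)) M)
    (cong (λ I → rowDet n M * colDet n I) (identity-⋆ N))

  _⊙_ : ∀ {m} → Row m → Row m → Row m
  _⊙_ = Vec.zipWith _*_

  productᵣ : ∀ {m} → Row m → Carrier
  productᵣ = Vec.foldr′ _*_ 1#

  colDet-scaleColumns : ∀ n (c : Row n) M → colDet n (Vec.map (c ⊙_) M) ≡ productᵣ c * colDet n M
  colDet-scaleColumns zero [] [] = sym (*-identityˡ 1#)
  colDet-scaleColumns (suc n) (c ∷ cs) M = trans (wedge-scale n (colDet n) M)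
    (trans (cong (c *_) (trans (wedge-cong n (colDet-scaleColumns n cs) M) (wedge-* n _ _ M)))
      (sym (*-assoc c _ _)))
    where
    tails : ∀ {k} (M : Rows k (suc n)) →
      Vec.map Vec.tail (Vec.map ((c ∷ cs) ⊙_) M) ≡ Vec.map (cs ⊙_) (Vec.map Vec.tail M)
    tails [] = refl
    tails ((_ ∷ _) ∷ M) = cong (_ ∷_) (tails M)
    wedge-scale : ∀ k (Δ : Rows k n → Carrier) M →
      wedge Δ (Vec.map ((c ∷ cs) ⊙_) M) ≡ c * wedge (λ N → Δ (Vec.map (cs ⊙_) N)) M
    wedge-scale zero Δ ((h ∷ t) ∷ []) = *-assoc c h _
    wedge-scale (suc k) Δ ((h ∷ t) ∷ M) = trans
      (cong₂ (λ u v → (c * h) * Δ u - v) (tails M) (wedge-scale k (λ N → Δ ((cs ⊙ t) ∷ N)) M))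
      (solve 4 (λ c h a b → (c ⊗ h) ⊗ a ⊖ c ⊗ b ⊜ c ⊗ (h ⊗ a ⊖ b)) refl c h _ _)

  toRows-cong : ∀ {n m} {M N : Fin n → Fin m → Carrier} → (∀ i j → M i j ≡ N i j) → toRows M ≡ toRows N
  toRows-cong eq = Vec.tabulate-cong λ i → Vec.tabulate-cong (eq i)

  tabulate-⋆ : ∀ {n m} (f : Fin n → Carrier) (N : Fin n → Fin m → Carrier) →
    Vec.tabulate f ⋆ toRows N ≡ Vec.tabulate λ l → sumᶠ n λ k → f k * N k l
  tabulate-⋆ {zero} f N = zeros _
    where
    zeros : ∀ m → Vec.replicate m 0# ≡ Vec.tabulate λ (_ : Fin m) → 0#
    zeros zero = refl
    zeros (suc m) = cong (0# ∷_) (zeros m)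
  tabulate-⋆ {suc n} {m} f N = trans
    (cong (f zero · Vec.tabulate (N zero) ⊹_) (tabulate-⋆ (f ∘ suc) (N ∘ suc)))
    (combine m (N zero) (λ l → sumᶠ n λ k → f (suc k) * N (suc k) l))
    where
    combine : ∀ m (g h : Fin m → Carrier) →
      f zero · Vec.tabulate g ⊹ Vec.tabulate h ≡ Vec.tabulate λ l → f zero * g l + h l
    combine zero g h = refl
    combine (suc m) g h = cong₂ _∷_ refl (combine m (g ∘ suc) (h ∘ suc))

  toRows-⋆ : ∀ {n m l} (M : Fin n → Fin m → Carrier) (N : Fin m → Fin l → Carrier) →
    Vec.map (_⋆ toRows N) (toRows M) ≡ toRows λ i k → sumᶠ m λ j → M i j * N j k
  toRows-⋆ {zero} M N = refl
  toRows-⋆ {suc n} M N = cong₂ _∷_ (tabulate-⋆ (M zero) N) (toRows-⋆ (M ∘ suc) N)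

  toRows-⊙ : ∀ {n m} (c : Fin m → Carrier) (M : Fin n → Fin m → Carrier) →
    Vec.map (Vec.tabulate c ⊙_) (toRows M) ≡ toRows λ i k → c k * M i k
  toRows-⊙ {zero} c M = refl
  toRows-⊙ {suc n} c M = cong₂ _∷_ (row _ c (M zero)) (toRows-⊙ c (M ∘ suc))
    where
    row : ∀ m (c g : Fin m → Carrier) → Vec.tabulate c ⊙ Vec.tabulate g ≡ Vec.tabulate λ k → c k * g k
    row zero c g = refl
    row (suc m) c g = cong₂ _∷_ refl (row m (c ∘ suc) (g ∘ suc))

  δ : ∀ {n} → Fin n → Fin n → Carrier
  δ zero zero = 1#
  δ zero (suc j) = 0#
  δ (suc i) zero = 0#
  δ (suc i) (suc j) = δ i j

  toRows-δ : ∀ n → toRows δ ≡ identity n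
  toRows-δ zero = refl
  toRows-δ (suc n) = cong₂ _∷_ (cong (1# ∷_) (zeros n))
    (trans (shift δ) (cong (Vec.map (0# ∷_)) (toRows-δ n)))
    where
    zeros : ∀ m → Vec.tabulate (λ (_ : Fin m) → 0#) ≡ Vec.replicate m 0#
    zeros zero = refl
    zeros (suc m) = cong (0# ∷_) (zeros m)
    shift : ∀ {k m} (M : Fin k → Fin m → Carrier) →
      Vec.tabulate (λ i → 0# ∷ Vec.tabulate (M i)) ≡ Vec.map (0# ∷_) (toRows M)
    shift {zero} M = refl
    shift {suc k} M = cong₂ _∷_ refl (shift (M ∘ suc))

  δ-≡ : ∀ {n} (i : Fin n) → δ i i ≡ 1#
  δ-≡ zero = refl
  δ-≡ (suc i) = δ-≡ i

  δ-≢ : ∀ {n} (i j : Fin n) → i ≢ j → δ i j ≡ 0#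
  δ-≢ zero zero i≢j = ⊥-elim (i≢j refl)
  δ-≢ zero (suc j) _ = refl
  δ-≢ (suc i) zero _ = refl
  δ-≢ (suc i) (suc j) i≢j = δ-≢ i j (i≢j ∘ cong suc)

  -- The ring is not assumed to be a domain, so det F cannot be cancelled directly from det C · det
  -- F = ∏ e · det F. Multiplying by det G turns det F into cⁿ, and c can be cancelled.
  rowDet-diagonalised : ∀ n (C F G : Fin n → Fin n → Carrier) (e : Fin n → Carrier) c →
    (∀ i k → sumᶠ n (λ j → C i j * F j k) ≡ e k * F i k) →
    (∀ i k → sumᶠ n (λ j → F i j * G j k) ≡ c * δ i k) →
    (∀ x → c * x ≡ 0# → x ≡ 0#) → rowDet n C ≡ productᵣ (Vec.tabulate e)
  rowDet-diagonalised n C F G e c CF≡Fe FG≡c c-cancel =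
    trans (solve 2 (λ d p → d ⊜ (d ⊖ p) ⊕ p) refl (rowDet n C) Π)
      (trans (cong (_+ Π) (cancel n difference)) (+-identityˡ Π))
    where
    open ≡-Reasoning
    Π = productᵣ (Vec.tabulate e)
    dF = colDet n (toRows F)
    dG = colDet n (toRows G)
    cancel : ∀ n {x} → productᵣ (Vec.tabulate {n = n} (λ _ → c)) * x ≡ 0# → x ≡ 0#
    cancel zero eq = trans (sym (*-identityˡ _)) eq
    cancel (suc n) eq = cancel n (c-cancel _ (trans (sym (*-assoc _ _ _)) eq))
    cs = Vec.tabulate {n = n} (λ _ → c)
    FG : Vec.map (_⋆ toRows G) (toRows F) ≡ Vec.map (cs ⊙_) (identity n)
    FG = trans (toRows-⋆ F G) (trans (toRows-cong FG≡c)
      (trans (sym (toRows-⊙ (λ _ → c) δ)) (cong (Vec.map (cs ⊙_)) (toRows-δ n))))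
    CF : Vec.map (_⋆ toRows F) (toRows C) ≡ Vec.map (Vec.tabulate e ⊙_) (toRows F)
    CF = trans (toRows-⋆ C F) (trans (toRows-cong CF≡Fe) (sym (toRows-⊙ e F)))
    detF : dF * dG ≡ productᵣ cs
    detF = begin
      dF * dG                                           ≡⟨ cong (_* dG) (colDet≡rowDet n F) ⟩
      rowDet n F * dG                                   ≡⟨ colDet-⋆ n F (toRows G) ⟨
      colDet n (Vec.map (_⋆ toRows G) (toRows F))       ≡⟨ cong (colDet n) FG ⟩
      colDet n (Vec.map (cs ⊙_) (identity n))           ≡⟨ colDet-scaleColumns n cs (identity n) ⟩
      productᵣ cs * colDet n (identity n)               ≡⟨ cong (productᵣ cs *_) (colDet-identity n) ⟩
      productᵣ cs * 1#                                  ≡⟨ *-identityʳ _ ⟩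
      productᵣ cs ∎
    eigen : rowDet n C * dF ≡ Π * dF
    eigen = begin
      rowDet n C * dF                                   ≡⟨ colDet-⋆ n C (toRows F) ⟨
      colDet n (Vec.map (_⋆ toRows F) (toRows C))       ≡⟨ cong (colDet n) CF ⟩
      colDet n (Vec.map (Vec.tabulate e ⊙_) (toRows F)) ≡⟨ colDet-scaleColumns n (Vec.tabulate e) (toRows F) ⟩
      Π * dF ∎
    difference : productᵣ cs * (rowDet n C - Π) ≡ 0#
    difference = begin
      productᵣ cs * (rowDet n C - Π)                    ≡⟨ cong (_* (rowDet n C - Π)) detF ⟨
      dF * dG * (rowDet n C - Π)
        ≡⟨ solve 4 (λ f g d p → f ⊗ g ⊗ (d ⊖ p) ⊜ (d ⊗ f ⊖ p ⊗ f) ⊗ g) refl dF dG (rowDet n C) Π ⟩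
      (rowDet n C * dF - Π * dF) * dG                   ≡⟨ cong (λ u → (u - Π * dF) * dG) eigen ⟩
      (Π * dF - Π * dF) * dG                            ≡⟨ solve 2 (λ p g → (p ⊖ p) ⊗ g ⊜ Κ (+ 0)) refl (Π * dF) dG ⟩
      0# ∎

-- Cyclotomic integers

ℤ≡ : Ring≡
ℤ≡ = record
  { isCommutativeRing = ℤ.+-*-isCommutativeRing ; ι = id
  ; ι-+ = λ _ _ → refl ; ι-* = λ _ _ → refl ; ι-neg = λ _ → refl }

-- The ring R[√u], with a + b√u encoded as (a , b).
module Quadratic (R : Ring≡) (u : Ring≡.Carrier R) where
  private
    module R = Ring≡ R
    open R using (_+_; _*_; -_; 0#; 1#; ι)
    open Solver R
    A = R.Carrier × R.Carrier

    _+₂_ _*₂_ : A → A → A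
    (a , b) +₂ (c , d) = a + c , b + d
    (a , b) *₂ (c , d) = a * c + u * (b * d) , a * d + b * c

    -₂_ : A → A
    -₂ (a , b) = - a , - b

    *₂-comm : ∀ x y → x *₂ y ≡ y *₂ x
    *₂-comm (a , b) (c , d) = cong₂ _,_
      (solve 5 (λ u a b c d → a ⊗ c ⊕ u ⊗ (b ⊗ d) ⊜ c ⊗ a ⊕ u ⊗ (d ⊗ b)) refl u a b c d)
      (solve 4 (λ a b c d → a ⊗ d ⊕ b ⊗ c ⊜ c ⊗ b ⊕ d ⊗ a) refl a b c d)

    *₂-identityˡ : ∀ x → (1# , 0#) *₂ x ≡ x
    *₂-identityˡ (a , b) = cong₂ _,_
      (solve 3 (λ u a b → Κ (+ 1) ⊗ a ⊕ u ⊗ (Κ (+ 0) ⊗ b) ⊜ a) refl u a b)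
      (solve 2 (λ a b → Κ (+ 1) ⊗ b ⊕ Κ (+ 0) ⊗ a ⊜ b) refl a b)

    *₂-distribˡ : ∀ x y z → x *₂ (y +₂ z) ≡ (x *₂ y) +₂ (x *₂ z)
    *₂-distribˡ (a , b) (c , d) (e , f) = cong₂ _,_
      (solve 7 (λ u a b c d e f → a ⊗ (c ⊕ e) ⊕ u ⊗ (b ⊗ (d ⊕ f)) ⊜ (a ⊗ c ⊕ u ⊗ (b ⊗ d)) ⊕ (a ⊗ e ⊕ u ⊗ (b ⊗ f)))
        refl u a b c d e f)
      (solve 6 (λ a b c d e f → a ⊗ (d ⊕ f) ⊕ b ⊗ (c ⊕ e) ⊜ (a ⊗ d ⊕ b ⊗ c) ⊕ (a ⊗ f ⊕ b ⊗ e)) refl a b c d e f)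

  ring : Ring≡
  ring = record
    { Carrier = A ; _+_ = _+₂_ ; _*_ = _*₂_ ; -_ = -₂_
    ; ι = λ n → ι n , 0#
    ; isCommutativeRing = record
      { isRing = record
        { +-isAbelianGroup = record
          { isGroup = record
            { isMonoid = record
              { isSemigroup = record
                { isMagma = record { isEquivalence = isEquivalence ; ∙-cong = cong₂ _+₂_ }
                ; assoc = λ _ _ _ → cong₂ _,_ (R.+-assoc _ _ _) (R.+-assoc _ _ _) }
              ; identity = (λ _ → cong₂ _,_ (R.+-identityˡ _) (R.+-identityˡ _))
                         , (λ _ → cong₂ _,_ (R.+-identityʳ _) (R.+-identityʳ _)) }
            ; inverse = (λ _ → cong₂ _,_ (R.-‿inverseˡ _) (R.-‿inverseˡ _))
                      , (λ _ → cong₂ _,_ (R.-‿inverseʳ _) (R.-‿inverseʳ _))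
            ; ⁻¹-cong = cong -₂_ }
          ; comm = λ _ _ → cong₂ _,_ (R.+-comm _ _) (R.+-comm _ _) }
        ; *-cong = cong₂ _*₂_
        ; *-assoc = λ where
            (a , b) (c , d) (e , f) → cong₂ _,_
              (solve 7 (λ u a b c d e f →
                 (a ⊗ c ⊕ u ⊗ (b ⊗ d)) ⊗ e ⊕ u ⊗ ((a ⊗ d ⊕ b ⊗ c) ⊗ f)
                   ⊜ a ⊗ (c ⊗ e ⊕ u ⊗ (d ⊗ f)) ⊕ u ⊗ (b ⊗ (c ⊗ f ⊕ d ⊗ e))) refl u a b c d e f)
              (solve 7 (λ u a b c d e f →
                 (a ⊗ c ⊕ u ⊗ (b ⊗ d)) ⊗ f ⊕ (a ⊗ d ⊕ b ⊗ c) ⊗ e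
                   ⊜ a ⊗ (c ⊗ f ⊕ d ⊗ e) ⊕ b ⊗ (c ⊗ e ⊕ u ⊗ (d ⊗ f))) refl u a b c d e f)
        ; *-identity = *₂-identityˡ , (λ x → trans (*₂-comm x _) (*₂-identityˡ x))
        ; distrib = *₂-distribˡ
                  , (λ x y z → trans (*₂-comm _ x) (trans (*₂-distribˡ x y z) (cong₂ _+₂_ (*₂-comm x y) (*₂-comm x z)))) }
      ; *-comm = *₂-comm }
    ; ι-+ = λ m n → cong₂ _,_ (R.ι-+ m n) (sym (R.+-identityˡ 0#))
    ; ι-* = λ m n → cong₂ _,_
        (trans (R.ι-* m n) (solve 3 (λ u x y → x ⊗ y ⊜ x ⊗ y ⊕ u ⊗ (Κ (+ 0) ⊗ Κ (+ 0))) refl u _ _))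
        (solve 2 (λ x y → Κ (+ 0) ⊜ x ⊗ Κ (+ 0) ⊕ Κ (+ 0) ⊗ y) refl _ _)
    ; ι-neg = λ n → cong₂ _,_ (R.ι-neg n) (solve 0 (Κ (+ 0) ⊜ ⊝ Κ (+ 0)) refl) }

  embed : R.Carrier → A
  embed a = a , 0#

  conj : A → A
  conj (a , b) = a , - b

  norm : A → R.Carrier
  norm (a , b) = a * a + - (u * (b * b))

  norm-* : ∀ x y → norm (x *₂ y) ≡ norm x * norm y
  norm-* (a , b) (c , d) = solve 5 (λ u a b c d →
    (a ⊗ c ⊕ u ⊗ (b ⊗ d)) ⊗ (a ⊗ c ⊕ u ⊗ (b ⊗ d)) ⊖ u ⊗ ((a ⊗ d ⊕ b ⊗ c) ⊗ (a ⊗ d ⊕ b ⊗ c))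
      ⊜ (a ⊗ a ⊖ u ⊗ (b ⊗ b)) ⊗ (c ⊗ c ⊖ u ⊗ (d ⊗ d))) refl u a b c d

  *-conj : ∀ x → x *₂ conj x ≡ embed (norm x)
  *-conj (a , b) = cong₂ _,_
    (solve 3 (λ u a b → a ⊗ a ⊕ u ⊗ (b ⊗ ⊝ b) ⊜ a ⊗ a ⊖ u ⊗ (b ⊗ b)) refl u a b)
    (solve 2 (λ a b → a ⊗ ⊝ b ⊕ b ⊗ a ⊜ Κ (+ 0)) refl a b)

record Hom (R S : Ring≡) : Set where
  no-eta-equality
  private
    module R = Ring≡ R
    module S = Ring≡ S
  field
    map : R.Carrier → S.Carrier
    map-+ : ∀ x y → map (x R.+ y) ≡ map x S.+ map y
    map-* : ∀ x y → map (x R.* y) ≡ map x S.* map y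
    map-neg : ∀ x → map (R.- x) ≡ S.- map x
    map-ι : ∀ n → map (R.ι n) ≡ S.ι n

module _ (R : Ring≡) (u : Ring≡.Carrier R) where
  open Ring≡ R
  open Solver R
  private module Q = Quadratic R u

  embed-hom : Hom R Q.ring
  embed-hom = record
    { map = Q.embed
    ; map-+ = λ x y → cong₂ _,_ refl (sym (+-identityˡ 0#))
    ; map-* = λ x y → cong₂ _,_
        (solve 3 (λ u x y → x ⊗ y ⊜ x ⊗ y ⊕ u ⊗ (Κ (+ 0) ⊗ Κ (+ 0))) refl u x y)
        (solve 2 (λ x y → Κ (+ 0) ⊜ x ⊗ Κ (+ 0) ⊕ Κ (+ 0) ⊗ y) refl x y)
    ; map-neg = λ x → cong₂ _,_ refl (solve 0 (Κ (+ 0) ⊜ ⊝ Κ (+ 0)) refl)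
    ; map-ι = λ n → refl }

  conj-hom : Hom Q.ring Q.ring
  conj-hom = record
    { map = Q.conj
    ; map-+ = λ where (a , b) (c , d) → cong₂ _,_ refl (solve 2 (λ b d → ⊝ (b ⊕ d) ⊜ ⊝ b ⊕ ⊝ d) refl b d)
    ; map-* = λ where
        (a , b) (c , d) → cong₂ _,_
          (solve 5 (λ u a b c d → a ⊗ c ⊕ u ⊗ (b ⊗ d) ⊜ a ⊗ c ⊕ u ⊗ (⊝ b ⊗ ⊝ d)) refl u a b c d)
          (solve 4 (λ a b c d → ⊝ (a ⊗ d ⊕ b ⊗ c) ⊜ a ⊗ ⊝ d ⊕ ⊝ b ⊗ c) refl a b c d)
    ; map-neg = λ _ → refl
    ; map-ι = λ n → cong (ι n ,_) (solve 0 (⊝ Κ (+ 0) ⊜ Κ (+ 0)) refl) }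

_∘ʰ_ : ∀ {R S T} → Hom S T → Hom R S → Hom R T
g ∘ʰ f = record
  { map = map g ∘ map f
  ; map-+ = λ x y → trans (cong (map g) (map-+ f x y)) (map-+ g _ _)
  ; map-* = λ x y → trans (cong (map g) (map-* f x y)) (map-* g _ _)
  ; map-neg = λ x → trans (cong (map g) (map-neg f x)) (map-neg g _)
  ; map-ι = λ n → trans (cong (map g) (map-ι f n)) (map-ι g n) }
  where open Hom

-- In the tower ℤ[i], ℤ[ζ₈], ℤ[ζ₁₆] every step adjoins a square root of the previous generator. The
-- constants `i²`, `ζ₈²` and `ζ₁₆²` are the squares -1, i and ζ₈ of the adjoined elements.
i² : ℤ
i² = ℤ.- ℤ.1ℤ

module ℤ[i] = Quadratic ℤ≡ i²

ζ₈² : ℤ × ℤ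
ζ₈² = ℤ.0ℤ , ℤ.1ℤ

module ℤ[ζ₈] = Quadratic ℤ[i].ring ζ₈²

ζ₁₆² : (ℤ × ℤ) × (ℤ × ℤ)
ζ₁₆² = (ℤ.0ℤ , ℤ.0ℤ) , (ℤ.1ℤ , ℤ.0ℤ)

module ℤ[ζ₁₆] = Quadratic ℤ[ζ₈].ring ζ₁₆²

-- Factorisation of circulant determinants

module Circulant (R : Ring≡) (ω : Ring≡.Carrier R) where
  open Ring≡ R
  open Solver R
  open Determinants R
  open import Algebra.Properties.CommutativeSemiring.Exp (CommutativeRing.commutativeSemiring bundle)
    using (_^_; ^-homo-*; ^-assocʳ; ^-distrib-*)
  import Algebra.Properties.CommutativeMonoid.Sum (CommutativeRing.+-commutativeMonoid bundle) as Sum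

  1^n≡1 : ∀ n → 1# ^ n ≡ 1#
  1^n≡1 zero = refl
  1^n≡1 (suc n) = trans (*-identityˡ _) (1^n≡1 n)

  ^-swap : ∀ x m n → (x ^ m) ^ n ≡ (x ^ n) ^ m
  ^-swap x m n = trans (^-assocʳ x m n) (trans (cong (x ^_) (ℕ.*-comm m n)) (sym (^-assocʳ x n m)))

  evaluate : (Fin 16 → ℤ) → Carrier → Carrier
  evaluate a x = sumᶠ 16 λ m → ι (a m) * x ^ toℕ m

  subMod16-involutive : ∀ i j → subMod16 i (subMod16 i j) ≡ j
  subMod16-involutive = toWitness {a? = all? λ i → all? λ j → subMod16 i (subMod16 i j) ≟ j} _

  subMod16-sum : ∀ i j → toℕ i ≡ toℕ j ℕ.+ toℕ (subMod16 i j) ⊎ toℕ i ℕ.+ 16 ≡ toℕ j ℕ.+ toℕ (subMod16 i j)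
  subMod16-sum = toWitness
    {a? = all? λ i → all? λ j → (toℕ i ℕ.≟ toℕ j ℕ.+ toℕ (subMod16 i j))
                          ⊎-dec (toℕ i ℕ.+ 16 ℕ.≟ toℕ j ℕ.+ toℕ (subMod16 i j))} _

  sumᶠ-subMod16 : ∀ i (f : Fin 16 → Carrier) → sumᶠ 16 (f ∘ subMod16 i) ≡ sumᶠ 16 f
  sumᶠ-subMod16 i f = sym (Sum.sum-permute f
    (permutation (subMod16 i) (subMod16 i) (subMod16-involutive i) (subMod16-involutive i)))

  geometric : Carrier → Carrier
  geometric x = sumᶠ 16 λ k → x ^ toℕ k

  private
    powerᴱ : ∀ {n} → Expr ℤ n → ℕ → Expr ℤ n
    powerᴱ x zero = Κ (+ 1)
    powerᴱ x (suc n) = x ⊗ powerᴱ x n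

    sumᴱ : ∀ {n} → ℕ → (ℕ → Expr ℤ n) → Expr ℤ n
    sumᴱ zero f = Κ (+ 0)
    sumᴱ (suc k) f = f zero ⊕ sumᴱ k (f ∘ suc)

  geometric-factor : ∀ x → geometric x ≡ (1# + x ^ 8) * ((1# + x ^ 4) * ((1# + x ^ 2) * (1# + x ^ 1)))
  geometric-factor = solve 1 (λ x → sumᴱ 16 (powerᴱ x)
    ⊜ (Κ (+ 1) ⊕ powerᴱ x 8) ⊗ ((Κ (+ 1) ⊕ powerᴱ x 4) ⊗ ((Κ (+ 1) ⊕ powerᴱ x 2) ⊗ (Κ (+ 1) ⊕ powerᴱ x 1)))) refl

  -- One factor 1 + x^(2^m) of the product is 0. The factorisation avoids dividing x¹⁶ - 1 by x - 1,
  -- which might be a zero divisor here.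
  geometric-zero : ∀ x (m : Fin 4) → x ^ (2 ℕ.^ toℕ m) ≡ - 1# → geometric x ≡ 0#
  geometric-zero x m eq = trans (geometric-factor x) (vanish m eq)
    where
    e₁ = 1# + x ^ 1
    e₂ = 1# + x ^ 2
    e₄ = 1# + x ^ 4
    e₈ = 1# + x ^ 8
    vanish : ∀ (m : Fin 4) → x ^ (2 ℕ.^ toℕ m) ≡ - 1# → e₈ * (e₄ * (e₂ * e₁)) ≡ 0#
    vanish zero eq = trans (cong (λ u → e₈ * (e₄ * (e₂ * (1# + u)))) eq)
      (solve 3 (λ a b c → a ⊗ (b ⊗ (c ⊗ (Κ (+ 1) ⊖ Κ (+ 1)))) ⊜ Κ (+ 0)) refl e₈ e₄ e₂)
    vanish (suc zero) eq = trans (cong (λ u → e₈ * (e₄ * ((1# + u) * e₁))) eq)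
      (solve 3 (λ a b c → a ⊗ (b ⊗ ((Κ (+ 1) ⊖ Κ (+ 1)) ⊗ c)) ⊜ Κ (+ 0)) refl e₈ e₄ e₁)
    vanish (suc (suc zero)) eq = trans (cong (λ u → e₈ * ((1# + u) * (e₂ * e₁))) eq)
      (solve 2 (λ a b → a ⊗ ((Κ (+ 1) ⊖ Κ (+ 1)) ⊗ b) ⊜ Κ (+ 0)) refl e₈ (e₂ * e₁))
    vanish (suc (suc (suc zero))) eq = trans (cong (λ u → (1# + u) * (e₄ * (e₂ * e₁))) eq)
      (solve 1 (λ a → (Κ (+ 1) ⊖ Κ (+ 1)) ⊗ a ⊜ Κ (+ 0)) refl (e₄ * (e₂ * e₁)))

  -1-odd-power : ∀ {x} k c → x ^ k ≡ - 1# → x ^ (k ℕ.* (1 ℕ.+ c ℕ.* 2)) ≡ - 1#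
  -1-odd-power {x} k c eq = trans (sym (^-assocʳ x k _)) (trans (cong (_^ (1 ℕ.+ c ℕ.* 2)) eq) (odd c))
    where
    odd : ∀ c → (- 1#) ^ (1 ℕ.+ c ℕ.* 2) ≡ - 1#
    odd zero = *-identityʳ _
    odd (suc c) = trans (cong (λ u → - 1# * (- 1# * u)) (odd c))
      (solve 0 (⊝ Κ (+ 1) ⊗ (⊝ Κ (+ 1) ⊗ ⊝ Κ (+ 1)) ⊜ ⊝ Κ (+ 1)) refl)

  module _ (ω⁸≡-1 : ω ^ 8 ≡ - 1#) (16-cancel : ∀ x → ι (+ 16) * x ≡ 0# → x ≡ 0#) where

    ω̄ : Carrier
    ω̄ = ω ^ 15

    ω¹⁶≡1 : ω ^ 16 ≡ 1#
    ω¹⁶≡1 = trans (^-homo-* ω 8 8) (trans (cong₂ _*_ ω⁸≡-1 ω⁸≡-1)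
      (solve 0 (⊝ Κ (+ 1) ⊗ ⊝ Κ (+ 1) ⊜ Κ (+ 1)) refl))

    ω̄⁸≡-1 : ω̄ ^ 8 ≡ - 1#
    ω̄⁸≡-1 = trans (^-assocʳ ω 15 8) (-1-odd-power 8 7 ω⁸≡-1)

    ω̄ω≡1 : ω̄ * ω ≡ 1#
    ω̄ω≡1 = trans (*-comm ω̄ ω) ω¹⁶≡1

    ω̄ω-cancel : ∀ n → ω̄ ^ n * ω ^ n ≡ 1#
    ω̄ω-cancel n = trans (sym (^-distrib-* ω̄ ω n)) (trans (cong (_^ n) ω̄ω≡1) (1^n≡1 n))

    ω̄-subMod16 : ∀ i j → ω̄ ^ toℕ i * ω ^ toℕ (subMod16 i j) ≡ ω̄ ^ toℕ j
    ω̄-subMod16 i j = trans (cong (_* ω ^ d) (split (subMod16-sum i j)))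
      (trans (*-assoc _ _ _) (trans (cong (ω̄ ^ toℕ j *_) (ω̄ω-cancel d)) (*-identityʳ _)))
      where
      d = toℕ (subMod16 i j)
      split : toℕ i ≡ toℕ j ℕ.+ d ⊎ toℕ i ℕ.+ 16 ≡ toℕ j ℕ.+ d → ω̄ ^ toℕ i ≡ ω̄ ^ toℕ j * ω̄ ^ d
      split (inj₁ eq) = trans (cong (ω̄ ^_) eq) (^-homo-* ω̄ (toℕ j) d)
      split (inj₂ eq) = trans (sym (*-identityʳ _)) (trans (cong (ω̄ ^ toℕ i *_) (sym ω̄¹⁶≡1))
        (trans (sym (^-homo-* ω̄ (toℕ i) 16)) (trans (cong (ω̄ ^_) eq) (^-homo-* ω̄ (toℕ j) d))))
        where
        ω̄¹⁶≡1 : ω̄ ^ 16 ≡ 1#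
        ω̄¹⁶≡1 = trans (^-assocʳ ω 15 16) (trans (cong (ω ^_) (ℕ.*-comm 15 16))
          (trans (sym (^-assocʳ ω 16 15)) (trans (cong (_^ 15) ω¹⁶≡1) (1^n≡1 15))))

    -- For 0 < d < 16 some d · 2^m with m < 4 is an odd multiple of 8, and ω̄ raised to an odd
    -- multiple of 8 is -1.
    geometric-ω̄ : ∀ d → d ≢ zero → geometric (ω̄ ^ toℕ d) ≡ 0#
    geometric-ω̄ d d≢0 = vanish (dyadic d d≢0)
      where
      Dyadic : Fin 16 → Set
      Dyadic d = ∃ λ (m : Fin 4) → ∃ λ (c : Fin 8) → toℕ d ℕ.* 2 ℕ.^ toℕ m ≡ 8 ℕ.* (1 ℕ.+ toℕ c ℕ.* 2)
      dyadic : ∀ d → d ≢ zero → Dyadic d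
      dyadic = toWitness {a? = all? λ d → ¬? (d ≟ zero) →-dec
        any? λ (m : Fin 4) → any? λ (c : Fin 8) → toℕ d ℕ.* 2 ℕ.^ toℕ m ℕ.≟ 8 ℕ.* (1 ℕ.+ toℕ c ℕ.* 2)} _
      vanish : Dyadic d → geometric (ω̄ ^ toℕ d) ≡ 0#
      vanish (m , c , eq) = geometric-zero (ω̄ ^ toℕ d) m
        (trans (^-assocʳ ω̄ (toℕ d) _) (trans (cong (ω̄ ^_) eq) (-1-odd-power 8 (toℕ c) ω̄⁸≡-1)))

    -- The discrete Fourier matrix and its inverse up to the factor 16. Column k of `F` is an
    -- eigenvector of every circulant, with eigenvalue f(ω^k).
    F G : Fin 16 → Fin 16 → Carrier
    F i k = (ω̄ ^ toℕ i) ^ toℕ k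
    G k l = (ω ^ toℕ l) ^ toℕ k

    FG≡16δ : ∀ i l → sumᶠ 16 (λ k → F i k * G k l) ≡ ι (+ 16) * δ i l
    FG≡16δ i l = trans
      (sumᶠ-cong 16 {f = λ k → F i k * G k l} {g = λ k → (ω̄ ^ toℕ (subMod16 i l)) ^ toℕ k} λ k →
        trans (sym (^-distrib-* (ω̄ ^ toℕ i) (ω ^ toℕ l) (toℕ k))) (cong (_^ toℕ k) quotient))
      (diagonal (i ≟ l))
      where
      quotient : ω̄ ^ toℕ i * ω ^ toℕ l ≡ ω̄ ^ toℕ (subMod16 i l)
      quotient = trans (cong (λ m → ω̄ ^ toℕ i * ω ^ toℕ m) (sym (subMod16-involutive i l))) (ω̄-subMod16 i (subMod16 i l))
      sub-zero : ∀ i l → subMod16 i l ≡ zero → i ≡ l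
      sub-zero = toWitness {a? = all? λ i → all? λ l → (subMod16 i l ≟ zero) →-dec (i ≟ l)} _
      sub-self : ∀ i → subMod16 i i ≡ zero
      sub-self = toWitness {a? = all? λ i → subMod16 i i ≟ zero} _
      diagonal : Dec (i ≡ l) → geometric (ω̄ ^ toℕ (subMod16 i l)) ≡ ι (+ 16) * δ i l
      diagonal (yes refl) = trans (cong (λ d → geometric (ω̄ ^ toℕ d)) (sub-self i))
        (trans (solve 0 (sumᴱ 16 (powerᴱ (Κ (+ 1))) ⊜ Κ (+ 16) ⊗ Κ (+ 1)) refl) (cong (ι (+ 16) *_) (sym (δ-≡ i))))
      diagonal (no i≢l) = trans (geometric-ω̄ (subMod16 i l) (i≢l ∘ sub-zero i l))
        (trans (sym (zeroʳ _)) (cong (ι (+ 16) *_) (sym (δ-≢ i l i≢l))))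

    CF≡FΛ : ∀ a i k → sumᶠ 16 (λ j → ι (circulant16 a i j) * F j k) ≡ evaluate a (ω ^ toℕ k) * F i k
    CF≡FΛ a i k = trans
      (sumᶠ-cong 16 {f = λ j → ι (a (subMod16 i j)) * F j k} {g = term ∘ subMod16 i} λ j →
        trans (cong (ι (a (subMod16 i j)) *_) (shift j)) (sym (*-assoc _ _ _)))
      (trans (sumᶠ-subMod16 i term) (sumᶠ-*ʳ 16 (λ m → ι (a m) * (ω ^ toℕ k) ^ toℕ m) (F i k)))
      where
      term : Fin 16 → Carrier
      term m = ι (a m) * (ω ^ toℕ k) ^ toℕ m * F i k
      shift : ∀ j → F j k ≡ (ω ^ toℕ k) ^ toℕ (subMod16 i j) * F i k
      shift j = trans (cong (_^ toℕ k) (sym (ω̄-subMod16 i j))) (trans (^-distrib-* _ _ (toℕ k))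
        (trans (*-comm _ _) (cong (_* F i k) (^-swap ω (toℕ (subMod16 i j)) (toℕ k)))))

    D-product : ∀ a → ι (D a) ≡ productᵣ (Vec.tabulate {n = 16} λ k → evaluate a (ω ^ toℕ k))
    D-product a = trans (sym (rowDet-ι 16 (circulant16 a)))
      (rowDet-diagonalised 16 (λ i j → ι (circulant16 a i j)) F G (λ k → evaluate a (ω ^ toℕ k)) (ι (+ 16))
        (CF≡FΛ a) FG≡16δ 16-cancel)

-- Grouping the sixteenth roots of unity by their fourth powers

coeff : (Fin 16 → ℤ) → Fin 4 → Fin 4 → ℤ
-- `Fin.combine j r` is 4j + r: here r is the exponent modulo 4, and j is the power of z = x⁴.
coeff a j r = a (Fin.combine j r)

module _ (R : Ring≡) where
  open Ring≡ R

  opaque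
    -- The four sections of f = Σ aₘxᵐ, as polynomials in z = x⁴.
    section : (Fin 16 → ℤ) → Fin 4 → Carrier → Carrier
    section a r z =
      ι (coeff a (# 0) r) + z * (ι (coeff a (# 1) r) +
        z * (ι (coeff a (# 2) r) + z * ι (coeff a (# 3) r)))

    -- The product of f over the four x with x⁴ = z, in terms of the sections p + x²q + x(s + x²t) of f.
    quartic : Carrier → Carrier → Carrier → Carrier → Carrier → Carrier
    quartic z p q s t =
      (p * p + z * (q * q) - ι (+ 2) * (z * (s * t))) * (p * p + z * (q * q) - ι (+ 2) * (z * (s * t)))
        - z * ((ι (+ 2) * (p * q) - s * s - z * (t * t)) * (ι (+ 2) * (p * q) - s * s - z * (t * t)))

  fourfold : (Fin 16 → ℤ) → Carrier → Carrier
  fourfold a z = quartic z (section a (# 0) z) (section a (# 2) z) (section a (# 1) z) (section a (# 3) z)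

module CirculantFactors (R : Ring≡) (ω : Ring≡.Carrier R) where
  open Ring≡ R
  open Solver R
  open Circulant R ω
  open Determinants R using (productᵣ; sumᶠ; sumᶠ-cong)
  open import Algebra.Properties.CommutativeSemiring.Exp (CommutativeRing.commutativeSemiring bundle)
    using (_^_; ^-homo-*; ^-assocʳ)

  opaque
    unfolding section

    evaluate-section : ∀ a x → let z = x ^ 4 in
      evaluate a x ≡ (section R a (# 0) z + x ^ 2 * section R a (# 2) z)
                   + x * (section R a (# 1) z + x ^ 2 * section R a (# 3) z)
    evaluate-section a x = solve 17
        (λ x b₀ b₁ b₂ b₃ b₄ b₅ b₆ b₇ b₈ b₉ b₁₀ b₁₁ b₁₂ b₁₃ b₁₄ b₁₅ → let z = x ^ᴱ 4 in
          b₀ ⊗ (x ^ᴱ 0) ⊕ (b₁ ⊗ (x ^ᴱ 1) ⊕ (b₂ ⊗ (x ^ᴱ 2) ⊕ (b₃ ⊗ (x ^ᴱ 3) ⊕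
            (b₄ ⊗ (x ^ᴱ 4) ⊕ (b₅ ⊗ (x ^ᴱ 5) ⊕ (b₆ ⊗ (x ^ᴱ 6) ⊕ (b₇ ⊗ (x ^ᴱ 7) ⊕
            (b₈ ⊗ (x ^ᴱ 8) ⊕ (b₉ ⊗ (x ^ᴱ 9) ⊕ (b₁₀ ⊗ (x ^ᴱ 10) ⊕ (b₁₁ ⊗ (x ^ᴱ 11) ⊕
            (b₁₂ ⊗ (x ^ᴱ 12) ⊕ (b₁₃ ⊗ (x ^ᴱ 13) ⊕ (b₁₄ ⊗ (x ^ᴱ 14) ⊕ (b₁₅ ⊗ (x ^ᴱ 15) ⊕ Κ (+ 0))))))))))))))))
          ⊜ (S z b₀ b₄ b₈ b₁₂ ⊕ (x ^ᴱ 2) ⊗ S z b₂ b₆ b₁₀ b₁₄)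
            ⊕ x ⊗ (S z b₁ b₅ b₉ b₁₃ ⊕ (x ^ᴱ 2) ⊗ S z b₃ b₇ b₁₁ b₁₅))
        refl x (ι (a (# 0))) (ι (a (# 1))) (ι (a (# 2))) (ι (a (# 3))) (ι (a (# 4))) (ι (a (# 5))) (ι (a (# 6))) (ι (a (# 7)))
          (ι (a (# 8))) (ι (a (# 9))) (ι (a (# 10))) (ι (a (# 11))) (ι (a (# 12))) (ι (a (# 13))) (ι (a (# 14))) (ι (a (# 15)))
      where
      S : ∀ {n} → Expr ℤ n → Expr ℤ n → Expr ℤ n → Expr ℤ n → Expr ℤ n → Expr ℤ n
      S z a b c d = a ⊕ z ⊗ (b ⊕ z ⊗ (c ⊕ z ⊗ d))
      _^ᴱ_ : ∀ {n} → Expr ℤ n → ℕ → Expr ℤ n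
      x ^ᴱ zero = Κ (+ 1)
      x ^ᴱ suc n = x ⊗ (x ^ᴱ n)

  opaque
    unfolding quartic

    -- The product f(x)f(-x) is a polynomial in y = x². The second factor is the same polynomial at
    -- -y, so that the product depends on y² = x⁴ only.
    quartic-pairs : ∀ p q s t x →
      ((p + x ^ 2 * q) * (p + x ^ 2 * q) - x ^ 2 * ((s + x ^ 2 * t) * (s + x ^ 2 * t))) *
      ((p + (- (x ^ 2)) * q) * (p + (- (x ^ 2)) * q) - (- (x ^ 2)) * ((s + (- (x ^ 2)) * t) * (s + (- (x ^ 2)) * t)))
        ≡ quartic R (x ^ 4) p q s t
    quartic-pairs p q s t x = solve 5 (λ p q s t x →
      let y = x ⊗ (x ⊗ Κ (+ 1)) ; z = x ⊗ (x ⊗ (x ⊗ (x ⊗ Κ (+ 1))))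
          e = p ⊗ p ⊕ z ⊗ (q ⊗ q) ⊖ Κ (+ 2) ⊗ (z ⊗ (s ⊗ t))
          o = Κ (+ 2) ⊗ (p ⊗ q) ⊖ s ⊗ s ⊖ z ⊗ (t ⊗ t) in
      ((p ⊕ y ⊗ q) ⊗ (p ⊕ y ⊗ q) ⊖ y ⊗ ((s ⊕ y ⊗ t) ⊗ (s ⊕ y ⊗ t))) ⊗
      ((p ⊕ (⊝ y) ⊗ q) ⊗ (p ⊕ (⊝ y) ⊗ q) ⊖ (⊝ y) ⊗ ((s ⊕ (⊝ y) ⊗ t) ⊗ (s ⊕ (⊝ y) ⊗ t)))
        ⊜ e ⊗ e ⊖ z ⊗ (o ⊗ o)) refl p q s t x

  -- x, -x, Ix and -Ix are the fourth roots of x⁴.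
  fourfold-product : ∀ a x I → I * I ≡ - 1# →
    (evaluate a x * evaluate a (- x)) * (evaluate a (I * x) * evaluate a (- (I * x))) ≡ fourfold R a (x ^ 4)
  fourfold-product a x I I²≡-1 = trans
    (cong₂ _*_ (cong₂ _*_ (at x refl refl) (at (- x) (neg² x) (neg⁴ x)))
               (cong₂ _*_ (at (I * x) Ix² Ix⁴) (at (- (I * x)) (trans (neg² (I * x)) Ix²) (trans (neg⁴ (I * x)) Ix⁴))))
    (trans (cong₂ _*_ (pair x p q s t y refl) (pair (I * x) p q s t (- y) Ix²)) (quartic-pairs p q s t x))
    where
    y = x ^ 2
    z = x ^ 4
    p = section R a (# 0) z
    q = section R a (# 2) z
    s = section R a (# 1) z
    t = section R a (# 3) z
    at : ∀ w {y z} → w ^ 2 ≡ y → w ^ 4 ≡ z → evaluate a w ≡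
      (section R a (# 0) z + y * section R a (# 2) z) + w * (section R a (# 1) z + y * section R a (# 3) z)
    at w refl refl = evaluate-section a w
    neg² : ∀ w → (- w) ^ 2 ≡ w ^ 2
    neg² = solve 1 (λ w → ⊝ w ⊗ (⊝ w ⊗ Κ (+ 1)) ⊜ w ⊗ (w ⊗ Κ (+ 1))) refl
    neg⁴ : ∀ w → (- w) ^ 4 ≡ w ^ 4
    neg⁴ = solve 1 (λ w → ⊝ w ⊗ (⊝ w ⊗ (⊝ w ⊗ (⊝ w ⊗ Κ (+ 1)))) ⊜ w ⊗ (w ⊗ (w ⊗ (w ⊗ Κ (+ 1))))) refl
    Ix² : (I * x) ^ 2 ≡ - y
    Ix² = trans (solve 2 (λ i x → i ⊗ x ⊗ (i ⊗ x ⊗ Κ (+ 1)) ⊜ (i ⊗ i) ⊗ (x ⊗ (x ⊗ Κ (+ 1)))) refl I x)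
      (trans (cong (_* y) I²≡-1) (solve 1 (λ y → ⊝ Κ (+ 1) ⊗ y ⊜ ⊝ y) refl y))
    Ix⁴ : (I * x) ^ 4 ≡ z
    Ix⁴ = trans (solve 2 (λ i x → let w = i ⊗ x in w ⊗ (w ⊗ (w ⊗ (w ⊗ Κ (+ 1))))
        ⊜ (i ⊗ i) ⊗ (i ⊗ i) ⊗ (x ⊗ (x ⊗ (x ⊗ (x ⊗ Κ (+ 1)))))) refl I x)
      (trans (cong (λ j → j * j * z) I²≡-1) (solve 1 (λ z → ⊝ Κ (+ 1) ⊗ ⊝ Κ (+ 1) ⊗ z ⊜ z) refl z))
    pair : ∀ w p q s t y → w * (w * 1#) ≡ y →
      ((p + y * q) + w * (s + y * t)) * ((p + y * q) + (- w) * (s + y * t))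
        ≡ (p + y * q) * (p + y * q) - y * ((s + y * t) * (s + y * t))
    pair w p q s t y refl = solve 5 (λ w p q s t → let y = w ⊗ (w ⊗ Κ (+ 1)) in
      ((p ⊕ y ⊗ q) ⊕ w ⊗ (s ⊕ y ⊗ t)) ⊗ ((p ⊕ y ⊗ q) ⊕ (⊝ w) ⊗ (s ⊕ y ⊗ t))
        ⊜ (p ⊕ y ⊗ q) ⊗ (p ⊕ y ⊗ q) ⊖ y ⊗ ((s ⊕ y ⊗ t) ⊗ (s ⊕ y ⊗ t))) refl w p q s t
  -- The roots ω^k, ω^(k+4), ω^(k+8), ω^(k+12) are the fourth roots of I^k, so the sixteen factors
  -- fall into four groups with z = 1, I, -1, -I.
  D-fourfold : ω ^ 8 ≡ - 1# → (∀ x → ι (+ 16) * x ≡ 0# → x ≡ 0#) → ∀ a → let I = ω ^ 4 in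
    ι (D a) ≡ (fourfold R a 1# * fourfold R a (- 1#)) * (fourfold R a I * fourfold R a (- I))
  D-fourfold ω⁸≡-1 16-cancel a = trans (D-product ω⁸≡-1 16-cancel a)
    (trans (regroup (λ k → evaluate a (ω ^ toℕ k)))
      (cong₂ _*_ (cong₂ _*_ (group 0 (1^n≡1 4)) (group 2 ω²⁴)) (cong₂ _*_ (group 1 (cong (_^ 4) (*-identityʳ ω))) (group 3 ω³⁴))))
    where
    I = ω ^ 4
    I²≡-1 : I * I ≡ - 1#
    I²≡-1 = trans (sym (^-homo-* ω 4 4)) ω⁸≡-1
    ω²⁴ : (ω ^ 2) ^ 4 ≡ - 1#
    ω²⁴ = trans (^-assocʳ ω 2 4) ω⁸≡-1
    ω³⁴ : (ω ^ 3) ^ 4 ≡ - I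
    ω³⁴ = trans (^-assocʳ ω 3 4) (trans (^-homo-* ω 8 4)
      (trans (cong (_* I) ω⁸≡-1) (solve 1 (λ i → ⊝ Κ (+ 1) ⊗ i ⊜ ⊝ i) refl I)))
    ω^[k+8] : ∀ k → ω ^ (8 ℕ.+ k) ≡ - (ω ^ k)
    ω^[k+8] k = trans (^-homo-* ω 8 k) (trans (cong (_* ω ^ k) ω⁸≡-1) (solve 1 (λ i → ⊝ Κ (+ 1) ⊗ i ⊜ ⊝ i) refl (ω ^ k)))
    group : ∀ k {z} → (ω ^ k) ^ 4 ≡ z →
      (evaluate a (ω ^ k) * evaluate a (ω ^ (8 ℕ.+ k))) * (evaluate a (ω ^ (4 ℕ.+ k)) * evaluate a (ω ^ (12 ℕ.+ k)))
        ≡ fourfold R a z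
    group k refl = trans
      (cong₂ _*_ (cong (λ w → evaluate a (ω ^ k) * evaluate a w) (ω^[k+8] k))
        (cong₂ (λ v w → evaluate a v * evaluate a w) (^-homo-* ω 4 k)
          (trans (ω^[k+8] (4 ℕ.+ k)) (cong -_ (^-homo-* ω 4 k)))))
      (fourfold-product a (ω ^ k) I I²≡-1)
    regroup : ∀ (e : Fin 16 → Carrier) → productᵣ (Vec.tabulate e) ≡
      (((e (# 0) * e (# 8)) * (e (# 4) * e (# 12))) * ((e (# 2) * e (# 10)) * (e (# 6) * e (# 14)))) *
      (((e (# 1) * e (# 9)) * (e (# 5) * e (# 13))) * ((e (# 3) * e (# 11)) * (e (# 7) * e (# 15))))
    regroup e = solve 16
      (λ e₀ e₁ e₂ e₃ e₄ e₅ e₆ e₇ e₈ e₉ e₁₀ e₁₁ e₁₂ e₁₃ e₁₄ e₁₅ →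
        e₀ ⊗ (e₁ ⊗ (e₂ ⊗ (e₃ ⊗ (e₄ ⊗ (e₅ ⊗ (e₆ ⊗ (e₇ ⊗ (e₈ ⊗ (e₉ ⊗ (e₁₀ ⊗ (e₁₁ ⊗ (e₁₂ ⊗ (e₁₃ ⊗ (e₁₄ ⊗ (e₁₅ ⊗ Κ (+ 1))))))))))))))))
        ⊜ (((e₀ ⊗ e₈) ⊗ (e₄ ⊗ e₁₂)) ⊗ ((e₂ ⊗ e₁₀) ⊗ (e₆ ⊗ e₁₄))) ⊗
          (((e₁ ⊗ e₉) ⊗ (e₅ ⊗ e₁₃)) ⊗ ((e₃ ⊗ e₁₁) ⊗ (e₇ ⊗ e₁₅))))
      refl (e (# 0)) (e (# 1)) (e (# 2)) (e (# 3)) (e (# 4)) (e (# 5)) (e (# 6)) (e (# 7))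
        (e (# 8)) (e (# 9)) (e (# 10)) (e (# 11)) (e (# 12)) (e (# 13)) (e (# 14)) (e (# 15))

ι-hom : ∀ R → Hom ℤ≡ R
ι-hom R = record { map = ι ; map-+ = ι-+ ; map-* = ι-* ; map-neg = ι-neg ; map-ι = λ _ → refl }
  where open Ring≡ R

module _ {R S : Ring≡} (φ : Hom R S) where
  private
    module R = Ring≡ R
    module S = Ring≡ S
  open Hom φ

  opaque
    unfolding section quartic

    map-section : ∀ a r z → map (section R a r z) ≡ section S a r (map z)
    map-section a r z = horner (coeff a (# 0) r) (horner (coeff a (# 1) r) (horner (coeff a (# 2) r) (map-ι (coeff a (# 3) r))))
      where
      horner : ∀ {x y} n → map x ≡ y → map (R.ι n R.+ z R.* x) ≡ S.ι n S.+ map z S.* y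
      horner n refl = trans (map-+ _ _) (cong₂ S._+_ (map-ι n) (map-* _ _))

    map-quartic : ∀ z p q s t → map (quartic R z p q s t) ≡ quartic S (map z) (map p) (map q) (map s) (map t)
    map-quartic z p q s t =
      trans (map-minus _ _) (cong₂ S._-_ (map-square even) (trans (map-* _ _) (cong (map z S.*_) (map-square odd))))
      where
      map-minus : ∀ x y → map (x R.- y) ≡ map x S.- map y
      map-minus x y = trans (map-+ _ _) (cong (λ v → map x S.+ v) (map-neg y))
      map-square : ∀ {x y} → map x ≡ y → map (x R.* x) ≡ y S.* y
      map-square refl = map-* _ _
      map-double : ∀ x → map (R.ι (+ 2) R.* x) ≡ S.ι (+ 2) S.* map x
      map-double x = trans (map-* _ _) (cong (S._* map x) (map-ι (+ 2)))
      even : map (p R.* p R.+ z R.* (q R.* q) R.- R.ι (+ 2) R.* (z R.* (s R.* t)))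
        ≡ map p S.* map p S.+ map z S.* (map q S.* map q) S.- S.ι (+ 2) S.* (map z S.* (map s S.* map t))
      even = trans (map-minus _ _) (cong₂ S._-_
        (trans (map-+ _ _) (cong₂ S._+_ (map-* _ _) (trans (map-* _ _) (cong (map z S.*_) (map-* _ _)))))
        (trans (map-double _) (cong (S.ι (+ 2) S.*_) (trans (map-* _ _) (cong (map z S.*_) (map-* _ _))))))
      odd : map (R.ι (+ 2) R.* (p R.* q) R.- s R.* s R.- z R.* (t R.* t))
        ≡ S.ι (+ 2) S.* (map p S.* map q) S.- map s S.* map s S.- map z S.* (map t S.* map t)
      odd = trans (map-minus _ _) (cong₂ S._-_
        (trans (map-minus _ _) (cong₂ S._-_ (trans (map-double _) (cong (S.ι (+ 2) S.*_) (map-* _ _))) (map-* _ _)))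
        (trans (map-* _ _) (cong (map z S.*_) (map-* _ _))))

  map-fourfold : ∀ a z → map (fourfold R a z) ≡ fourfold S a (map z)
  map-fourfold a z = trans (map-quartic z _ _ _ _)
    (trans (cong₂ (λ p q → quartic S (map z) p q (map (section R a (# 1) z)) (map (section R a (# 3) z)))
             (map-section a (# 0) z) (map-section a (# 2) z))
           (cong₂ (quartic S (map z) (section S a (# 0) (map z)) (section S a (# 2) (map z)))
             (map-section a (# 1) z) (map-section a (# 3) z)))

Cancellative : ℤ → Ring≡ → Set
Cancellative n R = ∀ x → ι n * x ≡ 0# → x ≡ 0#
  where open Ring≡ R

quadratic-cancel : ∀ n R u → Cancellative n R → Cancellative n (Quadratic.ring R u)
quadratic-cancel n R u cancel (a , b) eq = cong₂ _,_
  (cancel a (trans (solve 4 (λ n u a b → n ⊗ a ⊜ n ⊗ a ⊕ u ⊗ (Κ (+ 0) ⊗ b)) refl _ u a b) (cong proj₁ eq)))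
  (cancel b (trans (solve 3 (λ n a b → n ⊗ b ⊜ n ⊗ b ⊕ Κ (+ 0) ⊗ a) refl _ a b) (cong proj₂ eq)))
  where open Solver R

module NormFormula (A G : Ring≡) (φ : Hom G A) (conj : Hom G G)
  (ω : Ring≡.Carrier A) (i : Ring≡.Carrier G) (N : Ring≡.Carrier G → ℤ)
  (ω⁴≡φi : Ring≡._*_ A (Ring≡._*_ A ω ω) (Ring≡._*_ A ω ω) ≡ Hom.map φ i)
  (i²≡-1 : Ring≡._*_ G i i ≡ Ring≡.ι G (ℤ.- (+ 1)))
  (conj-i : Hom.map conj i ≡ Ring≡.-_ G i)
  (N-conj : ∀ x → Ring≡._*_ G x (Hom.map conj x) ≡ Ring≡.ι G (N x))
  (cancel : Cancellative (+ 16) A) where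
  private module G = Ring≡ G
  open Ring≡ A
  open Solver A using (solve; _⊜_; _⊗_; Κ)
  open import Algebra.Properties.CommutativeSemiring.Exp (CommutativeRing.commutativeSemiring bundle) using (_^_; ^-homo-*)

  -- The groups at z = 1 and z = -1 are already integers. Those at z = i and z = -i are conjugate
  -- Gaussian integers, whose product is a norm; no automorphism of the large ring is required.
  ι-D-norms : ∀ a → ι (D a) ≡ ι (fourfold ℤ≡ a (+ 1) ℤ.* fourfold ℤ≡ a (ℤ.- (+ 1)) ℤ.* N (fourfold G a i))
  ι-D-norms a = trans (CirculantFactors.D-fourfold A ω ω⁸≡-1 cancel a)
    (product (fourfold ℤ≡ a (+ 1)) (fourfold ℤ≡ a (ℤ.- (+ 1))) (N (fourfold G a i))
      (real (+ 1) refl) (real (ℤ.- (+ 1)) (ι-neg (+ 1))) imaginary)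
    where
    open ≡-Reasoning
    φi : Hom.map φ i ≡ ω ^ 4
    φi = trans (sym ω⁴≡φi) (solve 1 (λ x → x ⊗ x ⊗ (x ⊗ x) ⊜ x ⊗ (x ⊗ (x ⊗ (x ⊗ Κ (+ 1))))) refl ω)
    ω⁸≡-1 : ω ^ 8 ≡ - 1#
    ω⁸≡-1 = trans (^-homo-* ω 4 4) (trans (cong₂ _*_ (sym φi) (sym φi))
      (trans (sym (Hom.map-* φ i i)) (trans (cong (Hom.map φ) i²≡-1) (trans (Hom.map-ι φ (ℤ.- (+ 1))) (ι-neg (+ 1))))))
    real : ∀ n {z} → ι n ≡ z → fourfold A a z ≡ ι (fourfold ℤ≡ a n)
    real n refl = sym (map-fourfold (ι-hom A) a n)
    product : ∀ x y n {X Y Z} → X ≡ ι x → Y ≡ ι y → Z ≡ ι n → (X * Y) * Z ≡ ι (x ℤ.* y ℤ.* n)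
    product x y n refl refl refl = trans (cong (_* ι n) (sym (ι-* x y))) (sym (ι-* (x ℤ.* y) n))
    imaginary : fourfold A a (ω ^ 4) * fourfold A a (- (ω ^ 4)) ≡ ι (N (fourfold G a i))
    imaginary = begin
      fourfold A a (ω ^ 4) * fourfold A a (- (ω ^ 4))
        ≡⟨ cong₂ (λ u v → fourfold A a u * fourfold A a v) φi
             (trans (cong (Hom.map φ) conj-i) (trans (Hom.map-neg φ i) (cong -_ φi))) ⟨
      fourfold A a (Hom.map φ i) * fourfold A a (Hom.map φ (Hom.map conj i))
        ≡⟨ cong₂ _*_ (map-fourfold φ a i) (map-fourfold (φ ∘ʰ conj) a i) ⟨
      Hom.map φ (fourfold G a i) * Hom.map φ (Hom.map conj (fourfold G a i))
        ≡⟨ Hom.map-* φ _ _ ⟨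
      Hom.map φ (fourfold G a i G.* Hom.map conj (fourfold G a i))
        ≡⟨ cong (Hom.map φ) (N-conj (fourfold G a i)) ⟩
      Hom.map φ (G.ι (N (fourfold G a i)))
        ≡⟨ Hom.map-ι φ _ ⟩
      ι (N (fourfold G a i)) ∎

private
  ω : ((ℤ × ℤ) × (ℤ × ℤ)) × ((ℤ × ℤ) × (ℤ × ℤ))
  ω = ((+ 0 , + 0) , (+ 0 , + 0)) , ((+ 1 , + 0) , (+ 0 , + 0))

  φ : Hom ℤ[i].ring ℤ[ζ₁₆].ring
  φ = embed-hom ℤ[ζ₈].ring ζ₁₆² ∘ʰ embed-hom ℤ[i].ring ζ₈²

  ω⁴≡φi : let open Ring≡ ℤ[ζ₁₆].ring in (ω * ω) * (ω * ω) ≡ Hom.map φ (+ 0 , + 1)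
  ω⁴≡φi = refl

  16-cancellative : Cancellative (+ 16) ℤ[ζ₁₆].ring
  16-cancellative = quadratic-cancel (+ 16) ℤ[ζ₈].ring ζ₁₆² (quadratic-cancel (+ 16) ℤ[i].ring ζ₈²
    (quadratic-cancel (+ 16) ℤ≡ i² λ x → ℤ.*-cancelˡ-≡ (+ 16) x (+ 0)))

  ι-injective : ∀ m n → Ring≡.ι ℤ[ζ₁₆].ring m ≡ Ring≡.ι ℤ[ζ₁₆].ring n → m ≡ n
  ι-injective m n eq = cong (λ x → proj₁ (proj₁ (proj₁ x))) eq

  open NormFormula ℤ[ζ₁₆].ring ℤ[i].ring φ (conj-hom ℤ≡ i²) ω (+ 0 , + 1) ℤ[i].norm
    ω⁴≡φi refl refl ℤ[i].*-conj 16-cancellative using (ι-D-norms)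

norms : (Fin 16 → ℤ) → ℤ
norms a = fourfold ℤ≡ a (+ 1) ℤ.* fourfold ℤ≡ a (ℤ.- (+ 1)) ℤ.* ℤ[i].norm (fourfold ℤ[i].ring a (+ 0 , + 1))

D-norms : ∀ a → D a ≡ norms a
D-norms a = ι-injective (D a) (norms a) (ι-D-norms a)

-- Integer formulas for the factors

module _ where
  open import Data.Integer using (_+_; _*_; _-_; -_)

  sq : ℤ → ℤ
  sq x = x * x

  opaque
    -- The product of f(x) over x⁴ = 1, from the values p, q, s, t of the sections at 1.
    value₁ : (p q s t : ℤ) → ℤ
    value₁ p q s t = (sq (p + q) - sq (s + t)) * (sq (p - q) + sq (s - t))

    -- f(x)f(-x) at x² = i, from the values of the sections at -1.
    re₋₁ im₋₁ : (p q s t : ℤ) → ℤ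
    re₋₁ p q s t = sq p - sq q + + 2 * (s * t)
    im₋₁ p q s t = + 2 * (p * q) - sq s + sq t

    -- The product of f(x) over x⁴ = i, from the values p + ip′, q + iq′, s + is′, t + it′ of the sections at i.
    reₑ imₑ reₒ imₒ reᵢ imᵢ : (p p′ q q′ s s′ t t′ : ℤ) → ℤ
    reₑ p p′ q q′ s s′ t t′ = sq p - sq p′ - + 2 * (q * q′) + + 2 * (s * t′ + s′ * t)
    imₑ p p′ q q′ s s′ t t′ = + 2 * (p * p′) + sq q - sq q′ - + 2 * (s * t - s′ * t′)
    reₒ p p′ q q′ s s′ t t′ = + 2 * (p * q - p′ * q′) - sq s + sq s′ + + 2 * (t * t′)
    imₒ p p′ q q′ s s′ t t′ = + 2 * (p * q′ + p′ * q) - + 2 * (s * s′) - sq t + sq t′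
    reᵢ p p′ q q′ s s′ t t′ = sq (reₑ p p′ q q′ s s′ t t′) - sq (imₑ p p′ q q′ s s′ t t′)
      + + 2 * (reₒ p p′ q q′ s s′ t t′ * imₒ p p′ q q′ s s′ t t′)
    imᵢ p p′ q q′ s s′ t t′ = + 2 * (reₑ p p′ q q′ s s′ t t′ * imₑ p p′ q q′ s s′ t t′)
      - sq (reₒ p p′ q q′ s s′ t t′) + sq (imₒ p p′ q q′ s s′ t t′)

  at₁ at₋₁ atᵢ atᵢ′ : (Fin 16 → ℤ) → Fin 4 → ℤ
  at₁ a r = coeff a (# 0) r + coeff a (# 1) r + coeff a (# 2) r + coeff a (# 3) r
  at₋₁ a r = coeff a (# 0) r - coeff a (# 1) r + coeff a (# 2) r - coeff a (# 3) r
  atᵢ a r = coeff a (# 0) r - coeff a (# 2) r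
  atᵢ′ a r = coeff a (# 1) r - coeff a (# 3) r

  onSections : {B : Set} → (Fin 4 → ℤ) → (ℤ → ℤ → ℤ → ℤ → B) → B
  onSections v f = f (v (# 0)) (v (# 2)) (v (# 1)) (v (# 3))

  onSections₂ : {B : Set} → (Fin 4 → ℤ) → (Fin 4 → ℤ) → (ℤ → ℤ → ℤ → ℤ → ℤ → ℤ → ℤ → ℤ → B) → B
  onSections₂ v v′ f =
    f (v (# 0)) (v′ (# 0)) (v (# 2)) (v′ (# 2)) (v (# 1)) (v′ (# 1)) (v (# 3)) (v′ (# 3))

  -- The norms of f(ζ₈) and f(ζ₁₆); the subscript is the value of x⁴. The norms at 1, -1 and i are
  -- together in `value₁`, as f(1)f(-1) = (p + q)² - (s + t)² and f(i) = (p - q) + (s - t)i.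
  norm₋₁ normᵢ : (Fin 16 → ℤ) → ℤ
  norm₋₁ a = sq (onSections (at₋₁ a) re₋₁) + sq (onSections (at₋₁ a) im₋₁)
  normᵢ a = sq (onSections₂ (atᵢ a) (atᵢ′ a) reᵢ) + sq (onSections₂ (atᵢ a) (atᵢ′ a) imᵢ)

  private
    opaque
      unfolding section

      section-1 : ∀ a r → section ℤ≡ a r (+ 1) ≡ at₁ a r
      section-1 a r = identity (coeff a (# 0) r) (coeff a (# 1) r) (coeff a (# 2) r) (coeff a (# 3) r)
        where
        identity : ∀ k₀ k₁ k₂ k₃ → k₀ + + 1 * (k₁ + + 1 * (k₂ + + 1 * k₃)) ≡ k₀ + k₁ + k₂ + k₃
        identity = ℤ.solve-∀

      section--1 : ∀ a r → section ℤ≡ a r (- (+ 1)) ≡ at₋₁ a r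
      section--1 a r = identity (coeff a (# 0) r) (coeff a (# 1) r) (coeff a (# 2) r) (coeff a (# 3) r)
        where
        identity : ∀ k₀ k₁ k₂ k₃ → k₀ + - (+ 1) * (k₁ + - (+ 1) * (k₂ + - (+ 1) * k₃)) ≡ k₀ - k₁ + k₂ - k₃
        identity = ℤ.solve-∀

    open Solver ℤ≡

    module _ {n : ℕ} where
      infixl 6 _+ᴾ_ _-ᴾ_
      infixl 7 _*ᴾ_
      E = Expr ℤ n
      _+ᴾ_ _-ᴾ_ _*ᴾ_ : E × E → E × E → E × E
      (a , b) +ᴾ (c , d) = a ⊕ c , b ⊕ d
      (a , b) -ᴾ (c , d) = a ⊖ c , b ⊖ d
      (a , b) *ᴾ (c , d) = a ⊗ c ⊕ ⊝ Κ (+ 1) ⊗ (b ⊗ d) , a ⊗ d ⊕ b ⊗ c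
      ιᴾ : ℤ → E × E
      ιᴾ k = Κ k , Κ (+ 0)
      iᴾ : E × E
      iᴾ = Κ (+ 0) , Κ (+ 1)
      sqᴱ : E → E
      sqᴱ x = x ⊗ x
      sectionᴾ : E → E → E → E → E × E
      sectionᴾ a b c d = (a , Κ (+ 0)) +ᴾ iᴾ *ᴾ ((b , Κ (+ 0)) +ᴾ iᴾ *ᴾ ((c , Κ (+ 0)) +ᴾ iᴾ *ᴾ (d , Κ (+ 0))))
      quarticᴾ : E × E → E × E → E × E → E × E → E × E
      quarticᴾ p q s t =
        (p *ᴾ p +ᴾ iᴾ *ᴾ (q *ᴾ q) -ᴾ ιᴾ (+ 2) *ᴾ (iᴾ *ᴾ (s *ᴾ t))) *ᴾ (p *ᴾ p +ᴾ iᴾ *ᴾ (q *ᴾ q) -ᴾ ιᴾ (+ 2) *ᴾ (iᴾ *ᴾ (s *ᴾ t)))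
        -ᴾ iᴾ *ᴾ ((ιᴾ (+ 2) *ᴾ (p *ᴾ q) -ᴾ s *ᴾ s -ᴾ iᴾ *ᴾ (t *ᴾ t)) *ᴾ (ιᴾ (+ 2) *ᴾ (p *ᴾ q) -ᴾ s *ᴾ s -ᴾ iᴾ *ᴾ (t *ᴾ t)))
      reₑᴱ imₑᴱ reₒᴱ imₒᴱ reᵢᴱ imᵢᴱ : (p p′ q q′ s s′ t t′ : E) → E
      reₑᴱ p p′ q q′ s s′ t t′ = sqᴱ p ⊖ sqᴱ p′ ⊖ Κ (+ 2) ⊗ (q ⊗ q′) ⊕ Κ (+ 2) ⊗ (s ⊗ t′ ⊕ s′ ⊗ t)
      imₑᴱ p p′ q q′ s s′ t t′ = Κ (+ 2) ⊗ (p ⊗ p′) ⊕ sqᴱ q ⊖ sqᴱ q′ ⊖ Κ (+ 2) ⊗ (s ⊗ t ⊖ s′ ⊗ t′)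
      reₒᴱ p p′ q q′ s s′ t t′ = Κ (+ 2) ⊗ (p ⊗ q ⊖ p′ ⊗ q′) ⊖ sqᴱ s ⊕ sqᴱ s′ ⊕ Κ (+ 2) ⊗ (t ⊗ t′)
      imₒᴱ p p′ q q′ s s′ t t′ = Κ (+ 2) ⊗ (p ⊗ q′ ⊕ p′ ⊗ q) ⊖ Κ (+ 2) ⊗ (s ⊗ s′) ⊖ sqᴱ t ⊕ sqᴱ t′
      reᵢᴱ p p′ q q′ s s′ t t′ = sqᴱ (reₑᴱ p p′ q q′ s s′ t t′) ⊖ sqᴱ (imₑᴱ p p′ q q′ s s′ t t′)
        ⊕ Κ (+ 2) ⊗ (reₒᴱ p p′ q q′ s s′ t t′ ⊗ imₒᴱ p p′ q q′ s s′ t t′)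
      imᵢᴱ p p′ q q′ s s′ t t′ = Κ (+ 2) ⊗ (reₑᴱ p p′ q q′ s s′ t t′ ⊗ imₑᴱ p p′ q q′ s s′ t t′)
        ⊖ sqᴱ (reₒᴱ p p′ q q′ s s′ t t′) ⊕ sqᴱ (imₒᴱ p p′ q q′ s s′ t t′)

    opaque
      unfolding section

      section-i : ∀ a r → section ℤ[i].ring a r (+ 0 , + 1) ≡ (atᵢ a r , atᵢ′ a r)
      section-i a r = cong₂ _,_
        (solve 4 (λ a b c d → proj₁ (sectionᴾ a b c d) ⊜ a ⊖ c) refl (k (# 0)) (k (# 1)) (k (# 2)) (k (# 3)))
        (solve 4 (λ a b c d → proj₂ (sectionᴾ a b c d) ⊜ b ⊖ d) refl (k (# 0)) (k (# 1)) (k (# 2)) (k (# 3)))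
        where
        k : Fin 4 → ℤ
        k j = coeff a j r

    opaque
      unfolding quartic value₁ re₋₁ im₋₁ reₑ imₑ reₒ imₒ reᵢ imᵢ

      quartic-1 : ∀ p q s t → quartic ℤ≡ (+ 1) p q s t ≡ value₁ p q s t
      quartic-1 = solve 4 (λ p q s t →
        let e = p ⊗ p ⊕ Κ (+ 1) ⊗ (q ⊗ q) ⊖ Κ (+ 2) ⊗ (Κ (+ 1) ⊗ (s ⊗ t))
            o = Κ (+ 2) ⊗ (p ⊗ q) ⊖ s ⊗ s ⊖ Κ (+ 1) ⊗ (t ⊗ t) in
        e ⊗ e ⊖ Κ (+ 1) ⊗ (o ⊗ o) ⊜ (sqᴱ (p ⊕ q) ⊖ sqᴱ (s ⊕ t)) ⊗ (sqᴱ (p ⊖ q) ⊕ sqᴱ (s ⊖ t))) refl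

      quartic--1 : ∀ p q s t → quartic ℤ≡ (- (+ 1)) p q s t ≡ sq (re₋₁ p q s t) + sq (im₋₁ p q s t)
      quartic--1 = solve 4 (λ p q s t →
        let e = p ⊗ p ⊕ ⊝ Κ (+ 1) ⊗ (q ⊗ q) ⊖ Κ (+ 2) ⊗ (⊝ Κ (+ 1) ⊗ (s ⊗ t))
            o = Κ (+ 2) ⊗ (p ⊗ q) ⊖ s ⊗ s ⊖ ⊝ Κ (+ 1) ⊗ (t ⊗ t) in
        e ⊗ e ⊖ ⊝ Κ (+ 1) ⊗ (o ⊗ o) ⊜
          sqᴱ (sqᴱ p ⊖ sqᴱ q ⊕ Κ (+ 2) ⊗ (s ⊗ t)) ⊕ sqᴱ (Κ (+ 2) ⊗ (p ⊗ q) ⊖ sqᴱ s ⊕ sqᴱ t)) refl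

      quartic-i : ∀ p p′ q q′ s s′ t t′ → quartic ℤ[i].ring (+ 0 , + 1) (p , p′) (q , q′) (s , s′) (t , t′)
        ≡ (reᵢ p p′ q q′ s s′ t t′ , imᵢ p p′ q q′ s s′ t t′)
      quartic-i p p′ q q′ s s′ t t′ = cong₂ _,_
        (solve 8 (λ p p′ q q′ s s′ t t′ →
          proj₁ (quarticᴾ (p , p′) (q , q′) (s , s′) (t , t′)) ⊜ reᵢᴱ p p′ q q′ s s′ t t′) refl p p′ q q′ s s′ t t′)
        (solve 8 (λ p p′ q q′ s s′ t t′ →
          proj₂ (quarticᴾ (p , p′) (q , q′) (s , s′) (t , t′)) ⊜ imᵢᴱ p p′ q q′ s s′ t t′) refl p p′ q q′ s s′ t t′)

  D-formula : ∀ a → D a ≡ onSections (at₁ a) value₁ * norm₋₁ a * normᵢ a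
  D-formula a = trans {i = D a} {j = norms a} {k = onSections (at₁ a) value₁ * norm₋₁ a * normᵢ a} (D-norms a)
    (cong₃ (fourfold ℤ≡ a (+ 1)) (fourfold ℤ≡ a (- (+ 1))) (ℤ[i].norm (fourfold ℤ[i].ring a (+ 0 , + 1)))
      (onSections (at₁ a) value₁) (norm₋₁ a) (normᵢ a) outer middle inner)
    where
    cong₃ : ∀ (x y z x′ y′ z′ : ℤ) → x ≡ x′ → y ≡ y′ → z ≡ z′ → x * y * z ≡ x′ * y′ * z′
    cong₃ _ _ _ _ _ _ refl refl refl = refl
    quartic-cong : ∀ R {z p q s t p′ q′ s′ t′} → p ≡ p′ → q ≡ q′ → s ≡ s′ → t ≡ t′ →
      quartic R z p q s t ≡ quartic R z p′ q′ s′ t′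
    quartic-cong R refl refl refl refl = refl
    outer : fourfold ℤ≡ a (+ 1) ≡ onSections (at₁ a) value₁
    outer = trans (quartic-cong ℤ≡ (section-1 a (# 0)) (section-1 a (# 2)) (section-1 a (# 1)) (section-1 a (# 3)))
      (quartic-1 (at₁ a (# 0)) (at₁ a (# 2)) (at₁ a (# 1)) (at₁ a (# 3)))
    middle : fourfold ℤ≡ a (- (+ 1)) ≡ norm₋₁ a
    middle = trans (quartic-cong ℤ≡ (section--1 a (# 0)) (section--1 a (# 2)) (section--1 a (# 1)) (section--1 a (# 3)))
      (quartic--1 (at₋₁ a (# 0)) (at₋₁ a (# 2)) (at₋₁ a (# 1)) (at₋₁ a (# 3)))
    norm-squares : ∀ x y → x * x + - (- (+ 1) * (y * y)) ≡ x * x + y * y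
    norm-squares = ℤ.solve-∀
    v = atᵢ a
    v′ = atᵢ′ a
    w : fourfold ℤ[i].ring a (+ 0 , + 1) ≡ (onSections₂ v v′ reᵢ , onSections₂ v v′ imᵢ)
    w = trans (quartic-cong ℤ[i].ring (section-i a (# 0)) (section-i a (# 2)) (section-i a (# 1)) (section-i a (# 3)))
      (quartic-i (v (# 0)) (v′ (# 0)) (v (# 2)) (v′ (# 2)) (v (# 1)) (v′ (# 1)) (v (# 3)) (v′ (# 3)))
    inner : ℤ[i].norm (fourfold ℤ[i].ring a (+ 0 , + 1)) ≡ normᵢ a
    inner = trans (cong ℤ[i].norm w) (norm-squares (onSections₂ v v′ reᵢ) (onSections₂ v v′ imᵢ))

  -- Multiplication of f by x modulo x¹⁶ - 1. It takes the sections (p, q, s, t) to (zt, s, p, q).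
  rotate : (Fin 16 → ℤ) → Fin 16 → ℤ
  rotate a i = a (subMod16 i (# 1))

  private
    opaque
      unfolding value₁ re₋₁ im₋₁ reₑ imₑ reₒ imₒ reᵢ imᵢ

      value₁-rotate : ∀ p q s t → value₁ t s p q ≡ - value₁ p q s t
      value₁-rotate = solve 4 (λ p q s t →
        (sqᴱ (t ⊕ s) ⊖ sqᴱ (p ⊕ q)) ⊗ (sqᴱ (t ⊖ s) ⊕ sqᴱ (p ⊖ q))
          ⊜ ⊝ ((sqᴱ (p ⊕ q) ⊖ sqᴱ (s ⊕ t)) ⊗ (sqᴱ (p ⊖ q) ⊕ sqᴱ (s ⊖ t)))) refl
      norm₋₁-rotate : ∀ p q s t → sq (re₋₁ (- t) s p q) + sq (im₋₁ (- t) s p q) ≡ sq (re₋₁ p q s t) + sq (im₋₁ p q s t)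
      norm₋₁-rotate = solve 4 (λ p q s t →
        let re = λ p q s t → sqᴱ p ⊖ sqᴱ q ⊕ Κ (+ 2) ⊗ (s ⊗ t)
            im = λ p q s t → Κ (+ 2) ⊗ (p ⊗ q) ⊖ sqᴱ s ⊕ sqᴱ t in
        sqᴱ (re (⊝ t) s p q) ⊕ sqᴱ (im (⊝ t) s p q) ⊜ sqᴱ (re p q s t) ⊕ sqᴱ (im p q s t)) refl
      re-rotate : ∀ p p′ q q′ s s′ t t′ → reᵢ (- t′) t s s′ p p′ q q′ ≡ imᵢ p p′ q q′ s s′ t t′
      re-rotate = solve 8 (λ p p′ q q′ s s′ t t′ → reᵢᴱ (⊝ t′) t s s′ p p′ q q′ ⊜ imᵢᴱ p p′ q q′ s s′ t t′) refl
      im-rotate : ∀ p p′ q q′ s s′ t t′ → imᵢ (- t′) t s s′ p p′ q q′ ≡ - reᵢ p p′ q q′ s s′ t t′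
      im-rotate = solve 8 (λ p p′ q q′ s s′ t t′ → imᵢᴱ (⊝ t′) t s s′ p p′ q q′ ⊜ ⊝ reᵢᴱ p p′ q q′ s s′ t t′) refl

  -- The product of all sixteenth roots of unity is -1. The sign comes from x = -1, hence from
  -- `value₁`; the norms at ζ₈ and ζ₁₆ are unchanged.
  D-rotate : ∀ a → D (rotate a) ≡ - D a
  D-rotate a = trans (D-formula (rotate a)) (trans
    (cong₂ _*_ (cong₂ _*_ outer middle) inner)
    (trans (signs (onSections (at₁ a) value₁) (norm₋₁ a) (normᵢ a)) (cong -_ (sym (D-formula a)))))
    where
    signs : ∀ x y z → - x * y * z ≡ - (x * y * z)
    signs = ℤ.solve-∀
    cyclic₁ : ∀ k₀ k₁ k₂ k₃ → k₃ + k₀ + k₁ + k₂ ≡ k₀ + k₁ + k₂ + k₃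
    cyclic₁ = ℤ.solve-∀
    cyclic₋₁ : ∀ k₀ k₁ k₂ k₃ → k₃ - k₀ + k₁ - k₂ ≡ - (k₀ - k₁ + k₂ - k₃)
    cyclic₋₁ = ℤ.solve-∀
    cyclicᵢ : ∀ k₁ k₃ → k₃ - k₁ ≡ - (k₁ - k₃)
    cyclicᵢ = ℤ.solve-∀
    k = coeff a
    outer : onSections (at₁ (rotate a)) value₁ ≡ - onSections (at₁ a) value₁
    outer = trans (cong (λ t → value₁ t (at₁ a (# 1)) (at₁ a (# 0)) (at₁ a (# 2))) (cyclic₁ (k (# 0) (# 3)) (k (# 1) (# 3)) (k (# 2) (# 3)) (k (# 3) (# 3))))
      (value₁-rotate (at₁ a (# 0)) (at₁ a (# 2)) (at₁ a (# 1)) (at₁ a (# 3)))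
    middle : norm₋₁ (rotate a) ≡ norm₋₁ a
    middle = trans (cong (λ t → sq (re₋₁ t (at₋₁ a (# 1)) (at₋₁ a (# 0)) (at₋₁ a (# 2))) + sq (im₋₁ t (at₋₁ a (# 1)) (at₋₁ a (# 0)) (at₋₁ a (# 2))))
        (cyclic₋₁ (k (# 0) (# 3)) (k (# 1) (# 3)) (k (# 2) (# 3)) (k (# 3) (# 3))))
      (norm₋₁-rotate (at₋₁ a (# 0)) (at₋₁ a (# 2)) (at₋₁ a (# 1)) (at₋₁ a (# 3)))
    squares : ∀ x y → sq y + sq (- x) ≡ sq x + sq y
    squares = solve 2 (λ x y → sqᴱ y ⊕ sqᴱ (⊝ x) ⊜ sqᴱ x ⊕ sqᴱ y) refl
    inner : normᵢ (rotate a) ≡ normᵢ a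
    inner = trans
      (cong (λ t → sq (onSections₂′ t reᵢ) + sq (onSections₂′ t imᵢ)) (cyclicᵢ (k (# 1) (# 3)) (k (# 3) (# 3))))
      (trans (cong₂ (λ x y → sq x + sq y)
          (re-rotate (v (# 0)) (v′ (# 0)) (v (# 2)) (v′ (# 2)) (v (# 1)) (v′ (# 1)) (v (# 3)) (v′ (# 3)))
          (im-rotate (v (# 0)) (v′ (# 0)) (v (# 2)) (v′ (# 2)) (v (# 1)) (v′ (# 1)) (v (# 3)) (v′ (# 3))))
        (squares (onSections₂ v v′ reᵢ) (onSections₂ v v′ imᵢ)))
      where
      v = atᵢ a
      v′ = atᵢ′ a
      onSections₂′ : ℤ → (ℤ → ℤ → ℤ → ℤ → ℤ → ℤ → ℤ → ℤ → ℤ) → ℤ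
      onSections₂′ t f = f t (v (# 3)) (v (# 1)) (v′ (# 1)) (v (# 0)) (v′ (# 0)) (v (# 2)) (v′ (# 2))

-- Congruences between the factors

module _ where
  open import Data.Integer using (_+_; _*_; _-_; -_)

  infix 4 _≡₂_
  infixr 4 _,₂_
  record _≡₂_ (x y : ℤ) : Set where
    constructor _,₂_
    field
      half : ℤ
      equality : x ≡ y + + 2 * half

  ≡₂-refl : ∀ x → x ≡₂ x
  ≡₂-refl x = + 0 ,₂ sym (ℤ.+-identityʳ x)

  ≡₂-trans : ∀ {x y z} → x ≡₂ y → y ≡₂ z → x ≡₂ z
  ≡₂-trans {z = z} (k ,₂ refl) (l ,₂ refl) = (l + k) ,₂ identity z k l
    where
    identity : ∀ z k l → z + + 2 * l + + 2 * k ≡ z + + 2 * (l + k)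
    identity = ℤ.solve-∀

  ≡₂-+ : ∀ {x y z w} → x ≡₂ y → z ≡₂ w → x + z ≡₂ y + w
  ≡₂-+ {y = y} {w = w} (k ,₂ refl) (l ,₂ refl) = (k + l) ,₂ identity y w k l
    where
    identity : ∀ y w k l → y + + 2 * k + (w + + 2 * l) ≡ y + w + + 2 * (k + l)
    identity = ℤ.solve-∀

  ≡₂-* : ∀ {x y z w} → x ≡₂ y → z ≡₂ w → x * z ≡₂ y * w
  ≡₂-* {y = y} {w = w} (k ,₂ refl) (l ,₂ refl) = (k * w + y * l + + 2 * (k * l)) ,₂ identity y w k l
    where
    identity : ∀ y w k l → (y + + 2 * k) * (w + + 2 * l) ≡ y * w + + 2 * (k * w + y * l + + 2 * (k * l))
    identity = ℤ.solve-∀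

  parity : ∀ x → (∃ λ k → x ≡ + 2 * k) ⊎ (∃ λ k → x ≡ + 1 + + 2 * k)
  parity x = remainder (x ℤ.%ℕ 2) (ℤ.n%ℕd<d x 2) (ℤ.a≡a%ℕn+[a/ℕn]*n x 2)
    where
    flip : ∀ r k → r + k * + 2 ≡ r + + 2 * k
    flip = ℤ.solve-∀
    remainder : ∀ r → r ℕ.< 2 → x ≡ + r + (x ℤ./ℕ 2) * + 2 → (∃ λ k → x ≡ + 2 * k) ⊎ (∃ λ k → x ≡ + 1 + + 2 * k)
    remainder 0 _ eq = inj₁ (x ℤ./ℕ 2 , trans eq (trans (flip (+ 0) (x ℤ./ℕ 2)) (ℤ.+-identityˡ (+ 2 * (x ℤ./ℕ 2)))))
    remainder 1 _ eq = inj₂ (x ℤ./ℕ 2 , trans eq (flip (+ 1) (x ℤ./ℕ 2)))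
    remainder (suc (suc _)) (ℕ.s≤s (ℕ.s≤s ())) _

  triangular : ∀ x → ∃ λ τ → sq x ≡ x + + 2 * τ
  triangular x with parity x
  ... | inj₁ (k , refl) = + 2 * (k * k) - k , identity k
    where
    identity : ∀ k → + 2 * k * (+ 2 * k) ≡ + 2 * k + + 2 * (+ 2 * (k * k) - k)
    identity = ℤ.solve-∀
  ... | inj₂ (k , refl) = + 2 * (k * k) + k , identity k
    where
    identity : ∀ k → (+ 1 + + 2 * k) * (+ 1 + + 2 * k) ≡ + 1 + + 2 * k + + 2 * (+ 2 * (k * k) + k)
    identity = ℤ.solve-∀

  square-≡₂ : ∀ x → sq x ≡₂ x
  square-≡₂ x = proj₁ (triangular x) ,₂ proj₂ (triangular x)

  negate-≡₂ : ∀ x → - x ≡₂ x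
  negate-≡₂ x = - x ,₂ identity x
    where
    identity : ∀ x → - x ≡ x + + 2 * - x
    identity = ℤ.solve-∀

  +-double-≡₂ : ∀ {x y} z → x ≡₂ y → x + + 2 * z ≡₂ y
  +-double-≡₂ z p = ≡₂-trans (z ,₂ refl) p

  squares-≡₂ : ∀ {x y} → x ≡₂ y → sq x ≡₂ y
  squares-≡₂ {x} p = ≡₂-trans (square-≡₂ x) p

  difference-≡₂ : ∀ {x y z w} → x ≡₂ y → z ≡₂ w → x - z ≡₂ y + w
  difference-≡₂ {z = z} p q = ≡₂-+ p (≡₂-trans (negate-≡₂ z) q)

  opaque
    unfolding value₁ re₋₁ im₋₁ reₑ imₑ reₒ imₒ reᵢ imᵢ

    -- Roots of unity of order a power of 2 are congruent to 1 modulo the primes above 2, so every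
    -- factor has the parity of f(1). This and the next two lemmas read it off from the formulas,
    -- where squaring and signs do not matter modulo 2.
    value₁-≡₂ : ∀ p q s t → value₁ p q s t ≡₂ p + q + (s + t)
    value₁-≡₂ p q s t = ≡₂-trans
      (≡₂-* (difference-≡₂ (square-≡₂ (p + q)) (square-≡₂ (s + t)))
            (≡₂-+ (squares-≡₂ (difference-≡₂ (≡₂-refl p) (≡₂-refl q))) (squares-≡₂ (difference-≡₂ (≡₂-refl s) (≡₂-refl t)))))
      (square-≡₂ (p + q + (s + t)))

    norm₋₁-≡₂ : ∀ p q s t → sq (re₋₁ p q s t) + sq (im₋₁ p q s t) ≡₂ p + q + (s + t)
    norm₋₁-≡₂ p q s t = ≡₂-+
      (squares-≡₂ (+-double-≡₂ (s * t) (difference-≡₂ (square-≡₂ p) (square-≡₂ q))))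
      (squares-≡₂ (subst (_≡₂ s + t) (identity p q (sq s) (sq t))
        (+-double-≡₂ (p * q) (≡₂-+ (≡₂-trans (negate-≡₂ (sq s)) (square-≡₂ s)) (square-≡₂ t)))))
      where
      identity : ∀ p q s t → - s + t + + 2 * (p * q) ≡ + 2 * (p * q) - s + t
      identity = ℤ.solve-∀

    normᵢ-≡₂ : ∀ p p′ q q′ s s′ t t′ → sq (reᵢ p p′ q q′ s s′ t t′) + sq (imᵢ p p′ q q′ s s′ t t′)
      ≡₂ p + p′ + (q + q′) + (s + s′ + (t + t′))
    normᵢ-≡₂ p p′ q q′ s s′ t t′ = ≡₂-+
      (squares-≡₂ (+-double-≡₂ (reₒ p p′ q q′ s s′ t t′ * imₒ p p′ q q′ s s′ t t′) (difference-≡₂ (squares-≡₂ e) (squares-≡₂ e′))))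
      (squares-≡₂ (subst (_≡₂ s + s′ + (t + t′)) (shuffle (sq (reₒ p p′ q q′ s s′ t t′)) (sq (imₒ p p′ q q′ s s′ t t′)) (re*im))
        (+-double-≡₂ re*im (≡₂-+ (≡₂-trans (negate-≡₂ _) (squares-≡₂ o)) (squares-≡₂ o′)))))
      where
      re*im : ℤ
      re*im = reₑ p p′ q q′ s s′ t t′ * imₑ p p′ q q′ s s′ t t′
      shuffle : ∀ x y z → - x + y + + 2 * z ≡ + 2 * z - x + y
      shuffle = ℤ.solve-∀
      e : reₑ p p′ q q′ s s′ t t′ ≡₂ p + p′
      e = +-double-≡₂ (s * t′ + s′ * t) (subst (_≡₂ p + p′) (shuffle₋ (sq p - sq p′) (q * q′))
        (+-double-≡₂ (- (q * q′)) (difference-≡₂ (square-≡₂ p) (square-≡₂ p′))))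
        where
        shuffle₋ : ∀ x y → x + + 2 * - y ≡ x - + 2 * y
        shuffle₋ = ℤ.solve-∀
      e′ : imₑ p p′ q q′ s s′ t t′ ≡₂ q + q′
      e′ = subst (_≡₂ q + q′) (shuffle′ (sq q) (sq q′) (p * p′) (s * t - s′ * t′))
        (+-double-≡₂ (p * p′ - (s * t - s′ * t′)) (difference-≡₂ (square-≡₂ q) (square-≡₂ q′)))
        where
        shuffle′ : ∀ x y z w → x - y + + 2 * (z - w) ≡ + 2 * z + x - y - + 2 * w
        shuffle′ = ℤ.solve-∀
      o : reₒ p p′ q q′ s s′ t t′ ≡₂ s + s′
      o = +-double-≡₂ (t * t′) (subst (_≡₂ s + s′) (shuffle (sq s) (sq s′) (p * q - p′ * q′))
        (+-double-≡₂ (p * q - p′ * q′) (≡₂-+ (≡₂-trans (negate-≡₂ _) (square-≡₂ s)) (square-≡₂ s′))))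
      o′ : imₒ p p′ q q′ s s′ t t′ ≡₂ t + t′
      o′ = subst (_≡₂ t + t′) (shuffle′ (sq t) (sq t′) (p * q′ + p′ * q) (s * s′))
        (+-double-≡₂ (p * q′ + p′ * q - s * s′) (≡₂-+ (≡₂-trans (negate-≡₂ _) (square-≡₂ t)) (square-≡₂ t′)))
        where
        shuffle′ : ∀ x y z w → - x + y + + 2 * (z - w) ≡ + 2 * z - + 2 * w - x + y
        shuffle′ = ℤ.solve-∀

    -- All of p ± q and s ± t are even, and each of the two factors is a combination of two of their
    -- squares.
    value₁-16 : ∀ q t k l → ∃ λ w → value₁ (q + + 2 * k) q (t + + 2 * l) t ≡ + 16 * w
    value₁-16 q t k l = (sq (q + k) - sq (t + l)) * (sq k + sq l) , identity q t k l
      where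
      identity : ∀ q t k l →
        ((q + + 2 * k + q) * (q + + 2 * k + q) - (t + + 2 * l + t) * (t + + 2 * l + t)) *
        ((q + + 2 * k - q) * (q + + 2 * k - q) + (t + + 2 * l - t) * (t + + 2 * l - t))
          ≡ + 16 * (((q + k) * (q + k) - (t + l) * (t + l)) * (k * k + l * l))
      identity = ℤ.solve-∀

    norm₋₁-4 : ∀ q t k l → ∃ λ w →
      sq (re₋₁ (q + + 2 * k) q (t + + 2 * l) t) + sq (im₋₁ (q + + 2 * k) q (t + + 2 * l) t) ≡ + 4 * w
    norm₋₁-4 q t k l = sq (+ 2 * (q * k) + + 2 * sq k + (t + + 2 * l) * t) + sq ((q + + 2 * k) * q - + 2 * (t * l) - + 2 * sq l)
      , identity q t k l
      where
      identity : ∀ q t k l → let p = q + + 2 * k ; s = t + + 2 * l in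
        (p * p - q * q + + 2 * (s * t)) * (p * p - q * q + + 2 * (s * t))
          + (+ 2 * (p * q) - s * s + t * t) * (+ 2 * (p * q) - s * s + t * t)
        ≡ + 4 * ((+ 2 * (q * k) + + 2 * (k * k) + s * t) * (+ 2 * (q * k) + + 2 * (k * k) + s * t)
               + (p * q - + 2 * (t * l) - + 2 * (l * l)) * (p * q - + 2 * (t * l) - + 2 * (l * l)))
      identity = ℤ.solve-∀

    -- The odd squares (p + q)² and (s + t)² differ by a multiple of 8. The norm at i is kept as a
    -- separate factor, since it may supply the exceptional prime.
    value₁-8 : ∀ a b c d → ∃ λ w → value₁ (+ 1 + + 2 * a) (+ 2 * b) (+ 1 + + 2 * c) (+ 2 * d)
      ≡ + 8 * w * (sq (+ 1 + + 2 * a - + 2 * b) + sq (+ 1 + + 2 * c - + 2 * d))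
    value₁-8 a b c d = proj₁ (difference (a + b) (c + d)) , cong₂ _*_
      (trans (cong₂ (λ x y → sq x - sq y) (shape a b) (shape c d)) (proj₂ (difference (a + b) (c + d)))) refl
      where
      shape : ∀ a b → + 1 + + 2 * a + + 2 * b ≡ + 1 + + 2 * (a + b)
      shape = ℤ.solve-∀
      difference : ∀ x y → ∃ λ w → sq (+ 1 + + 2 * x) - sq (+ 1 + + 2 * y) ≡ + 8 * w
      difference x y with triangular x | triangular y
      ... | τ , eq | υ , eq′ = x - y + τ - υ , trans (expand x y)
        (trans (cong₂ (λ u v → + 4 * (x + u) - + 4 * (y + v)) eq eq′) (collect x y τ υ))
        where
        expand : ∀ x y → (+ 1 + + 2 * x) * (+ 1 + + 2 * x) - (+ 1 + + 2 * y) * (+ 1 + + 2 * y)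
          ≡ + 4 * (x + x * x) - + 4 * (y + y * y)
        expand = ℤ.solve-∀
        collect : ∀ x y τ υ → + 4 * (x + (x + + 2 * τ)) - + 4 * (y + (y + + 2 * υ)) ≡ + 8 * (x - y + τ - υ)
        collect = ℤ.solve-∀

    -- Modulo 8 an odd square is 1, (2b)² is 4b, and 2(1 + 2c)(2d) is 4d.
    re₋₁-mod8 : ∀ a b c d → ∃ λ w →
      re₋₁ (+ 1 + + 2 * a) (+ 2 * b) (+ 1 + + 2 * c) (+ 2 * d) ≡ + 1 + + 4 * (b + d) + + 8 * w
    re₋₁-mod8 a b c d with triangular a | triangular b
    ... | τ , eq | υ , eq′ = a + τ - b - υ + c * d , trans (expand a b c d)
      (trans (cong₂ (λ u v → + 1 + + 4 * (a + u) - + 4 * v + + 4 * d + + 8 * (c * d)) eq eq′) (collect a b c d τ υ))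
      where
      expand : ∀ a b c d → (+ 1 + + 2 * a) * (+ 1 + + 2 * a) - (+ 2 * b) * (+ 2 * b) + + 2 * ((+ 1 + + 2 * c) * (+ 2 * d))
        ≡ + 1 + + 4 * (a + a * a) - + 4 * (b * b) + + 4 * d + + 8 * (c * d)
      expand = ℤ.solve-∀
      collect : ∀ a b c d τ υ → + 1 + + 4 * (a + (a + + 2 * τ)) - + 4 * (b + + 2 * υ) + + 4 * d + + 8 * (c * d)
        ≡ + 1 + + 4 * (b + d) + + 8 * (a + τ - b - υ + c * d)
      collect = ℤ.solve-∀

    -- Here p + p′ and s + s′ are odd, q + q′ and t + t′ even. Then `reₑ` and `reₒ` are odd, while
    -- modulo 4 `imₑ` is 2t and `imₒ` is 2q. Hence `reₑ`² - `imₑ`² + 2 `reₒ` `imₒ` is 1 - 4t² + 4q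
    -- modulo 8.
    reᵢ-mod8 : ∀ p q s t a b c d → ∃ λ w →
      reᵢ p (+ 1 - p + + 2 * a) q (q + + 2 * b) s (+ 1 - s + + 2 * c) t (t + + 2 * d) ≡ + 1 + + 4 * (q + t) + + 8 * w
    reᵢ-mod8 p q s t a b c d = proj₁ total ,
      trans (cong₂ (λ x y → sq x - sq y + + 2 * (reₒ p p′ q q′ s s′ t t′ * imₒ p p′ q q′ s s′ t t′)) e (proj₂ e′))
        (trans (cong₂ (λ x y → sq (+ 1 + + 2 * α) - sq (+ 2 * t + + 4 * proj₁ e′) + + 2 * (x * y)) o (proj₂ o′)) (proj₂ total))
      where
      p′ q′ s′ t′ α γ : ℤ
      p′ = + 1 - p + + 2 * a
      q′ = q + + 2 * b
      s′ = + 1 - s + + 2 * c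
      t′ = t + + 2 * d
      α = p - + 1 - + 2 * a + + 2 * (a * p) - + 2 * (a * a) - q * q′ + (s * t′ + s′ * t)
      e : reₑ p p′ q q′ s s′ t t′ ≡ + 1 + + 2 * α
      e = identity p q s t a b c d
        where
        identity : ∀ p q s t a b c d → let p′ = + 1 - p + + 2 * a ; q′ = q + + 2 * b ; s′ = + 1 - s + + 2 * c ; t′ = t + + 2 * d in
          p * p - p′ * p′ - + 2 * (q * q′) + + 2 * (s * t′ + s′ * t)
          ≡ + 1 + + 2 * (p - + 1 - + 2 * a + + 2 * (a * p) - + 2 * (a * a) - q * q′ + (s * t′ + s′ * t))
        identity = ℤ.solve-∀
      γ = p * q - p′ * q′ - s + + 2 * c - + 2 * (c * s) + + 2 * (c * c) + t * t′
      o : reₒ p p′ q q′ s s′ t t′ ≡ + 1 + + 2 * γ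
      o = identity p q s t a b c d
        where
        identity : ∀ p q s t a b c d → let p′ = + 1 - p + + 2 * a ; q′ = q + + 2 * b ; s′ = + 1 - s + + 2 * c ; t′ = t + + 2 * d in
          + 2 * (p * q - p′ * q′) - s * s + s′ * s′ + + 2 * (t * t′)
          ≡ + 1 + + 2 * (p * q - p′ * q′ - s + + 2 * c - + 2 * (c * s) + + 2 * (c * c) + t * t′)
        identity = ℤ.solve-∀
      e′ : ∃ λ β → imₑ p p′ q q′ s s′ t t′ ≡ + 2 * t + + 4 * β
      e′ with triangular p
      ... | τ , eq = a * p - τ - b * q - b * b - s * t + d - s * d + c * t + + 2 * (c * d) , trans (expand p q s t a b c d)
        (trans (cong (λ u → + 2 * (p - u + + 2 * (a * p)) - + 4 * (b * q) - + 4 * (b * b)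
            - + 4 * (s * t) + + 2 * t + + 4 * d - + 4 * (s * d) + + 4 * (c * t) + + 8 * (c * d)) eq)
          (collect p q s t a b c d τ))
        where
        expand : ∀ p q s t a b c d → let p′ = + 1 - p + + 2 * a ; q′ = q + + 2 * b ; s′ = + 1 - s + + 2 * c ; t′ = t + + 2 * d in
          + 2 * (p * p′) + q * q - q′ * q′ - + 2 * (s * t - s′ * t′)
          ≡ + 2 * (p - p * p + + 2 * (a * p)) - + 4 * (b * q) - + 4 * (b * b)
            - + 4 * (s * t) + + 2 * t + + 4 * d - + 4 * (s * d) + + 4 * (c * t) + + 8 * (c * d)
        expand = ℤ.solve-∀
        collect : ∀ p q s t a b c d τ → + 2 * (p - (p + + 2 * τ) + + 2 * (a * p)) - + 4 * (b * q) - + 4 * (b * b)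
            - + 4 * (s * t) + + 2 * t + + 4 * d - + 4 * (s * d) + + 4 * (c * t) + + 8 * (c * d)
          ≡ + 2 * t + + 4 * (a * p - τ - b * q - b * b - s * t + d - s * d + c * t + + 2 * (c * d))
        collect = ℤ.solve-∀
      o′ : ∃ λ ε → imₒ p p′ q q′ s s′ t t′ ≡ + 2 * q + + 4 * ε
      o′ with triangular s
      ... | τ , eq = p * b + a * q + τ - c * s + d * t + d * d , trans (expand p q s t a b c d)
        (trans (cong (λ u → + 2 * (q + + 2 * (p * b) + + 2 * (a * q)) - + 2 * (s - u + + 2 * (c * s)) + + 4 * (d * t) + + 4 * (d * d)) eq)
          (collect p q s t a b c d τ))
        where
        expand : ∀ p q s t a b c d → let p′ = + 1 - p + + 2 * a ; q′ = q + + 2 * b ; s′ = + 1 - s + + 2 * c ; t′ = t + + 2 * d in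
          + 2 * (p * q′ + p′ * q) - + 2 * (s * s′) - t * t + t′ * t′
          ≡ + 2 * (q + + 2 * (p * b) + + 2 * (a * q)) - + 2 * (s - s * s + + 2 * (c * s)) + + 4 * (d * t) + + 4 * (d * d)
        expand = ℤ.solve-∀
        collect : ∀ p q s t a b c d τ →
          + 2 * (q + + 2 * (p * b) + + 2 * (a * q)) - + 2 * (s - (s + + 2 * τ) + + 2 * (c * s)) + + 4 * (d * t) + + 4 * (d * d)
          ≡ + 2 * q + + 4 * (p * b + a * q + τ - c * s + d * t + d * d)
        collect = ℤ.solve-∀
      combine : ∀ α β γ ε → ∃ λ w → sq (+ 1 + + 2 * α) - sq (+ 2 * t + + 4 * β) + + 2 * ((+ 1 + + 2 * γ) * (+ 2 * q + + 4 * ε))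
        ≡ + 1 + + 4 * (q + t) + + 8 * w
      combine α β γ ε with triangular α | triangular t
      ... | A , eq | τ , eq′ = α + A - t - τ - + 2 * (t * β + β * β) + ε + γ * q + + 2 * (γ * ε) , trans (expand q t α β γ ε)
        (trans (cong₂ (λ u v → + 1 + + 4 * (α + u) - + 4 * v - + 16 * (t * β + β * β) + + 4 * q + + 8 * (ε + γ * q + + 2 * (γ * ε))) eq eq′)
          (collect q t α β γ ε A τ))
        where
        expand : ∀ q t α β γ ε → (+ 1 + + 2 * α) * (+ 1 + + 2 * α) - (+ 2 * t + + 4 * β) * (+ 2 * t + + 4 * β)
            + + 2 * ((+ 1 + + 2 * γ) * (+ 2 * q + + 4 * ε))
          ≡ + 1 + + 4 * (α + α * α) - + 4 * (t * t) - + 16 * (t * β + β * β) + + 4 * q + + 8 * (ε + γ * q + + 2 * (γ * ε))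
        expand = ℤ.solve-∀
        collect : ∀ q t α β γ ε A τ →
          + 1 + + 4 * (α + (α + + 2 * A)) - + 4 * (t + + 2 * τ) - + 16 * (t * β + β * β) + + 4 * q + + 8 * (ε + γ * q + + 2 * (γ * ε))
          ≡ + 1 + + 4 * (q + t) + + 8 * (α + A - t - τ - + 2 * (t * β + β * β) + ε + γ * q + + 2 * (γ * ε))
        collect = ℤ.solve-∀
      total : ∃ λ w → sq (+ 1 + + 2 * α) - sq (+ 2 * t + + 4 * proj₁ e′) + + 2 * ((+ 1 + + 2 * γ) * (+ 2 * q + + 4 * proj₁ o′))
        ≡ + 1 + + 4 * (q + t) + + 8 * w
      total = combine α (proj₁ e′) γ (proj₁ o′)

    -- With x = p - q and y = s - t both ±1 mod 8 (ε, φ ∈ {0, -1}), the condition B + E even makes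
    -- (p + q)² - (s + t)² = (x + 4B)² - (y + 4E)² a multiple of 16.
    value₁-16′ : ∀ ε i φ j B m → sq ε ≡ - ε → sq φ ≡ - φ →
      let E = + 2 * m - B ; p = + 1 + + 2 * ε + + 8 * i + + 2 * B ; s = + 1 + + 2 * φ + + 8 * j + + 2 * E in
      ∃ λ w → value₁ p (+ 2 * B) s (+ 2 * E) ≡ + 16 * w * (sq (p - + 2 * B) + sq (s - + 2 * E))
    value₁-16′ ε i φ j B m eq eq′ = w , cong (_* (sq (p - + 2 * B) + sq (s - + 2 * E)))
      (trans (expand ε i φ j B m)
        (trans (cong₂ (λ u v → + 4 * (ε + u) - + 4 * (φ + v) + + 16 * w) eq eq′) (collect ε φ w)))
      where
      E p s w : ℤ
      E = + 2 * m - B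
      p = + 1 + + 2 * ε + + 8 * i + + 2 * B
      s = + 1 + + 2 * φ + + 8 * j + + 2 * E
      w = i * (+ 1 + + 2 * ε) + + 4 * (i * i) - j * (+ 1 + + 2 * φ) - + 4 * (j * j) + B - m + ε * B + + 4 * (i * B)
        - φ * E - + 4 * (j * E) + B * B - E * E
      expand : ∀ ε i φ j B m → let E = + 2 * m - B ; p = + 1 + + 2 * ε + + 8 * i + + 2 * B ; s = + 1 + + 2 * φ + + 8 * j + + 2 * E in
        (p + + 2 * B) * (p + + 2 * B) - (s + + 2 * E) * (s + + 2 * E)
          ≡ + 4 * (ε + ε * ε) - + 4 * (φ + φ * φ) + + 16 * (i * (+ 1 + + 2 * ε) + + 4 * (i * i) - j * (+ 1 + + 2 * φ) - + 4 * (j * j)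
            + B - m + ε * B + + 4 * (i * B) - φ * E - + 4 * (j * E) + B * B - E * E)
      expand = ℤ.solve-∀
      collect : ∀ ε φ w → + 4 * (ε + - ε) - + 4 * (φ + - φ) + + 16 * w ≡ + 16 * w
      collect = ℤ.solve-∀

  data ±3mod8 : ℤ → Set where
    3mod8 : ∀ j → ±3mod8 (+ 3 + + 8 * j)
    5mod8 : ∀ j → ±3mod8 (+ 5 + + 8 * j)

  -- Equivalently, n is the norm of the Gaussian integer (x + yi)/(1 + i).
  HalfSum : ℤ → Set
  HalfSum n = ∃ λ x → ∃ λ y → ±3mod8 x × + 2 * n ≡ sq x + sq y

  -- The residue ±1 is written as 1 + 2ε with ε² = -ε, that is ε ∈ {0, -1}, so that the sign can
  -- take part in polynomial identities.
  residue : ∀ k → ±3mod8 (+ 1 + + 2 * k) ⊎ (∃ λ ε → ∃ λ i → sq ε ≡ - ε × + 1 + + 2 * k ≡ + 1 + + 2 * ε + + 8 * i)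
  residue k with parity k
  ... | inj₁ (l , refl) with parity l
  ...   | inj₁ (j , refl) = inj₂ (+ 0 , j , refl , identity j)
    where
    identity : ∀ j → + 1 + + 2 * (+ 2 * (+ 2 * j)) ≡ + 1 + + 2 * + 0 + + 8 * j
    identity = ℤ.solve-∀
  ...   | inj₂ (j , refl) = inj₁ (subst ±3mod8 (identity j) (5mod8 j))
    where
    identity : ∀ j → + 5 + + 8 * j ≡ + 1 + + 2 * (+ 2 * (+ 1 + + 2 * j))
    identity = ℤ.solve-∀
  residue k | inj₂ (l , refl) with parity l
  ...   | inj₁ (j , refl) = inj₁ (subst ±3mod8 (identity j) (3mod8 j))
    where
    identity : ∀ j → + 3 + + 8 * j ≡ + 1 + + 2 * (+ 1 + + 2 * (+ 2 * j))
    identity = ℤ.solve-∀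
  ...   | inj₂ (j , refl) = inj₂ (- (+ 1) , + 1 + j , refl , identity j)
    where
    identity : ∀ j → + 1 + + 2 * (+ 1 + + 2 * (+ 1 + + 2 * j)) ≡ + 1 + + 2 * - (+ 1) + + 8 * (+ 1 + j)
    identity = ℤ.solve-∀

  EvenValue : ℤ → Set
  EvenValue z = (∃ λ w → z ≡ + 128 * w) ⊎ (∃ λ n → ∃ λ w → HalfSum n × z ≡ + 64 * n * w)

  evenValue-neg : ∀ {z} → EvenValue (- z) → EvenValue z
  evenValue-neg {z} (inj₁ (w , eq)) = inj₁ (- w , trans (sym (ℤ.neg-involutive z)) (trans (cong -_ eq) (identity w)))
    where
    identity : ∀ w → - (+ 128 * w) ≡ + 128 * - w
    identity = ℤ.solve-∀
  evenValue-neg {z} (inj₂ (n , w , half , eq)) =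
    inj₂ (n , - w , half , trans (sym (ℤ.neg-involutive z)) (trans (cong -_ eq) (identity n w)))
    where
    identity : ∀ n w → - (+ 64 * n * w) ≡ + 64 * n * - w
    identity = ℤ.solve-∀

  private
    at₋₁≡ : ∀ a r {v} → at₁ a r ≡ v → at₋₁ a r ≡ v - + 2 * (coeff a (# 1) r + coeff a (# 3) r)
    at₋₁≡ a r refl = identity (coeff a (# 0) r) (coeff a (# 1) r) (coeff a (# 2) r) (coeff a (# 3) r)
      where
      identity : ∀ k₀ k₁ k₂ k₃ → k₀ - k₁ + k₂ - k₃ ≡ k₀ + k₁ + k₂ + k₃ - + 2 * (k₁ + k₃)
      identity = ℤ.solve-∀

    atᵢ′≡ : ∀ a r {v} → at₁ a r ≡ v → atᵢ′ a r ≡ v - atᵢ a r - + 2 * (coeff a (# 2) r + coeff a (# 3) r)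
    atᵢ′≡ a r refl = identity (coeff a (# 0) r) (coeff a (# 1) r) (coeff a (# 2) r) (coeff a (# 3) r)
      where
      identity : ∀ k₀ k₁ k₂ k₃ → k₁ - k₃ ≡ k₀ + k₁ + k₂ + k₃ - (k₀ - k₂) - + 2 * (k₂ + k₃)
      identity = ℤ.solve-∀

  private
    cong₄ : ∀ (f : ℤ → ℤ → ℤ → ℤ → ℤ) {x y z w x′ y′ z′ w′} → x ≡ x′ → y ≡ y′ → z ≡ z′ → w ≡ w′ → f x y z w ≡ f x′ y′ z′ w′
    cong₄ f refl refl refl refl = refl

    at₋₁-≡₂ : ∀ a r → at₋₁ a r ≡₂ at₁ a r
    at₋₁-≡₂ a r = - (coeff a (# 1) r + coeff a (# 3) r) ,₂ trans (at₋₁≡ a r refl) (identity (at₁ a r) (coeff a (# 1) r + coeff a (# 3) r))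
      where
      identity : ∀ v h → v - + 2 * h ≡ v + + 2 * - h
      identity = ℤ.solve-∀

    atᵢ-≡₂ : ∀ a r → atᵢ a r + atᵢ′ a r ≡₂ at₁ a r
    atᵢ-≡₂ a r = - (coeff a (# 2) r + coeff a (# 3) r) ,₂
      trans (cong (λ u → atᵢ a r + u) (atᵢ′≡ a r refl)) (identity (at₁ a r) (atᵢ a r) (coeff a (# 2) r + coeff a (# 3) r))
      where
      identity : ∀ v u h → u + (v - u - + 2 * h) ≡ v + + 2 * - h
      identity = ℤ.solve-∀

  total : (Fin 16 → ℤ) → ℤ
  total a = at₁ a (# 0) + at₁ a (# 2) + (at₁ a (# 1) + at₁ a (# 3))

  norm₋₁-total : ∀ a → norm₋₁ a ≡₂ total a
  norm₋₁-total a = ≡₂-trans (norm₋₁-≡₂ (at₋₁ a (# 0)) (at₋₁ a (# 2)) (at₋₁ a (# 1)) (at₋₁ a (# 3)))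
    (≡₂-+ (≡₂-+ (at₋₁-≡₂ a (# 0)) (at₋₁-≡₂ a (# 2))) (≡₂-+ (at₋₁-≡₂ a (# 1)) (at₋₁-≡₂ a (# 3))))

  normᵢ-total : ∀ a → normᵢ a ≡₂ total a
  normᵢ-total a = ≡₂-trans
    (normᵢ-≡₂ (atᵢ a (# 0)) (atᵢ′ a (# 0)) (atᵢ a (# 2)) (atᵢ′ a (# 2)) (atᵢ a (# 1)) (atᵢ′ a (# 1)) (atᵢ a (# 3)) (atᵢ′ a (# 3)))
    (≡₂-+ (≡₂-+ (atᵢ-≡₂ a (# 0)) (atᵢ-≡₂ a (# 2))) (≡₂-+ (atᵢ-≡₂ a (# 1)) (atᵢ-≡₂ a (# 3))))

  odd-%ℕ : ∀ k → Odd (+ 1 + + 2 * k)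
  odd-%ℕ k = remainder (z ℤ.%ℕ 2) (ℤ.n%ℕd<d z 2) (ℤ.a≡a%ℕn+[a/ℕn]*n z 2)
    where
    z : ℤ
    z = + 1 + + 2 * k
    isolate : ∀ k m → + 1 + + 2 * k ≡ + 0 + m * + 2 → + 1 ≡ (m - k) * + 2
    isolate k m eq = trans (lhs k) (trans (cong (_- + 2 * k) eq) (rhs k m))
      where
      lhs : ∀ k → + 1 ≡ + 1 + + 2 * k - + 2 * k
      lhs = ℤ.solve-∀
      rhs : ∀ k m → + 0 + m * + 2 - + 2 * k ≡ (m - k) * + 2
      rhs = ℤ.solve-∀
    1≢even : ∀ m → + 1 ≢ m * + 2
    1≢even m eq = contradiction (ℕ.divides ℤ.∣ m ∣ (trans (cong ℤ.∣_∣ eq) (ℤ.abs-* m (+ 2)))) λ 2∣1 → ℕ.<⇒≱ (ℕ.s≤s (ℕ.s≤s ℕ.z≤n)) (ℕ.∣⇒≤ 2∣1)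
    remainder : ∀ r → r ℕ.< 2 → z ≡ + r + (z ℤ./ℕ 2) * + 2 → r ≡ 1
    remainder 0 _ eq = ⊥-elim (1≢even ((z ℤ./ℕ 2) - k) (isolate k (z ℤ./ℕ 2) eq))
    remainder 1 _ eq = refl
    remainder (suc (suc _)) (ℕ.s≤s (ℕ.s≤s ())) _

  ≡₂1⇒odd : ∀ {z} → z ≡₂ + 1 → Odd z
  ≡₂1⇒odd (k ,₂ refl) = odd-%ℕ k

  D-odd : ∀ a → total a ≡₂ + 1 → Odd (D a)
  D-odd a odd = ≡₂1⇒odd (subst (_≡₂ + 1) (sym (D-formula a))
    (≡₂-* (≡₂-* (≡₂-trans (value₁-≡₂ (at₁ a (# 0)) (at₁ a (# 2)) (at₁ a (# 1)) (at₁ a (# 3))) odd)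
      (≡₂-trans (norm₋₁-total a) odd)) (≡₂-trans (normᵢ-total a) odd)))

  private
    even-half : ∀ {x y} → x ≡₂ y → y ≡₂ + 0 → ∃ λ n → x ≡ + 2 * n
    even-half p q with ≡₂-trans p q
    ... | n ,₂ eq = n , trans eq (ℤ.+-identityˡ _)

    D-value : ∀ a {v n₁ nᵢ} → onSections (at₁ a) value₁ ≡ v → norm₋₁ a ≡ n₁ → normᵢ a ≡ nᵢ → D a ≡ v * n₁ * nᵢ
    D-value a refl refl refl = D-formula a

  -- The factors at 1, -1 and i give 16; both coordinates of the norm at ζ₈ are even, which gives 4;
  -- the norm at ζ₁₆ gives 2. Together 16 · 4 · 2 = 128.
  D-even-even : ∀ a k l → at₁ a (# 0) ≡ at₁ a (# 2) + + 2 * k → at₁ a (# 1) ≡ at₁ a (# 3) + + 2 * l → EvenValue (D a)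
  D-even-even a k l p≡ s≡ = inj₁ (proj₁ v * proj₁ m * proj₁ n ,
    trans (D-value a (trans (cong₂ (λ p s → value₁ p q s t) p≡ s≡) (proj₂ v))
                     (trans norm₋₁≡ (proj₂ m)) (proj₂ n))
      (identity (proj₁ v) (proj₁ m) (proj₁ n)))
    where
    identity : ∀ v m n → + 16 * v * (+ 4 * m) * (+ 2 * n) ≡ + 128 * (v * m * n)
    identity = ℤ.solve-∀
    q t q₋ t₋ k₋ l₋ : ℤ
    q = at₁ a (# 2)
    t = at₁ a (# 3)
    q₋ = at₋₁ a (# 2)
    t₋ = at₋₁ a (# 3)
    h : Fin 4 → ℤ
    h r = coeff a (# 1) r + coeff a (# 3) r
    k₋ = k + h (# 2) - h (# 0)
    l₋ = l + h (# 3) - h (# 1)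
    shift : ∀ q k h h′ → q + + 2 * k - + 2 * h ≡ q - + 2 * h′ + + 2 * (k + h′ - h)
    shift = ℤ.solve-∀
    p₋≡ : at₋₁ a (# 0) ≡ q₋ + + 2 * k₋
    p₋≡ = trans (at₋₁≡ a (# 0) p≡) (trans (shift q k (h (# 0)) (h (# 2))) (cong (_+ + 2 * k₋) (sym (at₋₁≡ a (# 2) refl))))
    s₋≡ : at₋₁ a (# 1) ≡ t₋ + + 2 * l₋
    s₋≡ = trans (at₋₁≡ a (# 1) s≡) (trans (shift t l (h (# 1)) (h (# 3))) (cong (_+ + 2 * l₋) (sym (at₋₁≡ a (# 3) refl))))
    v : ∃ λ w → value₁ (q + + 2 * k) q (t + + 2 * l) t ≡ + 16 * w
    v = value₁-16 q t k l
    norm₋₁≡ : norm₋₁ a ≡ sq (re₋₁ (q₋ + + 2 * k₋) q₋ (t₋ + + 2 * l₋) t₋) + sq (im₋₁ (q₋ + + 2 * k₋) q₋ (t₋ + + 2 * l₋) t₋)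
    norm₋₁≡ = cong₂ (λ p s → sq (re₋₁ p q₋ s t₋) + sq (im₋₁ p q₋ s t₋)) p₋≡ s₋≡
    m : ∃ λ w → sq (re₋₁ (q₋ + + 2 * k₋) q₋ (t₋ + + 2 * l₋) t₋) + sq (im₋₁ (q₋ + + 2 * k₋) q₋ (t₋ + + 2 * l₋) t₋) ≡ + 4 * w
    m = norm₋₁-4 q₋ t₋ k₋ l₋
    even : total a ≡₂ + 0
    even = (q + k + t + l) ,₂ trans (cong₂ (λ p s → p + q + (s + t)) p≡ s≡) (identity′ q t k l)
      where
      identity′ : ∀ q t k l → q + + 2 * k + q + (t + + 2 * l + t) ≡ + 0 + + 2 * (q + k + t + l)
      identity′ = ℤ.solve-∀
    n : ∃ λ w → normᵢ a ≡ + 2 * w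
    n = even-half (normᵢ-total a) even

  -- Always 8 · 2 · 2 · 2 = 64 divides the value, and each of the three halved norms is a candidate
  -- for n. If B + E is odd, the norm at ζ₈ or at ζ₁₆ has real part 5 mod 8. If B + E is even,
  -- either a coordinate x or y of f(i) is ±3 mod 8, or f(1)f(-1) is a multiple of 16 and the value
  -- is in 128ℤ.
  D-odd-odd : ∀ a A B C E → at₁ a (# 0) ≡ + 1 + + 2 * A → at₁ a (# 2) ≡ + 2 * B →
    at₁ a (# 1) ≡ + 1 + + 2 * C → at₁ a (# 3) ≡ + 2 * E → EvenValue (D a)
  D-odd-odd a A B C E p≡ q≡ s≡ t≡ = split (parity (B + E))
    where
    h l : Fin 4 → ℤ
    h r = coeff a (# 1) r + coeff a (# 3) r
    l r = coeff a (# 2) r + coeff a (# 3) r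
    x y : ℤ
    x = + 1 + + 2 * A - + 2 * B
    y = + 1 + + 2 * C - + 2 * E
    value : onSections (at₁ a) value₁ ≡ value₁ (+ 1 + + 2 * A) (+ 2 * B) (+ 1 + + 2 * C) (+ 2 * E)
    value = cong₄ value₁ p≡ q≡ s≡ t≡
    even : total a ≡₂ + 0
    even = (+ 1 + A + B + C + E) ,₂ trans (cong₄ (λ p q s t → p + q + (s + t)) p≡ q≡ s≡ t≡) (identity A B C E)
      where
      identity : ∀ A B C E → + 1 + + 2 * A + + 2 * B + (+ 1 + + 2 * C + + 2 * E) ≡ + 0 + + 2 * (+ 1 + A + B + C + E)
      identity = ℤ.solve-∀
    n₀ : ∃ λ n → sq x + sq y ≡ + 2 * n
    n₀ = even-half (≡₂-+ (square-≡₂ x) (square-≡₂ y)) ((+ 1 + A - B + C - E) ,₂ identity A B C E)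
      where
      identity : ∀ A B C E → + 1 + + 2 * A - + 2 * B + (+ 1 + + 2 * C - + 2 * E) ≡ + 0 + + 2 * (+ 1 + A - B + C - E)
      identity = ℤ.solve-∀
    n₁ : ∃ λ n → norm₋₁ a ≡ + 2 * n
    n₁ = even-half (norm₋₁-total a) even
    nᵢ : ∃ λ n → normᵢ a ≡ + 2 * n
    nᵢ = even-half (normᵢ-total a) even
    v : ∃ λ w → value₁ (+ 1 + + 2 * A) (+ 2 * B) (+ 1 + + 2 * C) (+ 2 * E) ≡ + 8 * w * (sq x + sq y)
    v = value₁-8 A B C E
    D-8 : D a ≡ + 8 * proj₁ v * (+ 2 * proj₁ n₀) * (+ 2 * proj₁ n₁) * (+ 2 * proj₁ nᵢ)
    D-8 = D-value a (trans value (trans (proj₂ v) (cong (+ 8 * proj₁ v *_) (proj₂ n₀)))) (proj₂ n₁) (proj₂ nᵢ)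
    collect₀ : ∀ w n₀ n₁ nᵢ → + 8 * w * (+ 2 * n₀) * (+ 2 * n₁) * (+ 2 * nᵢ) ≡ + 64 * n₀ * (w * n₁ * nᵢ)
    collect₀ = ℤ.solve-∀
    collect₁ : ∀ w n₀ n₁ nᵢ → + 8 * w * (+ 2 * n₀) * (+ 2 * n₁) * (+ 2 * nᵢ) ≡ + 64 * n₁ * (w * n₀ * nᵢ)
    collect₁ = ℤ.solve-∀
    collectᵢ : ∀ w n₀ n₁ nᵢ → + 8 * w * (+ 2 * n₀) * (+ 2 * n₁) * (+ 2 * nᵢ) ≡ + 64 * nᵢ * (w * n₀ * n₁)
    collectᵢ = ℤ.solve-∀
    via₀ : HalfSum (proj₁ n₀) → EvenValue (D a)
    via₀ half = inj₂ (proj₁ n₀ , proj₁ v * proj₁ n₁ * proj₁ nᵢ , half ,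
      trans D-8 (collect₀ (proj₁ v) (proj₁ n₀) (proj₁ n₁) (proj₁ nᵢ)))
    via₁ : HalfSum (proj₁ n₁) → EvenValue (D a)
    via₁ half = inj₂ (proj₁ n₁ , proj₁ v * proj₁ n₀ * proj₁ nᵢ , half ,
      trans D-8 (collect₁ (proj₁ v) (proj₁ n₀) (proj₁ n₁) (proj₁ nᵢ)))
    viaᵢ : HalfSum (proj₁ nᵢ) → EvenValue (D a)
    viaᵢ half = inj₂ (proj₁ nᵢ , proj₁ v * proj₁ n₀ * proj₁ n₁ , half ,
      trans D-8 (collectᵢ (proj₁ v) (proj₁ n₀) (proj₁ n₁) (proj₁ nᵢ)))
    M : ℤ
    M = B - h (# 2) + (E - h (# 3))
    re₋ : ∃ λ w → onSections (at₋₁ a) re₋₁ ≡ + 1 + + 4 * M + + 8 * w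
    re₋ = proj₁ r , trans (cong₄ re₋₁ (odd₋ (# 0) A p≡) (even₋ (# 2) B q≡) (odd₋ (# 1) C s≡) (even₋ (# 3) E t≡)) (proj₂ r)
      where
      odd₋ : ∀ r A → at₁ a r ≡ + 1 + + 2 * A → at₋₁ a r ≡ + 1 + + 2 * (A - h r)
      odd₋ r A eq = trans (at₋₁≡ a r eq) (identity A (h r))
        where
        identity : ∀ A h → + 1 + + 2 * A - + 2 * h ≡ + 1 + + 2 * (A - h)
        identity = ℤ.solve-∀
      even₋ : ∀ r B → at₁ a r ≡ + 2 * B → at₋₁ a r ≡ + 2 * (B - h r)
      even₋ r B eq = trans (at₋₁≡ a r eq) (identity B (h r))
        where
        identity : ∀ B h → + 2 * B - + 2 * h ≡ + 2 * (B - h)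
        identity = ℤ.solve-∀
      r : ∃ λ w → re₋₁ (+ 1 + + 2 * (A - h (# 0))) (+ 2 * (B - h (# 2))) (+ 1 + + 2 * (C - h (# 1))) (+ 2 * (E - h (# 3)))
        ≡ + 1 + + 4 * (B - h (# 2) + (E - h (# 3))) + + 8 * w
      r = re₋₁-mod8 (A - h (# 0)) (B - h (# 2)) (C - h (# 1)) (E - h (# 3))
    reᵢ≡ : ∃ λ w → onSections₂ (atᵢ a) (atᵢ′ a) reᵢ ≡ + 1 + + 4 * (atᵢ a (# 2) + atᵢ a (# 3)) + + 8 * w
    reᵢ≡ = proj₁ r , trans
      (cong₄ (λ p′ q′ s′ t′ → reᵢ (atᵢ a (# 0)) p′ (atᵢ a (# 2)) q′ (atᵢ a (# 1)) s′ (atᵢ a (# 3)) t′)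
        (oddᵢ (# 0) A p≡) (evenᵢ (# 2) B q≡) (oddᵢ (# 1) C s≡) (evenᵢ (# 3) E t≡))
      (proj₂ r)
      where
      oddᵢ : ∀ r A → at₁ a r ≡ + 1 + + 2 * A → atᵢ′ a r ≡ + 1 - atᵢ a r + + 2 * (A - l r)
      oddᵢ r A eq = trans (atᵢ′≡ a r eq) (identity A (atᵢ a r) (l r))
        where
        identity : ∀ A u l → + 1 + + 2 * A - u - + 2 * l ≡ + 1 - u + + 2 * (A - l)
        identity = ℤ.solve-∀
      evenᵢ : ∀ r B → at₁ a r ≡ + 2 * B → atᵢ′ a r ≡ atᵢ a r + + 2 * (B - atᵢ a r - l r)
      evenᵢ r B eq = trans (atᵢ′≡ a r eq) (identity B (atᵢ a r) (l r))
        where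
        identity : ∀ B u l → + 2 * B - u - + 2 * l ≡ u + + 2 * (B - u - l)
        identity = ℤ.solve-∀
      r = reᵢ-mod8 (atᵢ a (# 0)) (atᵢ a (# 2)) (atᵢ a (# 1)) (atᵢ a (# 3))
        (A - l (# 0)) (B - atᵢ a (# 2) - l (# 2)) (C - l (# 1)) (E - atᵢ a (# 3) - l (# 3))
    R : ℤ
    R = B - h (# 2) - coeff a (# 2) (# 2) + (E - h (# 3) - coeff a (# 2) (# 3))
    -- The real parts at ζ₈ and ζ₁₆ are 1 + 4M and 1 + 4K modulo 8, with K the bracket below. As M +
    -- K and B + E have equal parity, an odd B + E makes exactly one of M, K odd.
    link : M + (atᵢ a (# 2) + atᵢ a (# 3)) ≡ B + E + + 2 * R
    link = trans (cong₂ (λ u v → M + (u + v)) (single (# 2) B q≡) (single (# 3) E t≡))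
      (identity B E (h (# 2)) (h (# 3)) (coeff a (# 2) (# 2)) (coeff a (# 2) (# 3)))
      where
      isolate : ∀ k₀ k₁ k₂ k₃ → k₀ - k₂ ≡ k₀ + k₁ + k₂ + k₃ - (k₁ + k₃) - + 2 * k₂
      isolate = ℤ.solve-∀
      single : ∀ r B → at₁ a r ≡ + 2 * B → atᵢ a r ≡ + 2 * B - h r - + 2 * coeff a (# 2) r
      single r B eq = trans (isolate (coeff a (# 0) r) (coeff a (# 1) r) (coeff a (# 2) r) (coeff a (# 3) r))
        (cong (λ u → u - h r - + 2 * coeff a (# 2) r) eq)
      identity : ∀ B E h h′ k k′ → B - h + (E - h′) + (+ 2 * B - h - + 2 * k + (+ 2 * E - h′ - + 2 * k′))
        ≡ B + E + + 2 * (B - h - k + (E - h′ - k′))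
      identity = ℤ.solve-∀
    five : ∀ m w → + 1 + + 4 * (+ 1 + + 2 * m) + + 8 * w ≡ + 5 + + 8 * (m + w)
    five = ℤ.solve-∀
    half₁ : ∀ {r} → onSections (at₋₁ a) re₋₁ ≡ r → ±3mod8 r → HalfSum (proj₁ n₁)
    half₁ refl bad = onSections (at₋₁ a) re₋₁ , onSections (at₋₁ a) im₋₁ , bad , sym (proj₂ n₁)
    halfᵢ : ∀ {r} → onSections₂ (atᵢ a) (atᵢ′ a) reᵢ ≡ r → ±3mod8 r → HalfSum (proj₁ nᵢ)
    halfᵢ refl bad = onSections₂ (atᵢ a) (atᵢ′ a) reᵢ , onSections₂ (atᵢ a) (atᵢ′ a) imᵢ , bad , sym (proj₂ nᵢ)
    split : (∃ λ k → B + E ≡ + 2 * k) ⊎ (∃ λ k → B + E ≡ + 1 + + 2 * k) → EvenValue (D a)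
    split (inj₂ (j , B+E)) = byM (parity M)
      where
      byM : (∃ λ k → M ≡ + 2 * k) ⊎ (∃ λ k → M ≡ + 1 + + 2 * k) → EvenValue (D a)
      byM (inj₂ (m , M≡)) = via₁ (half₁
        (trans (proj₂ re₋) (trans (cong (λ u → + 1 + + 4 * u + + 8 * proj₁ re₋) M≡) (five m (proj₁ re₋)))) (5mod8 (m + proj₁ re₋)))
      byM (inj₁ (m , M≡)) = viaᵢ (halfᵢ
        (trans (proj₂ reᵢ≡) (trans (cong (λ u → + 1 + + 4 * u + + 8 * proj₁ reᵢ≡) K≡) (five (j + R - m) (proj₁ reᵢ≡)))) (5mod8 (j + R - m + proj₁ reᵢ≡)))
        where
        lhs : ∀ M K → K ≡ M + K - M
        lhs = ℤ.solve-∀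
        rhs : ∀ j R m → + 1 + + 2 * j + + 2 * R - + 2 * m ≡ + 1 + + 2 * (j + R - m)
        rhs = ℤ.solve-∀
        K≡ : atᵢ a (# 2) + atᵢ a (# 3) ≡ + 1 + + 2 * (j + R - m)
        K≡ = trans (lhs M (atᵢ a (# 2) + atᵢ a (# 3))) (trans (cong (_- M) link)
          (trans (cong₂ (λ u v → u + + 2 * R - v) B+E M≡) (rhs j R m)))
    -- f(i) = x + yi. If neither coordinate is ±3 mod 8, both are ±1, and `value₁-16′` finds one
    -- more factor 2 in f(1)f(-1).
    split (inj₁ (m , B+E)) = byX (residue (A - B)) (residue (C - E))
      where
      xs : ∀ A B → + 1 + + 2 * A - + 2 * B ≡ + 1 + + 2 * (A - B)
      xs = ℤ.solve-∀
      Residue : ℤ → Set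
      Residue k = ±3mod8 (+ 1 + + 2 * k) ⊎ (∃ λ ε → ∃ λ i → sq ε ≡ - ε × + 1 + + 2 * k ≡ + 1 + + 2 * ε + + 8 * i)
      byX : Residue (A - B) → Residue (C - E) → EvenValue (D a)
      byX (inj₁ bad) _ = via₀ (x , y , subst ±3mod8 (sym (xs A B)) bad , sym (proj₂ n₀))
      byX (inj₂ _) (inj₁ bad) = via₀ (y , x , subst ±3mod8 (sym (xs C E)) bad , trans (sym (proj₂ n₀)) (ℤ.+-comm (sq x) (sq y)))
      byX (inj₂ (ε , i , ε² , x≡)) (inj₂ (φ , j , φ² , y≡)) = inj₁ (proj₁ u * proj₁ n₀ * proj₁ n₁ * proj₁ nᵢ ,
        trans (D-value a value-16 (proj₂ n₁) (proj₂ nᵢ)) (collect (proj₁ u) (proj₁ n₀) (proj₁ n₁) (proj₁ nᵢ)))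
        where
        collect : ∀ w n₀ n₁ nᵢ → + 16 * w * (+ 2 * n₀) * (+ 2 * n₁) * (+ 2 * nᵢ) ≡ + 128 * (w * n₀ * n₁ * nᵢ)
        collect = ℤ.solve-∀
        p s E′ : ℤ
        E′ = + 2 * m - B
        p = + 1 + + 2 * ε + + 8 * i + + 2 * B
        s = + 1 + + 2 * φ + + 8 * j + + 2 * E′
        add-back : ∀ A B → + 1 + + 2 * A ≡ + 1 + + 2 * (A - B) + + 2 * B
        add-back = ℤ.solve-∀
        recover : ∀ B E → E ≡ B + E - B
        recover = ℤ.solve-∀
        E≡ : E ≡ E′
        E≡ = trans (recover B E) (cong (_- B) B+E)
        p≡′ : + 1 + + 2 * A ≡ p
        p≡′ = trans (add-back A B) (cong (_+ + 2 * B) x≡)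
        s≡′ : + 1 + + 2 * C ≡ s
        s≡′ = trans (add-back C E) (cong₂ (λ u v → u + + 2 * v) y≡ E≡)
        u : ∃ λ w → value₁ p (+ 2 * B) s (+ 2 * E′) ≡ + 16 * w * (sq (p - + 2 * B) + sq (s - + 2 * E′))
        u = value₁-16′ ε i φ j B m ε² φ²
        value-16 : onSections (at₁ a) value₁ ≡ + 16 * proj₁ u * (+ 2 * proj₁ n₀)
        value-16 = trans value (trans (cong₄ value₁ p≡′ refl s≡′ (cong (+ 2 *_) E≡)) (trans (proj₂ u)
          (cong (+ 16 * proj₁ u *_) (trans
            (cong₄ (λ p q s t → sq (p - q) + sq (s - t)) (sym p≡′) (refl {x = + 2 * B}) (sym s≡′) (cong (+ 2 *_) (sym E≡)))
            (proj₂ n₀)))))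

  private
    at₁-rotate : ∀ a → at₁ (rotate a) (# 0) ≡ at₁ a (# 3)
    at₁-rotate a = identity (coeff a (# 0) (# 3)) (coeff a (# 1) (# 3)) (coeff a (# 2) (# 3)) (coeff a (# 3) (# 3))
      where
      identity : ∀ k₀ k₁ k₂ k₃ → k₃ + k₀ + k₁ + k₂ ≡ k₀ + k₁ + k₂ + k₃
      identity = ℤ.solve-∀

    unrotate : ∀ a → EvenValue (D (rotate a)) → EvenValue (D a)
    unrotate a e = evenValue-neg (subst EvenValue (D-rotate a) e)

    OddSum : ℤ → ℤ → Set
    OddSum p q = ∃ λ k → p + q ≡ + 1 + + 2 * k

    complement-even : ∀ {p q} k B → p + q ≡ + 1 + + 2 * k → q ≡ + 2 * B → p ≡ + 1 + + 2 * (k - B)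
    complement-even {p} {q} k B eq refl = trans (recover p (+ 2 * B)) (trans (cong (_- + 2 * B) eq) (identity k B))
      where
      recover : ∀ p q → p ≡ p + q - q
      recover = ℤ.solve-∀
      identity : ∀ k B → + 1 + + 2 * k - + 2 * B ≡ + 1 + + 2 * (k - B)
      identity = ℤ.solve-∀

    complement-odd : ∀ {p q} k B → p + q ≡ + 1 + + 2 * k → q ≡ + 1 + + 2 * B → p ≡ + 2 * (k - B)
    complement-odd {p} {q} k B eq refl = trans (recover p (+ 1 + + 2 * B)) (trans (cong (_- (+ 1 + + 2 * B)) eq) (identity k B))
      where
      recover : ∀ p q → p ≡ p + q - q
      recover = ℤ.solve-∀
      identity : ∀ k B → + 1 + + 2 * k - (+ 1 + + 2 * B) ≡ + 2 * (k - B)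
      identity = ℤ.solve-∀

    Parity : ℤ → Set
    Parity x = (∃ λ k → x ≡ + 2 * k) ⊎ (∃ λ k → x ≡ + 1 + + 2 * k)

    -- Exactly one of p, q and exactly one of s, t is odd. Since a rotation takes (p, q, s, t) at 1
    -- to (t, s, p, q), at most three rotations bring the odd values to p and s.
    odd-sums : ∀ a → OddSum (at₁ a (# 0)) (at₁ a (# 2)) → OddSum (at₁ a (# 1)) (at₁ a (# 3)) →
      Parity (at₁ a (# 2)) → Parity (at₁ a (# 3)) → EvenValue (D a)
    odd-sums a (k , p+q) (l , s+t) (inj₁ (B , q≡)) (inj₁ (E , t≡)) =
      D-odd-odd a (k - B) B (l - E) E (complement-even k B p+q q≡) q≡ (complement-even l E s+t t≡) t≡
    odd-sums a (k , p+q) (l , s+t) (inj₁ (B , q≡)) (inj₂ (E , t≡)) = unrotate a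
      (D-odd-odd (rotate a) E (l - E) (k - B) B (trans (at₁-rotate a) t≡) (complement-odd l E s+t t≡) (complement-even k B p+q q≡) q≡)
    odd-sums a (k , p+q) (l , s+t) (inj₂ (B , q≡)) (inj₂ (E , t≡)) = unrotate a (unrotate (rotate a)
      (D-odd-odd (rotate (rotate a)) B (k - B) E (l - E) (trans (at₁-rotate (rotate a)) q≡) (complement-odd k B p+q q≡)
        (trans (at₁-rotate a) t≡) (complement-odd l E s+t t≡)))
    odd-sums a (k , p+q) (l , s+t) (inj₂ (B , q≡)) (inj₁ (E , t≡)) = unrotate a (unrotate (rotate a) (unrotate (rotate (rotate a))
      (D-odd-odd (rotate (rotate (rotate a))) (l - E) E B (k - B)
        (trans (at₁-rotate (rotate (rotate a))) (complement-even l E s+t t≡)) (trans (at₁-rotate a) t≡)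
        (trans (at₁-rotate (rotate a)) q≡) (complement-odd k B p+q q≡))))

  D-odd-or-even : ∀ a → Odd (D a) ⊎ EvenValue (D a)
  D-odd-or-even a = cases (parity (p + q)) (parity (s + t))
    where
    p q s t : ℤ
    p = at₁ a (# 0)
    q = at₁ a (# 2)
    s = at₁ a (# 1)
    t = at₁ a (# 3)
    shift : ∀ p q k → p + q ≡ + 2 * k → p ≡ q + + 2 * (k - q)
    shift p q k eq = trans (recover p q) (trans (cong (_- q) eq) (identity q k))
      where
      recover : ∀ p q → p ≡ p + q - q
      recover = ℤ.solve-∀
      identity : ∀ q k → + 2 * k - q ≡ q + + 2 * (k - q)
      identity = ℤ.solve-∀
    mixed : ∀ k l → + 2 * k + (+ 1 + + 2 * l) ≡ + 1 + + 2 * (k + l)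
    mixed = ℤ.solve-∀
    mixed′ : ∀ k l → + 1 + + 2 * k + + 2 * l ≡ + 1 + + 2 * (k + l)
    mixed′ = ℤ.solve-∀
    cases : Parity (p + q) → Parity (s + t) → Odd (D a) ⊎ EvenValue (D a)
    cases (inj₁ (k , eq)) (inj₁ (l , eq′)) = inj₂ (D-even-even a (k - q) (l - t) (shift p q k eq) (shift s t l eq′))
    cases (inj₁ (k , eq)) (inj₂ (l , eq′)) = inj₁ (D-odd a ((k + l) ,₂ trans (cong₂ _+_ eq eq′) (mixed k l)))
    cases (inj₂ (k , eq)) (inj₁ (l , eq′)) = inj₁ (D-odd a ((k + l) ,₂ trans (cong₂ _+_ eq eq′) (mixed′ k l)))
    cases (inj₂ o) (inj₂ o′) = inj₂ (odd-sums a o o′ (parity q) (parity t))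

-- Euclidean division in ℤ[i] and ℤ[ζ₈]

record NormEuclidean (R : Ring≡) : Set where
  open Ring≡ R
  field
    ν : Carrier → ℕ
    adjugate : Carrier → Carrier
    ν-* : ∀ x y → ν (x * y) ≡ ν x ℕ.* ν y
    *-adjugate : ∀ x → x * adjugate x ≡ ι (+ ν x)
    ν≡0⇒≡0 : ∀ x → ν x ≡ 0 → x ≡ 0#
    approximate : ∀ n → n ≢ 0 → ∀ x → ∃ λ q → ν (x - q * ι (+ n)) ℕ.< ν (ι (+ n))

module Euclid (R : Ring≡) (E : NormEuclidean R) where
  open Ring≡ R
  open Solver R
  open NormEuclidean E

  infix 4 _∣_
  _∣_ : Carrier → Carrier → Set
  x ∣ y = ∃ λ k → y ≡ k * x

  -- Multiplying a and b by the adjugate of b replaces the divisor by the rational integer ν b, for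
  -- which coordinates can be rounded. The common factor is removed from the estimate by
  -- multiplicativity of ν.
  divide : ∀ a b → ν b ≢ 0 → ∃ λ q → ν (a - q * b) ℕ.< ν b
  divide a b νb≢0 with approximate (ν b) νb≢0 (a * adjugate b)
  ... | q , close = q , ℕ.*-cancelʳ-< _ _ _ (subst₂ ℕ._<_ (trans (cong ν scaled) (ν-* _ _))
    (trans (cong ν (sym (*-adjugate b))) (ν-* _ _)) close)
    where
    scaled : a * adjugate b - q * ι (+ ν b) ≡ (a - q * b) * adjugate b
    scaled = trans (cong (λ n → a * adjugate b - q * n) (sym (*-adjugate b)))
      (solve 4 (λ a b c q → a ⊗ c ⊖ q ⊗ (b ⊗ c) ⊜ (a ⊖ q ⊗ b) ⊗ c) refl a b (adjugate b) q)

  unit : ∀ x → ν x ≡ 1 → ∃ λ y → x * y ≡ 1#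
  unit x νx≡1 = adjugate x , trans (*-adjugate x) (cong (λ n → ι (+ n)) νx≡1)

  record Bézout (a b : Carrier) : Set where
    field
      d x y a′ b′ : Carrier
      combination : d ≡ x * a + y * b
      a≡ : a ≡ a′ * d
      b≡ : b ≡ b′ * d

  bézout : ∀ a b → Bézout a b
  bézout a b = go (suc (ν b)) a b ℕ.≤-refl
    where
    go : ∀ fuel a b → ν b ℕ.< fuel → Bézout a b
    go (suc fuel) a b (ℕ.s≤s νb≤) with ν b ℕ.≟ 0
    ... | yes νb≡0 = record
      { d = a ; x = 1# ; y = 0# ; a′ = 1# ; b′ = 0#
      ; combination = solve 2 (λ a b → a ⊜ Κ (+ 1) ⊗ a ⊕ Κ (+ 0) ⊗ b) refl a b
      ; a≡ = sym (*-identityˡ a) ; b≡ = trans (ν≡0⇒≡0 b νb≡0) (sym (zeroˡ a)) }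
    ... | no νb≢0 = step (proj₁ quotient) (go fuel b (a - proj₁ quotient * b) (ℕ.<-≤-trans (proj₂ quotient) νb≤))
      where
      quotient = divide a b νb≢0
      step : ∀ q → Bézout b (a - q * b) → Bézout a b
      step q rec = record
        { d = d ; x = y ; y = x - y * q ; a′ = q * a′ + b′ ; b′ = a′
        ; combination = trans combination
            (solve 5 (λ x y a b q → x ⊗ b ⊕ y ⊗ (a ⊖ q ⊗ b) ⊜ y ⊗ a ⊕ (x ⊖ y ⊗ q) ⊗ b) refl x y a b q)
        ; a≡ = begin
            a                          ≡⟨ solve 3 (λ a b q → a ⊜ q ⊗ b ⊕ (a ⊖ q ⊗ b)) refl a b q ⟩
            q * b + (a - q * b)        ≡⟨ cong₂ (λ u v → q * u + v) a≡ b≡ ⟩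
            q * (a′ * d) + b′ * d      ≡⟨ solve 4 (λ q a b d → q ⊗ (a ⊗ d) ⊕ b ⊗ d ⊜ (q ⊗ a ⊕ b) ⊗ d) refl q a′ b′ d ⟩
            (q * a′ + b′) * d ∎
        ; b≡ = a≡ }
        where
        open Bézout rec
        open ≡-Reasoning

  -- The factor d is gcd (α , x).
  split : ∀ α x y → α ∣ x * y → ∃ λ d → ∃ λ e → α ≡ d * e × (ν d ≡ 1 → α ∣ y) × (ν e ≡ 1 → α ∣ x)
  split α x y (k , xy≡) = d , a′ , trans a≡ (*-comm a′ d) , d-unit , e-unit
    where
    open Bézout (bézout α x) renaming (x to u; y to v; b′ to x′; b≡ to x≡)
    open ≡-Reasoning
    d-unit : ν d ≡ 1 → α ∣ y
    d-unit νd≡1 = (u * y + v * k) * d⁻¹ , (begin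
      y                                   ≡⟨ *-identityˡ y ⟨
      1# * y                              ≡⟨ cong (_* y) (proj₂ (unit d νd≡1)) ⟨
      d * d⁻¹ * y                         ≡⟨ cong (λ d → d * d⁻¹ * y) combination ⟩
      (u * α + v * x) * d⁻¹ * y
        ≡⟨ solve 6 (λ u v α x y i → (u ⊗ α ⊕ v ⊗ x) ⊗ i ⊗ y ⊜ (u ⊗ y ⊗ α ⊕ v ⊗ (x ⊗ y)) ⊗ i) refl u v α x y d⁻¹ ⟩
      (u * y * α + v * (x * y)) * d⁻¹     ≡⟨ cong (λ w → (u * y * α + v * w) * d⁻¹) xy≡ ⟩
      (u * y * α + v * (k * α)) * d⁻¹
        ≡⟨ solve 6 (λ u v α k y i → (u ⊗ y ⊗ α ⊕ v ⊗ (k ⊗ α)) ⊗ i ⊜ (u ⊗ y ⊕ v ⊗ k) ⊗ i ⊗ α) refl u v α k y d⁻¹ ⟩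
      (u * y + v * k) * d⁻¹ * α ∎)
      where d⁻¹ = proj₁ (unit d νd≡1)
    e-unit : ν a′ ≡ 1 → α ∣ x
    e-unit νe≡1 = x′ * e⁻¹ , (begin
      x                      ≡⟨ x≡ ⟩
      x′ * d                 ≡⟨ solve 2 (λ x d → x ⊗ d ⊜ x ⊗ Κ (+ 1) ⊗ d) refl x′ d ⟩
      x′ * 1# * d            ≡⟨ cong (λ w → x′ * w * d) (proj₂ (unit a′ νe≡1)) ⟨
      x′ * (a′ * e⁻¹) * d    ≡⟨ solve 4 (λ x a i d → x ⊗ (a ⊗ i) ⊗ d ⊜ x ⊗ i ⊗ (a ⊗ d)) refl x′ a′ e⁻¹ d ⟩
      x′ * e⁻¹ * (a′ * d)    ≡⟨ cong (λ w → x′ * e⁻¹ * w) a≡ ⟨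
      x′ * e⁻¹ * α ∎)
      where e⁻¹ = proj₁ (unit a′ νe≡1)

module _ where
  open import Data.Integer using (_+_; _*_; _-_; -_; _≤_; _<_; ∣_∣)

  square-∣∣ : ∀ x → + (∣ x ∣ ℕ.* ∣ x ∣) ≡ x * x
  square-∣∣ (+ n) = ℤ.pos-* n n
  square-∣∣ -[1+ n ] = refl

  νᵢ : ℤ × ℤ → ℕ
  νᵢ (a , b) = ∣ a ∣ ℕ.* ∣ a ∣ ℕ.+ ∣ b ∣ ℕ.* ∣ b ∣

  +νᵢ : ∀ x → + νᵢ x ≡ ℤ[i].norm x
  +νᵢ (a , b) = trans (ℤ.pos-+ (∣ a ∣ ℕ.* ∣ a ∣) (∣ b ∣ ℕ.* ∣ b ∣))
    (trans (cong₂ _+_ (square-∣∣ a) (square-∣∣ b)) (identity a b))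
    where
    identity : ∀ a b → a * a + b * b ≡ a * a + - (- (+ 1) * (b * b))
    identity = ℤ.solve-∀

  νᵢ-* : ∀ x y → νᵢ (Ring≡._*_ ℤ[i].ring x y) ≡ νᵢ x ℕ.* νᵢ y
  νᵢ-* x y = ℤ.+-injective (trans (+νᵢ (Ring≡._*_ ℤ[i].ring x y)) (trans (ℤ[i].norm-* x y)
    (trans (cong₂ _*_ (sym (+νᵢ x)) (sym (+νᵢ y))) (sym (ℤ.pos-* (νᵢ x) (νᵢ y))))))

  νᵢ≡0⇒≡0 : ∀ x → νᵢ x ≡ 0 → x ≡ (+ 0 , + 0)
  νᵢ≡0⇒≡0 (a , b) eq = cong₂ _,_ (root a (ℕ.m+n≡0⇒m≡0 _ eq)) (root b (ℕ.m+n≡0⇒n≡0 (∣ a ∣ ℕ.* ∣ a ∣) eq))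
    where
    root : ∀ a → ∣ a ∣ ℕ.* ∣ a ∣ ≡ 0 → a ≡ + 0
    root a eq with ℕ.m*n≡0⇒m≡0∨n≡0 ∣ a ∣ eq
    ... | inj₁ z = ℤ.∣i∣≡0⇒i≡0 z
    ... | inj₂ z = ℤ.∣i∣≡0⇒i≡0 z

  ν₈ : (ℤ × ℤ) × (ℤ × ℤ) → ℕ
  ν₈ x = νᵢ (ℤ[ζ₈].norm x)

  ν₈-* : ∀ x y → ν₈ (Ring≡._*_ ℤ[ζ₈].ring x y) ≡ ν₈ x ℕ.* ν₈ y
  ν₈-* x y = trans (cong νᵢ (ℤ[ζ₈].norm-* x y)) (νᵢ-* (ℤ[ζ₈].norm x) (ℤ[ζ₈].norm y))

  trace-form cross-form : (a b c d : ℤ) → ℤ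
  trace-form a b c d = a * a + b * b + c * c + d * d
  cross-form a b c d = a * c + c * b + b * d - d * a

  -- The norm from ℚ(ζ₈) to ℚ(√2) is P + Q√2.
  ν₈-form : ∀ a b c d → + ν₈ ((a , b) , (c , d)) ≡
    trace-form a b c d * trace-form a b c d - + 2 * (cross-form a b c d * cross-form a b c d)
  ν₈-form a b c d = trans (+νᵢ (ℤ[ζ₈].norm ((a , b) , (c , d)))) (identity a b c d)
    where
    open Solver ℤ≡
    E = Expr ℤ 4
    N₈ : E → E → E → E → E × E
    N₈ a b c d =
      let c² = c ⊗ c ⊕ Κ (- (+ 1)) ⊗ (d ⊗ d) ; d² = c ⊗ d ⊕ d ⊗ c in
      (a ⊗ a ⊕ Κ (- (+ 1)) ⊗ (b ⊗ b)) ⊕ ⊝ (Κ (+ 0) ⊗ c² ⊕ Κ (- (+ 1)) ⊗ (Κ (+ 1) ⊗ d²)) ,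
      (a ⊗ b ⊕ b ⊗ a) ⊕ ⊝ (Κ (+ 0) ⊗ d² ⊕ Κ (+ 1) ⊗ c²)
    identity : ∀ a b c d → ℤ[i].norm (ℤ[ζ₈].norm ((a , b) , (c , d))) ≡
      trace-form a b c d * trace-form a b c d - + 2 * (cross-form a b c d * cross-form a b c d)
    identity = solve 4 (λ a b c d →
      let x = proj₁ (N₈ a b c d) ; y = proj₂ (N₈ a b c d)
          P = a ⊗ a ⊕ b ⊗ b ⊕ c ⊗ c ⊕ d ⊗ d ; Q = a ⊗ c ⊕ c ⊗ b ⊕ b ⊗ d ⊖ d ⊗ a in
      x ⊗ x ⊕ ⊝ (Κ (- (+ 1)) ⊗ (y ⊗ y)) ⊜ P ⊗ P ⊖ Κ (+ 2) ⊗ (Q ⊗ Q)) refl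

  √2-irrational : ∀ m k → m ℕ.* m ≡ 2 ℕ.* (k ℕ.* k) → m ≡ 0
  √2-irrational m k = go (suc m) m k ℕ.≤-refl
    where
    go : ∀ fuel m k → m ℕ.< fuel → m ℕ.* m ≡ 2 ℕ.* (k ℕ.* k) → m ≡ 0
    go (suc fuel) zero k _ eq = refl
    go (suc fuel) m@(suc _) k (ℕ.s≤s m≤) eq = ⊥-elim (descend (even-factor (ℕ.divides (k ℕ.* k) (trans eq (ℕ.*-comm 2 (k ℕ.* k))))))
      where
      even-factor : 2 ℕ.∣ m ℕ.* m → 2 ℕ.∣ m
      even-factor 2∣ with euclidsLemma m m (from-yes (prime? 2)) 2∣
      ... | inj₁ x = x
      ... | inj₂ x = x
      k<m : k ℕ.< m
      k<m = ℕ.≰⇒> λ m≤k → ℕ.<⇒≢ (ℕ.<-≤-trans (bigger k m≤k) (ℕ.≤-reflexive refl)) eq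
        where
        bigger : ∀ k → m ℕ.≤ k → m ℕ.* m ℕ.< 2 ℕ.* (k ℕ.* k)
        bigger k m≤k = ℕ.≤-<-trans (ℕ.*-mono-≤ m≤k m≤k)
          (ℕ.m<m+n (k ℕ.* k) (ℕ.≤-trans (ℕ.*-mono-≤ (ℕ.≤-trans (ℕ.s≤s ℕ.z≤n) m≤k) (ℕ.≤-trans (ℕ.s≤s ℕ.z≤n) m≤k))
            (ℕ.m≤m+n (k ℕ.* k) 0)))
      descend : 2 ℕ.∣ m → ⊥
      descend (ℕ.divides m′ m≡) = ℕ.<⇒≢ (ℕ.≤-<-trans ℕ.z≤n k<m) (sym m≡0)
        where
        halved : k ℕ.* k ≡ 2 ℕ.* (m′ ℕ.* m′)
        halved = ℕ.*-cancelˡ-≡ _ _ 2 (trans (sym eq) (trans (cong (λ m → m ℕ.* m) m≡) (rearrange m′)))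
          where
          rearrange : ∀ m → m ℕ.* 2 ℕ.* (m ℕ.* 2) ≡ 2 ℕ.* (2 ℕ.* (m ℕ.* m))
          rearrange = ℕ.solve-∀
        m≡0 : m ≡ 0
        m≡0 = [ id , id ]′ (ℕ.m*n≡0⇒m≡0∨n≡0 m (trans eq (cong (λ k → 2 ℕ.* (k ℕ.* k))
          (go fuel k m′ (ℕ.<-≤-trans k<m m≤) halved))))

  -- P² = 2Q² forces P = 0, as √2 is irrational, and P is the sum of the squares of the coordinates.
  ν₈≡0⇒≡0 : ∀ x → ν₈ x ≡ 0 → x ≡ ((+ 0 , + 0) , (+ 0 , + 0))
  ν₈≡0⇒≡0 ((a , b) , (c , d)) eq = cong₂ _,_
    (νᵢ≡0⇒≡0 (a , b) (ℕ.m+n≡0⇒m≡0 (νᵢ (a , b)) P≡0)) (νᵢ≡0⇒≡0 (c , d) (ℕ.m+n≡0⇒n≡0 (νᵢ (a , b)) P≡0))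
    where
    P : ℕ
    P = νᵢ (a , b) ℕ.+ νᵢ (c , d)
    Q = cross-form a b c d
    +P : + P ≡ trace-form a b c d
    +P = trans (ℤ.pos-+ (νᵢ (a , b)) (νᵢ (c , d))) (trans (cong₂ _+_ (+νᵢ (a , b)) (+νᵢ (c , d))) (identity a b c d))
      where
      identity : ∀ a b c d → a * a + - (- (+ 1) * (b * b)) + (c * c + - (- (+ 1) * (d * d))) ≡ a * a + b * b + c * c + d * d
      identity = ℤ.solve-∀
    P²≡2Q² : P ℕ.* P ≡ 2 ℕ.* (∣ Q ∣ ℕ.* ∣ Q ∣)
    P²≡2Q² = ℤ.+-injective (begin
      + (P ℕ.* P)                                  ≡⟨ ℤ.pos-* P P ⟩
      + P * + P                                    ≡⟨ cong (λ p → p * p) +P ⟩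
      tr * tr                                      ≡⟨ identity (tr * tr) (Q * Q) ⟩
      (tr * tr - + 2 * (Q * Q)) + + 2 * (Q * Q)      ≡⟨ cong (_+ + 2 * (Q * Q)) (trans (sym (ν₈-form a b c d)) (cong +_ eq)) ⟩
      + 0 + + 2 * (Q * Q)                          ≡⟨ ℤ.+-identityˡ _ ⟩
      + 2 * (Q * Q)                                ≡⟨ cong (+ 2 *_) (square-∣∣ Q) ⟨
      + 2 * + (∣ Q ∣ ℕ.* ∣ Q ∣)                    ≡⟨ ℤ.pos-* 2 (∣ Q ∣ ℕ.* ∣ Q ∣) ⟨
      + (2 ℕ.* (∣ Q ∣ ℕ.* ∣ Q ∣)) ∎)
      where
      open ≡-Reasoning
      tr = trace-form a b c d
      identity : ∀ x y → x ≡ (x - + 2 * y) + + 2 * y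
      identity = ℤ.solve-∀
    P≡0 : P ≡ 0
    P≡0 = √2-irrational P ∣ Q ∣ P²≡2Q²

  -- Nearest integer: y = 2ρ for the remainder ρ.
  record Rounding (n : ℕ) (x : ℤ) : Set where
    field
      q : ℤ
      upper : + 2 * (x - q * + n) < + n
      lower : - + n ≤ + 2 * (x - q * + n)

  -- The floor of x/n + 1/2. The half-open interval resolves every tie to -n/2, so in ℤ[ζ₈] only one
  -- vector with all coordinates tied has to be examined.
  round : ∀ n → n ≢ 0 → ∀ x → Rounding n x
  round zero n≢0 x = ⊥-elim (n≢0 refl)
  round n@(suc _) _ x = record
    { q = Q
    ; upper = subst₂ _<_ (sym y≡) (trans (cong (_+ - + n) (ℤ.pos-* 2 n)) (double-minus (+ n))) (ℤ.+-monoˡ-< (- + n) r<2n)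
    ; lower = subst₂ _≤_ (ℤ.+-identityˡ (- + n)) (sym y≡) (ℤ.+-monoˡ-≤ (- + n) 0≤r) }
    where
    z = + 2 * x + + n
    r = z ℤ.%ℕ (2 ℕ.* n)
    Q = z ℤ./ℕ (2 ℕ.* n)
    r<2n : + r < + (2 ℕ.* n)
    r<2n = ℤ.+<+ (ℤ.n%ℕd<d z (2 ℕ.* n))
    0≤r : + 0 ≤ + r
    0≤r = ℤ.+≤+ ℕ.z≤n
    double-minus : ∀ m → + 2 * m + - m ≡ m
    double-minus = ℤ.solve-∀
    y≡ : + 2 * (x - Q * + n) ≡ + r + - + n
    y≡ = trans (lhs x Q (+ n)) (trans (cong (λ z → z - + 2 * (Q * + n) - + n)
      (trans (ℤ.a≡a%ℕn+[a/ℕn]*n z (2 ℕ.* n)) (cong (λ m → + r + Q * m) (ℤ.pos-* 2 n)))) (rhs (+ r) Q (+ n)))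
      where
      lhs : ∀ x q n → + 2 * (x - q * n) ≡ + 2 * x + n - + 2 * (q * n) - n
      lhs = ℤ.solve-∀
      rhs : ∀ r q n → r + q * (+ 2 * n) - + 2 * (q * n) - n ≡ r + - n
      rhs = ℤ.solve-∀

  round-∣∣ : ∀ {n x} (r : Rounding n x) → 2 ℕ.* ∣ x - Rounding.q r * + n ∣ ℕ.≤ n
  round-∣∣ {n} {x} r = subst (ℕ._≤ n) (ℤ.abs-* (+ 2) (x - q * + n)) (bound (+ 2 * (x - q * + n)) (ℤ.<⇒≤ upper) lower)
    where
    open Rounding r
    bound : ∀ y → y ≤ + n → - + n ≤ y → ∣ y ∣ ℕ.≤ n
    bound (+ k) (ℤ.+≤+ k≤n) _ = k≤n
    bound -[1+ k ] _ -n≤ = ℤ.drop‿+≤+ (subst (+ suc k ≤_) (ℤ.neg-involutive (+ n)) (ℤ.neg-mono-≤ -n≤))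

  square-≤ : ∀ {m n} → 2 ℕ.* m ℕ.≤ n → 4 ℕ.* (m ℕ.* m) ℕ.≤ n ℕ.* n
  square-≤ {m} {n} le = ℕ.≤-trans (ℕ.≤-reflexive (identity m)) (ℕ.*-mono-≤ le le)
    where
    identity : ∀ m → 4 ℕ.* (m ℕ.* m) ≡ 2 ℕ.* m ℕ.* (2 ℕ.* m)
    identity = ℕ.solve-∀

  ℤ[i]-euclidean : NormEuclidean ℤ[i].ring
  ℤ[i]-euclidean = record
    { ν = νᵢ ; adjugate = ℤ[i].conj ; ν-* = νᵢ-*
    ; *-adjugate = λ x → trans (ℤ[i].*-conj x) (cong (λ n → n , + 0) (sym (+νᵢ x)))
    ; ν≡0⇒≡0 = νᵢ≡0⇒≡0
    ; approximate = approx }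
    where
    open Ring≡ ℤ[i].ring using () renaming (_-_ to _-ᵢ_; _*_ to _*ᵢ_; ι to ιᵢ)
    approx : ∀ n → n ≢ 0 → ∀ x → ∃ λ q → νᵢ (x -ᵢ q *ᵢ ιᵢ (+ n)) ℕ.< νᵢ (ιᵢ (+ n))
    approx n n≢0 (x , y) = (X.q , Y.q) ,
      subst₂ ℕ._<_ (cong νᵢ (sym (cong₂ _,_ (re x X.q Y.q (+ n)) (im y X.q Y.q (+ n))))) (sym (ℕ.+-identityʳ (n ℕ.* n)))
        (ℕ.≰⇒> λ n²≤ν → n≢0 (zero-square n (ℕ.≤-trans (ℕ.*-monoʳ-≤ 4 n²≤ν) 4ν≤2n²)))
      where
      rx = round n n≢0 x
      ry = round n n≢0 y
      module X = Rounding rx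
      module Y = Rounding ry
      re : ∀ x q q′ n → x + - (q * n + - (+ 1) * (q′ * + 0)) ≡ x - q * n
      re = ℤ.solve-∀
      im : ∀ y q q′ n → y + - (q * + 0 + q′ * n) ≡ y - q′ * n
      im = ℤ.solve-∀
      u = ∣ x - X.q * + n ∣
      v = ∣ y - Y.q * + n ∣
      4ν≤2n² : 4 ℕ.* (u ℕ.* u ℕ.+ v ℕ.* v) ℕ.≤ n ℕ.* n ℕ.+ n ℕ.* n
      4ν≤2n² = ℕ.≤-trans (ℕ.≤-reflexive (ℕ.*-distribˡ-+ 4 (u ℕ.* u) (v ℕ.* v)))
        (ℕ.+-mono-≤ (square-≤ {u} (round-∣∣ rx)) (square-≤ {v} (round-∣∣ ry)))
      zero-square : ∀ n → 4 ℕ.* (n ℕ.* n) ℕ.≤ n ℕ.* n ℕ.+ n ℕ.* n → n ≡ 0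
      zero-square zero _ = refl
      zero-square n@(suc _) le = ⊥-elim (ℕ.<⇒≱ (ℕ.+-monoʳ-< (n ℕ.* n) (ℕ.m<m+n (n ℕ.* n) (ℕ.s≤s ℕ.z≤n))) le)

  ℤ[ζ₈]-euclidean : NormEuclidean ℤ[ζ₈].ring
  ℤ[ζ₈]-euclidean = record
    { ν = ν₈ ; adjugate = adj ; ν-* = ν₈-* ; *-adjugate = *-adj ; ν≡0⇒≡0 = ν₈≡0⇒≡0 ; approximate = approx }
    where
    module R = Ring≡ ℤ[ζ₈].ring
    adj : (ℤ × ℤ) × (ℤ × ℤ) → (ℤ × ℤ) × (ℤ × ℤ)
    adj x = ℤ[ζ₈].conj x R.* ℤ[ζ₈].embed (ℤ[i].conj (ℤ[ζ₈].norm x))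
    *-adj : ∀ x → x R.* adj x ≡ R.ι (+ ν₈ x)
    *-adj x = trans (sym (R.*-assoc x (ℤ[ζ₈].conj x) (ℤ[ζ₈].embed (ℤ[i].conj (ℤ[ζ₈].norm x)))))
      (trans (cong (R._* ℤ[ζ₈].embed (ℤ[i].conj (ℤ[ζ₈].norm x))) (ℤ[ζ₈].*-conj x))
      (trans (sym (Hom.map-* (embed-hom ℤ[i].ring ζ₈²) (ℤ[ζ₈].norm x) (ℤ[i].conj (ℤ[ζ₈].norm x))))
        (cong ℤ[ζ₈].embed (NormEuclidean.*-adjugate ℤ[i]-euclidean (ℤ[ζ₈].norm x)))))
    fourth : ℕ → ℕ
    fourth n = (n ℕ.* n) ℕ.* (n ℕ.* n)
    ν₈-split : ∀ a b c d → ν₈ ((a , b) , (c , d)) ℕ.+ 2 ℕ.* (∣ cross-form a b c d ∣ ℕ.* ∣ cross-form a b c d ∣)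
      ≡ (νᵢ (a , b) ℕ.+ νᵢ (c , d)) ℕ.* (νᵢ (a , b) ℕ.+ νᵢ (c , d))
    ν₈-split a b c d = ℤ.+-injective (begin
      + (ν ℕ.+ 2 ℕ.* (∣ Q ∣ ℕ.* ∣ Q ∣))           ≡⟨ ℤ.pos-+ ν (2 ℕ.* (∣ Q ∣ ℕ.* ∣ Q ∣)) ⟩
      + ν + + (2 ℕ.* (∣ Q ∣ ℕ.* ∣ Q ∣))           ≡⟨ cong₂ _+_ (ν₈-form a b c d) (trans (ℤ.pos-* 2 (∣ Q ∣ ℕ.* ∣ Q ∣)) (cong (+ 2 *_) (square-∣∣ Q))) ⟩
      (tr * tr - + 2 * (Q * Q)) + + 2 * (Q * Q)   ≡⟨ identity (tr * tr) (Q * Q) ⟩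
      tr * tr                                     ≡⟨ cong (λ p → p * p) +P ⟨
      + P * + P                                   ≡⟨ ℤ.pos-* P P ⟨
      + (P ℕ.* P) ∎)
      where
      open ≡-Reasoning
      ν = ν₈ ((a , b) , (c , d))
      Q = cross-form a b c d
      tr = trace-form a b c d
      P = νᵢ (a , b) ℕ.+ νᵢ (c , d)
      identity : ∀ x y → (x - + 2 * y) + + 2 * y ≡ x
      identity = ℤ.solve-∀
      +P : + P ≡ tr
      +P = trans (ℤ.pos-+ (νᵢ (a , b)) (νᵢ (c , d))) (trans (cong₂ _+_ (+νᵢ (a , b)) (+νᵢ (c , d))) (sum a b c d))
        where
        sum : ∀ a b c d → a * a + - (- (+ 1) * (b * b)) + (c * c + - (- (+ 1) * (d * d))) ≡ a * a + b * b + c * c + d * d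
        sum = ℤ.solve-∀
    ν₈-ι : ∀ n → ν₈ (R.ι (+ n)) ≡ fourth n
    ν₈-ι n = ℤ.+-injective (trans (ν₈-form (+ n) (+ 0) (+ 0) (+ 0)) (trans (identity (+ n))
      (trans (cong₂ _*_ (sym (ℤ.pos-* n n)) (sym (ℤ.pos-* n n))) (sym (ℤ.pos-* (n ℕ.* n) (n ℕ.* n))))))
      where
      identity : ∀ n → (n * n + + 0 * + 0 + + 0 * + 0 + + 0 * + 0) * (n * n + + 0 * + 0 + + 0 * + 0 + + 0 * + 0)
        - + 2 * ((n * + 0 + + 0 * + 0 + + 0 * + 0 - + 0 * n) * (n * + 0 + + 0 * + 0 + + 0 * + 0 - + 0 * n)) ≡ n * n * (n * n)
      identity = ℤ.solve-∀
    tight : ∀ {n x} → n ≢ 0 → (r : Rounding n x) → (2 ℕ.* ∣ x - Rounding.q r * + n ∣ ℕ.< n) ⊎ (+ 2 * (x - Rounding.q r * + n) ≡ - + n)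
    tight {n} {x} n≢0 r with ℕ.m≤n⇒m<n∨m≡n (round-∣∣ r)
    ... | inj₁ lt = inj₁ lt
    ... | inj₂ eq = inj₂ (negative (+ 2 * (x - Rounding.q r * + n)) (Rounding.upper r) (trans (ℤ.abs-* (+ 2) (x - Rounding.q r * + n)) eq))
      where
      negative : ∀ y → y < + n → ∣ y ∣ ≡ n → y ≡ - + n
      negative (+ k) (ℤ.+<+ k<n) refl = ⊥-elim (ℕ.<-irrefl refl k<n)
      negative -[1+ k ] _ refl = refl
    -- If every coordinate of 2ρ is -n then ν₈ ρ = n⁴/2; otherwise P < n².
    approx : ∀ n → n ≢ 0 → ∀ x → ∃ λ q → ν₈ (x R.- q R.* R.ι (+ n)) ℕ.< ν₈ (R.ι (+ n))
    approx n n≢0 ((x , y) , (z , w)) = ((X.q , Y.q) , (Z.q , W.q)) ,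
      subst₂ ℕ._<_ (cong ν₈ (sym (cong₂ _,_
          (cong₂ _,_ (re x X.q Y.q Z.q W.q (+ n)) (im y X.q Y.q Z.q W.q (+ n)))
          (cong₂ _,_ (re′ z X.q Y.q Z.q W.q (+ n)) (im′ w X.q Y.q Z.q W.q (+ n))))))
        (sym (ν₈-ι n)) (cases (tight n≢0 rx) (tight n≢0 ry) (tight n≢0 rz) (tight n≢0 rw))
      where
      rx = round n n≢0 x
      ry = round n n≢0 y
      rz = round n n≢0 z
      rw = round n n≢0 w
      module X = Rounding rx
      module Y = Rounding ry
      module Z = Rounding rz
      module W = Rounding rw
      re : ∀ x a b c d n → x + - ((a * n + - (+ 1) * (b * + 0)) + (+ 0 * (c * + 0 + - (+ 1) * (d * + 0)) + - (+ 1) * (+ 1 * (c * + 0 + d * + 0)))) ≡ x - a * n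
      re = ℤ.solve-∀
      im : ∀ y a b c d n → y + - ((a * + 0 + b * n) + (+ 0 * (c * + 0 + d * + 0) + + 1 * (c * + 0 + - (+ 1) * (d * + 0)))) ≡ y - b * n
      im = ℤ.solve-∀
      re′ : ∀ z a b c d n → z + - ((a * + 0 + - (+ 1) * (b * + 0)) + (c * n + - (+ 1) * (d * + 0))) ≡ z - c * n
      re′ = ℤ.solve-∀
      im′ : ∀ w a b c d n → w + - ((a * + 0 + b * + 0) + (c * + 0 + d * n)) ≡ w - d * n
      im′ = ℤ.solve-∀
      a = x - X.q * + n
      b = y - Y.q * + n
      c = z - Z.q * + n
      d = w - W.q * + n
      P : ℕ
      P = νᵢ (a , b) ℕ.+ νᵢ (c , d)
      bound : ∀ {p q r s} → p ℕ.≤ n ℕ.* n → q ℕ.≤ n ℕ.* n → r ℕ.≤ n ℕ.* n → s ℕ.≤ n ℕ.* n → p ℕ.+ q ℕ.+ (r ℕ.+ s) ℕ.≤ 4 ℕ.* (n ℕ.* n)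
      bound p q r s = ℕ.≤-trans (ℕ.+-mono-≤ (ℕ.+-mono-≤ p q) (ℕ.+-mono-≤ r s)) (ℕ.≤-reflexive (four (n ℕ.* n)))
        where
        four : ∀ m → m ℕ.+ m ℕ.+ (m ℕ.+ m) ≡ 4 ℕ.* m
        four = ℕ.solve-∀
      4P : ∀ p q r s → 4 ℕ.* (p ℕ.+ q ℕ.+ (r ℕ.+ s)) ≡ 4 ℕ.* p ℕ.+ 4 ℕ.* q ℕ.+ (4 ℕ.* r ℕ.+ 4 ℕ.* s)
      4P = ℕ.solve-∀
      la : 4 ℕ.* (∣ a ∣ ℕ.* ∣ a ∣) ℕ.≤ n ℕ.* n
      la = square-≤ {∣ a ∣} (round-∣∣ rx)
      lb : 4 ℕ.* (∣ b ∣ ℕ.* ∣ b ∣) ℕ.≤ n ℕ.* n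
      lb = square-≤ {∣ b ∣} (round-∣∣ ry)
      lc : 4 ℕ.* (∣ c ∣ ℕ.* ∣ c ∣) ℕ.≤ n ℕ.* n
      lc = square-≤ {∣ c ∣} (round-∣∣ rz)
      ld : 4 ℕ.* (∣ d ∣ ℕ.* ∣ d ∣) ℕ.≤ n ℕ.* n
      ld = square-≤ {∣ d ∣} (round-∣∣ rw)
      square-< : ∀ {m} → 2 ℕ.* m ℕ.< n → 4 ℕ.* (m ℕ.* m) ℕ.< n ℕ.* n
      square-< {m} lt = ℕ.≤-<-trans (ℕ.≤-reflexive (identity m)) (ℕ.*-mono-< lt lt)
        where
        identity : ∀ m → 4 ℕ.* (m ℕ.* m) ≡ 2 ℕ.* m ℕ.* (2 ℕ.* m)
        identity = ℕ.solve-∀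
      ν≤P² : ν₈ ((a , b) , (c , d)) ℕ.≤ P ℕ.* P
      ν≤P² = subst (ν₈ ((a , b) , (c , d)) ℕ.≤_) (ν₈-split a b c d) (ℕ.m≤m+n _ _)
      strict : 4 ℕ.* P ℕ.< 4 ℕ.* (n ℕ.* n) → ν₈ ((a , b) , (c , d)) ℕ.< fourth n
      strict lt = ℕ.≤-<-trans ν≤P² (ℕ.*-mono-< P< P<)
        where
        P< : P ℕ.< n ℕ.* n
        P< = ℕ.*-cancelˡ-< 4 P (n ℕ.* n) lt
      ka kb kc kd : ℕ
      ka = 4 ℕ.* (∣ a ∣ ℕ.* ∣ a ∣)
      kb = 4 ℕ.* (∣ b ∣ ℕ.* ∣ b ∣)
      kc = 4 ℕ.* (∣ c ∣ ℕ.* ∣ c ∣)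
      kd = 4 ℕ.* (∣ d ∣ ℕ.* ∣ d ∣)
      strict′ : ka ℕ.+ kb ℕ.+ (kc ℕ.+ kd) ℕ.< 4 ℕ.* (n ℕ.* n) → ν₈ ((a , b) , (c , d)) ℕ.< fourth n
      strict′ lt = strict (subst (ℕ._< 4 ℕ.* (n ℕ.* n)) (sym (4P (∣ a ∣ ℕ.* ∣ a ∣) (∣ b ∣ ℕ.* ∣ b ∣) (∣ c ∣ ℕ.* ∣ c ∣) (∣ d ∣ ℕ.* ∣ d ∣))) lt)
      cases : (2 ℕ.* ∣ a ∣ ℕ.< n) ⊎ (+ 2 * a ≡ - + n) → (2 ℕ.* ∣ b ∣ ℕ.< n) ⊎ (+ 2 * b ≡ - + n) →
        (2 ℕ.* ∣ c ∣ ℕ.< n) ⊎ (+ 2 * c ≡ - + n) → (2 ℕ.* ∣ d ∣ ℕ.< n) ⊎ (+ 2 * d ≡ - + n) → ν₈ ((a , b) , (c , d)) ℕ.< fourth n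
      cases (inj₁ lt) _ _ _ = strict′ (bound (square-< {∣ a ∣} lt) lb lc ld)
      cases (inj₂ _) (inj₁ lt) _ _ = strict′ (ℕ.≤-trans (ℕ.≤-reflexive (lift₂ ka kb kc kd)) (bound la (square-< {∣ b ∣} lt) lc ld))
        where
        lift₂ : ∀ p q r s → suc (p ℕ.+ q ℕ.+ (r ℕ.+ s)) ≡ p ℕ.+ suc q ℕ.+ (r ℕ.+ s)
        lift₂ = ℕ.solve-∀
      cases (inj₂ _) (inj₂ _) (inj₁ lt) _ = strict′ (ℕ.≤-trans (ℕ.≤-reflexive (lift₃ ka kb kc kd)) (bound la lb (square-< {∣ c ∣} lt) ld))
        where
        lift₃ : ∀ p q r s → suc (p ℕ.+ q ℕ.+ (r ℕ.+ s)) ≡ p ℕ.+ q ℕ.+ (suc r ℕ.+ s)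
        lift₃ = ℕ.solve-∀
      cases (inj₂ _) (inj₂ _) (inj₂ _) (inj₁ lt) = strict′ (ℕ.≤-trans (ℕ.≤-reflexive (lift₄ ka kb kc kd)) (bound la lb lc (square-< {∣ d ∣} lt)))
        where
        lift₄ : ∀ p q r s → suc (p ℕ.+ q ℕ.+ (r ℕ.+ s)) ≡ p ℕ.+ q ℕ.+ (r ℕ.+ suc s)
        lift₄ = ℕ.solve-∀
      cases (inj₂ a≡) (inj₂ b≡) (inj₂ c≡) (inj₂ d≡) = ℤ.drop‿+<+ (subst₂ _<_ (sym ν≡) (sym n⁴≡)
        (subst (λ m → + 8 * (m * m) < + 16 * (m * m)) (square-∣∣ a)
          (subst₂ _<_ (scale 8) (scale 16) (ℤ.+<+ (ℕ.*-monoˡ-< (A ℕ.* A) {{ℕ.>-nonZero A²>0}} {8} {16} (from-yes (8 ℕ.<? 16)))))))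
        where
        A : ℕ
        A = ∣ a ∣ ℕ.* ∣ a ∣
        same : ∀ {u} → + 2 * u ≡ - + n → u ≡ a
        same {u} eq = ℤ.*-cancelˡ-≡ (+ 2) u a (trans eq (sym a≡))
        ν≡ : + ν₈ ((a , b) , (c , d)) ≡ + 8 * (a * a * (a * a))
        ν≡ = trans (ν₈-form a b c d) (trans
          (cong₂ (λ b c → trace-form a b c d * trace-form a b c d - + 2 * (cross-form a b c d * cross-form a b c d)) (same b≡) (same c≡))
          (trans (cong (λ d → trace-form a a a d * trace-form a a a d - + 2 * (cross-form a a a d * cross-form a a a d)) (same d≡))
            (identity a)))
          where
          identity : ∀ a → (a * a + a * a + a * a + a * a) * (a * a + a * a + a * a + a * a)
            - + 2 * ((a * a + a * a + a * a - a * a) * (a * a + a * a + a * a - a * a)) ≡ + 8 * (a * a * (a * a))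
          identity = ℤ.solve-∀
        n≡ : + n ≡ - (+ 2 * a)
        n≡ = trans (sym (ℤ.neg-involutive (+ n))) (cong -_ (sym a≡))
        n⁴≡ : + fourth n ≡ + 16 * (a * a * (a * a))
        n⁴≡ = trans (ℤ.pos-* (n ℕ.* n) (n ℕ.* n)) (trans (cong₂ _*_ (ℤ.pos-* n n) (ℤ.pos-* n n))
          (trans (cong (λ n → n * n * (n * n)) n≡) (identity a)))
          where
          identity : ∀ a → - (+ 2 * a) * - (+ 2 * a) * (- (+ 2 * a) * - (+ 2 * a)) ≡ + 16 * (a * a * (a * a))
          identity = ℤ.solve-∀
        A>0 : 0 ℕ.< A
        A>0 = ℕ.n≢0⇒n>0 λ A≡0 → n≢0 (ℤ.+-injective (trans n≡ (cong (λ a → - (+ 2 * a))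
          (ℤ.∣i∣≡0⇒i≡0 ([ id , id ]′ (ℕ.m*n≡0⇒m≡0∨n≡0 ∣ a ∣ A≡0))))))
        A²>0 : 0 ℕ.< A ℕ.* A
        A²>0 = ℕ.*-mono-< A>0 A>0
        scale : ∀ k → + (k ℕ.* (A ℕ.* A)) ≡ + k * (+ A * + A)
        scale k = trans (ℤ.pos-* k (A ℕ.* A)) (cong (+ k *_) (ℤ.pos-* A A))

-- Norms of Gaussian integers modulo 8

module _ where
  open import Data.Integer using (_+_; _*_; _-_; -_; ∣_∣)
  open Ring≡ ℤ[i].ring using () renaming (_*_ to _*ᵢ_; ι to ιᵢ; *-comm to *ᵢ-comm; *-assoc to *ᵢ-assoc)
  open Euclid ℤ[i].ring ℤ[i]-euclidean using () renaming (_∣_ to _∣ᵢ_; split to splitᵢ)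

  data Sign± : ℤ → Set where
    plus : Sign± (+ 1)
    minus : Sign± (- (+ 1))

  Sign±-* : ∀ {e f} → Sign± e → Sign± f → Sign± (e * f)
  Sign±-* plus plus = plus
  Sign±-* plus minus = minus
  Sign±-* minus plus = minus
  Sign±-* minus minus = plus

  -- The same k in both coordinates says that a + bi ≡ ±1 modulo 4(1 + i). The constructor
  -- `imaginary` of `Good` is multiplication by i, as a + bi = i(b - ai). Thus `Good` means
  -- congruent to a unit modulo 4(1 + i), which explains its closure under products and conjugation.
  data RealGood (a b : ℤ) : Set where
    real-good : ∀ {e} → Sign± e → ∀ i k → a ≡ e + + 8 * i + + 4 * k → b ≡ + 4 * k → RealGood a b

  -- a + b ≡ ±1 and a - b ≡ ±1 (mod 8).
  data Good : ℤ × ℤ → Set where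
    real : ∀ {a b} → RealGood a b → Good (a , b)
    imaginary : ∀ {a b} → RealGood b (- a) → Good (a , b)

  Bad : ℤ × ℤ → Set
  Bad (a , b) = ±3mod8 (a + b) ⊎ ±3mod8 (a - b)

  private
    realGood-subst : ∀ {a b a′ b′} → a ≡ a′ → b ≡ b′ → RealGood a b → RealGood a′ b′
    realGood-subst refl refl g = g

    sign-neg : ∀ {e} → Sign± e → Sign± (- e)
    sign-neg plus = minus
    sign-neg minus = plus

    realGood-neg : ∀ {a b} → RealGood a b → RealGood (- a) (- b)
    realGood-neg (real-good {e} s i k refl refl) = real-good {e = - e} (sign-neg s) (- i) (- k) (re e i k) (im k)
      where
      re : ∀ e i k → - (e + + 8 * i + + 4 * k) ≡ - e + + 8 * - i + + 4 * - k
      re = ℤ.solve-∀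
      im : ∀ k → - (+ 4 * k) ≡ + 4 * - k
      im = ℤ.solve-∀

    realGood-* : ∀ {a b c d} → RealGood a b → RealGood c d → RealGood (a * c - b * d) (a * d + b * c)
    realGood-* (real-good {e} s i k refl refl) (real-good {f} t j l refl refl) = real-good {e = e * f} (Sign±-* s t)
      (e * j + f * i + + 8 * (i * j) - + 4 * (k * l)) ((e + + 8 * i + + 4 * k) * l + (f + + 8 * j + + 4 * l) * k)
      (re e i k f j l) (im e i k f j l)
      where
      re : ∀ e i k f j l → (e + + 8 * i + + 4 * k) * (f + + 8 * j + + 4 * l) - + 4 * k * (+ 4 * l)
        ≡ e * f + + 8 * (e * j + f * i + + 8 * (i * j) - + 4 * (k * l)) + + 4 * ((e + + 8 * i + + 4 * k) * l + (f + + 8 * j + + 4 * l) * k)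
      re = ℤ.solve-∀
      im : ∀ e i k f j l → (e + + 8 * i + + 4 * k) * (+ 4 * l) + + 4 * k * (f + + 8 * j + + 4 * l)
        ≡ + 4 * ((e + + 8 * i + + 4 * k) * l + (f + + 8 * j + + 4 * l) * k)
      im = ℤ.solve-∀

    realGood-conj : ∀ {a b} → RealGood a b → RealGood a (- b)
    realGood-conj (real-good {e} s i k refl refl) = real-good s (i + k) (- k) (re e i k) (im k)
      where
      re : ∀ e i k → e + + 8 * i + + 4 * k ≡ e + + 8 * (i + k) + + 4 * - k
      re = ℤ.solve-∀
      im : ∀ k → - (+ 4 * k) ≡ + 4 * - k
      im = ℤ.solve-∀

  Good-* : ∀ {x y} → Good x → Good y → Good (x *ᵢ y)
  Good-* (real {a} {b} g) (real {c} {d} h) = real (realGood-subst (re a b c d) refl (realGood-* g h))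
    where
    re : ∀ a b c d → a * c - b * d ≡ a * c + - (+ 1) * (b * d)
    re = ℤ.solve-∀
  Good-* (real {a} {b} g) (imaginary {c} {d} h) = imaginary (realGood-subst (re a b c d) (im a b c d) (realGood-* g h))
    where
    re : ∀ a b c d → a * d - b * - c ≡ a * d + b * c
    re = ℤ.solve-∀
    im : ∀ a b c d → a * - c + b * d ≡ - (a * c + - (+ 1) * (b * d))
    im = ℤ.solve-∀
  Good-* (imaginary {a} {b} g) (real {c} {d} h) = imaginary (realGood-subst (re a b c d) (im a b c d) (realGood-* g h))
    where
    re : ∀ a b c d → b * c - - a * d ≡ a * d + b * c
    re = ℤ.solve-∀
    im : ∀ a b c d → b * d + - a * c ≡ - (a * c + - (+ 1) * (b * d))
    im = ℤ.solve-∀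
  Good-* (imaginary {a} {b} g) (imaginary {c} {d} h) = real (realGood-subst (re a b c d) (im a b c d) (realGood-neg (realGood-* g h)))
    where
    re : ∀ a b c d → - (b * d - - a * - c) ≡ a * c + - (+ 1) * (b * d)
    re = ℤ.solve-∀
    im : ∀ a b c d → - (b * - c + - a * d) ≡ a * d + b * c
    im = ℤ.solve-∀

  Good-conj : ∀ {x} → Good x → Good (ℤ[i].conj x)
  Good-conj (real g) = real (realGood-conj g)
  Good-conj (imaginary {a} {b} g) = imaginary (realGood-subst refl (ℤ.neg-involutive (- a)) (realGood-neg (realGood-conj g)))

  8∤ : ∀ c .{{_ : ℕ.NonZero c}} → c ℕ.< 8 → ∀ y → + c ≢ + 8 * y
  8∤ c c<8 y eq = ℕ.<⇒≱ c<8 (ℕ.∣⇒≤ (ℕ.divides ∣ y ∣ (trans (cong ∣_∣ eq) (trans (ℤ.abs-* (+ 8) y) (ℕ.*-comm 8 ∣ y ∣)))))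

  ±1≢±3mod8 : ∀ {e x} → Sign± e → ∀ w → x ≡ e + + 8 * w → ±3mod8 x → ⊥
  ±1≢±3mod8 plus w eq (3mod8 j) = 8∤ 2 (from-yes (2 ℕ.<? 8)) (w - j) (trans (lhs j) (trans (cong (λ x → x - + 8 * j - + 1) eq) (rhs w j)))
    where
    lhs : ∀ j → + 2 ≡ + 3 + + 8 * j - + 8 * j - + 1
    lhs = ℤ.solve-∀
    rhs : ∀ w j → + 1 + + 8 * w - + 8 * j - + 1 ≡ + 8 * (w - j)
    rhs = ℤ.solve-∀
  ±1≢±3mod8 plus w eq (5mod8 j) = 8∤ 4 (from-yes (4 ℕ.<? 8)) (w - j) (trans (lhs j) (trans (cong (λ x → x - + 8 * j - + 1) eq) (rhs w j)))
    where
    lhs : ∀ j → + 4 ≡ + 5 + + 8 * j - + 8 * j - + 1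
    lhs = ℤ.solve-∀
    rhs : ∀ w j → + 1 + + 8 * w - + 8 * j - + 1 ≡ + 8 * (w - j)
    rhs = ℤ.solve-∀
  ±1≢±3mod8 minus w eq (3mod8 j) = 8∤ 4 (from-yes (4 ℕ.<? 8)) (w - j) (trans (lhs j) (trans (cong (λ x → x - + 8 * j + + 1) eq) (rhs w j)))
    where
    lhs : ∀ j → + 4 ≡ + 3 + + 8 * j - + 8 * j + + 1
    lhs = ℤ.solve-∀
    rhs : ∀ w j → - (+ 1) + + 8 * w - + 8 * j + + 1 ≡ + 8 * (w - j)
    rhs = ℤ.solve-∀
  ±1≢±3mod8 minus w eq (5mod8 j) = 8∤ 6 (from-yes (6 ℕ.<? 8)) (w - j) (trans (lhs j) (trans (cong (λ x → x - + 8 * j + + 1) eq) (rhs w j)))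
    where
    lhs : ∀ j → + 6 ≡ + 5 + + 8 * j - + 8 * j + + 1
    lhs = ℤ.solve-∀
    rhs : ∀ w j → - (+ 1) + + 8 * w - + 8 * j + + 1 ≡ + 8 * (w - j)
    rhs = ℤ.solve-∀

  ±3mod8-neg : ∀ {x} → ±3mod8 x → ±3mod8 (- x)
  ±3mod8-neg (3mod8 j) = subst ±3mod8 (identity j) (5mod8 (- j - + 1))
    where
    identity : ∀ j → + 5 + + 8 * (- j - + 1) ≡ - (+ 3 + + 8 * j)
    identity = ℤ.solve-∀
  ±3mod8-neg (5mod8 j) = subst ±3mod8 (identity j) (3mod8 (- j - + 1))
    where
    identity : ∀ j → + 3 + + 8 * (- j - + 1) ≡ - (+ 5 + + 8 * j)
    identity = ℤ.solve-∀

  Good⇒¬Bad : ∀ {x} → Good x → Bad x → ⊥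
  Good⇒¬Bad (real g) bad = contra g bad
    where
    sum : ∀ e i k → e + + 8 * i + + 4 * k + + 4 * k ≡ e + + 8 * (i + k)
    sum = ℤ.solve-∀
    difference : ∀ e i k → e + + 8 * i + + 4 * k - + 4 * k ≡ e + + 8 * i
    difference = ℤ.solve-∀
    contra : ∀ {a b} → RealGood a b → Bad (a , b) → ⊥
    contra (real-good {e} s i k refl refl) (inj₁ bad) = ±1≢±3mod8 s (i + k) (sum e i k) bad
    contra (real-good {e} s i k refl refl) (inj₂ bad) = ±1≢±3mod8 s i (difference e i k) bad
  Good⇒¬Bad {a , b} (imaginary g) bad = Good⇒¬Bad (real g) (rotate-bad bad)
    where
    first : ∀ a b → a + b ≡ b - - a
    first = ℤ.solve-∀
    second : ∀ a b → - (a - b) ≡ b + - a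
    second = ℤ.solve-∀
    rotate-bad : Bad (a , b) → Bad (b , - a)
    rotate-bad (inj₁ x) = inj₂ (subst ±3mod8 (first a b) x)
    rotate-bad (inj₂ x) = inj₁ (subst ±3mod8 (second a b) (±3mod8-neg x))

  -- Both a + b and a - b are odd. If both are ±1 mod 8, equal signs give a ≡ ±1 and 4 ∣ b, opposite
  -- signs the same with a and b interchanged.
  Good⊎Bad : ∀ a b k → a + b ≡ + 1 + + 2 * k → Good (a , b) ⊎ Bad (a , b)
  Good⊎Bad a b k odd = cases (residue k) (residue (k - b))
    where
    minus≡ : ∀ a b → a + b - + 2 * b ≡ a - b
    minus≡ = ℤ.solve-∀
    shift : ∀ k b → + 1 + + 2 * (k - b) ≡ + 1 + + 2 * k - + 2 * b
    shift = ℤ.solve-∀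
    difference : + 1 + + 2 * (k - b) ≡ a - b
    difference = trans (shift k b) (trans (cong (_- + 2 * b) (sym odd)) (minus≡ a b))
    Residue : ℤ → Set
    Residue k = ±3mod8 (+ 1 + + 2 * k) ⊎ (∃ λ ε → ∃ λ i → sq ε ≡ - ε × + 1 + + 2 * k ≡ + 1 + + 2 * ε + + 8 * i)
    sign : ∀ {ε} → sq ε ≡ - ε → ε ≡ + 0 ⊎ ε ≡ - (+ 1)
    sign {ε} eq with ℤ.i*j≡0⇒i≡0∨j≡0 ε (trans (factor ε) (trans (cong (_+ ε) eq) (ℤ.+-inverseˡ ε)))
      where
      factor : ∀ ε → ε * (ε + + 1) ≡ ε * ε + ε
      factor = ℤ.solve-∀
    ... | inj₁ z = inj₁ z
    ... | inj₂ z = inj₂ (trans (recover ε) (cong (_- + 1) z))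
      where
      recover : ∀ ε → ε ≡ ε + + 1 - + 1
      recover = ℤ.solve-∀
    halve : ∀ {x y} → + 2 * x ≡ + 2 * y → x ≡ y
    halve {x} {y} = ℤ.*-cancelˡ-≡ (+ 2) x y
    sum₂ : ∀ a b → + 2 * a ≡ (a + b) + (a - b)
    sum₂ = ℤ.solve-∀
    difference₂ : ∀ a b → + 2 * b ≡ (a + b) - (a - b)
    difference₂ = ℤ.solve-∀
    same : ∀ {e} → Sign± e → ∀ i j → a + b ≡ e + + 8 * i → a - b ≡ e + + 8 * j → Good (a , b)
    same {e} s i j p q = real (real-good s j (i - j)
      (halve (trans (sum₂ a b) (trans (cong₂ _+_ p q) (re e i j))))
      (halve (trans (difference₂ a b) (trans (cong₂ _-_ p q) (im e i j)))))
      where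
      re : ∀ e i j → e + + 8 * i + (e + + 8 * j) ≡ + 2 * (e + + 8 * j + + 4 * (i - j))
      re = ℤ.solve-∀
      im : ∀ e i j → e + + 8 * i - (e + + 8 * j) ≡ + 2 * (+ 4 * (i - j))
      im = ℤ.solve-∀
    opposite : ∀ {e} → Sign± e → ∀ i j → a + b ≡ e + + 8 * i → a - b ≡ - e + + 8 * j → Good (a , b)
    opposite {e} s i j p q = imaginary (real-good s i (- (i + j))
      (halve (trans (difference₂ a b) (trans (cong₂ _-_ p q) (re e i j))))
      (halve (trans (neg₂ a) (trans (cong -_ (trans (sum₂ a b) (cong₂ _+_ p q))) (im e i j)))))
      where
      neg₂ : ∀ a → + 2 * - a ≡ - (+ 2 * a)
      neg₂ = ℤ.solve-∀
      re : ∀ e i j → e + + 8 * i - (- e + + 8 * j) ≡ + 2 * (e + + 8 * i + + 4 * - (i + j))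
      re = ℤ.solve-∀
      im : ∀ e i j → - (e + + 8 * i + (- e + + 8 * j)) ≡ + 2 * (+ 4 * - (i + j))
      im = ℤ.solve-∀
    cases : Residue k → Residue (k - b) → Good (a , b) ⊎ Bad (a , b)
    cases (inj₁ bad) _ = inj₂ (inj₁ (subst ±3mod8 (sym odd) bad))
    cases (inj₂ _) (inj₁ bad) = inj₂ (inj₂ (subst ±3mod8 difference bad))
    cases (inj₂ (ε , i , ε² , p)) (inj₂ (φ , j , φ² , q)) = inj₁ (signs (sign ε²) (sign φ²) (trans odd p) (trans (sym difference) q))
      where
      signs : ∀ {ε φ} → ε ≡ + 0 ⊎ ε ≡ - (+ 1) → φ ≡ + 0 ⊎ φ ≡ - (+ 1) →
        a + b ≡ + 1 + + 2 * ε + + 8 * i → a - b ≡ + 1 + + 2 * φ + + 8 * j → Good (a , b)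
      signs (inj₁ refl) (inj₁ refl) p q = same plus i j p q
      signs (inj₁ refl) (inj₂ refl) p q = opposite plus i j p q
      signs (inj₂ refl) (inj₁ refl) p q = opposite minus i j p q
      signs (inj₂ refl) (inj₂ refl) p q = same minus i j p q

  -- Multiples of the p, p or p² in the last three sets of the theorem.
  HasGenerator : ℤ → Set
  HasGenerator n =
      (∃[ p ] Prime p × p ℕ.% 8 ≡ 1
         × (∃[ a ] ∃[ b ] + p ≡ a * a + b * b × ((a + b) ℤ.%ℕ 8 ≡ 3 ⊎ (a + b) ℤ.%ℕ 8 ≡ 5))
         × (∃[ m ] n ≡ + p * m))
    ⊎ (∃[ p ] Prime p × p ℕ.% 8 ≡ 5 × (∃[ m ] n ≡ + p * m))
    ⊎ (∃[ p ] Prime p × p ℕ.% 8 ≡ 3 × (∃[ m ] n ≡ (+ p * + p) * m))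

  hasGenerator-* : ∀ {n} k → HasGenerator n → HasGenerator (n * k)
  hasGenerator-* k (inj₁ (p , pr , r , rep , m , refl)) = inj₁ (p , pr , r , rep , m * k , ℤ.*-assoc (+ p) m k)
  hasGenerator-* k (inj₂ (inj₁ (p , pr , r , m , refl))) = inj₂ (inj₁ (p , pr , r , m * k , ℤ.*-assoc (+ p) m k))
  hasGenerator-* k (inj₂ (inj₂ (p , pr , r , m , refl))) = inj₂ (inj₂ (p , pr , r , m * k , ℤ.*-assoc (+ p * + p) m k))

  %ℕ8-unique : ∀ r → r ℕ.< 8 → ∀ j → (+ r + + 8 * j) ℤ.%ℕ 8 ≡ r
  %ℕ8-unique r r<8 j = ℤ.+-injective (ℤ.i-j≡0⇒i≡j (+ s) (+ r) (ℤ.∣i∣≡0⇒i≡0 (small ∣ + s - + r ∣ below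
    (ℕ.divides ∣ j - q ∣ (trans (cong ∣_∣ multiple) (trans (ℤ.abs-* (+ 8) (j - q)) (ℕ.*-comm 8 ∣ j - q ∣)))))))
    where
    z : ℤ
    z = + r + + 8 * j
    s : ℕ
    s = z ℤ.%ℕ 8
    q : ℤ
    q = z ℤ./ℕ 8
    multiple : + s - + r ≡ + 8 * (j - q)
    multiple = trans (lhs (+ s) (+ r) q) (trans (cong (λ z → z - q * + 8 - + r) (sym (ℤ.a≡a%ℕn+[a/ℕn]*n z 8))) (rhs (+ r) j q))
      where
      lhs : ∀ s r q → s - r ≡ (s + q * + 8) - q * + 8 - r
      lhs = ℤ.solve-∀
      rhs : ∀ r j q → (r + + 8 * j) - q * + 8 - r ≡ + 8 * (j - q)
      rhs = ℤ.solve-∀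
    below : ∣ + s - + r ∣ ℕ.< 8
    below = subst (λ x → ∣ x ∣ ℕ.< 8) (sym (ℤ.m-n≡m⊖n s r))
      (ℕ.≤-<-trans (ℤ.∣m⊝n∣≤m⊔n s r) (ℕ.⊔-pres-<m (ℤ.n%ℕd<d z 8) r<8))
    small : ∀ n → n ℕ.< 8 → 8 ℕ.∣ n → n ≡ 0
    small zero _ _ = refl
    small n@(suc _) n<8 8∣n = ⊥-elim (ℕ.<⇒≱ n<8 (ℕ.∣⇒≤ 8∣n))

  ±3mod8-%ℕ : ∀ {x} → ±3mod8 x → x ℤ.%ℕ 8 ≡ 3 ⊎ x ℤ.%ℕ 8 ≡ 5
  ±3mod8-%ℕ (3mod8 j) = inj₁ (%ℕ8-unique 3 (from-yes (3 ℕ.<? 8)) j)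
  ±3mod8-%ℕ (5mod8 j) = inj₂ (%ℕ8-unique 5 (from-yes (5 ℕ.<? 8)) j)

  primeFactor : ∀ n → n ≢ 0 → n ≢ 1 → ∃ λ p → Prime p × p ℕ.∣ n
  primeFactor zero n≢0 _ = ⊥-elim (n≢0 refl)
  primeFactor n@(suc _) _ n≢1 with factorise n
  ... | record { factors = [] ; isFactorisation = eq } = ⊥-elim (n≢1 eq)
  ... | record { factors = p ∷ ps ; isFactorisation = eq ; factorsPrime = pr ∷ _ } =
    p , pr , ℕ.divides (ℕ.product ps) (trans eq (ℕ.*-comm p (ℕ.product ps)))

  prime-product : ∀ {p x y} → Prime p → x ℕ.* y ≡ p → x ≡ 1 ⊎ y ≡ 1
  prime-product {p} {x} {y} pr eq with prime⇒irreducible pr (ℕ.divides y (trans (sym eq) (ℕ.*-comm x y)))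
  ... | inj₁ x≡1 = inj₁ x≡1
  ... | inj₂ refl = inj₂ (ℕ.*-cancelˡ-≡ y 1 x {{prime⇒nonZero pr}} (trans eq (sym (ℕ.*-identityʳ x))))

  prime²-product : ∀ {p x y} → Prime p → x ℕ.* y ≡ p ℕ.* p → x ≡ 1 ⊎ y ≡ 1 ⊎ (x ≡ p × y ≡ p)
  prime²-product {p} {x} {y} pr eq = cases (euclidsLemma x y pr (ℕ.divides p eq))
    where
    instance nz = prime⇒nonZero pr
    one-side : ∀ x y → p ℕ.∣ x → x ℕ.* y ≡ p ℕ.* p → y ≡ 1 ⊎ (x ≡ p × y ≡ p)
    one-side x y (ℕ.divides k x≡) eq with prime-product {p} {k} {y} pr (ℕ.*-cancelˡ-≡ (k ℕ.* y) p p
      (trans (sym (ℕ.*-assoc p k y)) (trans (cong (ℕ._* y) (trans (ℕ.*-comm p k) (sym x≡))) eq)))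
    ... | inj₂ y≡1 = inj₁ y≡1
    ... | inj₁ refl = inj₂ (x≡p , ℕ.*-cancelˡ-≡ y p p (trans (cong (ℕ._* y) (sym x≡p)) eq))
      where x≡p = trans x≡ (ℕ.*-identityˡ p)
    cases : p ℕ.∣ x ⊎ p ℕ.∣ y → x ≡ 1 ⊎ y ≡ 1 ⊎ (x ≡ p × y ≡ p)
    cases (inj₁ p∣x) with one-side x y p∣x eq
    ... | inj₁ z = inj₂ (inj₁ z)
    ... | inj₂ z = inj₂ (inj₂ z)
    cases (inj₂ p∣y) with one-side y x p∣y (trans (ℕ.*-comm y x) eq)
    ... | inj₁ z = inj₁ z
    ... | inj₂ (u , v) = inj₂ (inj₂ (v , u))

  νᵢ-sum : ∀ a b → + νᵢ (a , b) ≡ sq a + sq b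
  νᵢ-sum a b = trans (ℤ.pos-+ (∣ a ∣ ℕ.* ∣ a ∣) (∣ b ∣ ℕ.* ∣ b ∣)) (cong₂ _+_ (square-∣∣ a) (square-∣∣ b))

  νᵢ-ι : ∀ n → νᵢ (ιᵢ (+ n)) ≡ n ℕ.* n
  νᵢ-ι n = ℕ.+-identityʳ (n ℕ.* n)

  OddNorm : ℤ × ℤ → Set
  OddNorm x = ¬ 2 ℕ.∣ νᵢ x

  oddNorm-sum : ∀ a b → OddNorm (a , b) → ∃ λ k → a + b ≡ + 1 + + 2 * k
  oddNorm-sum a b odd with parity (a + b)
  ... | inj₂ r = r
  ... | inj₁ (k , a+b) = ⊥-elim (odd (even (≡₂-trans (≡₂-+ (square-≡₂ a) (square-≡₂ b)) (k ,₂ trans a+b (sym (ℤ.+-identityˡ (+ 2 * k)))))))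
    where
    even : sq a + sq b ≡₂ + 0 → 2 ℕ.∣ νᵢ (a , b)
    even (l ,₂ eq) = ℕ.divides ∣ l ∣ (trans (cong ∣_∣ (trans (νᵢ-sum a b) (trans eq (ℤ.+-identityˡ (+ 2 * l)))))
      (trans (ℤ.abs-* (+ 2) l) (ℕ.*-comm 2 ∣ l ∣)))

  -- Otherwise x would be good by the dichotomy for odd norms, and so would the product.
  badQuotient : ∀ x y → Good y → OddNorm (x *ᵢ y) → Bad (x *ᵢ y) → OddNorm x × Bad x
  badQuotient x@(a , b) y good odd bad = oddx , [ (λ g → ⊥-elim (Good⇒¬Bad (Good-* g good) bad)) , id ]′
    (Good⊎Bad a b (proj₁ sum) (proj₂ sum))
    where
    oddx : OddNorm x
    oddx 2∣x = odd (subst (2 ℕ.∣_) (sym (νᵢ-* x y)) (ℕ.∣-trans 2∣x (ℕ.m∣m*n (νᵢ y))))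
    sum : ∃ λ k → a + b ≡ + 1 + + 2 * k
    sum = oddNorm-sum a b oddx

  unit-good : ∀ a b → νᵢ (a , b) ≡ 1 → Good (a , b)
  unit-good (+ 0) (+ 1) _ = imaginary (real-good plus (+ 0) (+ 0) refl refl)
  unit-good (+ 0) -[1+ 0 ] _ = imaginary (real-good minus (+ 0) (+ 0) refl refl)
  unit-good (+ 1) (+ 0) _ = real (real-good plus (+ 0) (+ 0) refl refl)
  unit-good -[1+ 0 ] (+ 0) _ = real (real-good minus (+ 0) (+ 0) refl refl)
  unit-good (+ 0) (+ 0) ()
  unit-good (+ 0) (+ suc (suc n)) ()
  unit-good (+ 0) -[1+ suc n ] ()
  unit-good (+ 1) (+ suc n) ()
  unit-good (+ 1) -[1+ n ] ()
  unit-good -[1+ 0 ] (+ suc n) ()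
  unit-good -[1+ 0 ] -[1+ n ] ()
  unit-good (+ suc (suc n)) b ()
  unit-good -[1+ suc n ] b ()

  data OddResidue (p : ℕ) : Set where
    1mod : p ℕ.% 8 ≡ 1 → ∀ q → + p ≡ + 1 + + 8 * q → OddResidue p
    3mod : p ℕ.% 8 ≡ 3 → ∀ q → + p ≡ + 3 + + 8 * q → OddResidue p
    5mod : p ℕ.% 8 ≡ 5 → ∀ q → + p ≡ + 5 + + 8 * q → OddResidue p
    7mod : p ℕ.% 8 ≡ 7 → ∀ q → + p ≡ + 7 + + 8 * q → OddResidue p

  division₈ : ∀ p {r} → p ℕ.% 8 ≡ r → p ≡ r ℕ.+ p ℕ./ 8 ℕ.* 8
  division₈ p refl = ℕ.m≡m%n+[m/n]*n p 8

  division₈ℤ : ∀ p {r} → p ℕ.% 8 ≡ r → + p ≡ + r + + 8 * + (p ℕ./ 8)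
  division₈ℤ p {r} eq = trans (cong +_ (division₈ p eq)) (trans (ℤ.pos-+ r (p ℕ./ 8 ℕ.* 8))
    (cong (λ x → + r + x) (trans (ℤ.pos-* (p ℕ./ 8) 8) (ℤ.*-comm (+ (p ℕ./ 8)) (+ 8)))))

  oddResidue : ∀ p → ¬ 2 ℕ.∣ p → OddResidue p
  oddResidue p odd = cases (p ℕ.% 8) refl (ℕ.m%n<n p 8)
    where
    even : ∀ {r} → p ℕ.% 8 ≡ r → 2 ℕ.∣ r → OddResidue p
    even eq 2∣r = ⊥-elim (odd (subst (2 ℕ.∣_) (sym (division₈ p eq))
      (ℕ.∣m∣n⇒∣m+n 2∣r (ℕ.∣n⇒∣m*n (p ℕ./ 8) (ℕ.divides 4 refl)))))
    cases : ∀ r → p ℕ.% 8 ≡ r → r ℕ.< 8 → OddResidue p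
    cases 0 eq _ = even eq (ℕ.divides 0 refl)
    cases 1 eq _ = 1mod eq (+ (p ℕ./ 8)) (division₈ℤ p eq)
    cases 2 eq _ = even eq (ℕ.divides 1 refl)
    cases 3 eq _ = 3mod eq (+ (p ℕ./ 8)) (division₈ℤ p eq)
    cases 4 eq _ = even eq (ℕ.divides 2 refl)
    cases 5 eq _ = 5mod eq (+ (p ℕ./ 8)) (division₈ℤ p eq)
    cases 6 eq _ = even eq (ℕ.divides 3 refl)
    cases 7 eq _ = 7mod eq (+ (p ℕ./ 8)) (division₈ℤ p eq)
    cases (suc (suc (suc (suc (suc (suc (suc (suc r)))))))) _ r<8 = ⊥-elim (ℕ.<⇒≱ r<8 (ℕ.m≤m+n 8 r))

  not-3mod4 : ∀ {p} a b → + p ≡ sq a + sq b → ∀ q → + p ≢ + 3 + + 4 * q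
  not-3mod4 {p} a b p≡ q p≡3 = contra (parity a) (parity b)
    where
    4∤ : ∀ c .{{_ : ℕ.NonZero c}} → c ℕ.< 4 → ∀ y → + c ≢ + 4 * y
    4∤ c c<4 y eq = ℕ.<⇒≱ c<4 (ℕ.∣⇒≤ (ℕ.divides ∣ y ∣ (trans (cong ∣_∣ eq) (trans (ℤ.abs-* (+ 4) y) (ℕ.*-comm 4 ∣ y ∣)))))
    eq : sq a + sq b ≡ + 3 + + 4 * q
    eq = trans (sym p≡) p≡3
    contra : (∃ λ k → a ≡ + 2 * k) ⊎ (∃ λ k → a ≡ + 1 + + 2 * k) → (∃ λ k → b ≡ + 2 * k) ⊎ (∃ λ k → b ≡ + 1 + + 2 * k) → ⊥
    contra (inj₁ (k , refl)) (inj₁ (l , refl)) = 4∤ 3 (from-yes (3 ℕ.<? 4)) (k * k + l * l - q)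
      (trans (lhs q) (trans (cong (_- + 4 * q) (sym eq)) (rhs k l q)))
      where
      lhs : ∀ q → + 3 ≡ + 3 + + 4 * q - + 4 * q
      lhs = ℤ.solve-∀
      rhs : ∀ k l q → + 2 * k * (+ 2 * k) + + 2 * l * (+ 2 * l) - + 4 * q ≡ + 4 * (k * k + l * l - q)
      rhs = ℤ.solve-∀
    contra (inj₁ (k , refl)) (inj₂ (l , refl)) = 4∤ 2 (from-yes (2 ℕ.<? 4)) (k * k + l + l * l - q)
      (trans (lhs q) (trans (cong (λ x → x - + 4 * q - + 1) (sym eq)) (rhs k l q)))
      where
      lhs : ∀ q → + 2 ≡ + 3 + + 4 * q - + 4 * q - + 1
      lhs = ℤ.solve-∀
      rhs : ∀ k l q → + 2 * k * (+ 2 * k) + (+ 1 + + 2 * l) * (+ 1 + + 2 * l) - + 4 * q - + 1 ≡ + 4 * (k * k + l + l * l - q)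
      rhs = ℤ.solve-∀
    contra (inj₂ (k , refl)) (inj₁ (l , refl)) = 4∤ 2 (from-yes (2 ℕ.<? 4)) (l * l + k + k * k - q)
      (trans (lhs q) (trans (cong (λ x → x - + 4 * q - + 1) (sym eq)) (rhs k l q)))
      where
      lhs : ∀ q → + 2 ≡ + 3 + + 4 * q - + 4 * q - + 1
      lhs = ℤ.solve-∀
      rhs : ∀ k l q → (+ 1 + + 2 * k) * (+ 1 + + 2 * k) + + 2 * l * (+ 2 * l) - + 4 * q - + 1 ≡ + 4 * (l * l + k + k * k - q)
      rhs = ℤ.solve-∀
    contra (inj₂ (k , refl)) (inj₂ (l , refl)) = 4∤ 1 (from-yes (1 ℕ.<? 4)) (k + k * k + l + l * l - q)
      (trans (lhs q) (trans (cong (λ x → x - + 4 * q - + 2) (sym eq)) (rhs k l q)))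
      where
      lhs : ∀ q → + 1 ≡ + 3 + + 4 * q - + 4 * q - + 2
      lhs = ℤ.solve-∀
      rhs : ∀ k l q → (+ 1 + + 2 * k) * (+ 1 + + 2 * k) + (+ 1 + + 2 * l) * (+ 1 + + 2 * l) - + 4 * q - + 2 ≡ + 4 * (k + k * k + l + l * l - q)
      rhs = ℤ.solve-∀

  -- Induction on the norm. For a prime p dividing the norm of x, the gcd of p and x shows that
  -- either p itself divides x or p is the norm of some Gaussian d. Good divisors are split off,
  -- leaving a bad quotient of smaller norm; in the other cases p or p² is already of one of the
  -- listed kinds. The process must stop at such a case, because units are good.
  bad⇒generator : ∀ x → OddNorm x → Bad x → HasGenerator (+ νᵢ x)
  bad⇒generator x = go (suc (νᵢ x)) x ℕ.≤-refl
    where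
    go : ∀ fuel x → νᵢ x ℕ.< fuel → OddNorm x → Bad x → HasGenerator (+ νᵢ x)
    go (suc fuel) x@(a , b) (ℕ.s≤s ν≤) odd bad = result
      where
      conjᵢ = ℤ[i].conj
      ν≢0 : νᵢ x ≢ 0
      ν≢0 eq = odd (subst (2 ℕ.∣_) (sym eq) (2 ℕ.∣0))
      factor = primeFactor (νᵢ x) ν≢0 λ eq → Good⇒¬Bad (unit-good a b eq) bad
      p : ℕ
      p = proj₁ factor
      pr : Prime p
      pr = proj₁ (proj₂ factor)
      p∣ν : p ℕ.∣ νᵢ x
      p∣ν = proj₂ (proj₂ factor)
      1<p : 1 ℕ.< p
      1<p = ℕ.nonTrivial⇒n>1 p {{prime⇒nonTrivial pr}}
      pᵢ : ℤ × ℤ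
      pᵢ = ιᵢ (+ p)
      residue-p : OddResidue p
      residue-p = oddResidue p λ 2∣p → odd (ℕ.∣-trans 2∣p p∣ν)
      descend : ∀ y z → x ≡ z *ᵢ y → Good y → 1 ℕ.< νᵢ y → HasGenerator (+ νᵢ x)
      descend y z x≡ good 1<ν = subst HasGenerator (trans (sym (ℤ.pos-* (νᵢ z) (νᵢ y))) (cong +_ (sym ν≡)))
        (hasGenerator-* (+ νᵢ y) (go fuel z smaller (proj₁ quotient) (proj₂ quotient)))
        where
        ν≡ : νᵢ x ≡ νᵢ z ℕ.* νᵢ y
        ν≡ = trans (cong νᵢ x≡) (νᵢ-* z y)
        quotient : OddNorm z × Bad z
        quotient = badQuotient z y good (subst OddNorm x≡ odd) (subst Bad x≡ bad)
        νz≢0 : νᵢ z ≢ 0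
        νz≢0 eq = ν≢0 (trans ν≡ (cong (ℕ._* νᵢ y) eq))
        smaller : νᵢ z ℕ.< fuel
        smaller = ℕ.<-≤-trans (subst (νᵢ z ℕ.<_) (sym ν≡) (ℕ.m<m*n (νᵢ z) (νᵢ y) {{ℕ.≢-nonZero νz≢0}} 1<ν)) ν≤
      -- If p divides x, then p² divides the norm. Primes ±1 mod 8 are good and are divided out; for
      -- 3 mod 8 the square p² is the generator, for 5 mod 8 already p.
      divisible : pᵢ ∣ᵢ x → HasGenerator (+ νᵢ x)
      divisible (z , x≡) = cases residue-p
        where
        ν≡ : + νᵢ x ≡ (+ p * + p) * + νᵢ z
        ν≡ = trans (cong +_ (trans (cong νᵢ x≡) (trans (νᵢ-* z pᵢ) (trans (cong (νᵢ z ℕ.*_) (νᵢ-ι p)) (ℕ.*-comm (νᵢ z) (p ℕ.* p))))))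
          (trans (ℤ.pos-* (p ℕ.* p) (νᵢ z)) (cong (_* + νᵢ z) (ℤ.pos-* p p)))
        1<νp : 1 ℕ.< νᵢ pᵢ
        1<νp = subst (1 ℕ.<_) (sym (νᵢ-ι p)) (ℕ.*-mono-< 1<p 1<p)
        cases : OddResidue p → HasGenerator (+ νᵢ x)
        cases (1mod _ q p≡) = descend pᵢ z x≡ (real (real-good plus q (+ 0) (trans p≡ (shape q)) refl)) 1<νp
          where
          shape : ∀ q → + 1 + + 8 * q ≡ + 1 + + 8 * q + + 4 * + 0
          shape = ℤ.solve-∀
        cases (7mod _ q p≡) = descend pᵢ z x≡ (real (real-good minus (q + + 1) (+ 0) (trans p≡ (shape q)) refl)) 1<νp
          where
          shape : ∀ q → + 7 + + 8 * q ≡ - (+ 1) + + 8 * (q + + 1) + + 4 * + 0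
          shape = ℤ.solve-∀
        cases (3mod r _ _) = inj₂ (inj₂ (p , pr , r , + νᵢ z , ν≡))
        cases (5mod r _ _) = inj₂ (inj₁ (p , pr , r , + p * + νᵢ z , trans ν≡ (ℤ.*-assoc (+ p) (+ p) (+ νᵢ z))))
      conj-divides : ∀ y → y ∣ᵢ conjᵢ x → conjᵢ y ∣ᵢ x
      conj-divides y (z , eq) = conjᵢ z , trans (cong₂ _,_ refl (sym (ℤ.neg-involutive b)))
        (trans (cong conjᵢ eq) (Hom.map-* (conj-hom ℤ≡ i²) z y))
      norm-multiple : ∀ y → y ∣ᵢ pᵢ → y ∣ᵢ x *ᵢ conjᵢ x
      norm-multiple y (z , p≡) = ιᵢ (+ k) *ᵢ z , trans (NormEuclidean.*-adjugate ℤ[i]-euclidean x)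
        (trans (cong (λ n → ιᵢ n) (trans (cong +_ (ℕ._∣_.equality p∣ν)) (ℤ.pos-* k p)))
          (trans (Ring≡.ι-* ℤ[i].ring (+ k) (+ p)) (trans (cong (ιᵢ (+ k) *ᵢ_) p≡) (sym (*ᵢ-assoc (ιᵢ (+ k)) z y)))))
        where k = ℕ._∣_.quotient p∣ν
      gaussian-prime : ∀ d → νᵢ d ≡ p → d ∣ᵢ pᵢ → HasGenerator (+ νᵢ x)
      gaussian-prime d@(u , v) νd≡p d∣p = cases residue-p
        where
        p≡ : + p ≡ sq u + sq v
        p≡ = trans (cong +_ (sym νd≡p)) (νᵢ-sum u v)
        multiple : + νᵢ x ≡ + p * + ℕ._∣_.quotient p∣ν
        multiple = trans (cong +_ (trans (ℕ._∣_.equality p∣ν) (ℕ.*-comm (ℕ._∣_.quotient p∣ν) p))) (ℤ.pos-* p (ℕ._∣_.quotient p∣ν))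
        1<νd : 1 ℕ.< νᵢ d
        1<νd = subst (1 ℕ.<_) (sym νd≡p) 1<p
        oddd : OddNorm d
        oddd 2∣d = odd (ℕ.∣-trans (subst (2 ℕ.∣_) νd≡p 2∣d) p∣ν)
        sum = oddNorm-sum u v oddd
        -- Being prime, d divides x or the conjugate of x; in the second case the conjugate of d,
        -- which is good too, divides x.
        splitting : Good d → HasGenerator (+ νᵢ x)
        splitting good = byFactor (splitᵢ d x (conjᵢ x) (norm-multiple d d∣p))
          where
          1<νd̄ : 1 ℕ.< νᵢ (conjᵢ d)
          1<νd̄ = subst (λ n → 1 ℕ.< ∣ u ∣ ℕ.* ∣ u ∣ ℕ.+ n ℕ.* n) (sym (ℤ.∣-i∣≡∣i∣ v)) 1<νd
          byUnit : ∀ d₁ e₁ → (νᵢ d₁ ≡ 1 → d ∣ᵢ conjᵢ x) → (νᵢ e₁ ≡ 1 → d ∣ᵢ x) →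
            νᵢ d₁ ≡ 1 ⊎ νᵢ e₁ ≡ 1 → HasGenerator (+ νᵢ x)
          byUnit d₁ e₁ _ e₁-unit (inj₂ νe≡1) = descend d (proj₁ (e₁-unit νe≡1)) (proj₂ (e₁-unit νe≡1)) good 1<νd
          byUnit d₁ e₁ d₁-unit _ (inj₁ νd≡1) = descend (conjᵢ d) (proj₁ dividing) (proj₂ dividing) (Good-conj good) 1<νd̄
            where
            dividing : conjᵢ d ∣ᵢ x
            dividing = conj-divides d (d₁-unit νd≡1)
          byFactor : (∃ λ d₁ → ∃ λ e₁ → d ≡ d₁ *ᵢ e₁ × (νᵢ d₁ ≡ 1 → d ∣ᵢ conjᵢ x) × (νᵢ e₁ ≡ 1 → d ∣ᵢ x)) →
            HasGenerator (+ νᵢ x)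
          byFactor (d₁ , e₁ , d≡ , d₁-unit , e₁-unit) = byUnit d₁ e₁ d₁-unit e₁-unit
            (prime-product pr (trans (sym (νᵢ-* d₁ e₁)) (trans (cong νᵢ (sym d≡)) νd≡p)))
        represent : Bad d → p ℕ.% 8 ≡ 1 → HasGenerator (+ νᵢ x)
        represent (inj₁ s) r = inj₁ (p , pr , r , (u , v , p≡ , ±3mod8-%ℕ s) , + ℕ._∣_.quotient p∣ν , multiple)
        represent (inj₂ s) r = inj₁ (p , pr , r , (u , - v , trans p≡ (neg-square u v) , ±3mod8-%ℕ s) , + ℕ._∣_.quotient p∣ν , multiple)
          where
          neg-square : ∀ u v → u * u + v * v ≡ u * u + - v * - v
          neg-square = ℤ.solve-∀
        cases : OddResidue p → HasGenerator (+ νᵢ x)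
        cases (1mod r _ _) = [ splitting , (λ bd → represent bd r) ]′ (Good⊎Bad u v (proj₁ sum) (proj₂ sum))
        cases (5mod r _ _) = inj₂ (inj₁ (p , pr , r , + ℕ._∣_.quotient p∣ν , multiple))
        cases (3mod _ q eq) = ⊥-elim (not-3mod4 u v p≡ (+ 2 * q) (trans eq (shape q)))
          where
          shape : ∀ q → + 3 + + 8 * q ≡ + 3 + + 4 * (+ 2 * q)
          shape = ℤ.solve-∀
        cases (7mod _ q eq) = ⊥-elim (not-3mod4 u v p≡ (+ 1 + + 2 * q) (trans eq (shape q)))
          where
          shape : ∀ q → + 7 + + 8 * q ≡ + 3 + + 4 * (+ 1 + + 2 * q)
          shape = ℤ.solve-∀
      result : HasGenerator (+ νᵢ x)
      result = byFactor (splitᵢ pᵢ x (conjᵢ x) (norm-multiple pᵢ (ιᵢ (+ 1) , sym (Ring≡.*-identityˡ ℤ[i].ring pᵢ))))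
        where
        byUnit : ∀ d e → pᵢ ≡ d *ᵢ e → (νᵢ d ≡ 1 → pᵢ ∣ᵢ conjᵢ x) → (νᵢ e ≡ 1 → pᵢ ∣ᵢ x) →
          νᵢ d ≡ 1 ⊎ νᵢ e ≡ 1 ⊎ (νᵢ d ≡ p × νᵢ e ≡ p) → HasGenerator (+ νᵢ x)
        byUnit d e _ d-unit _ (inj₁ νd≡1) = divisible (conj-divides pᵢ (d-unit νd≡1))
        byUnit d e _ _ e-unit (inj₂ (inj₁ νe≡1)) = divisible (e-unit νe≡1)
        byUnit d e p≡ _ _ (inj₂ (inj₂ (νd≡p , _))) = gaussian-prime d νd≡p (e , trans p≡ (*ᵢ-comm d e))
        byFactor : (∃ λ d → ∃ λ e → pᵢ ≡ d *ᵢ e × (νᵢ d ≡ 1 → pᵢ ∣ᵢ conjᵢ x) × (νᵢ e ≡ 1 → pᵢ ∣ᵢ x)) → HasGenerator (+ νᵢ x)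
        byFactor (d , e , p≡ , d-unit , e-unit) = byUnit d e p≡ d-unit e-unit
          (prime²-product pr (trans (sym (νᵢ-* d e)) (trans (cong νᵢ (sym p≡)) (νᵢ-ι p))))

  halfSum⇒generator : ∀ n → HalfSum n → HasGenerator n
  halfSum⇒generator n (x , y , bad , 2n≡) = build (odd-shape bad) (parity y)
    where
    odd-shape : ∀ {x} → ±3mod8 x → ∃ λ k → x ≡ + 1 + + 2 * k
    odd-shape (3mod8 j) = + 1 + + 4 * j , identity j
      where
      identity : ∀ j → + 3 + + 8 * j ≡ + 1 + + 2 * (+ 1 + + 4 * j)
      identity = ℤ.solve-∀
    odd-shape (5mod8 j) = + 2 + + 4 * j , identity j
      where
      identity : ∀ j → + 5 + + 8 * j ≡ + 1 + + 2 * (+ 2 + + 4 * j)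
      identity = ℤ.solve-∀
    build : (∃ λ k → x ≡ + 1 + + 2 * k) → (∃ λ l → y ≡ + 2 * l) ⊎ (∃ λ l → y ≡ + 1 + + 2 * l) → HasGenerator n
    build (k , x≡) (inj₁ (l , y≡)) = ⊥-elim (contra (even-half′ (n - + 2 * k - + 2 * (k * k) - + 2 * (l * l))
      (trans (lhs k l) (trans (cong₂ (λ u v → u - + 4 * k - + 4 * (k * k) - + 4 * (l * l) + v) eq refl) (rhs n k l)))))
      where
      eq : (+ 1 + + 2 * k) * (+ 1 + + 2 * k) + + 2 * l * (+ 2 * l) ≡ + 2 * n
      eq = trans (cong₂ (λ u v → u * u + v * v) (sym x≡) (sym y≡)) (sym 2n≡)
      lhs : ∀ k l → + 1 ≡ (+ 1 + + 2 * k) * (+ 1 + + 2 * k) + + 2 * l * (+ 2 * l) - + 4 * k - + 4 * (k * k) - + 4 * (l * l) + + 0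
      lhs = ℤ.solve-∀
      rhs : ∀ n k l → + 2 * n - + 4 * k - + 4 * (k * k) - + 4 * (l * l) + + 0 ≡ + 2 * (n - + 2 * k - + 2 * (k * k) - + 2 * (l * l))
      rhs = ℤ.solve-∀
      even-half′ : ∀ m → + 1 ≡ + 2 * m → 2 ℕ.∣ 1
      even-half′ m eq = ℕ.divides ∣ m ∣ (trans (cong ∣_∣ eq) (trans (ℤ.abs-* (+ 2) m) (ℕ.*-comm 2 ∣ m ∣)))
      contra : 2 ℕ.∣ 1 → ⊥
      contra 2∣1 = ℕ.<⇒≱ (from-yes (1 ℕ.<? 2)) (ℕ.∣⇒≤ 2∣1)
    build (k , x≡) (inj₂ (l , y≡)) = subst HasGenerator ν≡n (bad⇒generator (a , b) oddNorm (inj₂ (subst ±3mod8 (trans x≡ (difference k l)) bad)))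
      where
      -- a + bi = (x + yi)/(1 + i), so that a - b = x and a + b = y.
      a b : ℤ
      a = k + l + + 1
      b = l - k
      difference : ∀ k l → + 1 + + 2 * k ≡ k + l + + 1 - (l - k)
      difference = ℤ.solve-∀
      ν≡n : + νᵢ (a , b) ≡ n
      ν≡n = ℤ.*-cancelˡ-≡ (+ 2) _ _ (trans (cong (+ 2 *_) (νᵢ-sum a b)) (trans (identity k l)
        (trans (cong₂ (λ u v → u * u + v * v) (sym x≡) (sym y≡)) (sym 2n≡))))
        where
        identity : ∀ k l → + 2 * ((k + l + + 1) * (k + l + + 1) + (l - k) * (l - k))
          ≡ (+ 1 + + 2 * k) * (+ 1 + + 2 * k) + (+ 1 + + 2 * l) * (+ 1 + + 2 * l)
        identity = ℤ.solve-∀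
      oddNorm : OddNorm (a , b)
      oddNorm (ℕ.divides m ν≡) = contra (trans (lhs k l) (trans (cong (λ u → u - + 2 * (k * k + l * l + k + l)) eq) (rhs k l (+ m))))
        where
        eq : (k + l + + 1) * (k + l + + 1) + (l - k) * (l - k) ≡ + m * + 2
        eq = trans (sym (νᵢ-sum a b)) (trans (cong +_ ν≡) (ℤ.pos-* m 2))
        lhs : ∀ k l → + 1 ≡ (k + l + + 1) * (k + l + + 1) + (l - k) * (l - k) - + 2 * (k * k + l * l + k + l)
        lhs = ℤ.solve-∀
        rhs : ∀ k l m → m * + 2 - + 2 * (k * k + l * l + k + l) ≡ + 2 * (m - (k * k + l * l + k + l))
        rhs = ℤ.solve-∀
        contra : + 1 ≡ + 2 * (+ m - (k * k + l * l + k + l)) → ⊥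
        contra eq = ℕ.<⇒≱ (from-yes (1 ℕ.<? 2)) (ℕ.∣⇒≤ (ℕ.divides ∣ w ∣ (trans (cong ∣_∣ eq) (trans (ℤ.abs-* (+ 2) w) (ℕ.*-comm 2 ∣ w ∣)))))
          where w = + m - (k * k + l * l + k + l)

-- Every value lies in the stated set

S16⇒RHS16 : ∀ z → S16 z → RHS16 z
S16⇒RHS16 z (a , refl) = [ inj₁ , even ]′ (D-odd-or-even a)
  where
  open import Data.Integer using (_*_; ∣_∣)
  swap : ∀ p m w → + 64 * (p * m) * w ≡ + 64 * p * (m * w)
  swap = ℤ.solve-∀
  generator : ∀ {n w} → D a ≡ + 64 * n * w → HasGenerator n → RHS16 (D a)
  generator {w = w} eq (inj₁ (p , pr , r , rep , m , refl)) = inj₂ (inj₂ (inj₁ (p , pr , r , rep , m * w , trans eq (swap (+ p) m w))))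
  generator {w = w} eq (inj₂ (inj₁ (p , pr , r , m , refl))) = inj₂ (inj₂ (inj₂ (inj₁ (p , pr , r , m * w , trans eq (swap (+ p) m w)))))
  generator {w = w} eq (inj₂ (inj₂ (p , pr , r , m , refl))) = inj₂ (inj₂ (inj₂ (inj₂ (p , pr , r , m * w , trans eq (swap (+ p * + p) m w)))))
  even : EvenValue (D a) → RHS16 (D a)
  even (inj₁ (w , eq)) = inj₂ (inj₁ (ℕ.divides ∣ w ∣ (trans (cong ∣_∣ eq) (trans (ℤ.abs-* (+ 128) w) (ℕ.*-comm 128 ∣ w ∣)))))
  even (inj₂ (n , w , half , eq)) = generator {n} {w} eq (halfSum⇒generator n half)

-- Power residues modulo a prime

module _ where
  open import Data.Nat.Base using (_+_; _*_; _^_; _∸_; _!; _≤_; _<_)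
  open import Data.Nat.Combinatorics using (_C_; nCn≡1; nCk≡n!/k![n-k]!; k![n∸k]!∣n!)
  open import Algebra.Properties.CommutativeSemiring.Binomial ℕ.+-*-commutativeSemiring using (binomialTerm; theorem)
  import Algebra.Properties.CommutativeMonoid.Sum ℕ.+-0-commutativeMonoid as Sum
  open import Algebra.Definitions.RawMonoid (CommutativeMonoid.rawMonoid ℕ.+-0-commutativeMonoid) using () renaming (_×_ to _×ℕ_)
  open import Algebra.Definitions.RawSemiring (CommutativeSemiring.rawSemiring ℕ.+-*-commutativeSemiring) using () renaming (_^_ to _^ˢ_)

  prime>1 : ∀ {p} → Prime p → 1 < p
  prime>1 {p} pr = ℕ.nonTrivial⇒n>1 p {{prime⇒nonTrivial pr}}

  prime∤! : ∀ {p} → Prime p → ∀ k → k < p → ¬ p ℕ.∣ k !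
  prime∤! pr zero _ p∣1 = ℕ.<⇒≱ (prime>1 pr) (ℕ.∣⇒≤ p∣1)
  prime∤! pr (suc k) k<p p∣ with euclidsLemma (suc k) (k !) pr p∣
  ... | inj₁ p∣k = ℕ.<⇒≱ k<p (ℕ.∣⇒≤ p∣k)
  ... | inj₂ p∣k! = prime∤! pr k (ℕ.<-trans (ℕ.n<1+n k) k<p) p∣k!

  prime∣binomial : ∀ {p} → Prime p → ∀ k → 0 < k → k < p → p ℕ.∣ p C k
  prime∣binomial {p} pr k 0<k k<p = [ id , (λ p∣ → ⊥-elim ([ prime∤! pr k k<p , prime∤! pr (p ∸ k) p-k<p ]′
      (euclidsLemma (k !) ((p ∸ k) !) pr p∣))) ]′
    (euclidsLemma (p C k) (k ! * (p ∸ k) !) pr (subst (p ℕ.∣_) (sym product) (p∣p! p (ℕ.≤-trans (ℕ.s≤s ℕ.z≤n) (prime>1 pr)))))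
    where
    instance _ = k ℕ.!* (p ∸ k) !≢0
    p-k<p : p ∸ k < p
    p-k<p = ℕ.∸-monoʳ-< 0<k (ℕ.<⇒≤ k<p)
    p∣p! : ∀ p → 0 < p → p ℕ.∣ p !
    p∣p! (suc p) _ = ℕ.m∣m*n (p !)
    product : (p C k) * (k ! * (p ∸ k) !) ≡ p !
    product = trans (cong (_* (k ! * (p ∸ k) !)) (nCk≡n!/k![n-k]! (ℕ.<⇒≤ k<p))) (ℕ.m/n*n≡m (k![n∸k]!∣n! (ℕ.<⇒≤ k<p)))

  private
    ^ˢ≡^ : ∀ x n → x ^ˢ n ≡ x ^ n
    ^ˢ≡^ x zero = refl
    ^ˢ≡^ x (suc n) = cong (x *_) (^ˢ≡^ x n)

    ×≡* : ∀ n x → n ×ℕ x ≡ n * x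
    ×≡* zero x = refl
    ×≡* (suc n) x = cong (λ u → x + u) (×≡* n x)

    sum-∣ : ∀ {p} n (t : Fin n → ℕ) → (∀ k → p ℕ.∣ t k) → p ℕ.∣ Sum.sum t
    sum-∣ zero t div = _ ℕ.∣0
    sum-∣ (suc n) t div = ℕ.∣m∣n⇒∣m+n (div zero) (sum-∣ n (t ∘ suc) (div ∘ suc))

    sum-ends : ∀ {p} n (t : Fin (suc (suc n)) → ℕ) → (∀ k → p ℕ.∣ t (suc (Fin.inject₁ k))) →
      ∃ λ m → Sum.sum t ≡ t zero + (m * p + t (suc (Fin.fromℕ n)))
    sum-ends n t div with sum-∣ n (λ k → t (suc (Fin.inject₁ k))) div
    ... | ℕ.divides m eq = m , cong (λ u → t zero + u)
      (trans (Sum.sum-init-last (t ∘ suc)) (cong (_+ t (suc (Fin.fromℕ n))) eq))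

  -- Induction on x: the inner terms of the binomial expansion of (x + 1)^p are multiples of p.
  fermat : ∀ {p} → Prime p → ∀ x → ∃ λ k → x ^ p ≡ x + k * p
  fermat {suc n} pr zero = 0 , refl
  fermat {suc n} pr (suc x) with fermat pr x | sum-ends n (binomialTerm x 1 p) middle
    where
    p = suc n
    middle : ∀ k → p ℕ.∣ binomialTerm x 1 p (suc (Fin.inject₁ k))
    middle k = subst (p ℕ.∣_) (sym (×≡* (p C suc (toℕ (Fin.inject₁ k))) _)) (ℕ.∣m⇒∣m*n _
      (prime∣binomial pr (suc (toℕ (Fin.inject₁ k))) (ℕ.s≤s ℕ.z≤n)
        (ℕ.s≤s (subst (_< n) (sym (Fin.toℕ-inject₁ k)) (Fin.toℕ<n k)))))
  ... | k , x^p≡ | m , sum≡ = m + k , (begin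
    suc x ^ p                                   ≡⟨ cong (_^ p) (ℕ.+-comm 1 x) ⟩
    (x + 1) ^ p                                 ≡⟨ ^ˢ≡^ (x + 1) p ⟨
    (x + 1) ^ˢ p                                ≡⟨ theorem p x 1 ⟩
    Sum.sum (binomialTerm x 1 p)                ≡⟨ sum≡ ⟩
    binomialTerm x 1 p zero + (m * p + binomialTerm x 1 p (suc (Fin.fromℕ n)))
      ≡⟨ cong₂ (λ u v → u + (m * p + v)) first last ⟩
    1 + (m * p + x ^ p)                         ≡⟨ cong (λ u → 1 + (m * p + u)) x^p≡ ⟩
    1 + (m * p + (x + k * p))                   ≡⟨ collect m k x p ⟩
    suc x + (m + k) * p ∎)
    where
    open ≡-Reasoning
    p = suc n
    collect : ∀ m k x p → 1 + (m * p + (x + k * p)) ≡ 1 + x + (m + k) * p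
    collect = ℕ.solve-∀
    first : binomialTerm x 1 p zero ≡ 1
    first = trans (×≡* (p C 0) (1 * 1 ^ˢ p)) (trans (ℕ.*-identityˡ (1 * 1 ^ˢ p)) (trans (ℕ.*-identityˡ (1 ^ˢ p))
      (trans (^ˢ≡^ 1 p) (ℕ.^-zeroˡ p))))
    last : binomialTerm x 1 p (suc (Fin.fromℕ n)) ≡ x ^ p
    last = trans (cong (λ j → (p C suc j) ×ℕ (x ^ˢ suc j * 1 ^ˢ (n ∸ j))) (Fin.toℕ-fromℕ n))
      (trans (×≡* (p C p) (x ^ˢ p * 1 ^ˢ (n ∸ n))) (trans (cong₂ _*_ (nCn≡1 p) (trans (cong (x ^ˢ p *_)
        (trans (^ˢ≡^ 1 (n ∸ n)) (ℕ.^-zeroˡ (n ∸ n)))) (ℕ.*-identityʳ (x ^ˢ p))))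
        (trans (ℕ.*-identityˡ (x ^ˢ p)) (^ˢ≡^ x p))))

module _ where
  open import Data.Integer using (_+_; _*_; _-_; -_; _^_; ∣_∣)

  infix 4 _∣ℤ_
  record _∣ℤ_ (p : ℕ) (z : ℤ) : Set where
    constructor _,ℤ_
    field
      quotient : ℤ
      equality : z ≡ quotient * + p

  toℕ∣ : ∀ {p z} → p ∣ℤ z → p ℕ.∣ ∣ z ∣
  toℕ∣ {p} (k ,ℤ refl) = ℕ.divides ∣ k ∣ (ℤ.abs-* k (+ p))

  fromℕ∣ : ∀ {p} z → p ℕ.∣ ∣ z ∣ → p ∣ℤ z
  fromℕ∣ {p} (+ n) (ℕ.divides k refl) = (+ k) ,ℤ ℤ.pos-* k p
  fromℕ∣ {p} -[1+ n ] (ℕ.divides k eq) = (- (+ k)) ,ℤ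
    trans (cong (λ m → - (+ m)) eq) (trans (cong -_ (ℤ.pos-* k p)) (ℤ.neg-distribˡ-* (+ k) (+ p)))

  ∣ℤ-- : ∀ {p x y} → p ∣ℤ x → p ∣ℤ y → p ∣ℤ x - y
  ∣ℤ-- {p} (k ,ℤ refl) (l ,ℤ refl) = (k - l) ,ℤ identity k l (+ p)
    where
    identity : ∀ k l p → k * p - l * p ≡ (k - l) * p
    identity = ℤ.solve-∀

  prime∣ℤ* : ∀ {p} → Prime p → ∀ x y → p ∣ℤ x * y → p ∣ℤ x ⊎ p ∣ℤ y
  prime∣ℤ* {p} pr x y p∣ with euclidsLemma ∣ x ∣ ∣ y ∣ pr (subst (p ℕ.∣_) (ℤ.abs-* x y) (toℕ∣ p∣))
  ... | inj₁ z = inj₁ (fromℕ∣ x z)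
  ... | inj₂ z = inj₂ (fromℕ∣ y z)

  -- The monic polynomial with lower coefficients c₀, …, cₙ₋₁, by Horner's rule.
  monic : ∀ {n} → Vec ℤ n → ℤ → ℤ
  monic [] x = + 1
  monic (c ∷ cs) x = c + x * monic cs x

  deflate : ∀ {n} (cs : Vec ℤ (suc n)) r → ∃ λ (ds : Vec ℤ n) → ∀ x → monic cs x - monic cs r ≡ (x - r) * monic ds x
  deflate (c ∷ []) r = [] , λ x → identity c x r
    where
    identity : ∀ c x r → c + x * + 1 - (c + r * + 1) ≡ (x - r) * + 1
    identity = ℤ.solve-∀
  deflate (c ∷ cs@(_ ∷ _)) r with deflate cs r
  ... | ds , eq = monic cs r ∷ ds , λ x → trans (expand c x r (monic cs x) (monic cs r))
    (trans (cong (λ u → x * u + (x - r) * monic cs r) (eq x)) (collect x r (monic cs r) (monic ds x)))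
    where
    expand : ∀ c x r e f → c + x * e - (c + r * f) ≡ x * (e - f) + (x - r) * f
    expand = ℤ.solve-∀
    collect : ∀ x r f q → x * ((x - r) * q) + (x - r) * f ≡ (x - r) * (f + x * q)
    collect = ℤ.solve-∀

  -- Deflating at the root k leaves the roots k + 1, ..., k + n, because their differences from k
  -- are positive and less than p. Consecutive roots are enough for `nonresidue` and need no list of
  -- distinct residues.
  lagrange : ∀ {p} → Prime p → ∀ n (cs : Vec ℤ n) k → n ℕ.< p → (∀ j → j ℕ.≤ n → p ∣ℤ monic cs (+ (j ℕ.+ k))) → ⊥
  lagrange pr zero [] k _ roots = ℕ.<⇒≱ (prime>1 pr) (ℕ.∣⇒≤ (toℕ∣ (roots 0 ℕ.z≤n)))
  lagrange {p} pr (suc n) cs k n<p roots with deflate cs (+ k)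
  ... | ds , eq = lagrange pr n ds (suc k) (ℕ.<-trans (ℕ.n<1+n n) n<p) λ j j≤n →
    subst (λ m → p ∣ℤ monic ds (+ m)) (sym (ℕ.+-suc j k)) (root (suc j) (ℕ.s≤s j≤n) (ℕ.s≤s ℕ.z≤n))
    where
    shift : ∀ j k → + (j ℕ.+ k) - + k ≡ + j
    shift j k = trans (cong (_- + k) (ℤ.pos-+ j k)) (identity (+ j) (+ k))
      where
      identity : ∀ j k → j + k - k ≡ j
      identity = ℤ.solve-∀
    root : ∀ j → j ℕ.≤ suc n → 0 ℕ.< j → p ∣ℤ monic ds (+ (j ℕ.+ k))
    root j j≤n 0<j with prime∣ℤ* pr (+ j) (monic ds (+ (j ℕ.+ k)))
      (subst (p ∣ℤ_) (trans (eq (+ (j ℕ.+ k))) (cong (_* monic ds (+ (j ℕ.+ k))) (shift j k)))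
        (∣ℤ-- (roots j j≤n) (roots 0 ℕ.z≤n)))
    ... | inj₂ z = z
    ... | inj₁ z = ⊥-elim (ℕ.<⇒≱ (ℕ.≤-<-trans j≤n n<p) (ℕ.∣⇒≤ {{ℕ.>-nonZero 0<j}} (toℕ∣ z)))

  fermatℤ : ∀ {p} h → Prime p → p ≡ suc (h ℕ.+ h) → ∀ x → ¬ p ℕ.∣ x → p ∣ℤ ((+ x) ^ h - + 1) * ((+ x) ^ h + + 1)
  fermatℤ {p} h pr p≡ x p∤x with fermat pr x
  ... | k , x^p≡ with prime∣ℤ* pr (+ x) (((+ x) ^ h - + 1) * ((+ x) ^ h + + 1)) ((+ k) ,ℤ multiple)
    where
    pos-^ : ∀ x n → (+ x) ^ n ≡ + (x ℕ.^ n)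
    pos-^ x zero = refl
    pos-^ x (suc n) = trans (cong (+ x *_) (pos-^ x n)) (sym (ℤ.pos-* x (x ℕ.^ n)))
    expand : ∀ x y → x * ((y - + 1) * (y + + 1)) ≡ x * (y * y) - x
    expand = ℤ.solve-∀
    cancel : ∀ x k → x + k - x ≡ k
    cancel = ℤ.solve-∀
    multiple : + x * (((+ x) ^ h - + 1) * ((+ x) ^ h + + 1)) ≡ + k * + p
    multiple = trans (expand (+ x) ((+ x) ^ h)) (trans (cong (λ u → + x * u - + x) (sym (ℤ.^-distribˡ-+-* (+ x) h h)))
      (trans (cong (_- + x) (trans (cong ((+ x) ^_) (sym p≡)) (trans (pos-^ x p) (trans (cong +_ x^p≡) (ℤ.pos-+ x (k ℕ.* p))))))
        (trans (cancel (+ x) (+ (k ℕ.* p))) (ℤ.pos-* k p))))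
  ... | inj₁ z = ⊥-elim (p∤x (toℕ∣ z))
  ... | inj₂ z = z

  -- X^((p-1)/2) - 1 cannot vanish at all of 1, ..., (p + 1)/2. Where it does not, Fermat's theorem
  -- makes the complementary factor X^((p-1)/2) + 1 vanish.
  nonresidue : ∀ {p h} → Prime p → p ≡ suc (suc h ℕ.+ suc h) → ∃ λ x → p ∣ℤ (+ x) ^ suc h + + 1
  nonresidue {p} {h} pr p≡ with any? {n = suc (suc h)} (λ j → ¬? (p ℕ.∣? ∣ (+ suc (toℕ j)) ^ suc h - + 1 ∣))
  ... | yes (j , p∤) = suc (toℕ j) , [ (λ (z : p ∣ℤ (+ suc (toℕ j)) ^ suc h - + 1) → ⊥-elim (p∤ (toℕ∣ z))) , id ]′
    (prime∣ℤ* pr ((+ suc (toℕ j)) ^ suc h - + 1) ((+ suc (toℕ j)) ^ suc h + + 1) (fermatℤ (suc h) pr p≡ (suc (toℕ j)) λ p∣ → ℕ.<⇒≱ small (ℕ.∣⇒≤ p∣)))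
    where
    small : suc (toℕ j) ℕ.< p
    small = subst (suc (toℕ j) ℕ.<_) (sym p≡) (ℕ.s≤s (ℕ.≤-trans (Fin.toℕ<n j)
      (subst (suc (suc h) ℕ.≤_) (cong suc (sym (ℕ.+-suc h h))) (ℕ.s≤s (ℕ.s≤s (ℕ.m≤m+n h h))))))
  ... | no none = ⊥-elim (lagrange pr (suc h) (- (+ 1) ∷ Vec.replicate h (+ 0)) 1 degree λ j j≤h →
      subst (p ∣ℤ_) (sym (value (+ (j ℕ.+ 1)))) (fromℕ∣ ((+ (j ℕ.+ 1)) ^ suc h - + 1) (root j j≤h)))
    where
    degree : suc h ℕ.< p
    degree = subst (suc h ℕ.<_) (sym p≡) (ℕ.s≤s (ℕ.m≤m+n (suc h) (suc h)))
    zeros : ∀ n x → monic (Vec.replicate n (+ 0)) x ≡ x ^ n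
    zeros zero x = refl
    zeros (suc n) x = trans (ℤ.+-identityˡ _) (cong (x *_) (zeros n x))
    value : ∀ x → monic (- (+ 1) ∷ Vec.replicate h (+ 0)) x ≡ x ^ suc h - + 1
    value x = trans (ℤ.+-comm (- (+ 1)) (x * monic (Vec.replicate h (+ 0)) x)) (cong (λ u → x * u - + 1) (zeros h x))
    root : ∀ j → j ℕ.≤ suc h → p ℕ.∣ ∣ (+ (j ℕ.+ 1)) ^ suc h - + 1 ∣
    root j j≤h = decidable-stable (p ℕ.∣? _) λ p∤ → none (Fin.fromℕ< (ℕ.s≤s j≤h) ,
      subst (λ m → ¬ p ℕ.∣ ∣ (+ m) ^ suc h - + 1 ∣) (trans (ℕ.+-comm j 1) (cong suc (sym (Fin.toℕ-fromℕ< (ℕ.s≤s j≤h))))) p∤)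

-- Circulants with prescribed values at the roots of unity

module _ where
  open import Data.Integer using (_+_; _*_; _-_; -_)

  S16-neg : ∀ {z} → S16 z → S16 (- z)
  S16-neg (a , refl) = rotate a , D-rotate a

  S16-unneg : ∀ {z} → S16 (- z) → S16 z
  S16-unneg {z} s = subst S16 (ℤ.neg-involutive z) (S16-neg s)

  fromSections : (Fin 4 → Fin 4 → ℤ) → Fin 16 → ℤ
  fromSections k m = k (proj₁ (Fin.remQuot {4} 4 m)) (proj₂ (Fin.remQuot {4} 4 m))

  D-values : ∀ a (v₁ v₋₁ vᵢ vᵢ′ : Fin 4 → ℤ) → (∀ r → at₁ a r ≡ v₁ r) → (∀ r → at₋₁ a r ≡ v₋₁ r) →
    (∀ r → atᵢ a r ≡ vᵢ r) → (∀ r → atᵢ′ a r ≡ vᵢ′ r) →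
    D a ≡ onSections v₁ value₁ * (sq (onSections v₋₁ re₋₁) + sq (onSections v₋₁ im₋₁))
        * (sq (onSections₂ vᵢ vᵢ′ reᵢ) + sq (onSections₂ vᵢ vᵢ′ imᵢ))
  D-values a v₁ v₋₁ vᵢ vᵢ′ e₁ e₋₁ eᵢ eᵢ′ = trans (D-formula a)
    (product (onSections (at₁ a) value₁) (onSections v₁ value₁) (norm₋₁ a) (sq (onSections v₋₁ re₋₁) + sq (onSections v₋₁ im₋₁))
      (normᵢ a) (sq (onSections₂ vᵢ vᵢ′ reᵢ) + sq (onSections₂ vᵢ vᵢ′ imᵢ))
      (four value₁ e₁) (cong₂ (λ x y → sq x + sq y) (four re₋₁ e₋₁) (four im₋₁ e₋₁))
      (cong₂ (λ x y → sq x + sq y) (eight reᵢ) (eight imᵢ)))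
    where
    cong₄ : ∀ {B : Set} (f : ℤ → ℤ → ℤ → ℤ → B) {x y z w x′ y′ z′ w′} → x ≡ x′ → y ≡ y′ → z ≡ z′ → w ≡ w′ → f x y z w ≡ f x′ y′ z′ w′
    cong₄ f refl refl refl refl = refl
    product : ∀ (x x′ y y′ z z′ : ℤ) → x ≡ x′ → y ≡ y′ → z ≡ z′ → x * y * z ≡ x′ * y′ * z′
    product _ _ _ _ _ _ refl refl refl = refl
    four : ∀ {v w : Fin 4 → ℤ} (f : ℤ → ℤ → ℤ → ℤ → ℤ) → (∀ r → v r ≡ w r) → onSections v f ≡ onSections w f
    four f e = cong₄ f (e (# 0)) (e (# 2)) (e (# 1)) (e (# 3))
    eight : ∀ (f : ℤ → ℤ → ℤ → ℤ → ℤ → ℤ → ℤ → ℤ → ℤ) → onSections₂ (atᵢ a) (atᵢ′ a) f ≡ onSections₂ vᵢ vᵢ′ f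
    eight f = trans
      (cong₄ (λ p q s t → f p (atᵢ′ a (# 0)) q (atᵢ′ a (# 2)) s (atᵢ′ a (# 1)) t (atᵢ′ a (# 3))) (eᵢ (# 0)) (eᵢ (# 2)) (eᵢ (# 1)) (eᵢ (# 3)))
      (cong₄ (λ p q s t → f (vᵢ (# 0)) p (vᵢ (# 2)) q (vᵢ (# 1)) s (vᵢ (# 3)) t) (eᵢ′ (# 0)) (eᵢ′ (# 2)) (eᵢ′ (# 1)) (eᵢ′ (# 3)))

  firstFactor : (p q s t : ℤ) → ℤ
  firstFactor p q s t = ((p + q) * (p + q) - (s + t) * (s + t)) * ((p - q) * (p - q) + (s - t) * (s - t))

  tuple : (p q s t : ℤ) → Fin 4 → ℤ
  tuple p q s t zero = p
  tuple p q s t (suc zero) = s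
  tuple p q s t (suc (suc zero)) = q
  tuple p q s t (suc (suc (suc zero))) = t

  opaque
    unfolding value₁ re₋₁ im₋₁ reₑ imₑ reₒ imₒ reᵢ imᵢ

    normᵢ-2 : sq (reᵢ (+ 1) (+ 0) (+ 0) (+ 0) (+ 1) (+ 0) (+ 0) (+ 0)) + sq (imᵢ (+ 1) (+ 0) (+ 0) (+ 0) (+ 1) (+ 0) (+ 0) (+ 0)) ≡ + 2
    normᵢ-2 = refl

    value₁-expand : ∀ p q s t → value₁ p q s t ≡ firstFactor p q s t
    value₁-expand p q s t = refl

    norm-101 : sq (re₋₁ (+ 1) (+ 0) (+ 1) (+ 0)) + sq (im₋₁ (+ 1) (+ 0) (+ 1) (+ 0)) ≡ + 2
    norm-101 = refl

    norm-525 : sq (re₋₁ (+ 5) (+ 2) (+ 5) (- (+ 2))) + sq (im₋₁ (+ 5) (+ 2) (+ 5) (- (+ 2))) ≡ + 2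
    norm-525 = refl

  -- Prescribed values r at -1 and r + 4w at 1, for a residue 1 + x modulo x⁸ + 1.
  glue : ∀ q₀ q₂ q₁ q₃ w₀ w₂ w₁ w₃ →
    S16 (value₁ (+ 1 + + 2 * q₀ + + 4 * w₀) (+ 2 * q₂ + + 4 * w₂) (+ 1 + + 2 * q₁ + + 4 * w₁) (+ 2 * q₃ + + 4 * w₃)
      * (sq (re₋₁ (+ 1 + + 2 * q₀) (+ 2 * q₂) (+ 1 + + 2 * q₁) (+ 2 * q₃)) + sq (im₋₁ (+ 1 + + 2 * q₀) (+ 2 * q₂) (+ 1 + + 2 * q₁) (+ 2 * q₃)))
      * + 2)
  glue q₀ q₂ q₁ q₃ w₀ w₂ w₁ w₃ = a , trans
    (D-values a (tuple (+ 1 + + 2 * q₀ + + 4 * w₀) (+ 2 * q₂ + + 4 * w₂) (+ 1 + + 2 * q₁ + + 4 * w₁) (+ 2 * q₃ + + 4 * w₃))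
      (tuple (+ 1 + + 2 * q₀) (+ 2 * q₂) (+ 1 + + 2 * q₁) (+ 2 * q₃)) (tuple (+ 1) (+ 0) (+ 1) (+ 0)) (λ _ → + 0)
      e₁ e₋₁ eᵢ eᵢ′)
    (cong (V *_) normᵢ-2)
    where
    V : ℤ
    V = value₁ (+ 1 + + 2 * q₀ + + 4 * w₀) (+ 2 * q₂ + + 4 * w₂) (+ 1 + + 2 * q₁ + + 4 * w₁) (+ 2 * q₃ + + 4 * w₃)
      * (sq (re₋₁ (+ 1 + + 2 * q₀) (+ 2 * q₂) (+ 1 + + 2 * q₁) (+ 2 * q₃)) + sq (im₋₁ (+ 1 + + 2 * q₀) (+ 2 * q₂) (+ 1 + + 2 * q₁) (+ 2 * q₃)))
    m q w : Fin 4 → ℤ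
    m = tuple (+ 1) (+ 0) (+ 1) (+ 0)
    q = tuple q₀ q₂ q₁ q₃
    w = tuple w₀ w₂ w₁ w₃
    -- The section is m + q(1 + z²) + w(1 + z)(1 + z²): both added terms vanish at z = ±i, the last
    -- one also at z = -1. The residue m stands for 1 + x, whose norm at ζ₁₆ is exactly 2.
    k : Fin 4 → Fin 4 → ℤ
    k zero r = m r + q r + w r
    k (suc zero) r = w r
    k (suc (suc zero)) r = q r + w r
    k (suc (suc (suc zero))) r = w r
    a : Fin 16 → ℤ
    a = fromSections k
    odd₁ : ∀ q w → + 1 + q + w + w + (q + w) + w ≡ + 1 + + 2 * q + + 4 * w
    odd₁ = ℤ.solve-∀
    even₁ : ∀ q w → + 0 + q + w + w + (q + w) + w ≡ + 2 * q + + 4 * w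
    even₁ = ℤ.solve-∀
    odd₋ : ∀ q w → + 1 + q + w - w + (q + w) - w ≡ + 1 + + 2 * q
    odd₋ = ℤ.solve-∀
    even₋ : ∀ q w → + 0 + q + w - w + (q + w) - w ≡ + 2 * q
    even₋ = ℤ.solve-∀
    oddᵢ : ∀ q w → + 1 + q + w - (q + w) ≡ + 1
    oddᵢ = ℤ.solve-∀
    evenᵢ : ∀ q w → + 0 + q + w - (q + w) ≡ + 0
    evenᵢ = ℤ.solve-∀
    e₁ : ∀ r → at₁ a r ≡ tuple (+ 1 + + 2 * q₀ + + 4 * w₀) (+ 2 * q₂ + + 4 * w₂) (+ 1 + + 2 * q₁ + + 4 * w₁) (+ 2 * q₃ + + 4 * w₃) r
    e₁ zero = odd₁ q₀ w₀
    e₁ (suc zero) = odd₁ q₁ w₁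
    e₁ (suc (suc zero)) = even₁ q₂ w₂
    e₁ (suc (suc (suc zero))) = even₁ q₃ w₃
    e₋₁ : ∀ r → at₋₁ a r ≡ tuple (+ 1 + + 2 * q₀) (+ 2 * q₂) (+ 1 + + 2 * q₁) (+ 2 * q₃) r
    e₋₁ zero = odd₋ q₀ w₀
    e₋₁ (suc zero) = odd₋ q₁ w₁
    e₋₁ (suc (suc zero)) = even₋ q₂ w₂
    e₋₁ (suc (suc (suc zero))) = even₋ q₃ w₃
    eᵢ : ∀ r → atᵢ a r ≡ tuple (+ 1) (+ 0) (+ 1) (+ 0) r
    eᵢ zero = oddᵢ q₀ w₀
    eᵢ (suc zero) = oddᵢ q₁ w₁
    eᵢ (suc (suc zero)) = evenᵢ q₂ w₂
    eᵢ (suc (suc (suc zero))) = evenᵢ q₃ w₃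
    eᵢ′ : ∀ r → atᵢ′ a r ≡ + 0
    eᵢ′ zero = ℤ.+-inverseʳ w₀
    eᵢ′ (suc zero) = ℤ.+-inverseʳ w₁
    eᵢ′ (suc (suc zero)) = ℤ.+-inverseʳ w₂
    eᵢ′ (suc (suc (suc zero))) = ℤ.+-inverseʳ w₃

  record Glue (z : ℤ) : Set where
    field
      q₀ q₂ q₁ q₃ w₀ w₂ w₁ w₃ p q s t r₀ r₂ r₁ r₃ v n : ℤ
      p≡ : p ≡ + 1 + + 2 * q₀ + + 4 * w₀
      q≡ : q ≡ + 2 * q₂ + + 4 * w₂
      s≡ : s ≡ + 1 + + 2 * q₁ + + 4 * w₁
      t≡ : t ≡ + 2 * q₃ + + 4 * w₃
      r₀≡ : r₀ ≡ + 1 + + 2 * q₀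
      r₂≡ : r₂ ≡ + 2 * q₂
      r₁≡ : r₁ ≡ + 1 + + 2 * q₁
      r₃≡ : r₃ ≡ + 2 * q₃
      first : firstFactor p q s t ≡ v
      norm : sq (re₋₁ r₀ r₂ r₁ r₃) + sq (im₋₁ r₀ r₂ r₁ r₃) ≡ n
      product : v * n * + 2 ≡ z

  fromGlue : ∀ z → Glue z → S16 z
  fromGlue _ record { q₀ = q₀ ; q₂ = q₂ ; q₁ = q₁ ; q₃ = q₃ ; w₀ = w₀ ; w₂ = w₂ ; w₁ = w₁ ; w₃ = w₃ ; p = p ; q = q ; s = s ; t = t
                  ; p≡ = refl ; q≡ = refl ; s≡ = refl ; t≡ = refl ; r₀≡ = refl ; r₂≡ = refl ; r₁≡ = refl ; r₃≡ = refl
                  ; first = refl ; norm = refl ; product = refl } =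
    subst (λ v → S16 (v * N * + 2)) (value₁-expand p q s t) (glue q₀ q₂ q₁ q₃ w₀ w₂ w₁ w₃)
    where
    N : ℤ
    N = sq (re₋₁ (+ 1 + + 2 * q₀) (+ 2 * q₂) (+ 1 + + 2 * q₁) (+ 2 * q₃)) + sq (im₋₁ (+ 1 + + 2 * q₀) (+ 2 * q₂) (+ 1 + + 2 * q₁) (+ 2 * q₃))

  S16-128 : ∀ m → S16 (+ 128 * m)
  S16-128 m = cases (parity m)
    where
    -- p - q = s - t = 1 gives norm 2 at i, and f(1)f(-1) = (1 + 8n)² - (1 - 8n)² = 32n.
    even : ∀ n → Glue (+ 128 * (+ 2 * n))
    even n = record
      { q₀ = + 0 ; q₂ = + 0 ; q₁ = + 0 ; q₃ = + 0 ; w₀ = n ; w₂ = n ; w₁ = - n ; w₃ = - n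
      ; p = + 1 + + 4 * n ; q = + 4 * n ; s = + 1 + + 4 * - n ; t = + 4 * - n ; r₀ = + 1 ; r₂ = + 0 ; r₁ = + 1 ; r₃ = + 0
      ; v = + 64 * n ; n = + 2
      ; p≡ = refl ; q≡ = sym (ℤ.+-identityˡ (+ 4 * n)) ; s≡ = refl ; t≡ = sym (ℤ.+-identityˡ (+ 4 * - n))
      ; r₀≡ = refl ; r₂≡ = refl ; r₁≡ = refl ; r₃≡ = refl
      ; first = expand n ; norm = norm-101 ; product = collect n }
      where
      expand : ∀ n → firstFactor (+ 1 + + 4 * n) (+ 4 * n) (+ 1 + + 4 * - n) (+ 4 * - n) ≡ + 64 * n
      expand n = identity n
        where
        identity : ∀ n → let p = + 1 + + 4 * n ; q = + 4 * n ; s = + 1 + + 4 * - n ; t = + 4 * - n in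
          ((p + q) * (p + q) - (s + t) * (s + t)) * ((p - q) * (p - q) + (s - t) * (s - t)) ≡ + 64 * n
        identity = ℤ.solve-∀
      collect : ∀ n → + 64 * n * + 2 * + 2 ≡ + 128 * (+ 2 * n)
      collect = ℤ.solve-∀
    -- The residue 5, 2, 5, -2 at -1 has norm 2 again, so it is 1 + ζ₈ times a unit, but it allows
    -- other values at 1. Now p - q = s - t = -1, and f(1)f(-1) = (5 + 8n)² - (3 + 8n)² = 16(1 +
    -- 2n).
    odd : ∀ n → Glue (+ 128 * (+ 1 + + 2 * n))
    odd n = record
      { q₀ = + 2 ; q₂ = + 1 ; q₁ = + 2 ; q₃ = - (+ 1) ; w₀ = - (+ 2) - n ; w₂ = - (+ 1) - n ; w₁ = n - + 1 ; w₃ = n + + 1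
      ; p = + 5 + + 4 * (- (+ 2) - n) ; q = + 2 + + 4 * (- (+ 1) - n) ; s = + 5 + + 4 * (n - + 1) ; t = - (+ 2) + + 4 * (n + + 1)
      ; r₀ = + 5 ; r₂ = + 2 ; r₁ = + 5 ; r₃ = - (+ 2) ; v = + 32 * (+ 1 + + 2 * n) ; n = + 2
      ; p≡ = refl ; q≡ = refl ; s≡ = refl ; t≡ = refl ; r₀≡ = refl ; r₂≡ = refl ; r₁≡ = refl ; r₃≡ = refl
      ; first = expand n ; norm = norm-525 ; product = collect n }
      where
      expand : ∀ n → firstFactor (+ 5 + + 4 * (- (+ 2) - n)) (+ 2 + + 4 * (- (+ 1) - n)) (+ 5 + + 4 * (n - + 1)) (- (+ 2) + + 4 * (n + + 1))
        ≡ + 32 * (+ 1 + + 2 * n)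
      expand n = identity n
        where
        identity : ∀ n → let p = + 5 + + 4 * (- (+ 2) - n) ; q = + 2 + + 4 * (- (+ 1) - n) ; s = + 5 + + 4 * (n - + 1) ; t = - (+ 2) + + 4 * (n + + 1) in
          ((p + q) * (p + q) - (s + t) * (s + t)) * ((p - q) * (p - q) + (s - t) * (s - t)) ≡ + 32 * (+ 1 + + 2 * n)
        identity = ℤ.solve-∀
      collect : ∀ n → + 32 * (+ 1 + + 2 * n) * + 2 * + 2 ≡ + 128 * (+ 1 + + 2 * n)
      collect = ℤ.solve-∀
    cases : (∃ λ n → m ≡ + 2 * n) ⊎ (∃ λ n → m ≡ + 1 + + 2 * n) → S16 (+ 128 * m)
    cases (inj₁ (n , eq)) = subst (λ m → S16 (+ 128 * m)) (sym eq) (fromGlue (+ 128 * (+ 2 * n)) (even n))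
    cases (inj₂ (n , eq)) = subst (λ m → S16 (+ 128 * m)) (sym eq) (fromGlue (+ 128 * (+ 1 + + 2 * n)) (odd n))

  private
    -- Adding k(1 + x + ⋯ + x¹⁵) to f changes it, among the sixteenth roots of unity, only at 1, and
    -- there by 16k.
    shifted : (Fin 4 → Fin 4 → ℤ) → ℤ → Fin 16 → ℤ
    shifted b k = fromSections λ j r → b j r + k

    values-shift : ∀ b k (v₁ v₋₁ vᵢ vᵢ′ : Fin 4 → ℤ) →
      (∀ r → b (# 0) r + b (# 1) r + b (# 2) r + b (# 3) r ≡ v₁ r) → (∀ r → b (# 0) r - b (# 1) r + b (# 2) r - b (# 3) r ≡ v₋₁ r) →
      (∀ r → b (# 0) r - b (# 2) r ≡ vᵢ r) → (∀ r → b (# 1) r - b (# 3) r ≡ vᵢ′ r) →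
      D (shifted b k) ≡ onSections (λ r → v₁ r + + 4 * k) value₁ * (sq (onSections v₋₁ re₋₁) + sq (onSections v₋₁ im₋₁))
        * (sq (onSections₂ vᵢ vᵢ′ reᵢ) + sq (onSections₂ vᵢ vᵢ′ imᵢ))
    values-shift b k v₁ v₋₁ vᵢ vᵢ′ e₁ e₋₁ eᵢ eᵢ′ = D-values (shifted b k) (λ r → v₁ r + + 4 * k) v₋₁ vᵢ vᵢ′
      (each (λ r → trans (sum (b (# 0) r) (b (# 1) r) (b (# 2) r) (b (# 3) r) k) (cong (_+ + 4 * k) (e₁ r))))
      (each′ (λ r → trans (alternating (b (# 0) r) (b (# 1) r) (b (# 2) r) (b (# 3) r) k) (e₋₁ r)))
      (eachᵢ (λ r → trans (difference (b (# 0) r) (b (# 2) r) k) (eᵢ r)))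
      (eachᵢ′ (λ r → trans (difference (b (# 1) r) (b (# 3) r) k) (eᵢ′ r)))
      where
      sum : ∀ x y z w k → x + k + (y + k) + (z + k) + (w + k) ≡ x + y + z + w + + 4 * k
      sum = ℤ.solve-∀
      alternating : ∀ x y z w k → x + k - (y + k) + (z + k) - (w + k) ≡ x - y + z - w
      alternating = ℤ.solve-∀
      difference : ∀ x y k → x + k - (y + k) ≡ x - y
      difference = ℤ.solve-∀
      K : Fin 4 → Fin 4 → ℤ
      K j r = b j r + k
      each : (∀ r → K (# 0) r + K (# 1) r + K (# 2) r + K (# 3) r ≡ v₁ r + + 4 * k) → ∀ r → at₁ (shifted b k) r ≡ v₁ r + + 4 * k
      each e zero = e (# 0)
      each e (suc zero) = e (# 1)
      each e (suc (suc zero)) = e (# 2)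
      each e (suc (suc (suc zero))) = e (# 3)
      each′ : (∀ r → K (# 0) r - K (# 1) r + K (# 2) r - K (# 3) r ≡ v₋₁ r) → ∀ r → at₋₁ (shifted b k) r ≡ v₋₁ r
      each′ e zero = e (# 0)
      each′ e (suc zero) = e (# 1)
      each′ e (suc (suc zero)) = e (# 2)
      each′ e (suc (suc (suc zero))) = e (# 3)
      eachᵢ : (∀ r → K (# 0) r - K (# 2) r ≡ vᵢ r) → ∀ r → atᵢ (shifted b k) r ≡ vᵢ r
      eachᵢ e zero = e (# 0)
      eachᵢ e (suc zero) = e (# 1)
      eachᵢ e (suc (suc zero)) = e (# 2)
      eachᵢ e (suc (suc (suc zero))) = e (# 3)
      eachᵢ′ : (∀ r → K (# 1) r - K (# 3) r ≡ vᵢ′ r) → ∀ r → atᵢ′ (shifted b k) r ≡ vᵢ′ r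
      eachᵢ′ e zero = e (# 0)
      eachᵢ′ e (suc zero) = e (# 1)
      eachᵢ′ e (suc (suc zero)) = e (# 2)
      eachᵢ′ e (suc (suc (suc zero))) = e (# 3)

    -- Coefficients of 1 + x + ⋯ + xⁿ⁻¹.
    initial : ℕ → Fin 4 → Fin 4 → ℤ
    initial n j r = if toℕ (Fin.combine j r) ℕ.<ᵇ n then + 1 else + 0

    initial-sum initial-alternating initial-re initial-im : ℕ → Fin 4 → ℤ
    initial-sum n r = initial n (# 0) r + initial n (# 1) r + initial n (# 2) r + initial n (# 3) r
    initial-alternating n r = initial n (# 0) r - initial n (# 1) r + initial n (# 2) r - initial n (# 3) r
    initial-re n r = initial n (# 0) r - initial n (# 2) r
    initial-im n r = initial n (# 1) r - initial n (# 3) r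

    opaque
      unfolding value₁ re₋₁ im₋₁ reₑ imₑ reₒ imₒ reᵢ imᵢ

      -- For odd n, 1 + x + ⋯ + xⁿ⁻¹ is a unit at the 16th roots of unity other than ±1.
      Unit : ℕ → Set
      Unit n = (sq (onSections (initial-alternating n) re₋₁) + sq (onSections (initial-alternating n) im₋₁) ≡ + 1)
             × (sq (onSections₂ (initial-re n) (initial-im n) reᵢ) + sq (onSections₂ (initial-re n) (initial-im n) imᵢ) ≡ + 1)

      unit₁ : Unit 1
      unit₁ = refl , refl
      unit₃ : Unit 3
      unit₃ = refl , refl
      unit₅ : Unit 5
      unit₅ = refl , refl
      unit₇ : Unit 7
      unit₇ = refl , refl

      D-unit : ∀ n k z → Unit n → onSections (λ r → initial-sum n r + + 4 * k) value₁ ≡ z → D (shifted (initial n) k) ≡ z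
      D-unit n k z (u , v) eq = trans
        (values-shift (initial n) k (initial-sum n) (initial-alternating n) (initial-re n) (initial-im n)
          (λ _ → refl) (λ _ → refl) (λ _ → refl) (λ _ → refl))
        (trans (cong₂ (λ x y → onSections (λ r → initial-sum n r + + 4 * k) value₁ * x * y) u v)
          (trans (ℤ.*-identityʳ _) (trans (ℤ.*-identityʳ _) eq)))

      value-1 : ∀ k → onSections (λ r → initial-sum 1 r + + 4 * k) value₁ ≡ + 1 + + 16 * k
      value-1 k = identity k
        where
        identity : ∀ k → let p = + 1 + + 4 * k ; q = + 0 + + 4 * k ; s = + 0 + + 4 * k ; t = + 0 + + 4 * k in
          ((p + q) * (p + q) - (s + t) * (s + t)) * ((p - q) * (p - q) + (s - t) * (s - t)) ≡ + 1 + + 16 * k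
        identity = ℤ.solve-∀
      value-3 : ∀ k → onSections (λ r → initial-sum 3 r + + 4 * k) value₁ ≡ + 3 + + 16 * k
      value-3 k = identity k
        where
        identity : ∀ k → let p = + 1 + + 4 * k ; q = + 1 + + 4 * k ; s = + 1 + + 4 * k ; t = + 0 + + 4 * k in
          ((p + q) * (p + q) - (s + t) * (s + t)) * ((p - q) * (p - q) + (s - t) * (s - t)) ≡ + 3 + + 16 * k
        identity = ℤ.solve-∀
      value-5 : ∀ k → onSections (λ r → initial-sum 5 r + + 4 * k) value₁ ≡ + 5 + + 16 * k
      value-5 k = identity k
        where
        identity : ∀ k → let p = + 2 + + 4 * k ; q = + 1 + + 4 * k ; s = + 1 + + 4 * k ; t = + 1 + + 4 * k in
          ((p + q) * (p + q) - (s + t) * (s + t)) * ((p - q) * (p - q) + (s - t) * (s - t)) ≡ + 5 + + 16 * k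
        identity = ℤ.solve-∀
      value-7 : ∀ k → onSections (λ r → initial-sum 7 r + + 4 * k) value₁ ≡ + 7 + + 16 * k
      value-7 k = identity k
        where
        identity : ∀ k → let p = + 2 + + 4 * k ; q = + 2 + + 4 * k ; s = + 2 + + 4 * k ; t = + 1 + + 4 * k in
          ((p + q) * (p + q) - (s + t) * (s + t)) * ((p - q) * (p - q) + (s - t) * (s - t)) ≡ + 7 + + 16 * k
        identity = ℤ.solve-∀

  -- The polynomials 1 + x + ⋯ + xⁿ⁻¹ with n = 1, 3, 5, 7 give the values n + 16k; changing signs
  -- supplies the remaining odd residues modulo 16.
  S16-odd : ∀ k → S16 (+ 1 + + 2 * k)
  S16-odd k = cases (parity k)
    where
    s₁ : ∀ k → S16 (+ 1 + + 16 * k)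
    s₁ k = shifted (initial 1) k , D-unit 1 k (+ 1 + + 16 * k) unit₁ (value-1 k)
    s₃ : ∀ k → S16 (+ 3 + + 16 * k)
    s₃ k = shifted (initial 3) k , D-unit 3 k (+ 3 + + 16 * k) unit₃ (value-3 k)
    s₅ : ∀ k → S16 (+ 5 + + 16 * k)
    s₅ k = shifted (initial 5) k , D-unit 5 k (+ 5 + + 16 * k) unit₅ (value-5 k)
    s₇ : ∀ k → S16 (+ 7 + + 16 * k)
    s₇ k = shifted (initial 7) k , D-unit 7 k (+ 7 + + 16 * k) unit₇ (value-7 k)
    Parity′ : ℤ → Set
    Parity′ x = (∃ λ k → x ≡ + 2 * k) ⊎ (∃ λ k → x ≡ + 1 + + 2 * k)
    0mod8 : ∀ l → Parity′ l → S16 (+ 1 + + 8 * l)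
    0mod8 l (inj₁ (j , eq)) = subst (λ l → S16 (+ 1 + + 8 * l)) (sym eq) (subst S16 (identity j) (s₁ j))
      where
      identity : ∀ j → + 1 + + 16 * j ≡ + 1 + + 8 * (+ 2 * j)
      identity = ℤ.solve-∀
    0mod8 l (inj₂ (j , eq)) = subst (λ l → S16 (+ 1 + + 8 * l)) (sym eq) (S16-unneg (subst S16 (identity j) (s₇ (- j - + 1))))
      where
      identity : ∀ j → + 7 + + 16 * (- j - + 1) ≡ - (+ 1 + + 8 * (+ 1 + + 2 * j))
      identity = ℤ.solve-∀
    1mod8 : ∀ l → Parity′ l → S16 (+ 5 + + 8 * l)
    1mod8 l (inj₁ (j , eq)) = subst (λ l → S16 (+ 5 + + 8 * l)) (sym eq) (subst S16 (identity j) (s₅ j))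
      where
      identity : ∀ j → + 5 + + 16 * j ≡ + 5 + + 8 * (+ 2 * j)
      identity = ℤ.solve-∀
    1mod8 l (inj₂ (j , eq)) = subst (λ l → S16 (+ 5 + + 8 * l)) (sym eq) (S16-unneg (subst S16 (identity j) (s₃ (- j - + 1))))
      where
      identity : ∀ j → + 3 + + 16 * (- j - + 1) ≡ - (+ 5 + + 8 * (+ 1 + + 2 * j))
      identity = ℤ.solve-∀
    1mod4 : ∀ l → Parity′ l → S16 (+ 1 + + 4 * l)
    1mod4 l (inj₁ (j , eq)) = subst (λ l → S16 (+ 1 + + 4 * l)) (sym eq) (subst S16 (identity j) (0mod8 j (parity j)))
      where
      identity : ∀ j → + 1 + + 8 * j ≡ + 1 + + 4 * (+ 2 * j)
      identity = ℤ.solve-∀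
    1mod4 l (inj₂ (j , eq)) = subst (λ l → S16 (+ 1 + + 4 * l)) (sym eq) (subst S16 (identity j) (1mod8 j (parity j)))
      where
      identity : ∀ j → + 5 + + 8 * j ≡ + 1 + + 4 * (+ 1 + + 2 * j)
      identity = ℤ.solve-∀
    cases : Parity′ k → S16 (+ 1 + + 2 * k)
    cases (inj₁ (l , eq)) = subst (λ k → S16 (+ 1 + + 2 * k)) (sym eq) (subst S16 (identity l) (1mod4 l (parity l)))
      where
      identity : ∀ l → + 1 + + 4 * l ≡ + 1 + + 2 * (+ 2 * l)
      identity = ℤ.solve-∀
    cases (inj₂ (l , eq)) = subst (λ k → S16 (+ 1 + + 2 * k)) (sym eq) (S16-unneg (subst S16 (identity l) (1mod4 (- l - + 1) (parity (- l - + 1)))))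
      where
      identity : ∀ l → + 1 + + 4 * (- l - + 1) ≡ - (+ 1 + + 2 * (+ 1 + + 2 * l))
      identity = ℤ.solve-∀

  -- Given a norm 2n at -1, the choice s₀ - s₁ = s₂ - s₃ = 1 and s₁ - s₃ = ±2 of the values
  -- at 1 leaves the factor ±(s₁ + s₃ + 1), which runs through all odd numbers up to sign.
  S16-64 : ∀ n q′ q γ α β → q′ ≡ + 1 + + 2 * γ - q →
    sq (re₋₁ (+ 1 + + 2 * (q′ + + 2 * α)) (+ 2 * q′) (+ 1 + + 2 * (q + + 2 * β)) (+ 2 * q))
      + sq (im₋₁ (+ 1 + + 2 * (q′ + + 2 * α)) (+ 2 * q′) (+ 1 + + 2 * (q + + 2 * β)) (+ 2 * q)) ≡ + 2 * n →
    ∀ k → S16 (+ 64 * n * (+ 1 + + 2 * k))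
  S16-64 n q′ q γ α β q′≡ norm k = cases (parity k)
    where
    family₊ : ∀ j → S16 (+ 64 * n * (+ 3 + + 4 * q + + 8 * j))
    family₊ j = fromGlue (+ 64 * n * (+ 3 + + 4 * q + + 8 * j)) record
      { q₀ = q′ + + 2 * α ; q₂ = q′ ; q₁ = q + + 2 * β ; q₃ = q ; w₀ = j + q - γ - α ; w₂ = j + q - γ ; w₁ = j - β ; w₃ = j
      ; p = + 1 + + 2 * (q′ + + 2 * α) + + 4 * (j + q - γ - α) ; q = + 2 * q′ + + 4 * (j + q - γ)
      ; s = + 1 + + 2 * (q + + 2 * β) + + 4 * (j - β) ; t = + 2 * q + + 4 * j
      ; r₀ = + 1 + + 2 * (q′ + + 2 * α) ; r₂ = + 2 * q′ ; r₁ = + 1 + + 2 * (q + + 2 * β) ; r₃ = + 2 * q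
      ; v = + 16 * (+ 3 + + 4 * q + + 8 * j) ; n = + 2 * n
      ; p≡ = refl ; q≡ = refl ; s≡ = refl ; t≡ = refl ; r₀≡ = refl ; r₂≡ = refl ; r₁≡ = refl ; r₃≡ = refl
      ; first = expand q γ α β j q′ q′≡ ; norm = norm ; product = collect n q j }
      where
      identity : ∀ q γ α β j → let q′ = + 1 + + 2 * γ - q ; p = + 1 + + 2 * (q′ + + 2 * α) + + 4 * (j + q - γ - α) ; u = + 2 * q′ + + 4 * (j + q - γ)
                                   s = + 1 + + 2 * (q + + 2 * β) + + 4 * (j - β) ; t = + 2 * q + + 4 * j in
        ((p + u) * (p + u) - (s + t) * (s + t)) * ((p - u) * (p - u) + (s - t) * (s - t)) ≡ + 16 * (+ 3 + + 4 * q + + 8 * j)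
      identity = ℤ.solve-∀
      expand : ∀ q γ α β j q′ → q′ ≡ + 1 + + 2 * γ - q →
        firstFactor (+ 1 + + 2 * (q′ + + 2 * α) + + 4 * (j + q - γ - α)) (+ 2 * q′ + + 4 * (j + q - γ))
          (+ 1 + + 2 * (q + + 2 * β) + + 4 * (j - β)) (+ 2 * q + + 4 * j) ≡ + 16 * (+ 3 + + 4 * q + + 8 * j)
      expand q γ α β j _ refl = identity q γ α β j
      collect : ∀ n q j → + 16 * (+ 3 + + 4 * q + + 8 * j) * (+ 2 * n) * + 2 ≡ + 64 * n * (+ 3 + + 4 * q + + 8 * j)
      collect = ℤ.solve-∀
    family₋ : ∀ j → S16 (- (+ 64 * n * (- (+ 1) + + 4 * q + + 8 * j)))
    family₋ j = fromGlue (- (+ 64 * n * (- (+ 1) + + 4 * q + + 8 * j))) record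
      { q₀ = q′ + + 2 * α ; q₂ = q′ ; q₁ = q + + 2 * β ; q₃ = q ; w₀ = j + q - γ - + 1 - α ; w₂ = j + q - γ - + 1 ; w₁ = j - β ; w₃ = j
      ; p = + 1 + + 2 * (q′ + + 2 * α) + + 4 * (j + q - γ - + 1 - α) ; q = + 2 * q′ + + 4 * (j + q - γ - + 1)
      ; s = + 1 + + 2 * (q + + 2 * β) + + 4 * (j - β) ; t = + 2 * q + + 4 * j
      ; r₀ = + 1 + + 2 * (q′ + + 2 * α) ; r₂ = + 2 * q′ ; r₁ = + 1 + + 2 * (q + + 2 * β) ; r₃ = + 2 * q
      ; v = - (+ 16 * (- (+ 1) + + 4 * q + + 8 * j)) ; n = + 2 * n
      ; p≡ = refl ; q≡ = refl ; s≡ = refl ; t≡ = refl ; r₀≡ = refl ; r₂≡ = refl ; r₁≡ = refl ; r₃≡ = refl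
      ; first = expand q γ α β j q′ q′≡ ; norm = norm ; product = collect n q j }
      where
      identity : ∀ q γ α β j → let q′ = + 1 + + 2 * γ - q ; p = + 1 + + 2 * (q′ + + 2 * α) + + 4 * (j + q - γ - + 1 - α) ; u = + 2 * q′ + + 4 * (j + q - γ - + 1)
                                   s = + 1 + + 2 * (q + + 2 * β) + + 4 * (j - β) ; t = + 2 * q + + 4 * j in
        ((p + u) * (p + u) - (s + t) * (s + t)) * ((p - u) * (p - u) + (s - t) * (s - t)) ≡ - (+ 16 * (- (+ 1) + + 4 * q + + 8 * j))
      identity = ℤ.solve-∀
      expand : ∀ q γ α β j q′ → q′ ≡ + 1 + + 2 * γ - q →
        firstFactor (+ 1 + + 2 * (q′ + + 2 * α) + + 4 * (j + q - γ - + 1 - α)) (+ 2 * q′ + + 4 * (j + q - γ - + 1))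
          (+ 1 + + 2 * (q + + 2 * β) + + 4 * (j - β)) (+ 2 * q + + 4 * j) ≡ - (+ 16 * (- (+ 1) + + 4 * q + + 8 * j))
      expand q γ α β j _ refl = identity q γ α β j
      collect : ∀ n q j → - (+ 16 * (- (+ 1) + + 4 * q + + 8 * j)) * (+ 2 * n) * + 2 ≡ - (+ 64 * n * (- (+ 1) + + 4 * q + + 8 * j))
      collect = ℤ.solve-∀
    -- The choices s₁ - s₃ = 2 and s₁ - s₃ = -2 give the cofactors 3 + 4q + 8j and -1 + 4q + 8j.
    -- Together these are all numbers 3 mod 4, and negation reaches 1 mod 4.
    3mod4′ : ∀ l → (∃ λ j → l - q ≡ + 2 * j) ⊎ (∃ λ j → l - q ≡ + 1 + + 2 * j) → S16 (+ 64 * n * (+ 3 + + 4 * l))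
    3mod4′ l (inj₁ (j , eq)) = subst (λ m → S16 (+ 64 * n * m)) (trans (lhs q j) (trans (cong (λ u → + 3 + + 4 * (q + u)) (sym eq)) (rhs q l))) (family₊ j)
      where
      lhs : ∀ q j → + 3 + + 4 * q + + 8 * j ≡ + 3 + + 4 * (q + + 2 * j)
      lhs = ℤ.solve-∀
      rhs : ∀ q l → + 3 + + 4 * (q + (l - q)) ≡ + 3 + + 4 * l
      rhs = ℤ.solve-∀
    3mod4′ l (inj₂ (j , eq)) = subst (λ m → S16 (+ 64 * n * m)) (trans (lhs q j) (trans (cong (λ u → + 3 + + 4 * (q + u)) (sym eq)) (rhs q l)))
        (S16-unneg (family₋ (+ 1 + j)))
      where
      lhs : ∀ q j → - (+ 1) + + 4 * q + + 8 * (+ 1 + j) ≡ + 3 + + 4 * (q + (+ 1 + + 2 * j))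
      lhs = ℤ.solve-∀
      rhs : ∀ q l → + 3 + + 4 * (q + (l - q)) ≡ + 3 + + 4 * l
      rhs = ℤ.solve-∀
    3mod4 : ∀ l → S16 (+ 64 * n * (+ 3 + + 4 * l))
    3mod4 l = 3mod4′ l (parity (l - q))
    cases : (∃ λ l → k ≡ + 2 * l) ⊎ (∃ λ l → k ≡ + 1 + + 2 * l) → S16 (+ 64 * n * (+ 1 + + 2 * k))
    cases (inj₂ (l , eq)) = subst (λ k → S16 (+ 64 * n * (+ 1 + + 2 * k))) (sym eq) (subst (λ m → S16 (+ 64 * n * m)) (identity l) (3mod4 l))
      where
      identity : ∀ l → + 3 + + 4 * l ≡ + 1 + + 2 * (+ 1 + + 2 * l)
      identity = ℤ.solve-∀
    cases (inj₁ (l , eq)) = subst (λ k → S16 (+ 64 * n * (+ 1 + + 2 * k))) (sym eq) (S16-unneg (subst S16 (identity n l) (3mod4 (- l - + 1))))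
      where
      identity : ∀ n l → + 64 * n * (+ 3 + + 4 * (- l - + 1)) ≡ - (+ 64 * n * (+ 1 + + 2 * (+ 2 * l)))
      identity = ℤ.solve-∀

  -- X + Y + 2(s₁ + s₃) = -2 is solvable with s₁, s₃ ≡ 0 (mod 4), where X = s₀ - s₁ and Y = s₂ - s₃.
  S16-1mod4-norm : ∀ n X Y c d → + 1 + + 4 * X + (+ 1 + + 4 * Y) ≡ - (+ 2) - + 8 * c → + 1 + + 4 * X - (+ 1 + + 4 * Y) ≡ + 4 + + 8 * d →
    sq (+ 1 + + 4 * X) + sq (+ 1 + + 4 * Y) ≡ + 2 * n → ∀ k → S16 (+ 64 * n * (+ 1 + + 2 * k))
  S16-1mod4-norm n X Y c d sum difference squares k = cases (parity (k - c - d))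
    where
    -- These values at 1 satisfy p - q = 1 + 4X, s - t = 1 + 4Y, p + q + s + t = -2 and p + q - s -
    -- t = 4(1 + 2(c + d) - 4j). The last cofactor runs through one odd class modulo 4; the sign
    -- change gives the other.
    family : ∀ j → S16 (- (+ 64 * n * (+ 1 + + 2 * (c + d) - + 4 * j)))
    family j = fromGlue (- (+ 64 * n * (+ 1 + + 2 * (c + d) - + 4 * j))) record
      { q₀ = + 0 ; q₂ = + 0 ; q₁ = + 0 ; q₃ = + 0 ; w₀ = X + (c - j) ; w₂ = c - j ; w₁ = Y + j ; w₃ = j
      ; p = + 1 + + 4 * (X + (c - j)) ; q = + 4 * (c - j) ; s = + 1 + + 4 * (Y + j) ; t = + 4 * j
      ; r₀ = + 1 ; r₂ = + 0 ; r₁ = + 1 ; r₃ = + 0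
      ; v = (- (+ 2) - + 8 * c + + 8 * c) * (+ 4 + + 8 * d + + 8 * (c - + 2 * j)) * (+ 2 * n) ; n = + 2
      ; p≡ = refl ; q≡ = sym (ℤ.+-identityˡ (+ 4 * (c - j))) ; s≡ = refl ; t≡ = sym (ℤ.+-identityˡ (+ 4 * j))
      ; r₀≡ = refl ; r₂≡ = refl ; r₁≡ = refl ; r₃≡ = refl
      ; first = trans (expand X Y c j) (product sum difference squares) ; norm = norm-101 ; product = collect n c d j }
      where
      product : ∀ {u u′ v v′ w w′} → u ≡ u′ → v ≡ v′ → w ≡ w′ →
        (u + + 8 * c) * (v + + 8 * (c - + 2 * j)) * w ≡ (u′ + + 8 * c) * (v′ + + 8 * (c - + 2 * j)) * w′
      product refl refl refl = refl
      identity : ∀ X Y c j → let p = + 1 + + 4 * (X + (c - j)) ; q = + 4 * (c - j) ; s = + 1 + + 4 * (Y + j) ; t = + 4 * j in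
        ((p + q) * (p + q) - (s + t) * (s + t)) * ((p - q) * (p - q) + (s - t) * (s - t))
          ≡ (+ 1 + + 4 * X + (+ 1 + + 4 * Y) + + 8 * c) * (+ 1 + + 4 * X - (+ 1 + + 4 * Y) + + 8 * (c - + 2 * j))
            * ((+ 1 + + 4 * X) * (+ 1 + + 4 * X) + (+ 1 + + 4 * Y) * (+ 1 + + 4 * Y))
      identity = ℤ.solve-∀
      expand : ∀ X Y c j → firstFactor (+ 1 + + 4 * (X + (c - j))) (+ 4 * (c - j)) (+ 1 + + 4 * (Y + j)) (+ 4 * j)
        ≡ (+ 1 + + 4 * X + (+ 1 + + 4 * Y) + + 8 * c) * (+ 1 + + 4 * X - (+ 1 + + 4 * Y) + + 8 * (c - + 2 * j))
          * (sq (+ 1 + + 4 * X) + sq (+ 1 + + 4 * Y))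
      expand = identity
      collect : ∀ n c d j → (- (+ 2) - + 8 * c + + 8 * c) * (+ 4 + + 8 * d + + 8 * (c - + 2 * j)) * (+ 2 * n) * + 2 * + 2
        ≡ - (+ 64 * n * (+ 1 + + 2 * (c + d) - + 4 * j))
      collect = ℤ.solve-∀
    cases : (∃ λ j → k - c - d ≡ + 2 * j) ⊎ (∃ λ j → k - c - d ≡ + 1 + + 2 * j) → S16 (+ 64 * n * (+ 1 + + 2 * k))
    cases (inj₁ (j , eq)) = subst (λ m → S16 (+ 64 * n * m)) (trans (lhs c d j) (trans (cong (λ u → + 1 + + 2 * (c + d + u)) (sym eq)) (rhs c d k)))
        (S16-unneg (family (- j)))
      where
      lhs : ∀ c d j → + 1 + + 2 * (c + d) - + 4 * - j ≡ + 1 + + 2 * (c + d + + 2 * j)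
      lhs = ℤ.solve-∀
      rhs : ∀ c d k → + 1 + + 2 * (c + d + (k - c - d)) ≡ + 1 + + 2 * k
      rhs = ℤ.solve-∀
    cases (inj₂ (j , eq)) = subst S16 (trans (lhs n c d j) (cong (λ m → + 64 * n * m) (trans (cong (λ u → + 1 + + 2 * (c + d + u)) (sym eq)) (rhs c d k))))
        (family (+ 1 + j + c + d))
      where
      lhs : ∀ n c d j → - (+ 64 * n * (+ 1 + + 2 * (c + d) - + 4 * (+ 1 + j + c + d))) ≡ + 64 * n * (+ 1 + + 2 * (c + d + (+ 1 + + 2 * j)))
      lhs = ℤ.solve-∀
      rhs : ∀ c d k → + 1 + + 2 * (c + d + (k - c - d)) ≡ + 1 + + 2 * k
      rhs = ℤ.solve-∀

-- Elements of ℤ[ζ₈] of prime relative norm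

module _ where
  open import Data.Integer using (_+_; _*_; _-_; -_)
  open Ring≡ ℤ[i].ring using () renaming (_*_ to _*ᵢ_; _-_ to _-ᵢ_; -_ to -ᵢ_; ι to ιᵢ; *-comm to *ᵢ-comm; *-assoc to *ᵢ-assoc)
  open Ring≡ ℤ[ζ₈].ring using () renaming (_*_ to _*₈_)
  open Euclid ℤ[i].ring ℤ[i]-euclidean using () renaming (_∣_ to _∣ᵢ_; split to splitᵢ; unit to unitᵢ)
  open Euclid ℤ[ζ₈].ring ℤ[ζ₈]-euclidean using () renaming (_∣_ to _∣₈_; split to split₈)

  Irreducible : ℤ × ℤ → Set
  Irreducible α = ∀ d e → α ≡ d *ᵢ e → νᵢ d ≡ 1 ⊎ νᵢ e ≡ 1

  iᵢ : ℤ × ℤ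
  iᵢ = + 0 , + 1

  cancelᵢ : ∀ α z w → νᵢ α ≢ 0 → z *ᵢ α ≡ w *ᵢ α → z ≡ w
  cancelᵢ α z w να≢0 eq = trans (recover z w) (trans (cong (λ u → u +ᵢ w) (νᵢ≡0⇒≡0 (z -ᵢ w) ν≡0)) (Ring≡.+-identityˡ ℤ[i].ring w))
    where
    open Ring≡ ℤ[i].ring using () renaming (_+_ to _+ᵢ_)
    open Solver ℤ[i].ring
    recover : ∀ z w → z ≡ (z -ᵢ w) +ᵢ w
    recover = solve 2 (λ z w → z ⊜ (z ⊖ w) ⊕ w) refl
    distribute : ∀ z w α → (z -ᵢ w) *ᵢ α ≡ z *ᵢ α -ᵢ w *ᵢ α
    distribute = solve 3 (λ z w α → (z ⊖ w) ⊗ α ⊜ z ⊗ α ⊖ w ⊗ α) refl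
    self : ∀ x → x -ᵢ x ≡ ιᵢ (+ 0)
    self = solve 1 (λ x → x ⊖ x ⊜ Κ (+ 0)) refl
    ν≡0 : νᵢ (z -ᵢ w) ≡ 0
    ν≡0 = [ id , (λ να≡0 → ⊥-elim (να≢0 να≡0)) ]′ (ℕ.m*n≡0⇒m≡0∨n≡0 (νᵢ (z -ᵢ w)) (trans (sym (νᵢ-* (z -ᵢ w) α))
      (cong νᵢ (trans (distribute z w α) (trans (cong (_-ᵢ w *ᵢ α) eq) (self (w *ᵢ α)))))))

  -- α divides x or y. If x = kα, then ky = α, and k is a unit because y is not. If y = kα, then xk
  -- = α, again with k a unit, and x is α times its inverse.
  associate : ∀ α x y → νᵢ α ≢ 0 → Irreducible α → x *ᵢ y ≡ α *ᵢ α → νᵢ x ≢ 1 → νᵢ y ≢ 1 →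
    ∃ λ u → νᵢ u ≡ 1 × x ≡ u *ᵢ α
  associate α x y να≢0 irr xy≡ νx≢1 νy≢1 = bySplit (splitᵢ α x y (α , xy≡))
    where
    open ≡-Reasoning
    viaX : α ∣ᵢ x → ∃ λ u → νᵢ u ≡ 1 × x ≡ u *ᵢ α
    viaX (k , x≡) = k , [ id , (λ νy≡1 → ⊥-elim (νy≢1 νy≡1)) ]′ (irr k y (sym (cancelᵢ α (k *ᵢ y) α να≢0 (begin
      k *ᵢ y *ᵢ α     ≡⟨ *ᵢ-assoc k y α ⟩
      k *ᵢ (y *ᵢ α)   ≡⟨ cong (k *ᵢ_) (*ᵢ-comm y α) ⟩
      k *ᵢ (α *ᵢ y)   ≡⟨ *ᵢ-assoc k α y ⟨
      k *ᵢ α *ᵢ y     ≡⟨ cong (_*ᵢ y) x≡ ⟨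
      x *ᵢ y          ≡⟨ xy≡ ⟩
      α *ᵢ α ∎)))) , x≡
    viaY : α ∣ᵢ y → ∃ λ u → νᵢ u ≡ 1 × x ≡ u *ᵢ α
    viaY (k , y≡) = k⁻¹ , νk⁻¹≡1 , (begin
      x                     ≡⟨ Ring≡.*-identityʳ ℤ[i].ring x ⟨
      x *ᵢ ιᵢ (+ 1)         ≡⟨ cong (x *ᵢ_) kk⁻¹≡1 ⟨
      x *ᵢ (k *ᵢ k⁻¹)       ≡⟨ *ᵢ-assoc x k k⁻¹ ⟨
      x *ᵢ k *ᵢ k⁻¹         ≡⟨ cong (_*ᵢ k⁻¹) xk≡α ⟩
      α *ᵢ k⁻¹              ≡⟨ *ᵢ-comm α k⁻¹ ⟩
      k⁻¹ *ᵢ α ∎)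
      where
      xk≡α : x *ᵢ k ≡ α
      xk≡α = cancelᵢ α (x *ᵢ k) α να≢0 (trans (*ᵢ-assoc x k α) (trans (cong (x *ᵢ_) (sym y≡)) xy≡))
      νk≡1 : νᵢ k ≡ 1
      νk≡1 = [ (λ νx≡1 → ⊥-elim (νx≢1 νx≡1)) , id ]′ (irr x k (sym xk≡α))
      k⁻¹ : ℤ × ℤ
      k⁻¹ = proj₁ (unitᵢ k νk≡1)
      kk⁻¹≡1 : k *ᵢ k⁻¹ ≡ ιᵢ (+ 1)
      kk⁻¹≡1 = proj₂ (unitᵢ k νk≡1)
      νk⁻¹≡1 : νᵢ k⁻¹ ≡ 1
      νk⁻¹≡1 = trans (sym (ℕ.*-identityˡ (νᵢ k⁻¹))) (trans (cong (ℕ._* νᵢ k⁻¹) (sym νk≡1))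
        (trans (sym (νᵢ-* k k⁻¹)) (cong νᵢ kk⁻¹≡1)))
    bySplit : (∃ λ d → ∃ λ e → α ≡ d *ᵢ e × (νᵢ d ≡ 1 → α ∣ᵢ y) × (νᵢ e ≡ 1 → α ∣ᵢ x)) → ∃ λ u → νᵢ u ≡ 1 × x ≡ u *ᵢ α
    bySplit (d , e , α≡ , d-unit , e-unit) = [ viaY ∘ d-unit , viaX ∘ e-unit ]′ (irr d e α≡)

  data Unitᵢ : ℤ × ℤ → Set where
    1ᵤ : Unitᵢ (+ 1 , + 0)
    -1ᵤ : Unitᵢ (- (+ 1) , + 0)
    iᵤ : Unitᵢ (+ 0 , + 1)
    -iᵤ : Unitᵢ (+ 0 , - (+ 1))

  unit-cases : ∀ a b → νᵢ (a , b) ≡ 1 → Unitᵢ (a , b)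
  unit-cases (+ 0) (+ 1) _ = iᵤ
  unit-cases (+ 0) -[1+ 0 ] _ = -iᵤ
  unit-cases (+ 1) (+ 0) _ = 1ᵤ
  unit-cases -[1+ 0 ] (+ 0) _ = -1ᵤ
  unit-cases (+ 0) (+ 0) ()
  unit-cases (+ 0) (+ suc (suc n)) ()
  unit-cases (+ 0) -[1+ suc n ] ()
  unit-cases (+ 1) (+ suc n) ()
  unit-cases (+ 1) -[1+ n ] ()
  unit-cases -[1+ 0 ] (+ suc n) ()
  unit-cases -[1+ 0 ] -[1+ n ] ()
  unit-cases (+ suc (suc n)) b ()
  unit-cases -[1+ suc n ] b ()

  Both±3 : ℤ × ℤ → Set
  Both±3 (x , y) = ±3mod8 x × ±3mod8 y

  -- (1 - i)(a + bi) = (a + b) - (a - b)i, and a unit only permutes the coordinates up to sign.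
  both-unit : ∀ {u} a b → Unitᵢ u → ±3mod8 (a + b) → ±3mod8 (a - b) → Both±3 ((+ 1 , - (+ 1)) *ᵢ (u *ᵢ (a , b)))
  both-unit a b 1ᵤ s d = subst ±3mod8 (re a b) s , subst ±3mod8 (im a b) (±3mod8-neg d)
    where
    re : ∀ a b → a + b ≡ + 1 * (+ 1 * a + - (+ 1) * (+ 0 * b)) + - (+ 1) * (- (+ 1) * (+ 1 * b + + 0 * a))
    re = ℤ.solve-∀
    im : ∀ a b → - (a - b) ≡ + 1 * (+ 1 * b + + 0 * a) + - (+ 1) * (+ 1 * a + - (+ 1) * (+ 0 * b))
    im = ℤ.solve-∀
  both-unit a b -1ᵤ s d = subst ±3mod8 (re a b) (±3mod8-neg s) , subst ±3mod8 (im a b) d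
    where
    re : ∀ a b → - (a + b) ≡ + 1 * (- (+ 1) * a + - (+ 1) * (+ 0 * b)) + - (+ 1) * (- (+ 1) * (- (+ 1) * b + + 0 * a))
    re = ℤ.solve-∀
    im : ∀ a b → a - b ≡ + 1 * (- (+ 1) * b + + 0 * a) + - (+ 1) * (- (+ 1) * a + - (+ 1) * (+ 0 * b))
    im = ℤ.solve-∀
  both-unit a b iᵤ s d = subst ±3mod8 (re a b) d , subst ±3mod8 (im a b) s
    where
    re : ∀ a b → a - b ≡ + 1 * (+ 0 * a + - (+ 1) * (+ 1 * b)) + - (+ 1) * (- (+ 1) * (+ 0 * b + + 1 * a))
    re = ℤ.solve-∀
    im : ∀ a b → a + b ≡ + 1 * (+ 0 * b + + 1 * a) + - (+ 1) * (+ 0 * a + - (+ 1) * (+ 1 * b))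
    im = ℤ.solve-∀
  both-unit a b -iᵤ s d = subst ±3mod8 (re a b) (±3mod8-neg d) , subst ±3mod8 (im a b) (±3mod8-neg s)
    where
    re : ∀ a b → - (a - b) ≡ + 1 * (+ 0 * a + - (+ 1) * (- (+ 1) * b)) + - (+ 1) * (- (+ 1) * (+ 0 * b + - (+ 1) * a))
    re = ℤ.solve-∀
    im : ∀ a b → - (a + b) ≡ + 1 * (+ 0 * b + - (+ 1) * a) + - (+ 1) * (+ 0 * a + - (+ 1) * (- (+ 1) * b))
    im = ℤ.solve-∀

  -- The ideal (α , t - ζ₈) is generated by an element of relative norm α, up to units.
  relativeNorm : ∀ α t → νᵢ α ≢ 0 → νᵢ α ≢ 1 → Irreducible α → α ∣ᵢ (t *ᵢ t -ᵢ iᵢ) →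
    ∃ λ d → ∃ λ u → νᵢ u ≡ 1 × ℤ[ζ₈].norm d ≡ u *ᵢ α
  -- α divides t² - i = (t - ζ₈)(t + ζ₈) but neither factor, since the coefficient of ζ₈ is ±1. So
  -- the gcd d of α and t - ζ₈ and its cofactor in α are both nonunits, and their relative norms
  -- multiply to α².
  relativeNorm α t να≢0 να≢1 irr (k , root) = bySplit (split₈ (α , o) (t , -ᵢ one) (t , one) ((k , o) , factorisation))
    where
    open Solver ℤ[i].ring
    open Ring≡ ℤ[i].ring using () renaming (_+_ to _+ᵢ_)
    o one : ℤ × ℤ
    o = ιᵢ (+ 0)
    one = ιᵢ (+ 1)
    factorisation : (t , -ᵢ one) *₈ (t , one) ≡ (k , o) *₈ (α , o)
    factorisation = cong₂ _,_
      (trans (lhs t ζ₈²) (trans root (rhs k α ζ₈²)))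
      (solve 3 (λ t k α → t ⊗ Κ (+ 1) ⊕ ⊝ Κ (+ 1) ⊗ t ⊜ k ⊗ Κ (+ 0) ⊕ Κ (+ 0) ⊗ α) refl t k α)
      where
      lhs : ∀ t u → t *ᵢ t +ᵢ u *ᵢ ((-ᵢ one) *ᵢ one) ≡ t *ᵢ t -ᵢ u
      lhs = solve 2 (λ t u → t ⊗ t ⊕ u ⊗ (⊝ Κ (+ 1) ⊗ Κ (+ 1)) ⊜ t ⊗ t ⊖ u) refl
      rhs : ∀ k α u → k *ᵢ α ≡ k *ᵢ α +ᵢ u *ᵢ (o *ᵢ o)
      rhs = solve 3 (λ k α u → k ⊗ α ⊜ k ⊗ α ⊕ u ⊗ (Κ (+ 0) ⊗ Κ (+ 0))) refl
    nonunit : ∀ c → νᵢ c ≡ 1 → (α , o) ∣₈ (t , c) → ⊥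
    nonunit c νc≡1 ((k₀ , k₁) , eq) = να≢1 (ℕ.m*n≡1⇒n≡1 (νᵢ k₁) (νᵢ α) (trans (sym (νᵢ-* k₁ α))
      (trans (cong νᵢ (trans (second k₀ k₁ α) (sym (cong proj₂ eq)))) νc≡1)))
      where
      second : ∀ k₀ k₁ α → k₁ *ᵢ α ≡ k₀ *ᵢ o +ᵢ k₁ *ᵢ α
      second = solve 3 (λ k₀ k₁ α → k₁ ⊗ α ⊜ k₀ ⊗ Κ (+ 0) ⊕ k₁ ⊗ α) refl
    bySplit : (∃ λ d → ∃ λ e → (α , o) ≡ d *₈ e × (ν₈ d ≡ 1 → (α , o) ∣₈ (t , one)) × (ν₈ e ≡ 1 → (α , o) ∣₈ (t , -ᵢ one))) →
      ∃ λ d → ∃ λ u → νᵢ u ≡ 1 × ℤ[ζ₈].norm d ≡ u *ᵢ α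
    bySplit (d , e , α≡ , d-unit , e-unit) = d , associate α (ℤ[ζ₈].norm d) (ℤ[ζ₈].norm e) να≢0 irr
      (trans (sym (ℤ[ζ₈].norm-* d e)) (trans (cong ℤ[ζ₈].norm (sym α≡)) (square α ζ₈²)))
      (nonunit one refl ∘ d-unit) (nonunit (-ᵢ one) refl ∘ e-unit)
      where
      square : ∀ α u → α *ᵢ α -ᵢ u *ᵢ (o *ᵢ o) ≡ α *ᵢ α
      square = solve 2 (λ α u → α ⊗ α ⊖ u ⊗ (Κ (+ 0) ⊗ Κ (+ 0)) ⊜ α ⊗ α) refl

  opaque
    unfolding value₁ re₋₁ im₋₁

    re₋₁-≡₂ : ∀ p q s t → re₋₁ p q s t ≡₂ p + q
    re₋₁-≡₂ p q s t = +-double-≡₂ (s * t) (difference-≡₂ (square-≡₂ p) (square-≡₂ q))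

    -- (-t, s, p, q) are the coordinates of the element multiplied by ζ₈. Its relative norm is
    -- therefore multiplied by that of ζ₈, namely -i, which interchanges the real and imaginary
    -- parts up to sign.
    re₋₁-rotate : ∀ p q s t → re₋₁ (- t) s p q ≡ im₋₁ p q s t
    re₋₁-rotate = identity
      where
      identity : ∀ p q s t → - t * - t - s * s + + 2 * (p * q) ≡ + 2 * (p * q) - s * s + t * t
      identity = ℤ.solve-∀

    im₋₁-rotate : ∀ p q s t → im₋₁ (- t) s p q ≡ - re₋₁ p q s t
    im₋₁-rotate = identity
      where
      identity : ∀ p q s t → + 2 * (- t * s) - p * p + q * q ≡ - (p * p - q * q + + 2 * (s * t))
      identity = ℤ.solve-∀

    -- Negating p and q is conjugation over ℤ[i] up to sign, so the relative norm is kept.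
    re₋₁-flip : ∀ p q s t → re₋₁ (- p) (- q) s t ≡ re₋₁ p q s t
    re₋₁-flip = identity
      where
      identity : ∀ p q s t → - p * - p - - q * - q + + 2 * (s * t) ≡ p * p - q * q + + 2 * (s * t)
      identity = ℤ.solve-∀

    im₋₁-flip : ∀ p q s t → im₋₁ (- p) (- q) s t ≡ im₋₁ p q s t
    im₋₁-flip = identity
      where
      identity : ∀ p q s t → + 2 * (- p * - q) - s * s + t * t ≡ + 2 * (p * q) - s * s + t * t
      identity = ℤ.solve-∀

    re₋₁-flip′ : ∀ p q s t → re₋₁ p q (- s) (- t) ≡ re₋₁ p q s t
    re₋₁-flip′ = identity
      where
      identity : ∀ p q s t → p * p - q * q + + 2 * (- s * - t) ≡ p * p - q * q + + 2 * (s * t)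
      identity = ℤ.solve-∀

    im₋₁-flip′ : ∀ p q s t → im₋₁ p q (- s) (- t) ≡ im₋₁ p q s t
    im₋₁-flip′ = identity
      where
      identity : ∀ p q s t → + 2 * (p * q) - - s * - s + - t * - t ≡ + 2 * (p * q) - s * s + t * t
      identity = ℤ.solve-∀

    norm₋₁-ζ₈ : ∀ p q s t → ℤ[ζ₈].norm ((p , q) , (s , t)) ≡ (re₋₁ p q s t , im₋₁ p q s t)
    norm₋₁-ζ₈ p q s t = cong₂ _,_ (re p q s t) (im p q s t)
      where
      re : ∀ p q s t → (p * p + - (+ 1) * (q * q)) + - (+ 0 * (s * s + - (+ 1) * (t * t)) + - (+ 1) * (+ 1 * (s * t + t * s)))
        ≡ p * p - q * q + + 2 * (s * t)
      re = ℤ.solve-∀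
      im : ∀ p q s t → (p * q + q * p) + - (+ 0 * (s * t + t * s) + + 1 * (s * s + - (+ 1) * (t * t)))
        ≡ + 2 * (p * q) - s * s + t * t
      im = ℤ.solve-∀

  -- (p + qi) + (s + ti)ζ₈ has relative norm `re₋₁` + `im₋₁` i. Both parts are required to be ±3 mod
  -- 8 because multiplication by ζ₈ interchanges them.
  record NormForm (n p q s t : ℤ) : Set where
    field
      re±3 : ±3mod8 (re₋₁ p q s t)
      im±3 : ±3mod8 (im₋₁ p q s t)
      norm : sq (re₋₁ p q s t) + sq (im₋₁ p q s t) ≡ + 2 * n

  ±3-odd : ∀ {x y} → ±3mod8 x → x ≡₂ y → ∃ λ k → y ≡ + 1 + + 2 * k
  ±3-odd (3mod8 j) (h ,₂ eq) = + 1 + + 4 * j - h , trans (recover _ h) (trans (cong (_- + 2 * h) (sym eq)) (shape j h))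
    where
    recover : ∀ y h → y ≡ y + + 2 * h - + 2 * h
    recover = ℤ.solve-∀
    shape : ∀ j h → + 3 + + 8 * j - + 2 * h ≡ + 1 + + 2 * (+ 1 + + 4 * j - h)
    shape = ℤ.solve-∀
  ±3-odd (5mod8 j) (h ,₂ eq) = + 2 + + 4 * j - h , trans (recover _ h) (trans (cong (_- + 2 * h) (sym eq)) (shape j h))
    where
    recover : ∀ y h → y ≡ y + + 2 * h - + 2 * h
    recover = ℤ.solve-∀
    shape : ∀ j h → + 5 + + 8 * j - + 2 * h ≡ + 1 + + 2 * (+ 2 + + 4 * j - h)
    shape = ℤ.solve-∀

  private
    transport : ∀ {n x y x′ y′} → x′ ≡ x → y′ ≡ y → sq x + sq y ≡ n → sq x′ + sq y′ ≡ n
    transport refl refl eq = eq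

    rotate-form : ∀ {n p q s t} → NormForm n p q s t → NormForm n (- t) s p q
    rotate-form {n} {p} {q} {s} {t} f = record
      { re±3 = subst ±3mod8 (sym (re₋₁-rotate p q s t)) im±3
      ; im±3 = subst ±3mod8 (sym (im₋₁-rotate p q s t)) (±3mod8-neg re±3)
      ; norm = transport (re₋₁-rotate p q s t) (im₋₁-rotate p q s t) (trans (squares (re₋₁ p q s t) (im₋₁ p q s t)) norm) }
      where
      open NormForm f
      squares : ∀ x y → y * y + - x * - x ≡ x * x + y * y
      squares = ℤ.solve-∀

    flip-form : ∀ {n p q s t} → NormForm n p q s t → NormForm n (- p) (- q) s t
    flip-form {n} {p} {q} {s} {t} f = record
      { re±3 = subst ±3mod8 (sym (re₋₁-flip p q s t)) re±3
      ; im±3 = subst ±3mod8 (sym (im₋₁-flip p q s t)) im±3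
      ; norm = transport (re₋₁-flip p q s t) (im₋₁-flip p q s t) norm }
      where open NormForm f

    flip-form′ : ∀ {n p q s t} → NormForm n p q s t → NormForm n p q (- s) (- t)
    flip-form′ {n} {p} {q} {s} {t} f = record
      { re±3 = subst ±3mod8 (sym (re₋₁-flip′ p q s t)) re±3
      ; im±3 = subst ±3mod8 (sym (im₋₁-flip′ p q s t)) im±3
      ; norm = transport (re₋₁-flip′ p q s t) (im₋₁-flip′ p q s t) norm }
      where open NormForm f

    form-cong : ∀ {n p q s t p′ q′ s′ t′} → p ≡ p′ → q ≡ q′ → s ≡ s′ → t ≡ t′ → NormForm n p q s t → NormForm n p′ q′ s′ t′
    form-cong refl refl refl refl f = f

    Parity : ℤ → Set
    Parity x = (∃ λ k → x ≡ + 2 * k) ⊎ (∃ λ k → x ≡ + 1 + + 2 * k)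

    -- The real part is 1 + 4(q′ + q) modulo 8; as it is ±3, the sum q′ + q is odd, which is the
    -- hypothesis of `S16-64`.
    aligned : ∀ n q′ q α β → NormForm n (+ 1 + + 2 * (q′ + + 2 * α)) (+ 2 * q′) (+ 1 + + 2 * (q + + 2 * β)) (+ 2 * q) →
      ∀ k → S16 (+ 64 * n * (+ 1 + + 2 * k))
    aligned n q′ q α β f = byParity (parity (q′ + q))
      where
      open NormForm f
      mod8 : ∃ λ w → re₋₁ (+ 1 + + 2 * (q′ + + 2 * α)) (+ 2 * q′) (+ 1 + + 2 * (q + + 2 * β)) (+ 2 * q) ≡ + 1 + + 4 * (q′ + q) + + 8 * w
      mod8 = re₋₁-mod8 (q′ + + 2 * α) q′ (q + + 2 * β) q
      identity : ∀ e w → + 1 + + 4 * (+ 2 * e) + + 8 * w ≡ + 1 + + 8 * (e + w)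
      identity = ℤ.solve-∀
      recover : ∀ q′ q → q′ ≡ q′ + q - q
      recover = ℤ.solve-∀
      byParity : Parity (q′ + q) → ∀ k → S16 (+ 64 * n * (+ 1 + + 2 * k))
      byParity (inj₁ (e , eq)) = ⊥-elim (±1≢±3mod8 plus (e + proj₁ mod8)
        (trans (proj₂ mod8) (trans (cong (λ u → + 1 + + 4 * u + + 8 * proj₁ mod8) eq) (identity e (proj₁ mod8)))) re±3)
      byParity (inj₂ (γ , eq)) = S16-64 n q′ q γ α β (trans (recover q′ q) (cong (_- q) eq)) norm

    difference-shape : ∀ a b {e} → a - b ≡ e → a ≡ b + e
    difference-shape a b refl = identity a b
      where
      identity : ∀ a b → a ≡ b + (a - b)
      identity = ℤ.solve-∀

    -- The wanted shape of s and t amounts to s - t ≡ 1 (mod 4). If s - t ≡ 3, negating both s and t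
    -- produces it without changing the norm.
    half-aligned : ∀ n q′ α c d → NormForm n (+ 1 + + 2 * (q′ + + 2 * α)) (+ 2 * q′) (+ 1 + + 2 * c) (+ 2 * d) →
      ∀ k → S16 (+ 64 * n * (+ 1 + + 2 * k))
    half-aligned n q′ α c d f = byParity (parity (c - d))
      where
      byParity : Parity (c - d) → ∀ k → S16 (+ 64 * n * (+ 1 + + 2 * k))
      byParity (inj₁ (β , eq)) = aligned n q′ d α β
        (form-cong refl refl (cong (λ u → + 1 + + 2 * u) (difference-shape c d eq)) refl f)
      byParity (inj₂ (β , eq)) = aligned n q′ (- d) α (- β - + 1)
        (form-cong refl refl (trans (cong (λ u → - (+ 1 + + 2 * u)) (difference-shape c d eq)) (shape d β)) (neg₂ d) (flip-form′ f))
        where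
        shape : ∀ d β → - (+ 1 + + 2 * (d + (+ 1 + + 2 * β))) ≡ + 1 + + 2 * (- d + + 2 * (- β - + 1))
        shape = ℤ.solve-∀
        neg₂ : ∀ d → - (+ 2 * d) ≡ + 2 * - d
        neg₂ = ℤ.solve-∀

    oriented : ∀ n a b c d → NormForm n (+ 1 + + 2 * a) (+ 2 * b) (+ 1 + + 2 * c) (+ 2 * d) → ∀ k → S16 (+ 64 * n * (+ 1 + + 2 * k))
    oriented n a b c d f = byParity (parity (a - b))
      where
      byParity : Parity (a - b) → ∀ k → S16 (+ 64 * n * (+ 1 + + 2 * k))
      byParity (inj₁ (α , eq)) = half-aligned n b α c d
        (form-cong (cong (λ u → + 1 + + 2 * u) (difference-shape a b eq)) refl refl refl f)
      byParity (inj₂ (α , eq)) = half-aligned n (- b) (- α - + 1) c d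
        (form-cong (trans (cong (λ u → - (+ 1 + + 2 * u)) (difference-shape a b eq)) (shape b α)) (neg₂ b) refl refl (flip-form f))
        where
        shape : ∀ d β → - (+ 1 + + 2 * (d + (+ 1 + + 2 * β))) ≡ + 1 + + 2 * (- d + + 2 * (- β - + 1))
        shape = ℤ.solve-∀
        neg₂ : ∀ d → - (+ 2 * d) ≡ + 2 * - d
        neg₂ = ℤ.solve-∀

  -- Both parts of the relative norm are odd, hence p + q and s + t are odd. Multiplying by a power
  -- of ζ₈ brings the odd coordinates to p and s.
  S16-normForm : ∀ n p q s t → NormForm n p q s t → ∀ k → S16 (+ 64 * n * (+ 1 + + 2 * k))
  S16-normForm n p q s t f = cases (parity q) (parity t)
    where
    p+q : ∃ λ k → p + q ≡ + 1 + + 2 * k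
    p+q = ±3-odd (NormForm.re±3 f) (re₋₁-≡₂ p q s t)
    s+t : ∃ λ k → - t + s ≡ + 1 + + 2 * k
    s+t = ±3-odd (NormForm.re±3 (rotate-form f)) (re₋₁-≡₂ (- t) s p q)
    odd-from-even : ∀ x y k b → x + y ≡ + 1 + + 2 * k → y ≡ + 2 * b → x ≡ + 1 + + 2 * (k - b)
    odd-from-even x y k b eq y≡ = trans (recover x y) (trans (cong₂ _-_ eq y≡) (shape k b))
      where
      recover : ∀ x y → x ≡ x + y - y
      recover = ℤ.solve-∀
      shape : ∀ k b → + 1 + + 2 * k - + 2 * b ≡ + 1 + + 2 * (k - b)
      shape = ℤ.solve-∀
    even-from-odd : ∀ x y k b → x + y ≡ + 1 + + 2 * k → y ≡ + 1 + + 2 * b → x ≡ + 2 * (k - b)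
    even-from-odd x y k b eq y≡ = trans (recover x y) (trans (cong₂ _-_ eq y≡) (shape k b))
      where
      recover : ∀ x y → x ≡ x + y - y
      recover = ℤ.solve-∀
      shape : ∀ k b → + 1 + + 2 * k - (+ 1 + + 2 * b) ≡ + 2 * (k - b)
      shape = ℤ.solve-∀
    s-odd : ∀ d → t ≡ + 2 * d → s ≡ + 1 + + 2 * (proj₁ s+t + d)
    s-odd d t≡ = trans (recover s t) (trans (cong₂ _+_ (proj₂ s+t) t≡) (shape (proj₁ s+t) d))
      where
      recover : ∀ s t → s ≡ - t + s + t
      recover = ℤ.solve-∀
      shape : ∀ k d → + 1 + + 2 * k + + 2 * d ≡ + 1 + + 2 * (k + d)
      shape = ℤ.solve-∀
    s-even : ∀ d → t ≡ + 1 + + 2 * d → s ≡ + 2 * (+ 1 + proj₁ s+t + d)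
    s-even d t≡ = trans (recover s t) (trans (cong₂ _+_ (proj₂ s+t) t≡) (shape (proj₁ s+t) d))
      where
      recover : ∀ s t → s ≡ - t + s + t
      recover = ℤ.solve-∀
      shape : ∀ k d → + 1 + + 2 * k + (+ 1 + + 2 * d) ≡ + 2 * (+ 1 + k + d)
      shape = ℤ.solve-∀
    neg-odd : ∀ x b → x ≡ + 1 + + 2 * b → - x ≡ + 1 + + 2 * (- b - + 1)
    neg-odd x b eq = trans (cong -_ eq) (shape b)
      where
      shape : ∀ b → - (+ 1 + + 2 * b) ≡ + 1 + + 2 * (- b - + 1)
      shape = ℤ.solve-∀
    neg-even : ∀ x b → x ≡ + 2 * b → - x ≡ + 2 * - b
    neg-even x b eq = trans (cong -_ eq) (shape b)
      where
      shape : ∀ b → - (+ 2 * b) ≡ + 2 * - b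
      shape = ℤ.solve-∀
    a k₂ : ℤ
    a = proj₁ p+q
    k₂ = proj₁ s+t
    cases : Parity q → Parity t → ∀ k → S16 (+ 64 * n * (+ 1 + + 2 * k))
    cases (inj₁ (b , q≡)) (inj₁ (d , t≡)) = oriented n (a - b) b (k₂ + d) d
      (form-cong (odd-from-even p q a b (proj₂ p+q) q≡) q≡ (s-odd d t≡) t≡ f)
    cases (inj₁ (b , q≡)) (inj₂ (d , t≡)) = oriented n (- d - + 1) (+ 1 + k₂ + d) (a - b) b
      (form-cong (neg-odd t d t≡) (s-even d t≡) (odd-from-even p q a b (proj₂ p+q) q≡) q≡ (rotate-form f))
    cases (inj₂ (b , q≡)) (inj₂ (d , t≡)) = oriented n (- b - + 1) (a - b) (- d - + 1) (+ 1 + k₂ + d)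
      (form-cong (neg-odd q b q≡) (even-from-odd p q a b (proj₂ p+q) q≡) (neg-odd t d t≡) (s-even d t≡) (rotate-form (rotate-form f)))
    cases (inj₂ (b , q≡)) (inj₁ (d , t≡)) = oriented n (- (k₂ + d) - + 1) (- d) (- b - + 1) (a - b)
      (form-cong (neg-odd s (k₂ + d) (s-odd d t≡)) (neg-even t d t≡) (neg-odd q b q≡) (even-from-odd p q a b (proj₂ p+q) q≡) (rotate-form (rotate-form (rotate-form f))))

  -- If τ has relative norm uα, then (1 - ζ₈)τ has relative norm (1 - i)uα, whose coordinates are a
  -- + b and a - b up to order and signs, and whose norm is twice that of α = a + bi.
  S16-irreducible : ∀ a b t → νᵢ (a , b) ≢ 0 → νᵢ (a , b) ≢ 1 → Irreducible (a , b) → (a , b) ∣ᵢ (t *ᵢ t -ᵢ iᵢ) →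
    ±3mod8 (a + b) → ±3mod8 (a - b) → ∀ k → S16 (+ 64 * + νᵢ (a , b) * (+ 1 + + 2 * k))
  S16-irreducible a b t ν≢0 ν≢1 irr root s d = build (relativeNorm (a , b) t ν≢0 ν≢1 irr root)
    where
    build : (∃ λ τ → ∃ λ u → νᵢ u ≡ 1 × ℤ[ζ₈].norm τ ≡ u *ᵢ (a , b)) → ∀ k → S16 (+ 64 * + νᵢ (a , b) * (+ 1 + + 2 * k))
    build (τ , u , νu≡1 , norm≡) = S16-normForm (+ νᵢ (a , b)) p q r v record
      { re±3 = subst ±3mod8 (cong proj₁ shape) (proj₁ both) ; im±3 = subst ±3mod8 (cong proj₂ shape) (proj₂ both)
      ; norm = trans (sym (νᵢ-sum (re₋₁ p q r v) (im₋₁ p q r v))) (trans (cong (λ z → + νᵢ z) (sym shape)) norm₂) }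
      where
      1-ζ : (ℤ × ℤ) × (ℤ × ℤ)
      1-ζ = (+ 1 , + 0) , (- (+ 1) , + 0)
      κ : (ℤ × ℤ) × (ℤ × ℤ)
      κ = 1-ζ *₈ τ
      p q r v : ℤ
      p = proj₁ (proj₁ κ)
      q = proj₂ (proj₁ κ)
      r = proj₁ (proj₂ κ)
      v = proj₂ (proj₂ κ)
      both : Both±3 ((+ 1 , - (+ 1)) *ᵢ (u *ᵢ (a , b)))
      both = both-unit a b (unit-cases (proj₁ u) (proj₂ u) νu≡1) s d
      shape : (+ 1 , - (+ 1)) *ᵢ (u *ᵢ (a , b)) ≡ (re₋₁ p q r v , im₋₁ p q r v)
      shape = trans (cong ((+ 1 , - (+ 1)) *ᵢ_) (sym norm≡)) (trans (sym (ℤ[ζ₈].norm-* 1-ζ τ)) (norm₋₁-ζ₈ p q r v))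
      norm₂ : + νᵢ ((+ 1 , - (+ 1)) *ᵢ (u *ᵢ (a , b))) ≡ + 2 * + νᵢ (a , b)
      norm₂ = trans (cong +_ (trans (νᵢ-* (+ 1 , - (+ 1)) (u *ᵢ (a , b))) (cong (2 ℕ.*_) (trans (νᵢ-* u (a , b))
        (trans (cong (ℕ._* νᵢ (a , b)) νu≡1) (ℕ.*-identityˡ (νᵢ (a , b)))))))) (ℤ.pos-* 2 (νᵢ (a , b)))

-- Realising the multiples for each of the three kinds of primes

module _ where
  open import Data.Integer using (_+_; _*_; _-_; -_; _^_; ∣_∣)
  open Ring≡ ℤ[i].ring using () renaming (_+_ to _+ᵢ_; _*_ to _*ᵢ_; _-_ to _-ᵢ_; -_ to -ᵢ_; ι to ιᵢ; *-assoc to *ᵢ-assoc; *-comm to *ᵢ-comm)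
  open Euclid ℤ[i].ring ℤ[i]-euclidean using () renaming (_∣_ to _∣ᵢ_; split to splitᵢ)

  prime-norm-irreducible : ∀ {p α} → Prime p → νᵢ α ≡ p → Irreducible α
  prime-norm-irreducible pr ν≡p d e α≡ = prime-product pr (trans (sym (νᵢ-* d e)) (trans (cong νᵢ (sym α≡)) ν≡p))

  -- A proper factor would have norm p, making p ≡ 3 (mod 4) a sum of two squares.
  inert-irreducible : ∀ {p q} → Prime p → + p ≡ + 3 + + 4 * q → Irreducible (ιᵢ (+ p))
  inert-irreducible {p} {q} pr p≡ d e α≡ = cases (prime²-product pr (trans (sym (νᵢ-* d e)) (trans (cong νᵢ (sym α≡)) (νᵢ-ι p))))
    where
    cases : νᵢ d ≡ 1 ⊎ νᵢ e ≡ 1 ⊎ (νᵢ d ≡ p × νᵢ e ≡ p) → νᵢ d ≡ 1 ⊎ νᵢ e ≡ 1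
    cases (inj₁ z) = inj₁ z
    cases (inj₂ (inj₁ z)) = inj₂ z
    cases (inj₂ (inj₂ (νd≡p , _))) = ⊥-elim (not-3mod4 (proj₁ d) (proj₂ d)
      (trans (cong +_ (sym νd≡p)) (νᵢ-sum (proj₁ d) (proj₂ d))) q p≡)

  ι-divides : ∀ {p z} → p ∣ℤ z → ιᵢ (+ p) ∣ᵢ ιᵢ z
  ι-divides {p} (k ,ℤ eq) = ιᵢ k , trans (cong (λ z → ιᵢ z) eq) (Ring≡.ι-* ℤ[i].ring k (+ p))

  norm-divides : ∀ α {z} → νᵢ α ∣ℤ z → α ∣ᵢ ιᵢ z
  norm-divides α {z} ν∣z = k *ᵢ ᾱ , trans eq (trans (cong (k *ᵢ_) (trans (sym (NormEuclidean.*-adjugate ℤ[i]-euclidean α)) (*ᵢ-comm α ᾱ))) (sym (*ᵢ-assoc k ᾱ α)))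
    where
    ᾱ k : ℤ × ℤ
    ᾱ = NormEuclidean.adjugate ℤ[i]-euclidean α
    k = proj₁ (ι-divides {νᵢ α} {z} ν∣z)
    eq : ιᵢ z ≡ k *ᵢ ιᵢ (+ νᵢ α)
    eq = proj₂ (ι-divides {νᵢ α} {z} ν∣z)

  -- t⁴ + 1 = (t² - i)(t² + i), and t² + i = - ((i t)² - i).
  root-of-i : ∀ α t → Irreducible α → α ∣ᵢ (t *ᵢ t *ᵢ (t *ᵢ t) +ᵢ ιᵢ (+ 1)) → ∃ λ s → α ∣ᵢ (s *ᵢ s -ᵢ iᵢ)
  root-of-i α t irr (k , t⁴≡) = bySplit (splitᵢ α (t *ᵢ t -ᵢ iᵢ) (t *ᵢ t +ᵢ iᵢ) (k , trans (factor t iᵢ) (trans (negate (t *ᵢ t *ᵢ (t *ᵢ t))) t⁴≡)))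
    where
    open Solver ℤ[i].ring
    factor : ∀ t i → (t *ᵢ t -ᵢ i) *ᵢ (t *ᵢ t +ᵢ i) ≡ t *ᵢ t *ᵢ (t *ᵢ t) -ᵢ i *ᵢ i
    factor = solve 2 (λ t i → (t ⊗ t ⊖ i) ⊗ (t ⊗ t ⊕ i) ⊜ t ⊗ t ⊗ (t ⊗ t) ⊖ i ⊗ i) refl
    negate : ∀ x → x -ᵢ ιᵢ (- (+ 1)) ≡ x +ᵢ ιᵢ (+ 1)
    negate = solve 1 (λ x → x ⊖ Κ (- (+ 1)) ⊜ x ⊕ Κ (+ 1)) refl
    turn : ∀ t i → i *ᵢ t *ᵢ (i *ᵢ t) -ᵢ i ≡ i *ᵢ i *ᵢ (t *ᵢ t) -ᵢ i
    turn = solve 2 (λ t i → i ⊗ t ⊗ (i ⊗ t) ⊖ i ⊜ i ⊗ i ⊗ (t ⊗ t) ⊖ i) refl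
    opposite : ∀ x i → ιᵢ (- (+ 1)) *ᵢ x -ᵢ i ≡ -ᵢ (x +ᵢ i)
    opposite = solve 2 (λ x i → Κ (- (+ 1)) ⊗ x ⊖ i ⊜ ⊝ (x ⊕ i)) refl
    negative : ∀ k α → -ᵢ (k *ᵢ α) ≡ (-ᵢ k) *ᵢ α
    negative = solve 2 (λ k α → ⊝ (k ⊗ α) ⊜ ⊝ k ⊗ α) refl
    second : α ∣ᵢ (t *ᵢ t +ᵢ iᵢ) → ∃ λ s → α ∣ᵢ (s *ᵢ s -ᵢ iᵢ)
    second (l , eq) = iᵢ *ᵢ t , -ᵢ l , trans (turn t iᵢ) (trans (opposite (t *ᵢ t) iᵢ) (trans (cong -ᵢ_ eq) (negative l α)))
    bySplit : (∃ λ d → ∃ λ e → α ≡ d *ᵢ e × (νᵢ d ≡ 1 → α ∣ᵢ (t *ᵢ t +ᵢ iᵢ)) × (νᵢ e ≡ 1 → α ∣ᵢ (t *ᵢ t -ᵢ iᵢ))) →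
      ∃ λ s → α ∣ᵢ (s *ᵢ s -ᵢ iᵢ)
    bySplit (d , e , α≡ , d-unit , e-unit) = [ second ∘ d-unit , (λ z → t , z) ∘ e-unit ]′ (irr d e α≡)

  ±3mod8-from-%ℕ : ∀ z → z ℤ.%ℕ 8 ≡ 3 ⊎ z ℤ.%ℕ 8 ≡ 5 → ±3mod8 z
  ±3mod8-from-%ℕ z = [ (λ eq → subst ±3mod8 (sym (expand eq)) (3mod8 (z ℤ./ℕ 8))) , (λ eq → subst ±3mod8 (sym (expand eq)) (5mod8 (z ℤ./ℕ 8))) ]′
    where
    expand : ∀ {r} → z ℤ.%ℕ 8 ≡ r → z ≡ + r + + 8 * (z ℤ./ℕ 8)
    expand {r} eq = trans (ℤ.a≡a%ℕn+[a/ℕn]*n z 8) (cong₂ _+_ (cong +_ eq) (ℤ.*-comm (z ℤ./ℕ 8) (+ 8)))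

  -- The square of an odd number is 1 or 9 mod 16, according to whether it is ±1 or ±3 mod 8.
  squares-mod16 : ∀ {s} → ±3mod8 s → ∀ ε i q → sq ε ≡ - ε → sq s + sq (+ 1 + + 2 * ε + + 8 * i) ≢ + 2 * (+ 1 + + 8 * q)
  squares-mod16 (3mod8 j) ε i q ε² eq = 8∤ 4 (from-yes (4 ℕ.<? 8)) (q - + 3 * j - + 4 * (j * j) - i - + 2 * (i * ε) - + 4 * (i * i))
    (ℤ.*-cancelˡ-≡ (+ 2) (+ 4) _ (trans (lhs j ε i) (trans
      (cong₂ (λ u v → u - (+ 2 + + 48 * j + + 64 * (j * j) + + 4 * (ε + v) + + 16 * i + + 32 * (i * ε) + + 64 * (i * i))) eq ε²) (rhs j ε i q))))
    where
    lhs : ∀ j ε i → + 2 * + 4 ≡ (+ 3 + + 8 * j) * (+ 3 + + 8 * j) + (+ 1 + + 2 * ε + + 8 * i) * (+ 1 + + 2 * ε + + 8 * i)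
      - (+ 2 + + 48 * j + + 64 * (j * j) + + 4 * (ε + ε * ε) + + 16 * i + + 32 * (i * ε) + + 64 * (i * i))
    lhs = ℤ.solve-∀
    rhs : ∀ j ε i q → + 2 * (+ 1 + + 8 * q) - (+ 2 + + 48 * j + + 64 * (j * j) + + 4 * (ε + - ε) + + 16 * i + + 32 * (i * ε) + + 64 * (i * i))
      ≡ + 2 * (+ 8 * (q - + 3 * j - + 4 * (j * j) - i - + 2 * (i * ε) - + 4 * (i * i)))
    rhs = ℤ.solve-∀
  squares-mod16 (5mod8 j) ε i q ε² eq = 8∤ 4 (from-yes (4 ℕ.<? 8)) (q - + 1 - + 5 * j - + 4 * (j * j) - i - + 2 * (i * ε) - + 4 * (i * i))
    (ℤ.*-cancelˡ-≡ (+ 2) (+ 4) _ (trans (lhs j ε i) (trans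
      (cong₂ (λ u v → u - (+ 18 + + 80 * j + + 64 * (j * j) + + 4 * (ε + v) + + 16 * i + + 32 * (i * ε) + + 64 * (i * i))) eq ε²) (rhs j ε i q))))
    where
    lhs : ∀ j ε i → + 2 * + 4 ≡ (+ 5 + + 8 * j) * (+ 5 + + 8 * j) + (+ 1 + + 2 * ε + + 8 * i) * (+ 1 + + 2 * ε + + 8 * i)
      - (+ 18 + + 80 * j + + 64 * (j * j) + + 4 * (ε + ε * ε) + + 16 * i + + 32 * (i * ε) + + 64 * (i * i))
    lhs = ℤ.solve-∀
    rhs : ∀ j ε i q → + 2 * (+ 1 + + 8 * q) - (+ 18 + + 80 * j + + 64 * (j * j) + + 4 * (ε + - ε) + + 16 * i + + 32 * (i * ε) + + 64 * (i * i))
      ≡ + 2 * (+ 8 * (q - + 1 - + 5 * j - + 4 * (j * j) - i - + 2 * (i * ε) - + 4 * (i * i)))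
    rhs = ℤ.solve-∀

  sum-and-difference : ∀ a b → sq (a + b) + sq (a - b) ≡ + 2 * (sq a + sq b)
  sum-and-difference = identity
    where
    identity : ∀ a b → (a + b) * (a + b) + (a - b) * (a - b) ≡ + 2 * (a * a + b * b)
    identity = ℤ.solve-∀

  -- (a + b)² + (a - b)² = 2(1 + 8q) is 2 modulo 16. With the first square equal to 9, the second
  -- has to be 9 as well.
  ±3mod8-difference : ∀ a b q → sq a + sq b ≡ + 1 + + 8 * q → ±3mod8 (a + b) → ±3mod8 (a - b)
  ±3mod8-difference a b q eq s = cases (±3-odd {a + b} {a - b} s (b ,₂ identity a b))
    where
    identity : ∀ a b → a + b ≡ a - b + + 2 * b
    identity = ℤ.solve-∀
    cases : (∃ λ k → a - b ≡ + 1 + + 2 * k) → ±3mod8 (a - b)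
    cases (k , odd) = [ subst ±3mod8 (sym odd) , (λ (ε , i , ε² , k≡) → ⊥-elim (squares-mod16 s ε i q ε²
      (trans (cong (λ t → sq (a + b) + sq t) (sym (trans odd k≡))) (trans (sum-and-difference a b) (cong (λ n → + 2 * n) eq))))) ]′ (residue k)

  prime≢0 : ∀ {p} → Prime p → p ≢ 0
  prime≢0 pr refl = ℕ.<⇒≱ (prime>1 pr) ℕ.z≤n

  prime≢1 : ∀ {p} → Prime p → p ≢ 1
  prime≢1 pr refl = ℕ.<-irrefl refl (prime>1 pr)

  S16-1mod8 : ∀ {p} → Prime p → p ℕ.% 8 ≡ 1 → ∀ a b → + p ≡ a * a + b * b → (a + b) ℤ.%ℕ 8 ≡ 3 ⊎ (a + b) ℤ.%ℕ 8 ≡ 5 →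
    ∀ k → S16 (+ 64 * + p * (+ 1 + + 2 * k))
  S16-1mod8 {p} pr p%8 a b p≡ a+b%8 k = build (fourthRoot (p ℕ./ 8) (division₈ p p%8))
    where
    ν≡p : νᵢ (a , b) ≡ p
    ν≡p = ℤ.+-injective (trans (νᵢ-sum a b) (sym p≡))
    irr : Irreducible (a , b)
    irr = prime-norm-irreducible pr ν≡p
    a+b : ±3mod8 (a + b)
    a+b = ±3mod8-from-%ℕ (a + b) a+b%8
    fourthRoot : ∀ q → p ≡ 1 ℕ.+ q ℕ.* 8 → ∃ λ t → p ∣ℤ t * t * (t * t) + + 1
    fourthRoot zero p≡1 = ⊥-elim (prime≢1 pr p≡1)
    fourthRoot (suc q) p≡ = power (nonresidue {p} {3 ℕ.+ q ℕ.* 4} pr (trans p≡ (halves q)))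
      where
      halves : ∀ q → 1 ℕ.+ (8 ℕ.+ q ℕ.* 8) ≡ 1 ℕ.+ (4 ℕ.+ q ℕ.* 4 ℕ.+ (4 ℕ.+ q ℕ.* 4))
      halves = ℕ.solve-∀
      fourth : ∀ t → t * (t * (t * (t * + 1))) ≡ t * t * (t * t)
      fourth = ℤ.solve-∀
      -- Here p = 9 + 8q and t = x^((p-1)/8), so that t⁴ = x^((p-1)/2) ≡ -1 (mod p).
      power : (∃ λ x → p ∣ℤ (+ x) ^ (4 ℕ.+ q ℕ.* 4) + + 1) → ∃ λ t → p ∣ℤ t * t * (t * t) + + 1
      power (x , p∣) = (+ x) ^ suc q , subst (λ y → p ∣ℤ y + + 1) (trans (sym (ℤ.^-*-assoc (+ x) (suc q) 4)) (fourth ((+ x) ^ suc q))) p∣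
    build : (∃ λ t → p ∣ℤ t * t * (t * t) + + 1) → S16 (+ 64 * + p * (+ 1 + + 2 * k))
    build (t , p∣) = finish (root-of-i (a , b) (ιᵢ t) irr (subst ((a , b) ∣ᵢ_) ι≡
      (norm-divides (a , b) (subst (λ n → n ∣ℤ t * t * (t * t) + + 1) (sym ν≡p) p∣))))
      where
      ι≡ : ιᵢ (t * t * (t * t) + + 1) ≡ ιᵢ t *ᵢ ιᵢ t *ᵢ (ιᵢ t *ᵢ ιᵢ t) +ᵢ ιᵢ (+ 1)
      ι≡ = trans (Ring≡.ι-+ ℤ[i].ring (t * t * (t * t)) (+ 1)) (cong (_+ᵢ ιᵢ (+ 1))
        (trans (Ring≡.ι-* ℤ[i].ring (t * t) (t * t)) (cong₂ _*ᵢ_ (Ring≡.ι-* ℤ[i].ring t t) (Ring≡.ι-* ℤ[i].ring t t))))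
      finish : (∃ λ s → (a , b) ∣ᵢ (s *ᵢ s -ᵢ iᵢ)) → S16 (+ 64 * + p * (+ 1 + + 2 * k))
      finish (s , root) = subst (λ n → S16 (+ 64 * + n * (+ 1 + + 2 * k))) ν≡p
        (S16-irreducible a b s (subst (_≢ 0) (sym ν≡p) (prime≢0 pr)) (subst (_≢ 1) (sym ν≡p) (prime≢1 pr)) irr root a+b
          (±3mod8-difference a b (+ (p ℕ./ 8)) (trans (sym p≡) (division₈ℤ p p%8)) a+b) k)

  -- With s = 2^((p - 3) / 4), 4 s⁴ = 2^(p - 1) ≡ 1 (mod p) and (s + s i)⁴ = - 4 s⁴.
  S16-3mod8 : ∀ {p} → Prime p → p ℕ.% 8 ≡ 3 → ∀ k → S16 (+ 64 * (+ p * + p) * (+ 1 + + 2 * k))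
  S16-3mod8 {p} pr p%8 k = finish (root-of-i (ιᵢ (+ p)) (s , s) irr (subst (ιᵢ (+ p) ∣ᵢ_) (fourth s) (ι-divides multiple)))
    where
    q : ℕ
    q = p ℕ./ 8
    p≡ : p ≡ 3 ℕ.+ q ℕ.* 8
    p≡ = division₈ p p%8
    s : ℤ
    s = (+ 2) ^ (q ℕ.* 2)
    irr : Irreducible (ιᵢ (+ p))
    irr = inert-irreducible {q = + 2 * + q} pr (trans (division₈ℤ p p%8) (shape (+ q)))
      where
      shape : ∀ q → + 3 + + 8 * q ≡ + 3 + + 4 * (+ 2 * q)
      shape = ℤ.solve-∀
    p∤2 : ¬ p ℕ.∣ 2
    p∤2 p∣2 = ℕ.<⇒≱ (subst (2 ℕ.<_) (sym p≡) (ℕ.m≤m+n 3 (q ℕ.* 8))) (ℕ.∣⇒≤ p∣2)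
    halves : ∀ q → 3 ℕ.+ q ℕ.* 8 ≡ suc (1 ℕ.+ q ℕ.* 4 ℕ.+ (1 ℕ.+ q ℕ.* 4))
    halves = ℕ.solve-∀
    2^≡ : (+ 2) ^ (1 ℕ.+ q ℕ.* 4) ≡ + 2 * (s * s)
    2^≡ = cong (λ u → + 2 * u) (trans (cong ((+ 2) ^_) (sym (ℕ.*-assoc q 2 2)))
      (trans (sym (ℤ.^-*-assoc (+ 2) (q ℕ.* 2) 2)) (cong (s *_) (ℤ.*-identityʳ s))))
    multiple : p ∣ℤ - ((+ 2 * (s * s) - + 1) * (+ 2 * (s * s) + + 1))
    multiple = negate (subst (λ y → p ∣ℤ (y - + 1) * (y + + 1)) 2^≡ (fermatℤ (1 ℕ.+ q ℕ.* 4) pr (trans p≡ (halves q)) 2 p∤2))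
      where
      negate : ∀ {z} → p ∣ℤ z → p ∣ℤ - z
      negate (l ,ℤ eq) = (- l) ,ℤ trans (cong -_ eq) (ℤ.neg-distribˡ-* l (+ p))
    fourth : ∀ s → ιᵢ (- ((+ 2 * (s * s) - + 1) * (+ 2 * (s * s) + + 1))) ≡ (s , s) *ᵢ (s , s) *ᵢ ((s , s) *ᵢ (s , s)) +ᵢ ιᵢ (+ 1)
    fourth s = cong₂ _,_ (re s) (im s)
      where
      re : ∀ s → - ((+ 2 * (s * s) - + 1) * (+ 2 * (s * s) + + 1)) ≡
        (s * s + - (+ 1) * (s * s)) * (s * s + - (+ 1) * (s * s)) + - (+ 1) * ((s * s + s * s) * (s * s + s * s)) + + 1
      re = ℤ.solve-∀
      im : ∀ s → + 0 ≡ (s * s + - (+ 1) * (s * s)) * (s * s + s * s) + (s * s + s * s) * (s * s + - (+ 1) * (s * s)) + + 0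
      im = ℤ.solve-∀
    ν≡p² : νᵢ (+ p , + 0) ≡ p ℕ.* p
    ν≡p² = νᵢ-ι p
    p±3 : ±3mod8 (+ p + + 0)
    p±3 = subst ±3mod8 (sym (trans (ℤ.+-identityʳ (+ p)) (division₈ℤ p p%8))) (3mod8 (+ q))
    finish : (∃ λ t → ιᵢ (+ p) ∣ᵢ (t *ᵢ t -ᵢ iᵢ)) → S16 (+ 64 * (+ p * + p) * (+ 1 + + 2 * k))
    finish (t , root) = subst (λ n → S16 (+ 64 * n * (+ 1 + + 2 * k))) (trans (cong +_ ν≡p²) (ℤ.pos-* p p))
      (S16-irreducible (+ p) (+ 0) t
        (λ ν≡0 → [ prime≢0 pr , prime≢0 pr ]′ (ℕ.m*n≡0⇒m≡0∨n≡0 p (trans (sym ν≡p²) ν≡0)))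
        (λ ν≡1 → prime≢1 pr (ℕ.m*n≡1⇒m≡1 p p (trans (sym ν≡p²) ν≡1))) irr root p±3 p±3 k)

  -- For a nonresidue x, t = x^((p-1)/4) satisfies t² ≡ -1, so p divides (t - i)(t + i) but neither
  -- factor. The gcd of p with t - i then has norm p.
  sum-of-two-squares : ∀ {p q} → Prime p → p ≡ 5 ℕ.+ q ℕ.* 8 → ∃ λ a → ∃ λ b → νᵢ (a , b) ≡ p
  sum-of-two-squares {p} {q} pr p≡ = build (nonresidue {p} {1 ℕ.+ q ℕ.* 4} pr (trans p≡ (halves q)))
    where
    halves : ∀ q → 5 ℕ.+ q ℕ.* 8 ≡ 1 ℕ.+ (2 ℕ.+ q ℕ.* 4 ℕ.+ (2 ℕ.+ q ℕ.* 4))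
    halves = ℕ.solve-∀
    halves′ : ∀ q → 2 ℕ.+ q ℕ.* 4 ≡ (1 ℕ.+ q ℕ.* 2) ℕ.* 2
    halves′ = ℕ.solve-∀
    nonmultiple : ∀ t c → ∣ c ∣ ≡ 1 → ιᵢ (+ p) ∣ᵢ (t , c) → ⊥
    nonmultiple t c ∣c∣≡1 ((k₀ , k₁) , eq) = prime≢1 pr (ℕ.m*n≡1⇒n≡1 ∣ k₁ ∣ p (trans (sym (ℤ.abs-* k₁ (+ p)))
      (trans (cong ∣_∣ (trans (second k₀ k₁ (+ p)) (sym (cong proj₂ eq)))) ∣c∣≡1)))
      where
      second : ∀ k₀ k₁ p → k₁ * p ≡ k₀ * + 0 + k₁ * p
      second = ℤ.solve-∀
    build : (∃ λ x → p ∣ℤ (+ x) ^ (2 ℕ.+ q ℕ.* 4) + + 1) → ∃ λ a → ∃ λ b → νᵢ (a , b) ≡ p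
    build (x , p∣) = bySplit (splitᵢ (ιᵢ (+ p)) (t , - (+ 1)) (t , + 1) (subst (ιᵢ (+ p) ∣ᵢ_) (factor t) (ι-divides multiple)))
      where
      t : ℤ
      t = (+ x) ^ (1 ℕ.+ q ℕ.* 2)
      multiple : p ∣ℤ t * t + + 1
      multiple = subst (λ y → p ∣ℤ y + + 1) (trans (cong ((+ x) ^_) (halves′ q))
        (trans (sym (ℤ.^-*-assoc (+ x) (1 ℕ.+ q ℕ.* 2) 2)) (cong (t *_) (ℤ.*-identityʳ t)))) p∣
      factor : ∀ t → ιᵢ (t * t + + 1) ≡ (t , - (+ 1)) *ᵢ (t , + 1)
      factor t = cong₂ _,_ (re t) (im t)
        where
        re : ∀ t → t * t + + 1 ≡ t * t + - (+ 1) * (- (+ 1) * + 1)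
        re = ℤ.solve-∀
        im : ∀ t → + 0 ≡ t * + 1 + - (+ 1) * t
        im = ℤ.solve-∀
      bySplit : (∃ λ d → ∃ λ e → ιᵢ (+ p) ≡ d *ᵢ e × (νᵢ d ≡ 1 → ιᵢ (+ p) ∣ᵢ (t , + 1)) × (νᵢ e ≡ 1 → ιᵢ (+ p) ∣ᵢ (t , - (+ 1)))) →
        ∃ λ a → ∃ λ b → νᵢ (a , b) ≡ p
      bySplit (d , e , p≡de , d-unit , e-unit) = cases (prime²-product pr (trans (sym (νᵢ-* d e)) (trans (cong νᵢ (sym p≡de)) (νᵢ-ι p))))
        where
        cases : νᵢ d ≡ 1 ⊎ νᵢ e ≡ 1 ⊎ (νᵢ d ≡ p × νᵢ e ≡ p) → ∃ λ a → ∃ λ b → νᵢ (a , b) ≡ p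
        cases (inj₁ νd≡1) = ⊥-elim (nonmultiple t (+ 1) refl (d-unit νd≡1))
        cases (inj₂ (inj₁ νe≡1)) = ⊥-elim (nonmultiple t (- (+ 1)) refl (e-unit νe≡1))
        cases (inj₂ (inj₂ (νd≡p , _))) = proj₁ d , proj₂ d , νd≡p

  -- Of an odd number and its negative, one is 1 mod 4; only the square matters for the norm.
  1mod4-sign : ∀ k → ∃ λ x → sq (+ 1 + + 4 * x) ≡ sq (+ 1 + + 2 * k)
  1mod4-sign k = cases (parity k)
    where
    even : ∀ l → (+ 1 + + 4 * l) * (+ 1 + + 4 * l) ≡ (+ 1 + + 2 * (+ 2 * l)) * (+ 1 + + 2 * (+ 2 * l))
    even = ℤ.solve-∀
    odd : ∀ l → (+ 1 + + 4 * (- l - + 1)) * (+ 1 + + 4 * (- l - + 1)) ≡ (+ 1 + + 2 * (+ 1 + + 2 * l)) * (+ 1 + + 2 * (+ 1 + + 2 * l))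
    odd = ℤ.solve-∀
    cases : (∃ λ l → k ≡ + 2 * l) ⊎ (∃ λ l → k ≡ + 1 + + 2 * l) → ∃ λ x → sq (+ 1 + + 4 * x) ≡ sq (+ 1 + + 2 * k)
    cases (inj₁ (l , k≡)) = l , trans (even l) (cong (λ k → sq (+ 1 + + 2 * k)) (sym k≡))
    cases (inj₂ (l , k≡)) = - l - + 1 , trans (odd l) (cong (λ k → sq (+ 1 + + 2 * k)) (sym k≡))

  S16-5mod8 : ∀ {p} → Prime p → p ℕ.% 8 ≡ 5 → ∀ k → S16 (+ 64 * + p * (+ 1 + + 2 * k))
  S16-5mod8 {p} pr p%8 k = build (sum-of-two-squares {p} {p ℕ./ 8} pr (division₈ p p%8))
    where
    q : ℤ
    q = + (p ℕ./ 8)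
    odd : ¬ 2 ℕ.∣ p
    odd 2∣p = ℕ.<⇒≱ (from-yes (1 ℕ.<? 2)) (ℕ.∣⇒≤ (ℕ.∣m+n∣m⇒∣n (subst (2 ℕ.∣_) (trans (division₈ p p%8) (shape (p ℕ./ 8))) 2∣p) (ℕ.m∣m*n (2 ℕ.+ p ℕ./ 8 ℕ.* 4))))
      where
      shape : ∀ q → 5 ℕ.+ q ℕ.* 8 ≡ 2 ℕ.* (2 ℕ.+ q ℕ.* 4) ℕ.+ 1
      shape = ℕ.solve-∀
    build : (∃ λ a → ∃ λ b → νᵢ (a , b) ≡ p) → S16 (+ 64 * + p * (+ 1 + + 2 * k))
    build (a , b , ν≡p) = finish (1mod4-sign l) (1mod4-sign (l - b))
      where
      a+b : ∃ λ l → a + b ≡ + 1 + + 2 * l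
      a+b = oddNorm-sum a b (λ 2∣ν → odd (subst (2 ℕ.∣_) ν≡p 2∣ν))
      l : ℤ
      l = proj₁ a+b
      a-b : a - b ≡ + 1 + + 2 * (l - b)
      a-b = trans (recover a b) (trans (cong (_- + 2 * b) (proj₂ a+b)) (shift l b))
        where
        recover : ∀ a b → a - b ≡ a + b - + 2 * b
        recover = ℤ.solve-∀
        shift : ∀ l b → + 1 + + 2 * l - + 2 * b ≡ + 1 + + 2 * (l - b)
        shift = ℤ.solve-∀
      finish : (∃ λ x → sq (+ 1 + + 4 * x) ≡ sq (+ 1 + + 2 * l)) → (∃ λ y → sq (+ 1 + + 4 * y) ≡ sq (+ 1 + + 2 * (l - b))) →
        S16 (+ 64 * + p * (+ 1 + + 2 * k))
      finish (x , x²) (y , y²) = S16-1mod4-norm (+ p) x y (- (+ 1) - j) (j - y)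
        (trans (sum₁ x y) (trans (cong (λ u → + 2 + + 4 * u) x+y) (sum₂ j)))
        (trans (difference₁ x y) (trans (cong (λ u → + 4 * u - + 8 * y) x+y) (difference₂ j y))) squares k
        where
        j : ℤ
        j = q - x * x - y * y
        squares : sq (+ 1 + + 4 * x) + sq (+ 1 + + 4 * y) ≡ + 2 * + p
        squares = trans (cong₂ _+_ (trans x² (cong sq (sym (proj₂ a+b)))) (trans y² (cong sq (sym a-b))))
          (trans (sum-and-difference a b) (cong (λ n → + 2 * n) (trans (sym (νᵢ-sum a b)) (cong +_ ν≡p))))
        -- Modulo 16, 2p is 10 and (1 + 4x)² + (1 + 4y)² is 2 + 8(x + y), so x + y is odd. This
        -- makes the sum of the two coordinates 6 and their difference 4 modulo 8, as
        -- `S16-1mod4-norm` demands.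
        x+y : x + y ≡ + 1 + + 2 * j
        x+y = ℤ.*-cancelˡ-≡ (+ 8) (x + y) (+ 1 + + 2 * j) (trans (lhs x y) (trans
          (cong (λ u → u - + 2 - + 16 * (x * x) - + 16 * (y * y)) (trans squares (cong (λ n → + 2 * n) (division₈ℤ p p%8)))) (rhs x y q)))
          where
          lhs : ∀ x y → + 8 * (x + y) ≡ (+ 1 + + 4 * x) * (+ 1 + + 4 * x) + (+ 1 + + 4 * y) * (+ 1 + + 4 * y) - + 2 - + 16 * (x * x) - + 16 * (y * y)
          lhs = ℤ.solve-∀
          rhs : ∀ x y q → + 2 * (+ 5 + + 8 * q) - + 2 - + 16 * (x * x) - + 16 * (y * y) ≡ + 8 * (+ 1 + + 2 * (q - x * x - y * y))
          rhs = ℤ.solve-∀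
        sum₁ : ∀ x y → + 1 + + 4 * x + (+ 1 + + 4 * y) ≡ + 2 + + 4 * (x + y)
        sum₁ = ℤ.solve-∀
        sum₂ : ∀ j → + 2 + + 4 * (+ 1 + + 2 * j) ≡ - (+ 2) - + 8 * (- (+ 1) - j)
        sum₂ = ℤ.solve-∀
        difference₁ : ∀ x y → + 1 + + 4 * x - (+ 1 + + 4 * y) ≡ + 4 * (x + y) - + 8 * y
        difference₁ = ℤ.solve-∀
        difference₂ : ∀ j y → + 4 * (+ 1 + + 2 * j) - + 8 * y ≡ + 4 + + 8 * (j - y)
        difference₂ = ℤ.solve-∀

  S16-64-multiples : ∀ n → (∀ k → S16 (+ 64 * n * (+ 1 + + 2 * k))) → ∀ m → S16 (+ 64 * n * m)
  S16-64-multiples n odd m = cases (parity m)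
    where
    double : ∀ n l → + 128 * (n * l) ≡ + 64 * n * (+ 2 * l)
    double = ℤ.solve-∀
    cases : (∃ λ l → m ≡ + 2 * l) ⊎ (∃ λ l → m ≡ + 1 + + 2 * l) → S16 (+ 64 * n * m)
    cases (inj₁ (l , m≡)) = subst S16 (trans (double n l) (cong (λ m → + 64 * n * m) (sym m≡))) (S16-128 (n * l))
    cases (inj₂ (l , m≡)) = subst (λ m → S16 (+ 64 * n * m)) (sym m≡) (odd l)

  RHS16⇒S16 : ∀ z → RHS16 z → S16 z
  RHS16⇒S16 z (inj₁ odd) = subst S16 (sym (trans (ℤ.a≡a%ℕn+[a/ℕn]*n z 2)
    (cong₂ _+_ (cong +_ odd) (ℤ.*-comm (z ℤ./ℕ 2) (+ 2))))) (S16-odd (z ℤ./ℕ 2))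
  RHS16⇒S16 z (inj₂ (inj₁ 128∣z)) = multiple (fromℕ∣ z 128∣z)
    where
    multiple : 128 ∣ℤ z → S16 z
    multiple (m ,ℤ z≡) = subst S16 (trans (ℤ.*-comm (+ 128) m) (sym z≡)) (S16-128 m)
  RHS16⇒S16 z (inj₂ (inj₂ (inj₁ (p , pr , p%8 , (a , b , p≡ , a+b%8) , m , z≡)))) =
    subst S16 (sym z≡) (S16-64-multiples (+ p) (S16-1mod8 pr p%8 a b p≡ a+b%8) m)
  RHS16⇒S16 z (inj₂ (inj₂ (inj₂ (inj₁ (p , pr , p%8 , m , z≡))))) =
    subst S16 (sym z≡) (S16-64-multiples (+ p) (S16-5mod8 pr p%8) m)
  RHS16⇒S16 z (inj₂ (inj₂ (inj₂ (inj₂ (p , pr , p%8 , m , z≡))))) =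
    subst S16 (sym z≡) (S16-64-multiples (+ p * + p) (S16-3mod8 pr p%8) m)

theorem1p1 : (z : ℤ) → S16 z ⇔ RHS16 z
theorem1p1 z = mk⇔ (S16⇒RHS16 z) (RHS16⇒S16 z)
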